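{- Let $g\in\mathbb{F}_q[T]$ be monic with $\deg(g)\ge1$, let $\ell\in\mathbb{F}_q[T]$ be monic, and let $c\in\mathbb{F}_q[T]$ be such that $\ell\mid g$ and $(c,g)=1$. Let $\chi$ be a primitive Dirichlet character modulo $\ell$. Then, for all $u\in\mathbb{C}$ (as an identity of meromorphic functions of $u$), $$\mathcal{R}_2\Big(u;\chi,\frac cg\Big)=\overline\chi(-c)\,(qu^2)^{\deg(g)-1}\sum_{\lambda\in\mathbb{F}_q^\times}\mathcal{B}_\lambda(u;\chi)\,\mathcal{R}_2\Big(\frac{1}{qu};\chi,\frac{\lambda\overline c}{g}\Big),$$ where $\overline c$ is an inverse of $c$ modulo $g$ and $$\mathcal{B}_\lambda(u;\chi)=\sum_{\eta_1,\eta_2\in\{0,1\}}(-1)^{\eta_1+\eta_2}\frac{\mathrm{Kl}_\chi\big(\eta_1-1,(1-\eta_2)\lambda\big)}{q(1-qu)^{\eta_1+\eta_2}}.$$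
   Context: $q=p^\eta$ is a prime power; $e_q(y)=\exp(2\pi i\,\mathrm{Tr}_{\mathbb{F}_q/\mathbb{F}_p}(y)/p)$ for $y\in\mathbb{F}_q$; for $\alpha=\sum_{j\le N}\alpha_jT^j\in\mathbb{F}_q((1/T))$, $e(\alpha)=e_q(\alpha_{ -1})$. $\mathcal{M}$ is the set of monic polynomials in $\mathbb{F}_q[T]$. $r_\chi(f)=\sum_{g\mid f}\chi(g)$ over monic divisors $g$. For $\alpha,\beta\in\mathbb{F}_q$, $\mathrm{Kl}_\chi(\alpha,\beta)=\sum_{\gamma\in\mathbb{F}_q^\times}\chi(\gamma)e_q(\alpha\gamma+\beta\gamma^{ -1})$ (using the restriction of $\chi$ to $\mathbb{F}_q^\times$). $\mathcal{R}_2(u;\chi,c/g)=\sum_{f\in\mathcal{M}}r_\chi(f)e(cf/g)u^{\deg f}$ for $|u|<1/q$, extended meromorphically to $\mathbb{C}$. The modulus $\ell$ need not be irreducible, and $\ell=1$ (with $\chi=1$) is allowed. -}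

module Defs where

open import Level using (Level; _⊔_) renaming (suc to lsuc)
open import Algebra.Apartness.Bundles using (HeytingField)
open import Algebra.Bundles using (RawRing)
open import Algebra.Structures using (IsCommutativeRing)
import Algebra.Definitions.RawSemiring as RawSemiringDefs
open import Data.Fin.Base using (Fin; toℕ)
import Data.Fin.Properties as Fin
open import Data.Integer.Base as ℤ using (ℤ; +_; -[1+_])
open import Data.List.Base as List using (List; []; _∷_; _++_; [_])
open import Data.List.Relation.Unary.Any using (any?)
open import Data.Maybe.Base using (fromMaybe)
open import Data.Nat.Base as ℕ using (ℕ; zero; suc; NonZero; _∸_)
open import Data.Nat.Properties using (m^n≢0)
open import Data.Nat.Primality using (Prime; prime⇒nonZero)
open import Data.Product.Base using (∃; ∃-syntax; _×_; _,_; proj₁)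
open import Data.Sum.Base using (_⊎_)
open import Data.Vec.Base as Vec using (Vec)
open import Function.Base using (_∘_)
open import Function.Bundles using (_↔_; module Inverse)
open import Function.Properties.Inverse using (↔-sym; ↔⇒↣)
open import Relation.Binary.Core using (Rel)
open import Relation.Binary.Definitions using (DecidableEquality)
open import Relation.Binary.PropositionalEquality.Core using (_≡_; _≢_; refl)
open import Relation.Binary.Structures using (IsStrictPartialOrder)
open import Relation.Nullary.Decidable using (Dec; yes; ¬?; _×-dec_; map′; via-injection)
open import Relation.Nullary.Negation.Core using (¬_)

-- The reals, as a Cauchy complete Archimedean ordered field.  Apartness
-- takes the place of ≢ so that no classical axiom is presupposed; with
-- excluded middle these axioms determine ℝ up to isomorphism.
record RealNumbers (r ℓ₁ ℓ₂ : Level) : Set (lsuc (r ⊔ ℓ₁ ⊔ ℓ₂)) where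
  field
    heytingField : HeytingField r ℓ₁ ℓ₂

  open HeytingField heytingField public

  rawRing : RawRing r ℓ₁
  rawRing = record
    { _≈_ = _≈_ ; _+_ = _+_ ; _*_ = _*_ ; -_ = -_ ; 0# = 0# ; 1# = 1# }

  open RawSemiringDefs (RawRing.rawSemiring rawRing) public
    using () renaming (_×_ to _·_)

  infix 4 _<_
  field
    _<_                  : Rel Carrier ℓ₂
    isStrictPartialOrder : IsStrictPartialOrder _≈_ _<_
    #⇒<⊎>                : ∀ {x y} → x # y → x < y ⊎ y < x
    <⇒#                  : ∀ {x y} → x < y → x # y
    0<1                  : 0# < 1#
    +-monoˡ-<            : ∀ {x y} z → x < y → x + z < y + z
    *-positive           : ∀ {x y} → 0# < x → 0# < y → 0# < x * y
    archimedean          : ∀ x → ∃[ n ] x < n · 1#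

  Within : Carrier → Carrier → Carrier → Set ℓ₂
  Within ε x y = (- ε < x - y) × (x - y < ε)

  infix 4 _⟶_
  _⟶_ : (ℕ → Carrier) → Carrier → Set (r ⊔ ℓ₂)
  s ⟶ x = ∀ {ε} → 0# < ε → ∃[ N ] (∀ n → N ℕ.≤ n → Within ε (s n) x)

  IsCauchy : (ℕ → Carrier) → Set (r ⊔ ℓ₂)
  IsCauchy s = ∀ {ε} → 0# < ε →
    ∃[ N ] (∀ m n → N ℕ.≤ m → N ℕ.≤ n → Within ε (s m) (s n))

  field
    complete : ∀ {s} → IsCauchy s → ∃[ x ] s ⟶ x

  private
    module < = IsStrictPartialOrder isStrictPartialOrder

  0<1+n : ∀ n → 0# < suc n · 1#
  0<1+n zero    = <.<-respʳ-≈ (sym (+-identityʳ 1#)) 0<1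
  0<1+n (suc n) = <.trans (0<1+n n)
    (<.<-respˡ-≈ (+-identityˡ _) (+-monoˡ-< (suc n · 1#) 0<1))

  1/_ : (n : ℕ) .{{_ : NonZero n}} → Carrier
  1/ suc n = proj₁ (#⇒invertible (#-sym (<⇒# (0<1+n n))))

  1/_! : ℕ → Carrier
  1/ zero !  = 1#
  1/ suc n ! = (1/ suc n) * 1/ n !

module ComplexNumbers {r ℓ₁ ℓ₂} (ℝ : RealNumbers r ℓ₁ ℓ₂) where
  private
    module ℝ = RealNumbers ℝ

  infix 7 _+i_
  record ℂ : Set r where
    constructor _+i_
    field
      re im : ℝ.Carrier
  open ℂ public

  infix 4 _≈_ _#_
  _≈_ : Rel ℂ ℓ₁
  z ≈ w = (re z ℝ.≈ re w) × (im z ℝ.≈ im w)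

  _#_ : Rel ℂ ℓ₂
  z # w = (re z ℝ.# re w) ⊎ (im z ℝ.# im w)

  rawRing : RawRing r ℓ₁
  rawRing = record
    { Carrier = ℂ
    ; _≈_ = _≈_
    ; _+_ = λ z w → (re z ℝ.+ re w) +i (im z ℝ.+ im w)
    ; _*_ = λ z w → (re z ℝ.* re w ℝ.- im z ℝ.* im w) +i (re z ℝ.* im w ℝ.+ im z ℝ.* re w)
    ; -_  = λ z → (ℝ.- re z) +i (ℝ.- im z)
    ; 0#  = ℝ.0# +i ℝ.0#
    ; 1#  = ℝ.1# +i ℝ.0#
    }

  open RawRing rawRing public using (_+_; _*_; -_; 0#; 1#)
  open RawSemiringDefs (RawRing.rawSemiring rawRing) public
    using (_^_; sum) renaming (_×_ to _·_)

  conj : ℂ → ℂ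
  conj z = re z +i (ℝ.- im z)

  fromℝ : ℝ.Carrier → ℂ
  fromℝ x = x +i ℝ.0#

  fromℕ : ℕ → ℂ
  fromℕ n = n · 1#

  ∑ : ∀ {a} {A : Set a} → List A → (A → ℂ) → ℂ
  ∑ xs f = List.foldr _+_ 0# (List.map f xs)

  infix 4 _⟶_
  _⟶_ : (ℕ → ℂ) → ℂ → Set (r ⊔ ℓ₂)
  s ⟶ w = ((re ∘ s) ℝ.⟶ re w) × ((im ∘ s) ℝ.⟶ im w)

module PowerSeries {a ℓ} (R : RawRing a ℓ) where
  open RawRing R
  open RawSemiringDefs rawSemiring using (sum)

  infixl 7 _⊛_
  _⊛_ : (ℕ → Carrier) → (ℕ → Carrier) → ℕ → Carrier
  (f ⊛ g) n = sum {suc n} λ i → f (toℕ i) * g (n ∸ toℕ i)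

module Meromorphic {r ℓ₁ ℓ₂} (ℝ : RealNumbers r ℓ₁ ℓ₂) where
  open ComplexNumbers ℝ
  open PowerSeries rawRing

  Series : Set r
  Series = ℕ → ℂ

  HasValue : Series → ℂ → ℂ → Set (r ⊔ ℓ₂)
  HasValue a z w = (λ N → sum {N} λ n → a (toℕ n) * z ^ toℕ n) ⟶ w

  Entire : Series → Set (r ⊔ ℓ₂)
  Entire a = ∀ z → ∃[ w ] HasValue a z w

  -- A meromorphic function on ℂ, written as a quotient of two entire
  -- functions given by their Taylor series at 0, whose germ at 0 is the
  -- series F.  Taylor series determine germs, so num = den · F near 0 is
  -- the coefficientwise identity below.
  record MeromorphicExtension (F : Series) : Set (r ⊔ ℓ₁ ⊔ ℓ₂) where
    field
      num den    : Series
      num-entire : Entire num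
      den-entire : Entire den
      den≢0      : ∃[ n ] den n # 0#
      extends    : ∀ n → (den ⊛ F) n ≈ num n

  -- F at u ↦ v : the meromorphic extension of F is regular at u, with
  -- value v there.
  infix 4 _at_↦_
  _at_↦_ : Series → ℂ → ℂ → Set (r ⊔ ℓ₁ ⊔ ℓ₂)
  F at u ↦ v = ∃ λ (R : MeromorphicExtension F) →
    let open MeromorphicExtension R in
    ∃ λ n → ∃ λ d → HasValue num u n × HasValue den u d × d # 0# × d * v ≈ n

-- exp is the sum of its usual power series, and 2π is its least positive
-- period along the imaginary axis; this determines exp and π.
record Exponential {r ℓ₁ ℓ₂} (ℝ : RealNumbers r ℓ₁ ℓ₂) : Set (r ⊔ ℓ₁ ⊔ ℓ₂) where
  open ComplexNumbers ℝ
  open Meromorphic ℝ using (HasValue)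
  private
    module ℝ = RealNumbers ℝ

  field
    exp        : ℂ → ℂ
    exp-series : ∀ z → HasValue (λ n → fromℝ (ℝ.1/ n !)) z (exp z)
    π          : ℝ.Carrier
    π-positive : ℝ.0# ℝ.< π
    2π-period  : exp (ℝ.0# +i 2 ℝ.· π) ≈ 1#
    2π-least   : ∀ x → ℝ.0# ℝ.< x → x ℝ.< 2 ℝ.· π → ¬ (exp (ℝ.0# +i x) ≈ 1#)

record FiniteField (p η : ℕ) : Set₁ where
  infix  9 _⁻¹
  infix  8 -_
  infixl 7 _*_
  infixl 6 _+_
  field
    Carrier           : Set
    _+_ _*_           : Carrier → Carrier → Carrier
    -_                : Carrier → Carrier
    0# 1#             : Carrier
    isCommutativeRing : IsCommutativeRing _≡_ _+_ _*_ -_ 0# 1#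
    1≢0               : 1# ≢ 0#
    _⁻¹               : Carrier → Carrier
    ⁻¹-inverse        : ∀ {x} → x ≢ 0# → x * x ⁻¹ ≡ 1#
    p-prime           : Prime p
    enumeration       : Fin (p ℕ.^ η) ↔ Carrier

  rawRing : RawRing _ _
  rawRing = record
    { _≈_ = _≡_ ; _+_ = _+_ ; _*_ = _*_ ; -_ = -_ ; 0# = 0# ; 1# = 1# }

  open RawSemiringDefs (RawRing.rawSemiring rawRing) public
    using (_^_; sum) renaming (_×_ to _·_)

  q : ℕ
  q = p ℕ.^ η

  _≟_ : DecidableEquality Carrier
  _≟_ = via-injection (↔⇒↣ (↔-sym enumeration)) Fin._≟_

  elements units : List Carrier
  elements = List.map (Inverse.to enumeration) (List.allFin q)
  units    = List.filter (λ x → ¬? (x ≟ 0#)) elements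

  Tr : Carrier → Carrier
  Tr y = sum {η} λ j → y ^ (p ℕ.^ toℕ j)

  -- Tr y lies in the prime field, so it is the image of exactly one
  -- integer in {0, …, p-1}; the default 0 is never used.
  trace : Carrier → ℕ
  trace y = fromMaybe 0 (List.head (List.filter (λ a → (a · 1#) ≟ Tr y) (List.upTo p)))

  instance
    p-nonZero : NonZero p
    p-nonZero = prime⇒nonZero p-prime

    q-nonZero : NonZero q
    q-nonZero = m^n≢0 p η

module Polynomials {p η} (𝔽 : FiniteField p η) where
  private
    module F = FiniteField 𝔽
    open F using () renaming (Carrier to F)
  open PowerSeries F.rawRing

  -- Coefficients in increasing degree; trailing zeros are allowed, and
  -- equality is equality of all coefficients.
  Poly : Set
  Poly = List F

  coeff : Poly → ℕ → F
  coeff []      n       = F.0#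
  coeff (a ∷ f) zero    = a
  coeff (a ∷ f) (suc n) = coeff f n

  infixl 7 _·ₚ_
  _·ₚ_ : F → Poly → Poly
  a ·ₚ f = List.map (a F.*_) f

  private
    infixl 6 _⊕_
    _⊕_ : Poly → Poly → Poly
    []      ⊕ g       = g
    (a ∷ f) ⊕ []      = a ∷ f
    (a ∷ f) ⊕ (b ∷ g) = (a F.+ b) ∷ (f ⊕ g)

    _⊗_ : Poly → Poly → Poly
    []      ⊗ g = []
    (a ∷ f) ⊗ g = a ·ₚ g ⊕ (F.0# ∷ (f ⊗ g))

  polyRing : RawRing _ _
  polyRing = record
    { Carrier = Poly
    ; _≈_ = λ f g → ∀ n → coeff f n ≡ coeff g n
    ; _+_ = _⊕_
    ; _*_ = _⊗_
    ; -_  = List.map F.-_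
    ; 0#  = []
    ; 1#  = [ F.1# ]
    }

  open RawRing polyRing public using (_≈_; _+_; _*_; -_; 0#; 1#)
  open RawSemiringDefs (RawRing.rawSemiring polyRing) public using (_∣_; Coprime)

  infix 4 _≡_[mod_]
  _≡_[mod_] : Poly → Poly → Poly → Set
  f ≡ h [mod ℓ ] = ℓ ∣ (f + (- h))

  infix 4 _≈?_
  _≈?_ : ∀ f g → Dec (f ≈ g)
  []      ≈? []      = yes λ _ → refl
  []      ≈? (b ∷ g) = map′ cons uncons ((F.0# F.≟ b) ×-dec ([] ≈? g))
    where
    cons : F.0# ≡ b × [] ≈ g → [] ≈ b ∷ g
    cons (e , es) zero    = e
    cons (e , es) (suc n) = es n
    uncons : [] ≈ b ∷ g → F.0# ≡ b × [] ≈ g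
    uncons es = es zero , es ∘ suc
  (a ∷ f) ≈? []      = map′ cons uncons ((a F.≟ F.0#) ×-dec (f ≈? []))
    where
    cons : a ≡ F.0# × f ≈ [] → a ∷ f ≈ []
    cons (e , es) zero    = e
    cons (e , es) (suc n) = es n
    uncons : a ∷ f ≈ [] → a ≡ F.0# × f ≈ []
    uncons es = es zero , es ∘ suc
  (a ∷ f) ≈? (b ∷ g) = map′ cons uncons ((a F.≟ b) ×-dec (f ≈? g))
    where
    cons : a ≡ b × f ≈ g → a ∷ f ≈ b ∷ g
    cons (e , es) zero    = e
    cons (e , es) (suc n) = es n
    uncons : a ∷ f ≈ b ∷ g → a ≡ b × f ≈ g
    uncons es = es zero , es ∘ suc

  -- Monic polynomials of degree n, given by their n lower coefficients in
  -- increasing degree.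
  Monic : ℕ → Set
  Monic n = Vec F n

  ⟦_⟧ : ∀ {n} → Monic n → Poly
  ⟦ f ⟧ = Vec.toList f ++ [ F.1# ]

  monics : ∀ n → List (Monic n)
  monics zero    = [ Vec.[] ]
  monics (suc n) = List.cartesianProductWith Vec._∷_ F.elements (monics n)

  -- The monic divisors of degree k of f; the cofactor of such a divisor is
  -- monic of degree n ∸ k.
  divisors : ∀ {n} → Monic n → (k : ℕ) → List (Monic k)
  divisors {n} f k = List.filter
    (λ g → any? (λ h → ⟦ g ⟧ * ⟦ h ⟧ ≈? ⟦ f ⟧) (monics (n ∸ k))) (monics k)

  -- laurent N s is the element Σ_k s(k) T^(N - k) of F((1/T)).
  record Laurent : Set where
    constructor laurent
    field
      top    : ℤ
      digits : ℕ → F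

  infix 9 _⟨_⟩
  _⟨_⟩ : Laurent → ℤ → F
  laurent N s ⟨ j ⟩ with N ℤ.- j
  ... | + k      = s k
  ... | -[1+ _ ] = F.0#

  infixl 7 _*ᴸ_
  _*ᴸ_ : Laurent → Laurent → Laurent
  laurent N s *ᴸ laurent M t = laurent (N ℤ.+ M) (s ⊛ t)

  fromPoly : Poly → Laurent
  fromPoly f = laurent (+ List.length f ℤ.- + 1) (coeff (List.reverse f))

  -- The inverse b of a power series h with h 0 = 1, from the recursion
  -- b (n + 1) = - (h 1 * b n + … + h (n + 1) * b 0).
  module _ (h : ℕ → F) where
    dot : ∀ {n} → ℕ → Vec F n → F
    dot j Vec.[]       = F.0#
    dot j (x Vec.∷ xs) = h j F.* x F.+ dot (suc j) xs

    -- b n , … , b 0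
    inversePrefix : ∀ n → Vec F (suc n)
    inversePrefix zero    = F.1# Vec.∷ Vec.[]
    inversePrefix (suc n) = (F.- dot 1 (inversePrefix n)) Vec.∷ inversePrefix n

    inverseSeries : ℕ → F
    inverseSeries n = Vec.head (inversePrefix n)

  recip : ∀ {n} → Monic n → Laurent
  recip {n} g = laurent (ℤ.- + n) (inverseSeries (coeff (List.reverse ⟦ g ⟧)))

  _/_ : ∀ {n} → Poly → Monic n → Laurent
  f / g = fromPoly f *ᴸ recip g

module Characters {r ℓ₁ ℓ₂} {ℝ : RealNumbers r ℓ₁ ℓ₂} (E : Exponential ℝ)
                  {p η} (𝔽 : FiniteField p η) where
  private
    module ℝ = RealNumbers ℝ
    module C = ComplexNumbers ℝ
    module F = FiniteField 𝔽
    module P = Polynomials 𝔽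
    open F using () renaming (Carrier to F)
    open P using (Poly; Monic; ⟦_⟧; _∣_; Coprime; _≡_[mod_])
  open ComplexNumbers ℝ
  open Exponential E

  e_q : F → ℂ
  e_q y = exp (ℝ.0# +i ((2 ℕ.* F.trace y) ℝ.· π ℝ.* (ℝ.1/ p)))

  e : P.Laurent → ℂ
  e α = e_q (α P.⟨ -[1+ 0 ] ⟩)

  record DirichletCharacter (ℓ : Poly) : Set (r ⊔ ℓ₁) where
    field
      ⟨_⟩       : Poly → ℂ
      periodic  : ∀ {f h} → f ≡ h [mod ℓ ] → ⟨ f ⟩ ≈ ⟨ h ⟩
      homo-1    : ⟨ P.1# ⟩ ≈ 1#
      homo-*    : ∀ f h → ⟨ f P.* h ⟩ ≈ ⟨ f ⟩ * ⟨ h ⟩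
      vanishes  : ∀ f → ¬ Coprime f ℓ → ⟨ f ⟩ ≈ 0#

  open DirichletCharacter using () renaming (⟨_⟩ to infix 9 _⟨_⟩) public

  -- d is an induced modulus of χ: on polynomials prime to ℓ, χ depends only
  -- on the residue modulo d.
  InducedModulus : ∀ {ℓ} → DirichletCharacter ℓ → Poly → Set ℓ₁
  InducedModulus {ℓ} χ d = ∀ f h → Coprime f ℓ → Coprime h ℓ →
    f ≡ h [mod d ] → χ ⟨ f ⟩ ≈ χ ⟨ h ⟩

  Primitive : ∀ {ℓ} → DirichletCharacter ℓ → Set ℓ₁
  Primitive {ℓ} χ = ∀ {k} (d : Monic k) → ⟦ d ⟧ ∣ ℓ →
    InducedModulus χ ⟦ d ⟧ → ⟦ d ⟧ P.≈ ℓ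

  r[_] : ∀ {ℓ} → DirichletCharacter ℓ → ∀ {n} → Monic n → ℂ
  r[ χ ] {n} f = ∑ (List.upTo (suc n)) λ k → ∑ (P.divisors f k) λ g → χ ⟨ ⟦ g ⟧ ⟩

  Kl : ∀ {ℓ} → DirichletCharacter ℓ → F → F → ℂ
  Kl χ α β = ∑ F.units λ γ → χ ⟨ [ γ ] ⟩ * e_q (α F.* γ F.+ β F.* γ F.⁻¹)

  -- 𝓡₂ χ c g n is the coefficient of uⁿ, i.e. the sum over f of degree n.
  𝓡₂ : ∀ {ℓ m} → DirichletCharacter ℓ → Poly → Monic m → ℕ → ℂ
  𝓡₂ χ c g n = ∑ (P.monics n) λ f → r[ χ ] f * e ((c P.* ⟦ f ⟧) P./ g)

  -- s stands for the inverse of 1 - q u.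
  𝓑 : ∀ {ℓ} → DirichletCharacter ℓ → F → (s : ℂ) → ℂ
  𝓑 χ μ s = ∑ bits λ η₁ → ∑ bits λ η₂ →
    (- 1#) ^ (η₁ ℕ.+ η₂)
      * Kl χ (η₁ F.· F.1# F.+ (F.- F.1#)) ((F.1# F.+ (F.- (η₂ F.· F.1#))) F.* μ)
      * (fromℝ (ℝ.1/ F.q) * s ^ (η₁ ℕ.+ η₂))
    where
    bits : List ℕ
    bits = 0 ∷ 1 ∷ []

{-# OPTIONS --safe #-}
-- Write ζ_a(u) for (1 - q u) Σ u ^ deg f over the monic f ≡ a (mod g), which is
-- a polynomial in u.  Splitting into residue classes gives
--   (1 - q u)² 𝓡₂(u; χ, c/g) = Σ_{a,b} χ(a) e(c a b / g) ζ_a(u) ζ_b(u),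
-- and this continues 𝓡₂.  The Fourier transform Σ_b e(h b / g) ζ_b(u) depends
-- on h only through its degree and leading coefficient modulo g, and with
-- x = 1 / (q u) it satisfies
--   (1 - q x) Σ_b e(h b / g) ζ_b(u)
--     = (q u) ^ (deg g - 1) Σ_λ ((1 - q u) e_q(λ) - 1) ζ_{h/λ}(x).
-- Apply this to the sum over b, substitute a ↦ λ c̄ a, and apply it to the other
-- variable after Fourier inversion; the product of the two kernels yields the
-- Kloosterman sums in 𝓑.  If x is the pole 1 / q, all 𝓡₂(·; χ, ν c̄ / g) are
-- polynomials and the identity is read off over ℂ[[ε]], at u (1 + ε).  The
-- conjugate of χ(- c) is its inverse because it has finite order.  Equality in
-- ℂ is ¬¬-stable, so case distinctions on it are allowed.
module Submission where

open import Level using (Level; _⊔_) renaming (suc to lsuc; zero to lzero)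
open import Algebra.Bundles using (CommutativeRing; RawRing)
open import Algebra.Definitions.RawMagma using (_,_)
import Algebra.Properties.CommutativeSemigroup as CommutativeSemigroupProperties
import Algebra.Properties.CommutativeSemiring.Binomial as BinomialTheorem
import Algebra.Properties.CommutativeSemiring.Exp as ExpProperties
import Algebra.Properties.Ring as RingProperties
import Algebra.Properties.Semiring.Mult as MultProperties
import Algebra.Properties.Semiring.Sum as SumProperties
import Algebra.Solver.Ring as RingSolver
import Algebra.Solver.Ring.AlmostCommutativeRing as ACR
import Algebra.Solver.Ring.NaturalCoefficients.Default as NaturalSolver
open import Data.Fin.Base as Fin using (Fin; toℕ)
import Data.Fin.Properties as Fin
open import Data.Integer.Base as ℤ using (ℤ; -[1+_])
import Data.Integer.Properties as ℤ
open import Data.List.Base as List using (List; []; _∷_; _++_; [_]; map; foldr; length)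
import Data.List.Properties as List
open import Data.List.Membership.Propositional using (_∈_; find; lose)
open import Data.List.Membership.Propositional.Properties
  using (∈-map⁺; ∈-map⁻; ∈-filter⁺; ∈-filter⁻; ∈-allFin; ∈-upTo⁺; ∈-upTo⁻; ∈-cartesianProductWith⁺)
open import Data.List.Membership.Propositional.Properties.WithK using (unique∧set⇒bag)
open import Data.List.Relation.Binary.BagAndSetEquality using (∼bag⇒↭)
import Data.List.Relation.Binary.Permutation.Propositional as Perm
open import Data.List.Relation.Binary.Permutation.Propositional.Properties using (↭-length)
open import Data.List.Relation.Unary.All as All using (All; []; _∷_)
import Data.List.Relation.Unary.All.Properties as All
open import Data.List.Relation.Unary.AllPairs.Core using ([]; _∷_)
open import Data.List.Relation.Unary.Any as Any using (Any; here; there; any?)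
open import Data.List.Relation.Unary.Any.Properties using (lookup-index)
open import Data.List.Relation.Unary.Unique.Propositional using (Unique)
import Data.List.Relation.Unary.Unique.Propositional.Properties as Unique
open import Data.Maybe.Base using (Maybe; just; nothing; fromMaybe)
open import Data.Nat.Base as ℕ using (ℕ; zero; suc; NonZero; _∸_; _≤_; z≤n; s≤s)
import Data.Nat.Combinatorics as ℕ using (_C_; nCn≡1; nCk≡n!/k![n-k]!; k![n∸k]!∣n!)
import Data.Nat.Divisibility as ℕ
import Data.Nat.DivMod as ℕ
import Data.Nat.Properties as ℕ
import Data.Nat.Coprimality as ℕ using (coprime-Bézout; prime⇒coprime)
import Data.Nat.GCD as ℕ using (module Bézout)
open import Data.Nat.Primality using (Prime; euclidsLemma; prime⇒nonTrivial)
open import Data.Product.Base using (Σ; ∃; ∃-syntax; _×_; _,_; proj₁; proj₂)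
open import Data.Sum.Base using (_⊎_; inj₁; inj₂)
open import Data.Vec.Base as Vec using (Vec; []; _∷_)
import Data.Vec.Properties as Vec
open import Function.Base using (_∘_; id)
open import Function.Bundles using (module Inverse; mk⇔)
open import Relation.Binary.PropositionalEquality as ≡ using (_≡_; _≢_; refl; cong; cong₂; subst)
import Relation.Binary.Reasoning.Setoid as SetoidReasoning
open import Relation.Binary.Structures using (IsStrictPartialOrder)
open import Relation.Nullary.Decidable using (Dec; yes; no; ¬?)
open import Relation.Nullary.Negation using (¬_; contradiction)
open import Defs

-- The functional equation is proved over an arbitrary commutative ring with an additive character,
-- because it is applied twice: over ℂ, and over ℂ[[ε]] at the pole. There both sides carry the
-- factor (1 - q x)² = 0 and say nothing, while at the deformed point 1 - q x becomes ε times a unit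
-- and can be cancelled.
--
-- The powers of q balance as follows. Each use of the duality contributes (q u)^(deg g - 1), and
-- Fourier inversion contributes q^(deg g); the quotient (q u)^(2 deg g - 2) / q^(deg g) is (q
-- u²)^(deg g - 1) / q, whose last factor is the 1/q in `𝓑`. Dividing the kernel by 1 - q u leaves
-- e_q(λ) - 1/(1 - q u), and expanding the product of two such factors gives the four terms indexed
-- by η₁ and η₂.
--
-- The analytic obstacle is that `exp` is known only by its power series and the least period 2π.
-- That e_q is a nontrivial additive character therefore rests on exp (a + b) = exp a exp b, proved
-- with a Cauchy product, and on the nonvanishing of the trace, proved by counting roots.

-- The types mention the ring only through its operations, so that implicit
-- arguments are found by first-order unification instead of through the nested
-- records of the bundle.
module RingLaws {c ℓ} (R : CommutativeRing c ℓ) where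
  private module R = CommutativeRing R
  open CommutativeRing R public
    using (Carrier; _≈_; _+_; _*_; -_; _-_; 0#; 1#; rawRing; semiring; commutativeSemiring)

  ≈-refl : ∀ {x : Carrier} → x ≈ x
  ≈-refl = R.refl

  sym : ∀ {x y : Carrier} → x ≈ y → y ≈ x
  sym = R.sym

  trans : ∀ {x y z : Carrier} → x ≈ y → y ≈ z → x ≈ z
  trans = R.trans

  reflexive : ∀ {x y : Carrier} → x ≡ y → x ≈ y
  reflexive refl = R.refl

  +-cong : ∀ {x y z w : Carrier} → x ≈ y → z ≈ w → x + z ≈ y + w
  +-cong = R.+-cong

  +-congˡ : ∀ {x y z : Carrier} → y ≈ z → x + y ≈ x + z
  +-congˡ = R.+-congˡ

  +-congʳ : ∀ {x y z : Carrier} → y ≈ z → y + x ≈ z + x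
  +-congʳ = R.+-congʳ

  *-cong : ∀ {x y z w : Carrier} → x ≈ y → z ≈ w → x * z ≈ y * w
  *-cong = R.*-cong

  *-congˡ : ∀ {x y z : Carrier} → y ≈ z → x * y ≈ x * z
  *-congˡ = R.*-congˡ

  *-congʳ : ∀ {x y z : Carrier} → y ≈ z → y * x ≈ z * x
  *-congʳ = R.*-congʳ

  -‿cong : ∀ {x y : Carrier} → x ≈ y → - x ≈ - y
  -‿cong = R.-‿cong

  +-assoc : ∀ x y z → (x + y) + z ≈ x + (y + z)
  +-assoc = R.+-assoc

  +-comm : ∀ x y → x + y ≈ y + x
  +-comm = R.+-comm

  +-identityˡ : ∀ x → 0# + x ≈ x
  +-identityˡ = R.+-identityˡ

  +-identityʳ : ∀ x → x + 0# ≈ x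
  +-identityʳ = R.+-identityʳ

  -‿inverseˡ : ∀ x → - x + x ≈ 0#
  -‿inverseˡ = R.-‿inverseˡ

  -‿inverseʳ : ∀ x → x + - x ≈ 0#
  -‿inverseʳ = R.-‿inverseʳ

  *-assoc : ∀ x y z → (x * y) * z ≈ x * (y * z)
  *-assoc = R.*-assoc

  *-comm : ∀ x y → x * y ≈ y * x
  *-comm = R.*-comm

  *-identityˡ : ∀ x → 1# * x ≈ x
  *-identityˡ = R.*-identityˡ

  *-identityʳ : ∀ x → x * 1# ≈ x
  *-identityʳ = R.*-identityʳ

  zeroˡ : ∀ x → 0# * x ≈ 0#
  zeroˡ = R.zeroˡ

  zeroʳ : ∀ x → x * 0# ≈ 0#
  zeroʳ = R.zeroʳ

  distribˡ : ∀ x y z → x * (y + z) ≈ x * y + x * z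
  distribˡ = R.distribˡ

  distribʳ : ∀ x y z → (y + z) * x ≈ y * x + z * x
  distribʳ = R.distribʳ

  +-interchange : ∀ x y z w → (x + y) + (z + w) ≈ (x + z) + (y + w)
  +-interchange = CommutativeSemigroupProperties.interchange R.+-commutativeSemigroup

module RingReasoning {c ℓ} (R : CommutativeRing c ℓ) where
  open RingLaws R

  infix  1 begin_
  infixr 2 step-≈-⟩ step-≈-⟨ step-≡-⟩ step-≡-⟨
  infix  3 _∎

  begin_ : ∀ {x y : Carrier} → x ≈ y → x ≈ y
  begin e = e

  step-≈-⟩ : ∀ (x : Carrier) {y z : Carrier} → y ≈ z → x ≈ y → x ≈ z
  step-≈-⟩ x y≈z x≈y = trans x≈y y≈z

  step-≈-⟨ : ∀ (x : Carrier) {y z : Carrier} → y ≈ z → y ≈ x → x ≈ z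
  step-≈-⟨ x y≈z y≈x = trans (sym y≈x) y≈z

  step-≡-⟩ : ∀ (x : Carrier) {y z : Carrier} → y ≈ z → x ≡ y → x ≈ z
  step-≡-⟩ x y≈z refl = y≈z

  step-≡-⟨ : ∀ (x : Carrier) {y z : Carrier} → y ≈ z → y ≡ x → x ≈ z
  step-≡-⟨ x y≈z refl = y≈z

  syntax step-≈-⟩ x y≈z x≈y = x ≈⟨ x≈y ⟩ y≈z
  syntax step-≈-⟨ x y≈z y≈x = x ≈⟨ y≈x ⟨ y≈z
  syntax step-≡-⟩ x y≈z x≡y = x ≡⟨ x≡y ⟩ y≈z
  syntax step-≡-⟨ x y≈z y≡x = x ≡⟨ y≡x ⟨ y≈z

  _∎ : ∀ (x : Carrier) → x ≈ x
  x ∎ = ≈-refl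

-- Ring normalization, finite sums and power series over a commutative ring

module IntegerSolver {c ℓ} (R : CommutativeRing c ℓ) where
  open CommutativeRing R hiding (zero)
  private
    module Mult = MultProperties semiring
    module RP = RingProperties ring
    open CommutativeSemigroupProperties (CommutativeRing.+-commutativeSemigroup R) using (interchange)
    open SetoidReasoning setoid

    -- The pair stands for the difference of its entries. The first two clauses make `:0` and `:1`
    -- evaluate to `0#` and `1#` themselves, so that equations containing these literals are matched
    -- without rewriting.
    int : ℕ × ℕ → Carrier
    int (0 , 0) = 0#
    int (1 , 0) = 1#
    int (a , b) = a Mult.× 1# - b Mult.× 1#

    int≈ : ∀ a b → int (a , b) ≈ a Mult.× 1# - b Mult.× 1#
    int≈ 0             0       = sym (-‿inverseʳ 0#)
    int≈ 1             0       = sym (trans (+-cong (+-identityʳ 1#) RP.-0#≈0#) (+-identityʳ 1#))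
    int≈ 0             (suc b) = CommutativeRing.refl R
    int≈ 1             (suc b) = CommutativeRing.refl R
    int≈ (suc (suc a)) b       = CommutativeRing.refl R

    difference-+ : ∀ x y z w → (x + z) - (y + w) ≈ (x - y) + (z - w)
    difference-+ x y z w = trans (+-congˡ (sym (RP.-‿+-comm y w))) (interchange x z (- y) (- w))

    -- The signs are pushed onto the atoms `- y` and `- w`, after which only semiring laws remain
    -- and the solver with natural coefficients applies; the one with integer coefficients is still
    -- being built.
    difference-* : ∀ x y z w → (x * z + y * w) - (x * w + y * z) ≈ (x - y) * (z - w)
    difference-* x y z w = begin
      (x * z + y * w) - (x * w + y * z)
        ≈⟨ +-cong (+-congˡ (trans (sym (RP.-‿involutive _)) (trans (-‿cong (RP.-‿distribˡ-* y w)) (RP.-‿distribʳ-* (- y) w))))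
                  (sym (RP.-‿+-comm _ _)) ⟩
      (x * z + - y * - w) + (- (x * w) + - (y * z))
        ≈⟨ +-congˡ (+-cong (RP.-‿distribʳ-* x w) (RP.-‿distribˡ-* y z)) ⟩
      (x * z + - y * - w) + (x * - w + - y * z)
        ≈⟨ solve 4 (λ a b c d → (a :* c :+ b :* d) :+ (a :* d :+ b :* c) := (a :+ b) :* (c :+ d))
             (CommutativeRing.refl R) x (- y) z (- w) ⟩
      (x - y) * (z - w) ∎
      where open NaturalSolver commutativeSemiring

    -- The solver compares evaluated normal forms syntactically, so the
    -- coefficients are kept in the canonical form (n , 0) or (0 , n).
    cancel : ℕ → ℕ → ℕ × ℕ
    cancel zero    b       = zero , b
    cancel (suc a) zero    = suc a , zero
    cancel (suc a) (suc b) = cancel a b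

    coefficients : RawRing _ _
    coefficients = record
      { Carrier = ℕ × ℕ
      ; _≈_ = _≡_
      ; _+_ = λ { (a , b) (c , d) → cancel (a ℕ.+ c) (b ℕ.+ d) }
      ; _*_ = λ { (a , b) (c , d) → cancel (a ℕ.* c ℕ.+ b ℕ.* d) (a ℕ.* d ℕ.+ b ℕ.* c) }
      ; -_  = λ { (a , b) → b , a }
      ; 0#  = 0 , 0
      ; 1#  = 1 , 0
      }

    balanced : ∀ x y z w → x + w ≈ z + y → x - y ≈ z - w
    balanced x y z w e = begin
      x - y              ≈⟨ +-identityʳ _ ⟨
      (x - y) + 0#       ≈⟨ +-congˡ (-‿inverseʳ w) ⟨
      (x - y) + (w - w)  ≈⟨ interchange x (- y) w (- w) ⟩
      (x + w) + (- y - w) ≈⟨ +-congʳ e ⟩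
      (z + y) + (- y - w) ≈⟨ interchange z y (- y) (- w) ⟩
      (z - y) + (y - w)  ≈⟨ interchange z (- y) y (- w) ⟩
      (z + y) + (- y - w) ≈⟨ +-assoc _ _ _ ⟩
      z + (y + (- y - w)) ≈⟨ +-congˡ (+-assoc _ _ _) ⟨
      z + ((y - y) - w)   ≈⟨ +-congˡ (+-congʳ (-‿inverseʳ y)) ⟩
      z + (0# - w)        ≈⟨ +-congˡ (+-identityˡ _) ⟩
      z - w              ∎

    int-cancel : ∀ a b → int (cancel a b) ≈ a Mult.× 1# - b Mult.× 1#
    int-cancel zero    b       = int≈ zero b
    int-cancel (suc a) zero    = int≈ (suc a) zero
    int-cancel (suc a) (suc b) = trans (int-cancel a b)
      (balanced _ _ _ _ (trans (sym (+-assoc _ _ _)) (+-congʳ (+-comm _ 1#))))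

    ×-* : ∀ m n → (m ℕ.* n) Mult.× 1# ≈ m Mult.× 1# * n Mult.× 1#
    ×-* m n = Mult.×1-homo-* m n

    *-homo : ∀ p q → int (RawRing._*_ coefficients p q) ≈ int p * int q
    *-homo (a , b) (c , d) = begin
      int (cancel (a ℕ.* c ℕ.+ b ℕ.* d) (a ℕ.* d ℕ.+ b ℕ.* c))
        ≈⟨ int-cancel (a ℕ.* c ℕ.+ b ℕ.* d) (a ℕ.* d ℕ.+ b ℕ.* c) ⟩
      (a ℕ.* c ℕ.+ b ℕ.* d) Mult.× 1# - (a ℕ.* d ℕ.+ b ℕ.* c) Mult.× 1#
        ≈⟨ +-cong (Mult.×-homo-+ 1# (a ℕ.* c) (b ℕ.* d)) (-‿cong (Mult.×-homo-+ 1# (a ℕ.* d) (b ℕ.* c))) ⟩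
      ((a ℕ.* c) Mult.× 1# + (b ℕ.* d) Mult.× 1#) - ((a ℕ.* d) Mult.× 1# + (b ℕ.* c) Mult.× 1#)
        ≈⟨ +-cong (+-cong (×-* a c) (×-* b d)) (-‿cong (+-cong (×-* a d) (×-* b c))) ⟩
      _ ≈⟨ difference-* (a Mult.× 1#) (b Mult.× 1#) (c Mult.× 1#) (d Mult.× 1#) ⟩
      (a Mult.× 1# - b Mult.× 1#) * (c Mult.× 1# - d Mult.× 1#)
        ≈⟨ *-cong (int≈ a b) (int≈ c d) ⟨
      int (a , b) * int (c , d) ∎

    +-homo : ∀ p q → int (RawRing._+_ coefficients p q) ≈ int p + int q
    +-homo (a , b) (c , d) = begin
      int (cancel (a ℕ.+ c) (b ℕ.+ d))             ≈⟨ int-cancel (a ℕ.+ c) (b ℕ.+ d) ⟩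
      (a ℕ.+ c) Mult.× 1# - (b ℕ.+ d) Mult.× 1#
        ≈⟨ +-cong (Mult.×-homo-+ 1# a c) (-‿cong (Mult.×-homo-+ 1# b d)) ⟩
      _                                            ≈⟨ difference-+ _ _ _ _ ⟩
      (a Mult.× 1# - b Mult.× 1#) + (c Mult.× 1# - d Mult.× 1#)
        ≈⟨ +-cong (int≈ a b) (int≈ c d) ⟨
      int (a , b) + int (c , d)                    ∎

    neg-homo : ∀ p → int (RawRing.-_ coefficients p) ≈ - int p
    neg-homo (a , b) = begin
      int (b , a)                        ≈⟨ int≈ b a ⟩
      b Mult.× 1# - a Mult.× 1#          ≈⟨ +-comm _ _ ⟩
      - (a Mult.× 1#) + b Mult.× 1#      ≈⟨ +-congˡ (RP.-‿involutive _) ⟨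
      - (a Mult.× 1#) - - (b Mult.× 1#)  ≈⟨ RP.-‿+-comm _ _ ⟩
      - (a Mult.× 1# - b Mult.× 1#)      ≈⟨ -‿cong (int≈ a b) ⟨
      - int (a , b)                      ∎

    almostRing : ACR.AlmostCommutativeRing _ _
    almostRing = ACR.fromCommutativeRing R

    morphism : coefficients ACR.-Raw-AlmostCommutative⟶ almostRing
    morphism = record
      { ⟦_⟧ = int
      ; +-homo = +-homo
      ; *-homo = *-homo
      ; -‿homo = neg-homo
      ; 0-homo = CommutativeRing.refl R
      ; 1-homo = CommutativeRing.refl R
      }

    _coeff≟_ : ∀ p q → Maybe (int p ≈ int q)
    (a , b) coeff≟ (c , d) with a ℕ.+ d ℕ.≟ c ℕ.+ b
    ... | no  _ = nothing
    ... | yes e = just (begin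
      int (a , b)                ≈⟨ int≈ a b ⟩
      a Mult.× 1# - b Mult.× 1#  ≈⟨ balanced _ _ _ _ a+d≈c+b ⟩
      c Mult.× 1# - d Mult.× 1#  ≈⟨ int≈ c d ⟨
      int (c , d)                ∎)
      where
      a+d≈c+b : a Mult.× 1# + d Mult.× 1# ≈ c Mult.× 1# + b Mult.× 1#
      a+d≈c+b = trans (sym (Mult.×-homo-+ 1# a d))
        (trans (reflexive (cong (Mult._× 1#) e)) (Mult.×-homo-+ 1# c b))

  open RingSolver coefficients almostRing morphism _coeff≟_ public
    using (solve; _:=_; _:+_; _:*_; _:-_; :-_; _:^_; con; Polynomial)

  :0 :1 : ∀ {n} → Polynomial n
  :0 = con (0 , 0)
  :1 = con (1 , 0)

module ListSum {c ℓ} (R : CommutativeRing c ℓ) where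
  open RingLaws R
  open IntegerSolver R
  open RingReasoning R
  private
    variable
      a b : Level
      X : Set a
      Y : Set b

  ∑ : List X → (X → Carrier) → Carrier
  ∑ xs f = foldr _+_ 0# (map f xs)

  ∑-cong-∈ : ∀ (xs : List X) {f g : X → Carrier} → (∀ {x} → x ∈ xs → f x ≈ g x) → ∑ xs f ≈ ∑ xs g
  ∑-cong-∈ []       f≈g = ≈-refl
  ∑-cong-∈ (x ∷ xs) f≈g = +-cong (f≈g (here refl)) (∑-cong-∈ xs (f≈g ∘ there))

  ∑-cong : ∀ (xs : List X) {f g : X → Carrier} → (∀ x → f x ≈ g x) → ∑ xs f ≈ ∑ xs g
  ∑-cong xs f≈g = ∑-cong-∈ xs (λ {x} _ → f≈g x)

  ∑-0 : ∀ (xs : List X) → ∑ xs (λ _ → 0#) ≈ 0#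
  ∑-0 []       = ≈-refl
  ∑-0 (x ∷ xs) = trans (+-identityˡ _) (∑-0 xs)

  ∑-zero : ∀ (xs : List X) {f : X → Carrier} → (∀ x → f x ≈ 0#) → ∑ xs f ≈ 0#
  ∑-zero xs f≈0 = trans (∑-cong xs f≈0) (∑-0 xs)

  ∑-+ : ∀ (xs : List X) (f g : X → Carrier) → ∑ xs (λ x → f x + g x) ≈ ∑ xs f + ∑ xs g
  ∑-+ []       f g = sym (+-identityˡ 0#)
  ∑-+ (x ∷ xs) f g = trans (+-congˡ (∑-+ xs f g)) (+-interchange _ _ _ _)

  ∑-*ˡ : ∀ (xs : List X) k (f : X → Carrier) → ∑ xs (λ x → k * f x) ≈ k * ∑ xs f
  ∑-*ˡ []       k f = sym (zeroʳ k)
  ∑-*ˡ (x ∷ xs) k f = trans (+-congˡ (∑-*ˡ xs k f)) (sym (distribˡ k _ _))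

  ∑-*ʳ : ∀ (xs : List X) k (f : X → Carrier) → ∑ xs (λ x → f x * k) ≈ ∑ xs f * k
  ∑-*ʳ xs k f = trans (∑-cong xs (λ x → *-comm _ k)) (trans (∑-*ˡ xs k f) (*-comm k _))

  ∑-++ : ∀ (xs ys : List X) (f : X → Carrier) → ∑ (xs ++ ys) f ≈ ∑ xs f + ∑ ys f
  ∑-++ []       ys f = sym (+-identityˡ _)
  ∑-++ (x ∷ xs) ys f = trans (+-congˡ (∑-++ xs ys f)) (sym (+-assoc _ _ _))

  ∑-map : ∀ (xs : List X) (h : X → Y) (f : Y → Carrier) → ∑ (map h xs) f ≡ ∑ xs (f ∘ h)
  ∑-map []       h f = refl
  ∑-map (x ∷ xs) h f = cong (_ +_) (∑-map xs h f)

  ∑-swap : ∀ (xs : List X) (ys : List Y) (f : X → Y → Carrier) →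
    ∑ xs (λ x → ∑ ys (f x)) ≈ ∑ ys (λ y → ∑ xs (λ x → f x y))
  ∑-swap []       ys f = sym (∑-0 ys)
  ∑-swap (x ∷ xs) ys f = trans (+-congˡ (∑-swap xs ys f)) (sym (∑-+ ys _ _))

  ∑-* : ∀ (xs : List X) (ys : List Y) f g →
    ∑ xs f * ∑ ys g ≈ ∑ xs (λ x → ∑ ys (λ y → f x * g y))
  ∑-* xs ys f g = trans (sym (∑-*ʳ xs (∑ ys g) f)) (∑-cong xs (λ x → sym (∑-*ˡ ys (f x) g)))

  ∑-cartesianProductWith : ∀ {z} {Z : Set z} (h : X → Y → Z) xs ys (f : Z → Carrier) →
    ∑ (List.cartesianProductWith h xs ys) f ≈ ∑ xs (λ x → ∑ ys (λ y → f (h x y)))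
  ∑-cartesianProductWith h []       ys f = ≈-refl
  ∑-cartesianProductWith h (x ∷ xs) ys f = trans (∑-++ (map (h x) ys) _ f)
    (+-cong (reflexive (∑-map ys (h x) f)) (∑-cartesianProductWith h xs ys f))

  [_]₁ : ∀ {p} {P : Set p} → Dec P → Carrier
  [ yes _ ]₁ = 1#
  [ no  _ ]₁ = 0#

  [_]₁-true : ∀ {p} {P : Set p} (P? : Dec P) → P → [ P? ]₁ ≈ 1#
  [ yes _ ]₁-true p = ≈-refl
  [ no ¬p ]₁-true p = contradiction p ¬p

  [_]₁-false : ∀ {p} {P : Set p} (P? : Dec P) → ¬ P → [ P? ]₁ ≈ 0#
  [ yes p ]₁-false ¬p = contradiction p ¬p
  [ no _  ]₁-false ¬p = ≈-refl

  indicator-cong : ∀ {p q} {P : Set p} {Q : Set q} (P? : Dec P) (Q? : Dec Q) → (P → Q) → (Q → P) →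
    [ P? ]₁ ≈ [ Q? ]₁
  indicator-cong (yes p) Q? P⇒Q Q⇒P = sym ([ Q? ]₁-true (P⇒Q p))
  indicator-cong (no ¬p) Q? P⇒Q Q⇒P = sym ([ Q? ]₁-false (¬p ∘ Q⇒P))

  ∑-filter : ∀ {p} {P : X → Set p} (P? : ∀ x → Dec (P x)) xs (f : X → Carrier) →
    ∑ (List.filter P? xs) f ≈ ∑ xs (λ x → [ P? x ]₁ * f x)
  ∑-filter P? []       f = ≈-refl
  ∑-filter P? (x ∷ xs) f with P? x
  ... | yes _ = +-cong (sym (*-identityˡ _)) (∑-filter P? xs f)
  ... | no  _ = trans (∑-filter P? xs f) (trans (sym (+-identityˡ _)) (+-congʳ (sym (zeroˡ _))))

  ∑-single : ∀ {xs : List X} {x} → Unique xs → x ∈ xs → (f : X → Carrier) →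
    (∀ {y} → y ∈ xs → y ≢ x → f y ≈ 0#) → ∑ xs f ≈ f x
  ∑-single {xs = x ∷ xs} (x∉xs ∷ _) (here refl) f f≈0 = begin
    f x + ∑ xs f            ≈⟨ +-congˡ (∑-cong-∈ xs (λ y∈xs → f≈0 (there y∈xs) (λ { refl → All.lookup x∉xs y∈xs refl }))) ⟩
    f x + ∑ xs (λ _ → 0#)   ≈⟨ +-congˡ (∑-0 xs) ⟩
    f x + 0#                ≈⟨ +-identityʳ _ ⟩
    f x                     ∎
  ∑-single {xs = y ∷ xs} {x} (y∉xs ∷ u) (there x∈xs) f f≈0 = begin
    f y + ∑ xs f  ≈⟨ +-cong (f≈0 (here refl) (λ { refl → All.lookup y∉xs x∈xs refl })) (∑-single u x∈xs f (f≈0 ∘ there)) ⟩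
    0# + f x      ≈⟨ +-identityˡ _ ⟩
    f x           ∎

  ∑-δ : ∀ {xs : List X} {x} {p} {P : X → Set p} (P? : ∀ y → Dec (P y)) → Unique xs → x ∈ xs → P x →
    (∀ {y} → y ∈ xs → P y → y ≡ x) → (f : X → Carrier) →
    ∑ xs (λ y → [ P? y ]₁ * f y) ≈ f x
  ∑-δ P? u x∈xs px unique f = trans
    (∑-single u x∈xs _ (λ y∈xs y≢x → trans (*-congʳ ([ P? _ ]₁-false (y≢x ∘ unique y∈xs))) (zeroˡ _)))
    (trans (*-congʳ ([ P? _ ]₁-true px)) (*-identityˡ _))

  -- Both sides are the sum of f over the graph of h.
  ∑-reindex : ∀ {xs : List X} {ys : List Y} → Unique xs → Unique ys →
    (_≟_ : (y y′ : Y) → Dec (y ≡ y′))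
    (h : X → Y) (k : Y → X) →
    (∀ {x} → x ∈ xs → h x ∈ ys) → (∀ {y} → y ∈ ys → k y ∈ xs) →
    (∀ {x} → x ∈ xs → k (h x) ≡ x) → (∀ {y} → y ∈ ys → h (k y) ≡ y) →
    (f : Y → Carrier) → ∑ xs (f ∘ h) ≈ ∑ ys f
  ∑-reindex {xs = xs} {ys} ux uy _≟_ h k h∈ k∈ kh hk f = begin
    ∑ xs (f ∘ h)
      ≈⟨ ∑-cong-∈ xs (λ x∈ → ∑-δ (λ y → h _ ≟ y) uy (h∈ x∈) refl (λ _ → ≡.sym) f) ⟨
    ∑ xs (λ x → ∑ ys (λ y → [ h x ≟ y ]₁ * f y))
      ≈⟨ ∑-swap xs ys _ ⟩
    ∑ ys (λ y → ∑ xs (λ x → [ h x ≟ y ]₁ * f y))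
      ≈⟨ ∑-cong-∈ ys (λ {y} y∈ → ∑-δ (λ x → h x ≟ y) ux (k∈ y∈) (hk y∈)
           (λ x∈ hx≡y → ≡.trans (≡.sym (kh x∈)) (cong k hx≡y)) (λ _ → f y)) ⟩
    ∑ ys f ∎

module Series {c ℓ} (R : CommutativeRing c ℓ) where
  open RingLaws R
  open IntegerSolver R
  open RingReasoning R
  open PowerSeries rawRing public using (_⊛_)

  infix 4 _≋_
  _≋_ : (f g : ℕ → Carrier) → Set ℓ
  f ≋ g = ∀ n → f n ≈ g n

  shift : (ℕ → Carrier) → ℕ → Carrier
  shift f zero    = 0#
  shift f (suc n) = f n

  constant : Carrier → ℕ → Carrier
  constant x zero    = x
  constant x (suc n) = 0#

  ⊛-cong : ∀ {f f′ g g′} → f ≋ f′ → g ≋ g′ → f ⊛ g ≋ f′ ⊛ g′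
  ⊛-cong f≋ g≋ zero    = +-congʳ (*-cong (f≋ 0) (g≋ 0))
  ⊛-cong f≋ g≋ (suc n) = +-cong (*-cong (f≋ 0) (g≋ (suc n))) (⊛-cong (f≋ ∘ suc) g≋ n)

  ⊛-0 : ∀ f g → (f ⊛ g) 0 ≈ f 0 * g 0
  ⊛-0 f g = +-identityʳ _

  -- `⊛` recurses on its first factor; commutativity needs the sum unrolled from the other end.
  ⊛-sucʳ : ∀ f g n → (f ⊛ g) (suc n) ≈ (f ⊛ (g ∘ suc)) n + f (suc n) * g 0
  ⊛-sucʳ f g zero    = trans (+-congˡ (+-identityʳ _)) (+-congʳ (sym (+-identityʳ _)))
  ⊛-sucʳ f g (suc n) = trans (+-congˡ (⊛-sucʳ (f ∘ suc) g n)) (sym (+-assoc _ _ _))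

  ⊛-comm : ∀ f g → f ⊛ g ≋ g ⊛ f
  ⊛-comm f g zero    = +-congʳ (*-comm _ _)
  ⊛-comm f g (suc n) = trans (+-congˡ (⊛-comm (f ∘ suc) g n))
    (trans (+-congʳ (*-comm _ _)) (trans (+-comm _ _) (sym (⊛-sucʳ g f n))))

  ⊛-distribʳ : ∀ h f g → (λ n → f n + g n) ⊛ h ≋ λ n → (f ⊛ h) n + (g ⊛ h) n
  ⊛-distribʳ h f g zero    = trans (+-identityʳ _) (trans (distribʳ _ _ _) (sym (+-cong (+-identityʳ _) (+-identityʳ _))))
  ⊛-distribʳ h f g (suc n) = trans (+-cong (distribʳ _ _ _) (⊛-distribʳ h (f ∘ suc) (g ∘ suc) n)) (+-interchange _ _ _ _)

  ⊛-scale : ∀ k f g → (λ n → k * f n) ⊛ g ≋ λ n → k * (f ⊛ g) n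
  ⊛-scale k f g zero    = trans (+-identityʳ _) (trans (*-assoc k _ _) (*-congˡ (sym (+-identityʳ _))))
  ⊛-scale k f g (suc n) = trans (+-cong (*-assoc k _ _) (⊛-scale k (f ∘ suc) g n)) (sym (distribˡ k _ _))

  ⊛-assoc : ∀ f g h → (f ⊛ g) ⊛ h ≋ f ⊛ (g ⊛ h)
  ⊛-assoc f g h zero    = trans (+-identityʳ _) (trans (*-congʳ (⊛-0 f g)) (trans (*-assoc _ _ _)
    (trans (*-congˡ (sym (⊛-0 g h))) (sym (+-identityʳ _)))))
  ⊛-assoc f g h (suc n) = begin
    (f ⊛ g) 0 * h (suc n) + ((λ i → f 0 * g (suc i) + ((f ∘ suc) ⊛ g) i) ⊛ h) n
      ≈⟨ +-cong (trans (*-congʳ (⊛-0 f g)) (*-assoc _ _ _)) (trans (⊛-distribʳ h (λ i → f 0 * g (suc i)) ((f ∘ suc) ⊛ g) n)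
           (+-cong (⊛-scale (f 0) (g ∘ suc) h n) (⊛-assoc (f ∘ suc) g h n))) ⟩
    f 0 * (g 0 * h (suc n)) + (f 0 * ((g ∘ suc) ⊛ h) n + ((f ∘ suc) ⊛ (g ⊛ h)) n)
      ≈⟨ solve 4 (λ x y z w → x :* y :+ (x :* z :+ w) := x :* (y :+ z) :+ w) ≈-refl _ _ _ _ ⟩
    f 0 * (g ⊛ h) (suc n) + ((f ∘ suc) ⊛ (g ⊛ h)) n ∎

  0⊛ : ∀ g → (λ _ → 0#) ⊛ g ≋ λ _ → 0#
  0⊛ g zero    = trans (+-identityʳ _) (zeroˡ _)
  0⊛ g (suc n) = trans (+-cong (zeroˡ _) (0⊛ g n)) (+-identityˡ _)

  constant⊛ : ∀ k g → constant k ⊛ g ≋ λ n → k * g n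
  constant⊛ k g zero    = +-identityʳ _
  constant⊛ k g (suc n) = trans (+-congˡ (0⊛ g n)) (+-identityʳ _)

  shift⊛ : ∀ f g → shift f ⊛ g ≋ shift (f ⊛ g)
  shift⊛ f g zero    = trans (+-identityʳ _) (zeroˡ _)
  shift⊛ f g (suc n) = trans (+-congʳ (zeroˡ _)) (+-identityˡ _)

  seriesRing : CommutativeRing c ℓ
  seriesRing = record
    { Carrier = ℕ → Carrier
    ; _≈_ = _≋_
    ; _+_ = λ f g n → f n + g n
    ; _*_ = _⊛_
    ; -_  = λ f n → - f n
    ; 0#  = λ _ → 0#
    ; 1#  = constant 1#
    ; isCommutativeRing = record
      { isRing = record
        { +-isAbelianGroup = record
          { isGroup = record
            { isMonoid = record
              { isSemigroup = record
                { isMagma = record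
                  { isEquivalence = record
                    { refl = λ n → ≈-refl ; sym = λ e n → sym (e n) ; trans = λ e e′ n → trans (e n) (e′ n) }
                  ; ∙-cong = λ e e′ n → +-cong (e n) (e′ n)
                  }
                ; assoc = λ f g h n → +-assoc _ _ _
                }
              ; identity = (λ f n → +-identityˡ _) , (λ f n → +-identityʳ _)
              }
            ; inverse = (λ f n → -‿inverseˡ _) , (λ f n → -‿inverseʳ _)
            ; ⁻¹-cong = λ e n → -‿cong (e n)
            }
          ; comm = λ f g n → +-comm _ _
          }
        ; *-cong = ⊛-cong
        ; *-assoc = ⊛-assoc
        ; *-identity = (λ f n → trans (constant⊛ 1# f n) (*-identityˡ _))
                     , (λ f n → trans (⊛-comm f (constant 1#) n) (trans (constant⊛ 1# f n) (*-identityˡ _)))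
        ; distrib = (λ h f g n → trans (⊛-comm h (λ i → f i + g i) n) (trans (⊛-distribʳ h f g n) (+-cong (⊛-comm f h n) (⊛-comm g h n))))
                  , ⊛-distribʳ
        }
      ; *-comm = ⊛-comm
      }
    }

-- The polynomial ring over the finite field

module PolynomialRing {p η} (𝔽 : FiniteField p η) where
  private
    module F = FiniteField 𝔽
    module P = Polynomials 𝔽
  open ≡.≡-Reasoning

  fieldRing : CommutativeRing _ _
  fieldRing = record { isCommutativeRing = F.isCommutativeRing }

  open RingLaws fieldRing using (+-identityˡ; +-identityʳ; zeroʳ; +-assoc; +-comm; *-identityˡ; *-assoc; *-comm; -‿inverseʳ)
  private module RP = RingProperties (CommutativeRing.ring fieldRing)
  open IntegerSolver fieldRing
  open Series fieldRing

  0∤ : ∀ {x y} → x ≢ F.0# → x F.* y ≡ F.0# → y ≡ F.0#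
  0∤ {x} {y} x≢0 e = begin
    y                    ≡⟨ *-identityˡ y ⟨
    F.1# F.* y           ≡⟨ cong (F._* y) (F.⁻¹-inverse x≢0) ⟨
    (x F.* x F.⁻¹) F.* y ≡⟨ solve 3 (λ a b c → (a :* b) :* c := b :* (a :* c)) refl x (x F.⁻¹) y ⟩
    x F.⁻¹ F.* (x F.* y) ≡⟨ cong (x F.⁻¹ F.*_) e ⟩
    x F.⁻¹ F.* F.0#      ≡⟨ zeroʳ _ ⟩
    F.0#                 ∎

  coeff-+ : ∀ f g n → P.coeff (f P.+ g) n ≡ P.coeff f n F.+ P.coeff g n
  coeff-+ []      g       n       = ≡.sym (+-identityˡ _)
  coeff-+ (a ∷ f) []      n       = ≡.sym (+-identityʳ _)
  coeff-+ (a ∷ f) (b ∷ g) zero    = refl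
  coeff-+ (a ∷ f) (b ∷ g) (suc n) = coeff-+ f g n

  coeff-· : ∀ k f n → P.coeff (k P.·ₚ f) n ≡ k F.* P.coeff f n
  coeff-· k []      n       = ≡.sym (zeroʳ k)
  coeff-· k (a ∷ f) zero    = refl
  coeff-· k (a ∷ f) (suc n) = coeff-· k f n

  coeff-neg : ∀ f n → P.coeff (P.- f) n ≡ F.- P.coeff f n
  coeff-neg []      n       = ≡.sym RP.-0#≈0#
  coeff-neg (a ∷ f) zero    = refl
  coeff-neg (a ∷ f) (suc n) = coeff-neg f n

  coeff-* : ∀ f g → P.coeff (f P.* g) ≋ P.coeff f ⊛ P.coeff g
  coeff-* []      g n       = ≡.sym (0⊛ (P.coeff g) n)
  coeff-* (a ∷ f) g zero    = ≡.trans (coeff-+ (a P.·ₚ g) _ 0) (cong (F._+ F.0#) (coeff-· a g 0))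
  coeff-* (a ∷ f) g (suc n) = ≡.trans (coeff-+ (a P.·ₚ g) _ (suc n))
    (cong₂ F._+_ (coeff-· a g (suc n)) (coeff-* f g n))

  coeff-1 : P.coeff P.1# ≋ constant F.1#
  coeff-1 zero    = refl
  coeff-1 (suc n) = refl

  private
    module S = RingLaws seriesRing

    pull : ∀ f g {f′ g′ : ℕ → F.Carrier} → P.coeff f ≋ f′ → P.coeff g ≋ g′ → f′ ≋ g′ → f P.≈ g
    pull _ _ e e′ h n = ≡.trans (e n) (≡.trans (h n) (≡.sym (e′ n)))

    +c : ∀ f g → P.coeff (f P.+ g) ≋ P.coeff f S.+ P.coeff g
    +c = coeff-+

  -- Polynomials are equal when their coefficient series are, and `coeff` carries `P._*_` to `⊛`. So
  -- the multiplicative laws are those of `seriesRing`, pulled back along an injective homomorphism.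
  polynomialRing : CommutativeRing _ _
  polynomialRing = record
    { Carrier = P.Poly
    ; _≈_ = P._≈_
    ; _+_ = P._+_
    ; _*_ = P._*_
    ; -_  = P.-_
    ; 0#  = P.0#
    ; 1#  = P.1#
    ; isCommutativeRing = record
      { isRing = record
        { +-isAbelianGroup = record
          { isGroup = record
            { isMonoid = record
              { isSemigroup = record
                { isMagma = record
                  { isEquivalence = record
                    { refl = λ n → refl
                    ; sym = λ e n → ≡.sym (e n)
                    ; trans = λ e e′ n → ≡.trans (e n) (e′ n) }
                  ; ∙-cong = λ {f} {f′} {g} {g′} e e′ n → ≡.trans (coeff-+ f g n)
                      (≡.trans (cong₂ F._+_ (e n) (e′ n)) (≡.sym (coeff-+ f′ g′ n)))
                  }
                ; assoc = λ f g h n → begin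
                    P.coeff (f P.+ g P.+ h) n  ≡⟨ coeff-+ (f P.+ g) h n ⟩
                    _                          ≡⟨ cong (F._+ _) (coeff-+ f g n) ⟩
                    _                          ≡⟨ +-assoc _ _ _ ⟩
                    _                          ≡⟨ cong (_ F.+_) (coeff-+ g h n) ⟨
                    _                          ≡⟨ coeff-+ f (g P.+ h) n ⟨
                    _                          ∎
                }
              ; identity = (λ f n → refl) , (λ f n → ≡.trans (coeff-+ f [] n) (+-identityʳ _))
              }
            ; inverse = (λ f n → ≡.trans (coeff-+ (P.- f) f n)
                          (≡.trans (cong (F._+ P.coeff f n) (coeff-neg f n)) (RingLaws.-‿inverseˡ fieldRing _)))
                      , (λ f n → ≡.trans (coeff-+ f (P.- f) n)
                          (≡.trans (cong (P.coeff f n F.+_) (coeff-neg f n)) (-‿inverseʳ _)))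
            ; ⁻¹-cong = λ {f} {g} e n → ≡.trans (coeff-neg f n) (≡.trans (cong F.-_ (e n)) (≡.sym (coeff-neg g n)))
            }
          ; comm = λ f g n → ≡.trans (coeff-+ f g n) (≡.trans (+-comm _ _) (≡.sym (coeff-+ g f n)))
          }
        ; *-cong = λ {f} {f′} {g} {g′} e e′ → pull (f P.* g) (f′ P.* g′) (coeff-* f g) (coeff-* f′ g′) (⊛-cong e e′)
        ; *-assoc = λ f g h → pull ((f P.* g) P.* h) (f P.* (g P.* h))
            (S.trans (coeff-* (f P.* g) h) (⊛-cong {P.coeff (f P.* g)} {g = P.coeff h} (coeff-* f g) (λ _ → refl)))
            (S.trans (coeff-* f (g P.* h)) (⊛-cong {P.coeff f} {g = P.coeff (g P.* h)} (λ _ → refl) (coeff-* g h)))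
            (⊛-assoc (P.coeff f) (P.coeff g) (P.coeff h))
        ; *-identity = (λ f → pull (P.1# P.* f) f (S.trans (coeff-* P.1# f) (⊛-cong {P.coeff P.1#} {g = P.coeff f} coeff-1 (λ _ → refl)))
                          (λ _ → refl) (S.*-identityˡ (P.coeff f)))
                     , (λ f → pull (f P.* P.1#) f (S.trans (coeff-* f P.1#) (⊛-cong {P.coeff f} {g = P.coeff P.1#} (λ _ → refl) coeff-1))
                          (λ _ → refl) (S.*-identityʳ (P.coeff f)))
        ; distrib = (λ h f g → pull (h P.* (f P.+ g)) (h P.* f P.+ h P.* g)
              (S.trans (coeff-* h (f P.+ g)) (⊛-cong {P.coeff h} {g = P.coeff (f P.+ g)} (λ _ → refl) (+c f g)))
              (S.trans (+c (h P.* f) (h P.* g)) (λ n → cong₂ F._+_ (coeff-* h f n) (coeff-* h g n)))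
              (S.distribˡ (P.coeff h) (P.coeff f) (P.coeff g)))
          , (λ h f g → pull ((f P.+ g) P.* h) (f P.* h P.+ g P.* h)
              (S.trans (coeff-* (f P.+ g) h) (⊛-cong {P.coeff (f P.+ g)} {g = P.coeff h} (+c f g) (λ _ → refl)))
              (S.trans (+c (f P.* h) (g P.* h)) (λ n → cong₂ F._+_ (coeff-* f h n) (coeff-* g h n)))
              (S.distribʳ (P.coeff h) (P.coeff f) (P.coeff g)))
        }
      ; *-comm = λ f g → pull (f P.* g) (g P.* f) (coeff-* f g) (coeff-* g f) (⊛-comm (P.coeff f) (P.coeff g))
      }
    }

  ·ₚ≈* : ∀ k f → (k P.·ₚ f) P.≈ ([ k ] P.* f)
  ·ₚ≈* k f n = ≡.sym (≡.trans (coeff-+ (k P.·ₚ f) (F.0# ∷ []) n)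
    (≡.trans (cong (P.coeff (k P.·ₚ f) n F.+_) (zeros n)) (+-identityʳ _)))
    where
    zeros : ∀ n → P.coeff (F.0# ∷ []) n ≡ F.0#
    zeros zero    = refl
    zeros (suc n) = refl

  monic-high : ∀ {n} (a : P.Monic n) k → P.coeff P.⟦ a ⟧ (suc (n ℕ.+ k)) ≡ F.0#
  monic-high []      k = refl
  monic-high (x ∷ a) k = monic-high a k

  monic-top : ∀ {n} (a : P.Monic n) → P.coeff P.⟦ a ⟧ n ≡ F.1#
  monic-top []      = refl
  monic-top (x ∷ a) = monic-top a

-- Linear functionals on polynomials

module FunctionalDot {p η} (𝔽 : FiniteField p η) where
  private
    module F = FiniteField 𝔽
    module P = Polynomials 𝔽
  open PolynomialRing 𝔽
  open RingLaws fieldRing using (+-identityˡ; +-identityʳ; zeroˡ; zeroʳ; +-assoc; +-comm)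
  open IntegerSolver fieldRing
  open Series fieldRing
  open ≡.≡-Reasoning

  -- The value at a polynomial of the linear functional that sends T^i to `B i`.
  dot : P.Poly → (ℕ → F.Carrier) → F.Carrier
  dot []      B = F.0#
  dot (a ∷ f) B = a F.* B 0 F.+ dot f (B ∘ suc)

  dot-congʳ : ∀ f {B C} → B ≋ C → dot f B ≡ dot f C
  dot-congʳ []      e = refl
  dot-congʳ (a ∷ f) e = cong₂ F._+_ (cong (a F.*_) (e 0)) (dot-congʳ f (e ∘ suc))

  dot-zeroˡ : ∀ f B → f P.≈ [] → dot f B ≡ F.0#
  dot-zeroˡ []      B e = refl
  dot-zeroˡ (a ∷ f) B e = begin
    a F.* B 0 F.+ dot f (B ∘ suc)  ≡⟨ cong₂ (λ x y → x F.* B 0 F.+ y) (e 0) (dot-zeroˡ f (B ∘ suc) (e ∘ suc)) ⟩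
    F.0# F.* B 0 F.+ F.0#          ≡⟨ +-identityʳ _ ⟩
    F.0# F.* B 0                   ≡⟨ zeroˡ _ ⟩
    F.0#                           ∎

  dot-congˡ : ∀ f g B → f P.≈ g → dot f B ≡ dot g B
  dot-congˡ []      g       B e = ≡.sym (dot-zeroˡ g B (λ n → ≡.sym (e n)))
  dot-congˡ (a ∷ f) []      B e = dot-zeroˡ (a ∷ f) B e
  dot-congˡ (a ∷ f) (b ∷ g) B e = cong₂ (λ x y → x F.* B 0 F.+ y) (e 0) (dot-congˡ f g (B ∘ suc) (e ∘ suc))

  dot-+ : ∀ f g B → dot (f P.+ g) B ≡ dot f B F.+ dot g B
  dot-+ []      g       B = ≡.sym (+-identityˡ _)
  dot-+ (a ∷ f) []      B = ≡.sym (+-identityʳ _)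
  dot-+ (a ∷ f) (b ∷ g) B = ≡.trans (cong (_ F.+_) (dot-+ f g (B ∘ suc)))
    (solve 5 (λ a b c x y → (a :+ b) :* c :+ (x :+ y) := (a :* c :+ x) :+ (b :* c :+ y)) refl _ _ _ _ _)

  dot-· : ∀ k f B → dot (k P.·ₚ f) B ≡ k F.* dot f B
  dot-· k []      B = ≡.sym (zeroʳ k)
  dot-· k (a ∷ f) B = ≡.trans (cong (_ F.+_) (dot-· k f (B ∘ suc)))
    (solve 4 (λ k a b x → (k :* a) :* b :+ k :* x := k :* (a :* b :+ x)) refl _ _ _ _)

  -- Multiplication by T^i turns the functional `B` into its shift by i, so the first factor may act
  -- on the values of the shifted functionals at the second.
  dot-* : ∀ f h B → dot (f P.* h) B ≡ dot f (λ i → dot h (λ j → B (i ℕ.+ j)))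
  dot-* []      h B = refl
  dot-* (a ∷ f) h B = begin
    dot (a P.·ₚ h P.+ (F.0# ∷ (f P.* h))) B
      ≡⟨ dot-+ (a P.·ₚ h) _ B ⟩
    dot (a P.·ₚ h) B F.+ (F.0# F.* B 0 F.+ dot (f P.* h) (B ∘ suc))
      ≡⟨ cong₂ F._+_ (dot-· a h B) (≡.trans (cong (F._+ dot (f P.* h) (B ∘ suc)) (zeroˡ _)) (+-identityˡ _)) ⟩
    a F.* dot h B F.+ dot (f P.* h) (B ∘ suc)
      ≡⟨ cong (a F.* dot h B F.+_) (dot-* f h (B ∘ suc)) ⟩
    _ ∎

  dot-zeroʳ : ∀ f {B} → (∀ n → B n ≡ F.0#) → dot f B ≡ F.0#
  dot-zeroʳ []      e = refl
  dot-zeroʳ (a ∷ f) e = ≡.trans (cong₂ F._+_ (≡.trans (cong (a F.*_) (e 0)) (zeroʳ a)) (dot-zeroʳ f (e ∘ suc))) (+-identityʳ _)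

  dot-++ : ∀ f a B → dot (f ++ [ a ]) B ≡ dot f B F.+ a F.* B (length f)
  dot-++ []      a B = +-comm _ _
  dot-++ (b ∷ f) a B = ≡.trans (cong (_ F.+_) (dot-++ f a (B ∘ suc))) (≡.sym (+-assoc _ _ _))

  -- A pairing is a convolution with one side reversed. This is the bridge from Laurent series,
  -- which list coefficients downwards and multiply by `⊛`, to functionals on polynomials, which
  -- list them upwards.
  dot-reverse : ∀ f B i → dot (List.reverse f) (λ j → B (i ℕ.+ j)) ≡ (P.coeff f ⊛ B) (ℕ.pred (length f) ℕ.+ i)
  dot-reverse []          B i = ≡.sym (0⊛ B i)
  dot-reverse (a ∷ [])    B zero    = refl
  dot-reverse (a ∷ [])    B (suc i) = cong₂ F._+_ (cong (λ k → a F.* B (suc k)) (ℕ.+-identityʳ i)) (≡.sym (0⊛ B i))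
  dot-reverse (a ∷ b ∷ f) B i = begin
    dot (List.reverse (a ∷ b ∷ f)) (λ j → B (i ℕ.+ j))
      ≡⟨ cong (λ h → dot h (λ j → B (i ℕ.+ j))) (List.unfold-reverse a (b ∷ f)) ⟩
    dot (List.reverse (b ∷ f) ++ [ a ]) (λ j → B (i ℕ.+ j))
      ≡⟨ dot-++ (List.reverse (b ∷ f)) a _ ⟩
    dot (List.reverse (b ∷ f)) (λ j → B (i ℕ.+ j)) F.+ a F.* B (i ℕ.+ length (List.reverse (b ∷ f)))
      ≡⟨ cong₂ (λ x k → x F.+ a F.* B k) (dot-reverse (b ∷ f) B i)
           (≡.trans (cong (i ℕ.+_) (List.length-reverse (b ∷ f))) (ℕ.+-comm i _)) ⟩
    (P.coeff (b ∷ f) ⊛ B) (length f ℕ.+ i) F.+ a F.* B (suc (length f ℕ.+ i))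
      ≡⟨ +-comm _ _ ⟩
    _ ∎

-- Residues modulo g and the coefficient of 1/T in h/g

module MonicModulus {p η} (𝔽 : FiniteField p η) {m′} (g : Polynomials.Monic 𝔽 (suc m′)) where
  private
    module F = FiniteField 𝔽
    module P = Polynomials 𝔽
    m = suc m′
  open PolynomialRing 𝔽
  open FunctionalDot 𝔽
  open RingLaws fieldRing using (+-identityˡ; +-identityʳ; zeroˡ; zeroʳ; *-identityˡ; *-identityʳ; -‿inverseʳ)
  open Series fieldRing
  private
    module RP = RingProperties (CommutativeRing.ring fieldRing)
    module PR = RingLaws polynomialRing
    module S = IntegerSolver polynomialRing
    module FS = IntegerSolver fieldRing

  ↑ : ∀ {n} → Vec F.Carrier n → P.Poly
  ↑ = Vec.toList

  infix 4 _≅_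
  _≅_ : P.Poly → P.Poly → Set
  f ≅ h = f P.≡ h [mod P.⟦ g ⟧ ]

  ≈⇒≅ : ∀ f h → f P.≈ h → f ≅ h
  ≈⇒≅ f h e = P.0# , λ n → ≡.sym (≡.trans (PR.+-congʳ {P.- h} {f} {h} e n) (PR.-‿inverseʳ h n))

  ≅-refl : ∀ f → f ≅ f
  ≅-refl f = ≈⇒≅ f f (λ _ → refl)

  ≅-sym : ∀ f h → f ≅ h → h ≅ f
  ≅-sym f h (k , e) = P.- k , λ n → begin
    P.coeff (P.- k P.* P.⟦ g ⟧) n      ≡⟨ S.solve 2 (λ k g → (S.:- k) S.:* g S.:= S.:- (k S.:* g)) (λ _ → refl) k P.⟦ g ⟧ n ⟩
    P.coeff (P.- (k P.* P.⟦ g ⟧)) n    ≡⟨ PR.-‿cong {k P.* P.⟦ g ⟧} {f P.+ (P.- h)} e n ⟩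
    P.coeff (P.- (f P.+ (P.- h))) n    ≡⟨ S.solve 2 (λ f h → S.:- (f S.:- h) S.:= h S.:- f) (λ _ → refl) f h n ⟩
    P.coeff (h P.+ (P.- f)) n          ∎
    where open ≡.≡-Reasoning

  ≅-trans : ∀ f h k → f ≅ h → h ≅ k → f ≅ k
  ≅-trans f h k (a , e) (b , e′) = a P.+ b , λ n → begin
    P.coeff ((a P.+ b) P.* P.⟦ g ⟧) n
      ≡⟨ PR.distribʳ P.⟦ g ⟧ a b n ⟩
    P.coeff (a P.* P.⟦ g ⟧ P.+ b P.* P.⟦ g ⟧) n
      ≡⟨ PR.+-cong {a P.* P.⟦ g ⟧} {f P.+ (P.- h)} {b P.* P.⟦ g ⟧} {h P.+ (P.- k)} e e′ n ⟩
    P.coeff ((f P.+ (P.- h)) P.+ (h P.+ (P.- k))) n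
      ≡⟨ S.solve 3 (λ f h k → (f S.:- h) S.:+ (h S.:- k) S.:= f S.:- k) (λ _ → refl) f h k n ⟩
    P.coeff (f P.+ (P.- k)) n ∎
    where open ≡.≡-Reasoning

  ≅-* : ∀ f f′ h h′ → f ≅ f′ → h ≅ h′ → f P.* h ≅ f′ P.* h′
  ≅-* f f′ h h′ (a , e) (b , e′) = a P.* h P.+ f′ P.* b , λ n → begin
    P.coeff ((a P.* h P.+ f′ P.* b) P.* P.⟦ g ⟧) n
      ≡⟨ S.solve 5 (λ a h f b g → (a S.:* h S.:+ f S.:* b) S.:* g S.:= (a S.:* g) S.:* h S.:+ f S.:* (b S.:* g))
           (λ _ → refl) a h f′ b P.⟦ g ⟧ n ⟩
    P.coeff ((a P.* P.⟦ g ⟧) P.* h P.+ f′ P.* (b P.* P.⟦ g ⟧)) n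
      ≡⟨ PR.+-cong {(a P.* P.⟦ g ⟧) P.* h} {(f P.+ (P.- f′)) P.* h} {f′ P.* (b P.* P.⟦ g ⟧)} {f′ P.* (h P.+ (P.- h′))}
           (PR.*-congʳ {h} {a P.* P.⟦ g ⟧} {f P.+ (P.- f′)} e) (PR.*-congˡ {f′} {b P.* P.⟦ g ⟧} {h P.+ (P.- h′)} e′) n ⟩
    P.coeff ((f P.+ (P.- f′)) P.* h P.+ f′ P.* (h P.+ (P.- h′))) n
      ≡⟨ S.solve 4 (λ f f′ h h′ → (f S.:- f′) S.:* h S.:+ f′ S.:* (h S.:- h′) S.:= f S.:* h S.:- f′ S.:* h′)
           (λ _ → refl) f f′ h h′ n ⟩
    P.coeff (f P.* h P.+ (P.- (f′ P.* h′))) n ∎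
    where open ≡.≡-Reasoning

  ≅-*ˡ : ∀ f h h′ → h ≅ h′ → f P.* h ≅ f P.* h′
  ≅-*ˡ f h h′ = ≅-* f f h h′ (≅-refl f)

  zeros : ∀ n → Vec F.Carrier n
  zeros n = Vec.replicate n F.0#

  ↑zeros : ∀ n → ↑ (zeros n) P.≈ []
  ↑zeros (suc n) zero    = refl
  ↑zeros (suc n) (suc k) = ↑zeros n k
  ↑zeros zero    k       = refl

  ↑-injective : ∀ {n} (a b : Vec F.Carrier n) → ↑ a P.≈ ↑ b → a ≡ b
  ↑-injective []      []      e = refl
  ↑-injective (x ∷ a) (y ∷ b) e = cong₂ _∷_ (e 0) (↑-injective a b (e ∘ suc))

  ↑-high : ∀ {n} (a : Vec F.Carrier n) k → P.coeff (↑ a) (n ℕ.+ k) ≡ F.0#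
  ↑-high []      k = refl
  ↑-high (x ∷ a) k = ↑-high a k

  -- A nonzero multiple of a monic polynomial of degree n has degree at least n. In the induction
  -- the lowest coefficient `a` of the cofactor only affects degrees up to n, so the hypothesis
  -- passes to `h`; then `a` itself is read off in degree n.
  small-multiple : ∀ h {n} (f : P.Monic n) → (∀ k → P.coeff (h P.* P.⟦ f ⟧) (n ℕ.+ k) ≡ F.0#) → h P.≈ []
  small-multiple []      f e = λ _ → refl
  small-multiple (a ∷ h) {n} f e = λ { zero → a≡0 ; (suc i) → h≈0 i }
    where
    open ≡.≡-Reasoning
    step : ∀ k → P.coeff ((a ∷ h) P.* P.⟦ f ⟧) (suc (n ℕ.+ k)) ≡ P.coeff (h P.* P.⟦ f ⟧) (n ℕ.+ k)
    step k = begin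
      P.coeff ((a ∷ h) P.* P.⟦ f ⟧) (suc (n ℕ.+ k))
        ≡⟨ coeff-+ (a P.·ₚ P.⟦ f ⟧) _ (suc (n ℕ.+ k)) ⟩
      P.coeff (a P.·ₚ P.⟦ f ⟧) (suc (n ℕ.+ k)) F.+ P.coeff (h P.* P.⟦ f ⟧) (n ℕ.+ k)
        ≡⟨ cong (F._+ _) (≡.trans (coeff-· a P.⟦ f ⟧ (suc (n ℕ.+ k))) (≡.trans (cong (a F.*_) (monic-high f k)) (zeroʳ a))) ⟩
      F.0# F.+ P.coeff (h P.* P.⟦ f ⟧) (n ℕ.+ k)
        ≡⟨ +-identityˡ _ ⟩
      P.coeff (h P.* P.⟦ f ⟧) (n ℕ.+ k) ∎
    h≈0 : h P.≈ []
    h≈0 = small-multiple h f (λ k → ≡.trans (≡.sym (step k)) (≡.trans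
      (cong (P.coeff ((a ∷ h) P.* P.⟦ f ⟧)) (≡.sym (ℕ.+-suc n k))) (e (suc k))))
    a≡0 : a ≡ F.0#
    a≡0 = begin
      a                                          ≡⟨ *-identityʳ a ⟨
      a F.* F.1#                                 ≡⟨ cong (a F.*_) (monic-top f) ⟨
      a F.* P.coeff P.⟦ f ⟧ n                    ≡⟨ coeff-· a P.⟦ f ⟧ n ⟨
      P.coeff (a P.·ₚ P.⟦ f ⟧) n                 ≡⟨ +-identityʳ _ ⟨
      P.coeff (a P.·ₚ P.⟦ f ⟧) n F.+ F.0#        ≡⟨ cong (P.coeff (a P.·ₚ P.⟦ f ⟧) n F.+_) (zero-shift n) ⟨
      P.coeff (a P.·ₚ P.⟦ f ⟧) n F.+ P.coeff (F.0# ∷ (h P.* P.⟦ f ⟧)) n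
                                                 ≡⟨ coeff-+ (a P.·ₚ P.⟦ f ⟧) _ n ⟨
      P.coeff ((a ∷ h) P.* P.⟦ f ⟧) n            ≡⟨ cong (P.coeff ((a ∷ h) P.* P.⟦ f ⟧)) (ℕ.+-identityʳ n) ⟨
      P.coeff ((a ∷ h) P.* P.⟦ f ⟧) (n ℕ.+ 0)    ≡⟨ e 0 ⟩
      F.0#                                       ∎
      where
      zero-shift : ∀ n → P.coeff (F.0# ∷ (h P.* P.⟦ f ⟧)) n ≡ F.0#
      zero-shift zero    = refl
      zero-shift (suc n) = PR.*-congʳ {P.⟦ f ⟧} {h} {[]} h≈0 n

  -- The difference of two residues has degree below `m`, so as a multiple of `g` it vanishes.
  residue-unique : ∀ (a b : Vec F.Carrier m) → ↑ a ≅ ↑ b → a ≡ b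
  residue-unique a b (h , e) = ↑-injective a b (λ n → ≡.trans (a≈b+0 n) (≡.trans (coeff-+ (↑ b) _ n)
    (≡.trans (cong (P.coeff (↑ b) n F.+_) (≡.sym (e n))) (≡.trans
      (cong (P.coeff (↑ b) n F.+_) (PR.*-congʳ {P.⟦ g ⟧} {h} {[]} h≈0 n)) (+-identityʳ _)))))
    where
    a≈b+0 : ↑ a P.≈ (↑ b P.+ (↑ a P.+ (P.- ↑ b)))
    a≈b+0 = S.solve 2 (λ a b → a S.:= b S.:+ (a S.:- b)) (λ _ → refl) (↑ a) (↑ b)
    h≈0 : h P.≈ []
    h≈0 = small-multiple h g (λ k → ≡.trans (e (m ℕ.+ k)) (≡.trans (coeff-+ (↑ a) (P.- ↑ b) (m ℕ.+ k))
      (≡.trans (cong₂ F._+_ (↑-high a k) (≡.trans (coeff-neg (↑ b) (m ℕ.+ k)) (≡.trans (cong F.-_ (↑-high b k)) RP.-0#≈0#)))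
        (+-identityʳ F.0#))))

  private
    subtract : ∀ {n} → F.Carrier → Vec F.Carrier n → Vec F.Carrier n → Vec F.Carrier n
    subtract t r v = Vec.zipWith (λ x y → x F.+ F.- (t F.* y)) r v

    subtract-spec : ∀ {n} t (r v : Vec F.Carrier n) → (↑ r ++ [ t ]) P.≈ (↑ (subtract t r v) P.+ (t P.·ₚ P.⟦ v ⟧))
    subtract-spec t []      []      zero    = ≡.sym (*-identityʳ t)
    subtract-spec t []      []      (suc n) = refl
    subtract-spec t (x ∷ r) (y ∷ v) zero    = FS.solve 2 (λ x y → x FS.:= (x FS.:- y) FS.:+ y) refl x (t F.* y)
    subtract-spec t (x ∷ r) (y ∷ v) (suc n) = subtract-spec t r v n

    init-last : ∀ {n} (r : Vec F.Carrier (suc n)) → ↑ r ≡ ↑ (Vec.init r) ++ [ Vec.last r ]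
    init-last (x ∷ [])    = refl
    init-last (x ∷ y ∷ r) = cong (x ∷_) (init-last (y ∷ r))

    ∷-≅ : ∀ a {f h} → f ≅ h → (a ∷ f) ≅ (a ∷ h)
    ∷-≅ a {f} {h} (k , e) = F.0# ∷ k , λ
      { zero    → ≡.trans (coeff-+ (F.0# P.·ₚ P.⟦ g ⟧) _ 0) (≡.trans (+-identityʳ _)
                    (≡.trans (coeff-· F.0# P.⟦ g ⟧ 0) (≡.trans (zeroˡ _) (≡.sym (-‿inverseʳ a)))))
      ; (suc n) → ≡.trans (coeff-+ (F.0# P.·ₚ P.⟦ g ⟧) _ (suc n)) (≡.trans
                    (cong (F._+ P.coeff (k P.* P.⟦ g ⟧) n) (≡.trans (coeff-· F.0# P.⟦ g ⟧ (suc n)) (zeroˡ _)))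
                    (≡.trans (+-identityˡ _) (e n)))
      }

  -- Long division in Horner's form: if r is the remainder of `f`, then a + T r has degree at most
  -- `m`, its coefficient in degree `m` is the last entry of r, and that multiple of `g` is
  -- subtracted.
  remainder : P.Poly → Vec F.Carrier m
  remainder []      = zeros m
  remainder (a ∷ f) = subtract (Vec.last (remainder f)) (a ∷ Vec.init (remainder f)) g

  remainder-≅ : ∀ f → f ≅ ↑ (remainder f)
  remainder-≅ [] = ≅-sym (↑ (zeros m)) [] (≈⇒≅ (↑ (zeros m)) [] (↑zeros m))
  remainder-≅ (a ∷ f) = ≅-trans (a ∷ f) (a ∷ ↑ r) (↑ s) (∷-≅ a {f} (remainder-≅ f))
    (≅-trans (a ∷ ↑ r) (↑ s P.+ (t P.·ₚ P.⟦ g ⟧)) (↑ s)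
      (≈⇒≅ (a ∷ ↑ r) (↑ s P.+ (t P.·ₚ P.⟦ g ⟧)) (λ n → ≡.trans (cong (λ l → P.coeff (a ∷ l) n) (init-last r)) (subtract-spec t (a ∷ Vec.init r) g n)))
      ([ t ] , λ n → ≡.trans (≡.sym (·ₚ≈* t P.⟦ g ⟧ n))
        (S.solve 2 (λ s t → t S.:= (s S.:+ t) S.:- s) (λ _ → refl) (↑ s) (t P.·ₚ P.⟦ g ⟧) n)))
    where
    r = remainder f
    t = Vec.last r
    s = subtract t (a ∷ Vec.init r) g

  remainder-cong : ∀ f h → f ≅ h → remainder f ≡ remainder h
  remainder-cong f h e = residue-unique _ _
    (≅-trans (↑ (remainder f)) f (↑ (remainder h)) (≅-sym f (↑ (remainder f)) (remainder-≅ f)) (≅-trans f h (↑ (remainder h)) e (remainder-≅ h)))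

  remainder-↑ : ∀ a → remainder (↑ a) ≡ a
  remainder-↑ a = residue-unique _ _ (≅-sym (↑ a) (↑ (remainder (↑ a))) (remainder-≅ (↑ a)))

  open Polynomials 𝔽 using (laurent; _⟨_⟩)

  private
    G : ℕ → F.Carrier
    G = P.coeff (List.reverse P.⟦ g ⟧)

    b : ℕ → F.Carrier
    b = P.inverseSeries G

    iterate-shift : ℕ → (ℕ → F.Carrier) → ℕ → F.Carrier
    iterate-shift zero    f = f
    iterate-shift (suc n) f = shift (iterate-shift n f)

  -- `B i` is the coefficient of 1/T in T^i / g. With `G` the reversed modulus, 1/g is T^(-m) times
  -- the series `b` = 1/G in 1/T, so the coefficient sought is that of index i - (m - 1), and 0 when
  -- this is negative.
  B : ℕ → F.Carrier
  B = iterate-shift m′ b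

  resid : P.Poly → F.Carrier
  resid h = (h P./ g) ⟨ -[1+ 0 ] ⟩

  private
    iterate-shift-≥ : ∀ n f k → iterate-shift n f (n ℕ.+ k) ≡ f k
    iterate-shift-≥ zero    f k = refl
    iterate-shift-≥ (suc n) f k = iterate-shift-≥ n f k

    iterate-shift-< : ∀ n f {k} → k ℕ.< n → iterate-shift n f k ≡ F.0#
    iterate-shift-< (suc n) f {zero}  _         = refl
    iterate-shift-< (suc n) f {suc k} (s≤s k<n) = iterate-shift-< n f k<n

    iterate-shift-0 : ∀ n {f} → (∀ k → f k ≡ F.0#) → ∀ k → iterate-shift n f k ≡ F.0#
    iterate-shift-0 zero    f≡0 k       = f≡0 k
    iterate-shift-0 (suc n) f≡0 zero    = refl
    iterate-shift-0 (suc n) f≡0 (suc k) = iterate-shift-0 n f≡0 k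

    ⊛-shift : ∀ f h → f ⊛ shift h ≋ shift (f ⊛ h)
    ⊛-shift f h n = ≡.trans (⊛-comm f (shift h) n) (≡.trans (shift⊛ h f n) (shift-cong n))
      where
      shift-cong : ∀ n → shift (h ⊛ f) n ≡ shift (f ⊛ h) n
      shift-cong zero    = refl
      shift-cong (suc n) = ⊛-comm h f n

    ⊛-iterate-shift : ∀ n f h → f ⊛ iterate-shift n h ≋ iterate-shift n (f ⊛ h)
    ⊛-iterate-shift zero    f h k = refl
    ⊛-iterate-shift (suc n) f h k = ≡.trans (⊛-shift f (iterate-shift n h) k) (lift k)
      where
      lift : ∀ k → shift (f ⊛ iterate-shift n h) k ≡ shift (iterate-shift n (f ⊛ h)) k
      lift zero    = refl
      lift (suc k) = ⊛-iterate-shift n f h k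

    -- `inversePrefix` lists `b` backwards, which is the order in which a Cauchy product reads its
    -- second factor.
    b-prefix : ∀ j n (f : ℕ → F.Carrier) → (∀ i → f i ≡ G (j ℕ.+ i)) →
      P.dot G j (P.inversePrefix G n) ≡ (f ⊛ b) n
    b-prefix j zero    f e = cong (λ x → x F.* F.1# F.+ F.0#) (≡.trans (cong G (≡.sym (ℕ.+-identityʳ j))) (≡.sym (e 0)))
    b-prefix j (suc n) f e = cong₂ F._+_
      (cong (F._* b (suc n)) (≡.trans (cong G (≡.sym (ℕ.+-identityʳ j))) (≡.sym (e 0))))
      (b-prefix (suc j) n (f ∘ suc) (λ i → ≡.trans (e (suc i)) (cong G (ℕ.+-suc j i))))

    reverse-monic : ∀ {n} (f : P.Monic n) → List.reverse P.⟦ f ⟧ ≡ F.1# ∷ List.reverse (↑ f)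
    reverse-monic f = List.reverse-++ (↑ f) [ F.1# ]

    G0≡1 : G 0 ≡ F.1#
    G0≡1 = cong (λ l → P.coeff l 0) (reverse-monic g)

    G⊛b≡0 : ∀ n → (G ⊛ b) (suc n) ≡ F.0#
    G⊛b≡0 n = begin
      G 0 F.* b (suc n) F.+ ((G ∘ suc) ⊛ b) n
        ≡⟨ cong₂ F._+_ (≡.trans (cong (F._* b (suc n)) G0≡1) (*-identityˡ _)) (≡.sym (b-prefix 1 n (G ∘ suc) (λ _ → refl))) ⟩
      F.- P.dot G 1 (P.inversePrefix G n) F.+ P.dot G 1 (P.inversePrefix G n)
        ≡⟨ RingLaws.-‿inverseˡ fieldRing _ ⟩
      F.0# ∎
      where open ≡.≡-Reasoning

  B-< : ∀ {k} → k ℕ.< m′ → B k ≡ F.0#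
  B-< = iterate-shift-< m′ b

  B-top : B m′ ≡ F.1#
  B-top = ≡.trans (cong B (≡.sym (ℕ.+-identityʳ m′))) (iterate-shift-≥ m′ b 0)

  private
    dot-reversed : ∀ f i → dot f (λ j → B (i ℕ.+ j)) ≡ (P.coeff (List.reverse f) ⊛ B) (ℕ.pred (length f) ℕ.+ i)
    dot-reversed f i = ≡.trans
      (cong (λ l → dot l (λ j → B (i ℕ.+ j))) (≡.sym (List.reverse-involutive f)))
      (≡.trans (dot-reverse (List.reverse f) B i)
        (cong (λ n → (P.coeff (List.reverse f) ⊛ B) (ℕ.pred n ℕ.+ i)) (List.length-reverse f)))

    length-monic : ∀ {n} (f : P.Monic n) → length P.⟦ f ⟧ ≡ suc n
    length-monic []      = refl
    length-monic (x ∷ f) = cong suc (length-monic f)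

  -- T^i g / g is the polynomial T^i and has no term in 1/T. In coefficients this is the recursion
  -- that defines the reciprocal series of `G`.
  dot-modulus : ∀ i → dot P.⟦ g ⟧ (λ j → B (i ℕ.+ j)) ≡ F.0#
  dot-modulus i = begin
    dot P.⟦ g ⟧ (λ j → B (i ℕ.+ j))                 ≡⟨ dot-reversed P.⟦ g ⟧ i ⟩
    (G ⊛ B) (ℕ.pred (length P.⟦ g ⟧) ℕ.+ i)         ≡⟨ cong (λ n → (G ⊛ B) (ℕ.pred n ℕ.+ i)) (length-monic g) ⟩
    (G ⊛ B) (m ℕ.+ i)                               ≡⟨ ⊛-iterate-shift m′ G b (m ℕ.+ i) ⟩
    iterate-shift m′ (G ⊛ b) (suc m′ ℕ.+ i)         ≡⟨ cong (iterate-shift m′ (G ⊛ b)) (ℕ.+-suc m′ i) ⟨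
    iterate-shift m′ (G ⊛ b) (m′ ℕ.+ suc i)         ≡⟨ iterate-shift-≥ m′ (G ⊛ b) (suc i) ⟩
    (G ⊛ b) (suc i)                                 ≡⟨ G⊛b≡0 i ⟩
    F.0#                                            ∎
    where open ≡.≡-Reasoning

  private
    digit : ∀ N s j {k} → N ℤ.- j ≡ ℤ.+ k → laurent N s ⟨ j ⟩ ≡ s k
    digit N s j e with N ℤ.- j
    digit N s j refl | ℤ.+ k = refl

    digit⁻ : ∀ N s j {k} → N ℤ.- j ≡ -[1+ k ] → laurent N s ⟨ j ⟩ ≡ F.0#
    digit⁻ N s j e with N ℤ.- j
    digit⁻ N s j refl | -[1+ k ] = refl

    top-digit : ∀ n → ((ℤ.+ n ℤ.- ℤ.+ 1) ℤ.+ ℤ.- (ℤ.+ m)) ℤ.- -[1+ 0 ] ≡ n ℤ.⊖ m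
    top-digit n = begin
      ((ℤ.+ n ℤ.- ℤ.+ 1) ℤ.+ ℤ.- (ℤ.+ m)) ℤ.+ ℤ.+ 1  ≡⟨ ℤ.+-assoc (ℤ.+ n ℤ.- ℤ.+ 1) (ℤ.- (ℤ.+ m)) (ℤ.+ 1) ⟩
      (ℤ.+ n ℤ.- ℤ.+ 1) ℤ.+ (ℤ.- (ℤ.+ m) ℤ.+ ℤ.+ 1)  ≡⟨ ℤ.+-assoc (ℤ.+ n) (ℤ.- (ℤ.+ 1)) _ ⟩
      ℤ.+ n ℤ.+ (ℤ.- (ℤ.+ 1) ℤ.+ (ℤ.- (ℤ.+ m) ℤ.+ ℤ.+ 1))
        ≡⟨ cong (λ z → ℤ.+ n ℤ.+ (ℤ.- (ℤ.+ 1) ℤ.+ z)) (ℤ.+-comm (ℤ.- (ℤ.+ m)) (ℤ.+ 1)) ⟩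
      ℤ.+ n ℤ.+ (ℤ.- (ℤ.+ 1) ℤ.+ (ℤ.+ 1 ℤ.+ ℤ.- (ℤ.+ m)))
        ≡⟨ cong (λ z → ℤ.+ n ℤ.+ z) (≡.sym (ℤ.+-assoc (ℤ.- (ℤ.+ 1)) (ℤ.+ 1) (ℤ.- (ℤ.+ m)))) ⟩
      ℤ.+ n ℤ.+ (ℤ.+ 0 ℤ.+ ℤ.- (ℤ.+ m))              ≡⟨ cong (λ z → ℤ.+ n ℤ.+ z) (ℤ.+-identityˡ (ℤ.- (ℤ.+ m))) ⟩
      ℤ.+ n ℤ.+ ℤ.- (ℤ.+ m)                          ≡⟨ ℤ.m-n≡m⊖n n m ⟩
      n ℤ.⊖ m                                        ∎
      where open ≡.≡-Reasoning

  -- The term in 1/T sits at index `length h - m` of the product series. If the list is too short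
  -- this index is negative, `_⟨_⟩` returns 0, and the delayed series vanishes at the corresponding
  -- place as well.
  resid-dot : ∀ h → resid h ≡ dot h B
  resid-dot h = ≡.trans (by-length (ℕ.<-≤-connex m′ (length h))) (≡.sym (≡.trans (dot-reversed h 0)
      (≡.trans (cong (P.coeff (List.reverse h) ⊛ B) (ℕ.+-identityʳ (ℕ.pred (length h))))
               (⊛-iterate-shift m′ (P.coeff (List.reverse h)) b (ℕ.pred (length h))))))
    where
    R : ℕ → F.Carrier
    R = P.coeff (List.reverse h)
    N = (ℤ.+ length h ℤ.- ℤ.+ 1) ℤ.+ ℤ.- (ℤ.+ m)
    by-length : m ≤ length h ⊎ length h ≤ m′ → resid h ≡ iterate-shift m′ (R ⊛ b) (ℕ.pred (length h))
    by-length (inj₁ m≤n) = ≡.trans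
      (digit N (R ⊛ b) -[1+ 0 ] (≡.trans (top-digit (length h)) (ℤ.⊖-≥ m≤n)))
      (≡.trans (≡.sym (iterate-shift-≥ m′ (R ⊛ b) (length h ∸ m)))
        (cong (iterate-shift m′ (R ⊛ b)) (≡.trans (cong ℕ.pred (ℕ.m+[n∸m]≡n m≤n)) refl)))
    by-length (inj₂ n≤m′) = ≡.trans
      (digit⁻ N (R ⊛ b) -[1+ 0 ] (≡.trans (top-digit (length h)) (≡.trans (ℤ.⊖-< (s≤s n≤m′)) (negative n≤m′))))
      (small h n≤m′)
      where
      negative : ∀ {n} → n ≤ m′ → ℤ.- (ℤ.+ (m ∸ n)) ≡ -[1+ (m′ ∸ n) ]
      negative n≤m′ = cong (λ z → ℤ.- (ℤ.+ z)) (ℕ.+-∸-assoc 1 n≤m′)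
      small : ∀ h → length h ≤ m′ → F.0# ≡ iterate-shift m′ (P.coeff (List.reverse h) ⊛ b) (ℕ.pred (length h))
      small []      _ = ≡.sym (iterate-shift-0 m′ (0⊛ b) 0)
      small (x ∷ h) n≤ = ≡.sym (iterate-shift-< m′ _ n≤)

  resid-≈ : ∀ f h → f P.≈ h → resid f ≡ resid h
  resid-≈ f h e = ≡.trans (resid-dot f) (≡.trans (dot-congˡ f h B e) (≡.sym (resid-dot h)))

  resid-+ : ∀ f h → resid (f P.+ h) ≡ resid f F.+ resid h
  resid-+ f h = ≡.trans (resid-dot (f P.+ h)) (≡.trans (dot-+ f h B) (≡.sym (cong₂ F._+_ (resid-dot f) (resid-dot h))))

  resid-multiple : ∀ h → resid (h P.* P.⟦ g ⟧) ≡ F.0#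
  resid-multiple h = ≡.trans (resid-dot (h P.* P.⟦ g ⟧)) (≡.trans (dot-* h P.⟦ g ⟧ B) (dot-zeroʳ h dot-modulus))

  resid-cong : ∀ f h → f ≅ h → resid f ≡ resid h
  resid-cong f h (k , e) = begin
    resid f                              ≡⟨ resid-≈ f (h P.+ (f P.+ (P.- h))) (S.solve 2 (λ f h → f S.:= h S.:+ (f S.:- h)) (λ _ → refl) f h) ⟩
    resid (h P.+ (f P.+ (P.- h)))        ≡⟨ resid-+ h _ ⟩
    resid h F.+ resid (f P.+ (P.- h))    ≡⟨ cong (resid h F.+_) (≡.trans (resid-≈ (f P.+ (P.- h)) (k P.* P.⟦ g ⟧) (λ n → ≡.sym (e n))) (resid-multiple k)) ⟩
    resid h F.+ F.0#                     ≡⟨ +-identityʳ _ ⟩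
    resid h                              ∎
    where open ≡.≡-Reasoning

-- Enumeration of field elements and residues without repetition

module Enumeration {p η} (𝔽 : FiniteField p η) where
  private
    module F = FiniteField 𝔽
    module P = Polynomials 𝔽

  ∈-elements : ∀ x → x ∈ F.elements
  ∈-elements x = subst (_∈ F.elements) (Inverse.strictlyInverseˡ F.enumeration x)
    (∈-map⁺ (Inverse.to F.enumeration) (∈-allFin (Inverse.from F.enumeration x)))

  elements-unique : Unique F.elements
  elements-unique = Unique.map⁺ (λ {i} {j} e → ≡.trans (≡.sym (Inverse.strictlyInverseʳ F.enumeration i))
    (≡.trans (cong (Inverse.from F.enumeration) e) (Inverse.strictlyInverseʳ F.enumeration j))) (Unique.allFin⁺ F.q)

  ∈-units : ∀ {x} → x ≢ F.0# → x ∈ F.units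
  ∈-units x≢0 = ∈-filter⁺ (λ x → ¬? (x F.≟ F.0#)) (∈-elements _) x≢0

  ∈-units⁻ : ∀ {x} → x ∈ F.units → x ≢ F.0#
  ∈-units⁻ x∈ = proj₂ (∈-filter⁻ (λ x → ¬? (x F.≟ F.0#)) {xs = F.elements} x∈)

  units-unique : Unique F.units
  units-unique = Unique.filter⁺ (λ x → ¬? (x F.≟ F.0#)) elements-unique

  ∈-monics : ∀ {n} (a : P.Monic n) → a ∈ P.monics n
  ∈-monics []      = here refl
  ∈-monics (x ∷ a) = ∈-cartesianProductWith⁺ _∷_ (∈-elements x) (∈-monics a)

  monics-unique : ∀ n → Unique (P.monics n)
  monics-unique zero    = [] ∷ []
  monics-unique (suc n) = Unique.cartesianProductWith⁺ _∷_ (λ e → Vec.∷-injectiveˡ e , Vec.∷-injectiveʳ e)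
    elements-unique (monics-unique n)

  _≟ᵥ_ : ∀ {n} (a b : Vec F.Carrier n) → Dec (a ≡ b)
  _≟ᵥ_ = Vec.≡-dec F._≟_

-- Fourier transform of the zeta functions of residue classes

record AdditiveCharacter {c ℓ} (A : CommutativeRing c ℓ) : Set (c ⊔ ℓ ⊔ lsuc lzero) where
  private module A = CommutativeRing A
  field
    {p η} : ℕ
    𝔽     : FiniteField p η
  private module F = FiniteField 𝔽
  field
    ψ    : F.Carrier → A.Carrier
    ψ-0  : ψ F.0# A.≈ A.1#
    ψ-+  : ∀ x y → ψ (x F.+ y) A.≈ ψ x A.* ψ y
    -- Nontriviality in the form of an equation: it survives ring homomorphisms, and it does not
    -- require cancelling ψ y - 1 in `A`, which may have zero divisors.
    ∑ψ≈0 : ListSum.∑ A F.elements ψ A.≈ A.0#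

module Fourier {c ℓ} (A : CommutativeRing c ℓ) (Ψ : AdditiveCharacter A) where
  open AdditiveCharacter Ψ
  private
    module F = FiniteField 𝔽
    module P = Polynomials 𝔽
    module FR = RingLaws (PolynomialRing.fieldRing 𝔽)
  open RingLaws A
  open IntegerSolver A
  open ListSum A
  open Enumeration 𝔽
  open PolynomialRing 𝔽 using (0∤)
  open FunctionalDot 𝔽
  open ExpProperties commutativeSemiring using (_^_)
  open RingReasoning A

  ↑ : ∀ {n} → Vec F.Carrier n → P.Poly
  ↑ = Vec.toList

  zeros : ∀ n → Vec F.Carrier n
  zeros n = Vec.replicate n F.0#

  -- The image of q in `A`, written as a sum that every ring homomorphism respects.
  Q : Carrier
  Q = ∑ F.elements (λ _ → 1#)

  ∑-elements : ∀ f → ∑ F.elements f ≈ f F.0# + ∑ F.units f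
  ∑-elements f = begin
    ∑ F.elements f
      ≈⟨ ∑-cong F.elements (λ x → split (x F.≟ F.0#) (f x)) ⟩
    ∑ F.elements (λ x → [ x F.≟ F.0# ]₁ * f x + [ ¬? (x F.≟ F.0#) ]₁ * f x)
      ≈⟨ ∑-+ F.elements _ _ ⟩
    ∑ F.elements (λ x → [ x F.≟ F.0# ]₁ * f x) + ∑ F.elements (λ x → [ ¬? (x F.≟ F.0#) ]₁ * f x)
      ≈⟨ +-cong (∑-δ (F._≟ F.0#) elements-unique (∈-elements F.0#) refl (λ _ e → e) f)
                (sym (∑-filter (λ x → ¬? (x F.≟ F.0#)) F.elements f)) ⟩
    f F.0# + ∑ F.units f ∎
    where
    split : ∀ {x} (d : Dec (x ≡ F.0#)) y → y ≈ [ d ]₁ * y + [ ¬? d ]₁ * y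
    split (yes _) y = solve 1 (λ y → y := :1 :* y :+ :0 :* y) ≈-refl y
    split (no  _) y = solve 1 (λ y → y := :0 :* y :+ :1 :* y) ≈-refl y

  ∑-units-1 : ∑ F.units (λ _ → 1#) ≈ Q - 1#
  ∑-units-1 = trans (solve 2 (λ x y → y := (x :+ y) :- x) ≈-refl 1# _) (+-congʳ (sym (∑-elements (λ _ → 1#))))

  ∑-units-ψ : ∑ F.units ψ ≈ - 1#
  ∑-units-ψ = trans (solve 2 (λ x y → y := (x :+ y) :- x) ≈-refl (ψ F.0#) _)
    (trans (+-cong (trans (sym (∑-elements ψ)) ∑ψ≈0) (-‿cong ψ-0)) (+-identityˡ _))

  ∑-ψ-scaled : ∀ ρ → ∑ F.elements (λ y → ψ (y F.* ρ)) ≈ [ ρ F.≟ F.0# ]₁ * Q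
  ∑-ψ-scaled ρ with ρ F.≟ F.0#
  ... | yes refl = trans (∑-cong F.elements (λ y → trans (reflexive (cong ψ (FR.zeroʳ y))) ψ-0)) (sym (*-identityˡ _))
  ... | no  ρ≢0  = trans (∑-reindex elements-unique elements-unique F._≟_ (F._* ρ) (F._* ρ F.⁻¹)
    (λ _ → ∈-elements _) (λ _ → ∈-elements _)
    (λ {y} _ → ≡.trans (FR.*-assoc y ρ _) (≡.trans (cong (y F.*_) (F.⁻¹-inverse ρ≢0)) (FR.*-identityʳ y)))
    (λ {y} _ → ≡.trans (FR.*-assoc y _ ρ) (≡.trans (cong (y F.*_) (≡.trans (FR.*-comm _ ρ) (F.⁻¹-inverse ρ≢0))) (FR.*-identityʳ y)))
    ψ) (trans ∑ψ≈0 (sym (zeroˡ _)))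

  pairing : ∀ {n} → (ℕ → F.Carrier) → Vec F.Carrier n → Carrier
  pairing ρ a = ψ (dot (↑ a) ρ)

  -- z ^ deg a when a, viewed as a polynomial, is monic, and 0 otherwise.
  monomial : ∀ {n} → Carrier → Vec F.Carrier n → Carrier
  monomial z []      = 0#
  monomial z (x ∷ a) = [ a ≟ᵥ zeros _ ]₁ * [ x F.≟ F.1# ]₁ + z * monomial z a

  -- For n = deg g this is (1 - q z) times Σ z ^ deg f, summed over the monic
  -- f congruent to a modulo g.
  zeta : ∀ {n} → Carrier → Vec F.Carrier n → Carrier
  zeta {n} z a = (1# - Q * z) * monomial z a + z ^ n

  -- The functional `ρ` is arbitrary, not only one that comes from a residue, because the recursion
  -- on n replaces it by its shift.
  zetaHat : ∀ n → Carrier → (ℕ → F.Carrier) → Carrier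
  zetaHat n z ρ = ∑ (P.monics n) (λ a → pairing ρ a * zeta z a)

  ∑-monics-suc : ∀ n (f : Vec F.Carrier (suc n) → Carrier) →
    ∑ (P.monics (suc n)) f ≈ ∑ F.elements (λ x → ∑ (P.monics n) (λ a → f (x ∷ a)))
  ∑-monics-suc n f = ∑-cartesianProductWith _∷_ F.elements (P.monics n) f

  ∑-pairing : ∀ n ρ → ∑ (P.monics (suc n)) (pairing ρ) ≈ [ ρ 0 F.≟ F.0# ]₁ * Q * ∑ (P.monics n) (pairing (ρ ∘ suc))
  ∑-pairing n ρ = begin
    ∑ (P.monics (suc n)) (pairing ρ)
      ≈⟨ ∑-monics-suc n _ ⟩
    ∑ F.elements (λ x → ∑ (P.monics n) (λ a → ψ (x F.* ρ 0 F.+ dot (↑ a) (ρ ∘ suc))))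
      ≈⟨ ∑-cong F.elements (λ x → ∑-cong (P.monics n) (λ a → ψ-+ _ _)) ⟩
    ∑ F.elements (λ x → ∑ (P.monics n) (λ a → ψ (x F.* ρ 0) * pairing (ρ ∘ suc) a))
      ≈⟨ ∑-* F.elements (P.monics n) _ _ ⟨
    ∑ F.elements (λ x → ψ (x F.* ρ 0)) * ∑ (P.monics n) (pairing (ρ ∘ suc))
      ≈⟨ *-congʳ (∑-ψ-scaled (ρ 0)) ⟩
    [ ρ 0 F.≟ F.0# ]₁ * Q * ∑ (P.monics n) (pairing (ρ ∘ suc)) ∎

  dot-zeros : ∀ n ρ → dot (↑ (zeros n)) ρ ≡ F.0#
  dot-zeros zero    ρ = refl
  dot-zeros (suc n) ρ = ≡.trans (cong₂ F._+_ (FR.zeroˡ _) (dot-zeros n (ρ ∘ suc))) (FR.+-identityʳ _)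

  ∑-pairing-monomial : ∀ n z ρ → ∑ (P.monics (suc n)) (λ a → pairing ρ a * monomial z a) ≈
    ψ (ρ 0) + z * ([ ρ 0 F.≟ F.0# ]₁ * Q * ∑ (P.monics n) (λ a → pairing (ρ ∘ suc) a * monomial z a))
  ∑-pairing-monomial n z ρ = begin
    ∑ (P.monics (suc n)) (λ a → pairing ρ a * monomial z a)
      ≈⟨ ∑-monics-suc n _ ⟩
    ∑ F.elements (λ x → ∑ (P.monics n) (λ a → pairing ρ (x ∷ a) * monomial z (x ∷ a)))
      ≈⟨ ∑-cong F.elements (λ x → trans (∑-cong (P.monics n) (λ a → trans (*-congʳ (ψ-+ _ _))
           (solve 6 (λ s t d e z w → (s :* t) :* (d :* e :+ z :* w) := d :* ((s :* t) :* e) :+ (z :* s) :* (t :* w)) ≈-refl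
             (ψ (x F.* ρ 0)) (pairing (ρ ∘ suc) a) [ a ≟ᵥ zeros n ]₁ [ x F.≟ F.1# ]₁ z (monomial z a))))
           (∑-+ (P.monics n) _ _)) ⟩
    ∑ F.elements (λ x → ∑ (P.monics n) (λ a → [ a ≟ᵥ zeros n ]₁ * ((ψ (x F.* ρ 0) * pairing (ρ ∘ suc) a) * [ x F.≟ F.1# ]₁))
                      + ∑ (P.monics n) (λ a → (z * ψ (x F.* ρ 0)) * (pairing (ρ ∘ suc) a * monomial z a)))
      ≈⟨ ∑-+ F.elements _ _ ⟩
    ∑ F.elements (λ x → ∑ (P.monics n) (λ a → [ a ≟ᵥ zeros n ]₁ * ((ψ (x F.* ρ 0) * pairing (ρ ∘ suc) a) * [ x F.≟ F.1# ]₁)))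
      + ∑ F.elements (λ x → ∑ (P.monics n) (λ a → (z * ψ (x F.* ρ 0)) * (pairing (ρ ∘ suc) a * monomial z a)))
      ≈⟨ +-cong
           (trans (∑-cong F.elements (λ x → trans (∑-δ (_≟ᵥ zeros n) (monics-unique n) (∈-monics (zeros n)) refl (λ _ e → e) _)
                     (trans (*-congʳ (trans (*-congˡ (trans (reflexive (cong ψ (dot-zeros n (ρ ∘ suc)))) ψ-0)) (*-identityʳ _))) (*-comm _ _))))
             (trans (∑-δ (F._≟ F.1#) elements-unique (∈-elements F.1#) refl (λ _ e → e) (λ x → ψ (x F.* ρ 0)))
               (reflexive (cong ψ (FR.*-identityˡ (ρ 0))))))
           (sym (∑-* F.elements (P.monics n) (λ x → z * ψ (x F.* ρ 0)) (λ a → pairing (ρ ∘ suc) a * monomial z a))) ⟩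
    ψ (ρ 0) + ∑ F.elements (λ x → z * ψ (x F.* ρ 0)) * ∑ (P.monics n) (λ a → pairing (ρ ∘ suc) a * monomial z a)
      ≈⟨ +-congˡ (trans (*-congʳ (trans (∑-*ˡ F.elements z _) (*-congˡ (∑-ψ-scaled (ρ 0))))) (*-assoc z _ _)) ⟩
    ψ (ρ 0) + z * ([ ρ 0 F.≟ F.0# ]₁ * Q * ∑ (P.monics n) (λ a → pairing (ρ ∘ suc) a * monomial z a)) ∎

  zetaHat-split : ∀ n z ρ → zetaHat n z ρ ≈
    (1# - Q * z) * ∑ (P.monics n) (λ a → pairing ρ a * monomial z a) + z ^ n * ∑ (P.monics n) (pairing ρ)
  zetaHat-split n z ρ = begin
    ∑ (P.monics n) (λ a → pairing ρ a * zeta z a)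
      ≈⟨ ∑-cong (P.monics n) (λ a → solve 4 (λ w k x y → w :* (k :* x :+ y) := k :* (w :* x) :+ y :* w) ≈-refl
           (pairing ρ a) (1# - Q * z) (monomial z a) (z ^ n)) ⟩
    ∑ (P.monics n) (λ a → (1# - Q * z) * (pairing ρ a * monomial z a) + z ^ n * pairing ρ a)
      ≈⟨ ∑-+ (P.monics n) _ _ ⟩
    ∑ (P.monics n) (λ a → (1# - Q * z) * (pairing ρ a * monomial z a)) + ∑ (P.monics n) (λ a → z ^ n * pairing ρ a)
      ≈⟨ +-cong (∑-*ˡ (P.monics n) _ _) (∑-*ˡ (P.monics n) _ _) ⟩
    _ ∎

  zetaHat-cong : ∀ n z {ρ σ} → (∀ i → ρ i ≡ σ i) → zetaHat n z ρ ≈ zetaHat n z σ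
  zetaHat-cong n z e = ∑-cong (P.monics n) (λ a → *-congʳ (reflexive (cong ψ (dot-congʳ (↑ a) e))))

  zetaHat-0 : ∀ z ρ → zetaHat 0 z ρ ≈ 1#
  zetaHat-0 z ρ = trans (+-identityʳ _) (trans (*-cong ψ-0 (trans (+-congʳ (zeroʳ _)) (+-identityˡ _))) (*-identityˡ _))

  -- Summing over the lowest coefficient of `a` gives `Q` if `ρ 0` vanishes and 0 otherwise. The
  -- constant polynomial 1 is the only monic one that escapes this sum, since its lowest coefficient
  -- is fixed; it contributes ψ (ρ 0).
  zetaHat-suc : ∀ n z ρ → zetaHat (suc n) z ρ ≈
    (1# - Q * z) * ψ (ρ 0) + (Q * z) * ([ ρ 0 F.≟ F.0# ]₁ * zetaHat n z (ρ ∘ suc))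
  zetaHat-suc n z ρ = begin
    zetaHat (suc n) z ρ
      ≈⟨ zetaHat-split (suc n) z ρ ⟩
    (1# - Q * z) * ∑ (P.monics (suc n)) (λ a → pairing ρ a * monomial z a) + z ^ suc n * ∑ (P.monics (suc n)) (pairing ρ)
      ≈⟨ +-cong (*-congˡ (∑-pairing-monomial n z ρ)) (*-congˡ (∑-pairing n ρ)) ⟩
    (1# - Q * z) * (ψ (ρ 0) + z * (δ * Q * X)) + (z * z ^ n) * (δ * Q * W)
      ≈⟨ solve 7 (λ k z s d q x wz → k :* (s :+ z :* (d :* q :* x)) :+ wz := k :* s :+ (z :* (d :* q)) :* (k :* x) :+ wz)
           ≈-refl (1# - Q * z) z (ψ (ρ 0)) δ Q X ((z * z ^ n) * (δ * Q * W)) ⟩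
    (1# - Q * z) * ψ (ρ 0) + (z * (δ * Q)) * ((1# - Q * z) * X) + (z * z ^ n) * (δ * Q * W)
      ≈⟨ solve 7 (λ a z d q y zn w → a :+ (z :* (d :* q)) :* y :+ (z :* zn) :* (d :* q :* w) := a :+ (q :* z) :* (d :* (y :+ zn :* w)))
           ≈-refl _ z δ Q ((1# - Q * z) * X) (z ^ n) W ⟩
    (1# - Q * z) * ψ (ρ 0) + (Q * z) * (δ * ((1# - Q * z) * X + z ^ n * W))
      ≈⟨ +-congˡ (*-congˡ (*-congˡ (zetaHat-split n z (ρ ∘ suc)))) ⟨
    (1# - Q * z) * ψ (ρ 0) + (Q * z) * (δ * zetaHat n z (ρ ∘ suc)) ∎
    where
    δ = [ ρ 0 F.≟ F.0# ]₁
    X = ∑ (P.monics n) (λ a → pairing (ρ ∘ suc) a * monomial z a)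
    W = ∑ (P.monics n) (pairing (ρ ∘ suc))

  ∑-pairing-trivial : ∀ n ρ → (∀ i → i ℕ.< n → ρ i ≡ F.0#) → ∑ (P.monics n) (pairing ρ) ≈ Q ^ n
  ∑-pairing-trivial zero    ρ e = trans (+-identityʳ _) ψ-0
  ∑-pairing-trivial (suc n) ρ e = trans (∑-pairing n ρ) (*-cong (trans (*-congʳ ([ ρ 0 F.≟ F.0# ]₁-true (e 0 (s≤s z≤n)))) (*-identityˡ Q))
    (∑-pairing-trivial n (ρ ∘ suc) (λ i i<n → e (suc i) (s≤s i<n))))

  ∑-pairing-nontrivial : ∀ n ρ i → i ℕ.< n → ρ i ≢ F.0# → ∑ (P.monics n) (pairing ρ) ≈ 0#
  ∑-pairing-nontrivial (suc n) ρ zero    _         e = trans (∑-pairing n ρ)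
    (trans (*-congʳ (trans (*-congʳ ([ ρ 0 F.≟ F.0# ]₁-false e)) (zeroˡ Q))) (zeroˡ _))
  ∑-pairing-nontrivial (suc n) ρ (suc i) (s≤s i<n) e = trans (∑-pairing n ρ)
    (trans (*-congˡ (∑-pairing-nontrivial n (ρ ∘ suc) i i<n e)) (zeroʳ _))

  private
    snoc-zeros : ∀ n → zeros n Vec.∷ʳ F.0# ≡ zeros (suc n)
    snoc-zeros zero    = refl
    snoc-zeros (suc n) = cong (F.0# ∷_) (snoc-zeros n)

  -- Coefficients are listed upwards, whereas the inductions below strip the leading one; hence the
  -- behaviour of `monomial` at the far end of the vector.
  monomial-snoc-0 : ∀ {n} z (h : Vec F.Carrier n) → monomial z (h Vec.∷ʳ F.0#) ≈ monomial z h
  monomial-snoc-0 z []      = trans (+-cong (trans (*-cong ([ [] ≟ᵥ zeros 0 ]₁-true refl) ([ F.0# F.≟ F.1# ]₁-false (F.1≢0 ∘ ≡.sym))) (zeroʳ _)) (zeroʳ z)) (+-identityˡ 0#)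
  monomial-snoc-0 {suc n} z (x ∷ h) = +-cong (*-congʳ (indicator-cong ((h Vec.∷ʳ F.0#) ≟ᵥ zeros (suc n)) (h ≟ᵥ zeros n)
      (λ e → Vec.∷ʳ-injectiveˡ h (zeros n) (≡.trans e (≡.sym (snoc-zeros n)))) (λ e → ≡.trans (cong (Vec._∷ʳ F.0#) e) (snoc-zeros n))))
    (*-congˡ (monomial-snoc-0 z h))

  monomial-snoc : ∀ {n} z (h : Vec F.Carrier n) {t} → t ≢ F.0# → monomial z (h Vec.∷ʳ t) ≈ [ t F.≟ F.1# ]₁ * z ^ n
  monomial-snoc z []      {t} t≢0 = trans (+-cong (*-congʳ ([ [] ≟ᵥ zeros 0 ]₁-true refl)) (zeroʳ z)) (trans (+-identityʳ _) (*-comm _ _))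
  monomial-snoc {suc n} z (x ∷ h) {t} t≢0 = trans (+-cong
      (trans (*-congʳ ([ (h Vec.∷ʳ t) ≟ᵥ zeros (suc n) ]₁-false (λ e → t≢0 (Vec.∷ʳ-injectiveʳ h (zeros n) (≡.trans e (≡.sym (snoc-zeros n))))))) (zeroˡ _))
      (*-congˡ (monomial-snoc z h t≢0)))
    (solve 3 (λ z d y → :0 :+ z :* (d :* y) := d :* (z :* y)) ≈-refl z _ (z ^ n))

  toList-snoc : ∀ {n} (h : Vec F.Carrier n) t → ↑ (h Vec.∷ʳ t) ≡ ↑ h ++ [ t ]
  toList-snoc []      t = refl
  toList-snoc (x ∷ h) t = cong (x ∷_) (toList-snoc h t)

  dot-snoc : ∀ {n} (h : Vec F.Carrier n) t C → dot (↑ (h Vec.∷ʳ t)) C ≡ dot (↑ h) C F.+ t F.* C n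
  dot-snoc {n} h t C = ≡.trans (cong (λ l → dot l C) (toList-snoc h t))
    (≡.trans (dot-++ (↑ h) t C) (cong (λ k → dot (↑ h) C F.+ t F.* C k) (Vec.length-toList h)))

  dot-low : ∀ {n} (h : Vec F.Carrier n) (C : ℕ → F.Carrier) → (∀ {i} → i ℕ.< n → C i ≡ F.0#) → dot (↑ h) C ≡ F.0#
  dot-low []      C e = refl
  dot-low (x ∷ h) C e = ≡.trans (cong₂ F._+_ (≡.trans (cong (x F.*_) (e (s≤s z≤n))) (FR.zeroʳ x)) (dot-low h (C ∘ suc) (λ i<n → e (s≤s i<n))))
    (FR.+-identityʳ _)

  -- If `h` has degree n - 1 - i, then T^i h has degree n - 1, where `C` is 1, while all its lower
  -- terms meet zeros of `C`: the pairing is the leading coefficient of `h`. The conditions on `C`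
  -- are phrased so that they also make sense for n = 0.
  nondegenerate : ∀ n (h : Vec F.Carrier n) (C : ℕ → F.Carrier) →
    (∀ {i} → suc i ℕ.< n → C i ≡ F.0#) → (∀ {k} → n ≡ suc k → C k ≡ F.1#) →
    h ≢ zeros n → ∃[ i ] i ℕ.< n × dot (↑ h) (λ j → C (i ℕ.+ j)) ≢ F.0#
  nondegenerate zero    []  C low top h≢0 = contradiction refl h≢0
  nondegenerate (suc n) h′ C low top h≢0 with Vec.initLast h′
  ... | h , t , refl with t F.≟ F.0#
  ...   | no t≢0 = 0 , s≤s z≤n , λ e → t≢0 (≡.trans (≡.sym (≡.trans (dot-snoc h t C)
          (≡.trans (cong₂ F._+_ (dot-low h C (λ i<n → low (s≤s i<n))) (≡.trans (cong (t F.*_) (top refl)) (FR.*-identityʳ t)))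
            (FR.+-identityˡ t)))) e)
  ...   | yes refl with nondegenerate n h (C ∘ suc) (λ i<n → low (s≤s i<n)) (λ { refl → top refl })
                          (λ e → h≢0 (≡.trans (cong (Vec._∷ʳ F.0#) e) (snoc-zeros n)))
  ...     | i , i<n , ρ≢0 = suc i , s≤s i<n , λ e → ρ≢0 (≡.trans (≡.sym (≡.trans (dot-snoc h F.0# _)
              (≡.trans (cong (dot (↑ h) _ F.+_) (FR.zeroˡ _)) (FR.+-identityʳ _)))) e)

  module Duality (u x : Carrier) (Qu*x≈1 : Q * u * x ≈ 1#) where
    private
      y : Carrier
      y = Q * u

    -- For `h` of degree d with leading coefficient t, the recursion passes through k = n - 1 - d
    -- vanishing values and ends at t. This gives (1 - y)(1 + ... + y^(k-1)) + y^k (1 - y) ψ t = 1 +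
    -- y^k ((1 - y) ψ t - 1), and the last bracket is the kernel at t.
    kernel : F.Carrier → Carrier
    kernel μ = (1# - y) * ψ μ - 1#

    monomialDual : ∀ {n} → Vec F.Carrier n → Carrier
    monomialDual h = ∑ F.units (λ μ → kernel μ * monomial x (Vec.map (μ F.⁻¹ F.*_) h))

    -- The Fourier transform at h only sees the leading coefficient of h:
    -- the first nonvanishing ρ i ends the recursion for zetaHat, and it is
    -- the leading coefficient because C is zero below n - 1 and one there.
    zetaHat-monomial : ∀ n (h : Vec F.Carrier n) (C : ℕ → F.Carrier) →
      (∀ {i} → suc i ℕ.< n → C i ≡ F.0#) → (∀ {k} → n ≡ suc k → C k ≡ F.1#) →
      y * zetaHat n u (λ i → dot (↑ h) (λ j → C (i ℕ.+ j))) ≈ y + y ^ n * monomialDual h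
    zetaHat-monomial zero [] C _ _ = begin
      y * zetaHat 0 u (λ _ → F.0#)  ≈⟨ *-congˡ (zetaHat-0 u (λ _ → F.0#)) ⟩
      y * 1#             ≈⟨ *-identityʳ y ⟩
      y                  ≈⟨ +-identityʳ y ⟨
      y + 0#             ≈⟨ +-congˡ (trans (*-congˡ (∑-zero F.units (λ μ → zeroʳ (kernel μ)))) (zeroʳ 1#)) ⟨
      y + 1# * monomialDual [] ∎
    zetaHat-monomial (suc n) h′ C low top with Vec.initLast h′
    ... | h , t , refl with t F.≟ F.0#
    ...   | yes refl = begin
      y * zetaHat (suc n) u ρ
        ≈⟨ *-congˡ (trans (zetaHat-suc n u ρ) (+-cong (*-congˡ (trans (reflexive (cong ψ ρ0≡0)) ψ-0))
             (*-congˡ (trans (*-congʳ ([ ρ 0 F.≟ F.0# ]₁-true ρ0≡0)) (trans (*-identityˡ _) (zetaHat-cong n u ρ-suc)))))) ⟩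
      y * ((1# - y) * 1# + y * zetaHat n u σ)
        ≈⟨ *-congˡ (+-congˡ (zetaHat-monomial n h (C ∘ suc) (λ i<n → low (s≤s i<n)) (λ { refl → top refl }))) ⟩
      y * ((1# - y) * 1# + (y + y ^ n * monomialDual h))
        ≈⟨ solve 3 (λ y e m → y :* ((:1 :- y) :* :1 :+ (y :+ e :* m)) := y :+ (y :* e) :* m) ≈-refl y (y ^ n) _ ⟩
      y + y ^ suc n * monomialDual h
        ≈⟨ +-congˡ (*-congˡ (∑-cong F.units (λ μ → *-congˡ {kernel μ} (trans (reflexive (cong (monomial x)
             (≡.trans (Vec.map-∷ʳ (μ F.⁻¹ F.*_) F.0# h) (cong (Vec.map (μ F.⁻¹ F.*_) h Vec.∷ʳ_) (FR.zeroʳ _)))))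
             (monomial-snoc-0 x (Vec.map (μ F.⁻¹ F.*_) h)))))) ⟨
      y + y ^ suc n * monomialDual (h Vec.∷ʳ F.0#) ∎
      where
      ρ σ : ℕ → F.Carrier
      ρ i = dot (↑ (h Vec.∷ʳ F.0#)) (λ j → C (i ℕ.+ j))
      σ i = dot (↑ h) (λ j → C (suc i ℕ.+ j))
      drop0 : ∀ D → dot (↑ (h Vec.∷ʳ F.0#)) D ≡ dot (↑ h) D
      drop0 D = ≡.trans (dot-snoc h F.0# D) (≡.trans (cong (dot (↑ h) D F.+_) (FR.zeroˡ _)) (FR.+-identityʳ _))
      ρ0≡0 : ρ 0 ≡ F.0#
      ρ0≡0 = ≡.trans (drop0 C) (dot-low h C (λ i<n → low (s≤s i<n)))
      ρ-suc : ∀ i → ρ (suc i) ≡ σ i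
      ρ-suc i = drop0 (λ j → C (suc i ℕ.+ j))
    ...   | no t≢0 = begin
      y * zetaHat (suc n) u ρ
        ≈⟨ *-congˡ (trans (zetaHat-suc n u ρ) (+-cong (*-congˡ (reflexive (cong ψ ρ0≡t)))
             (trans (*-congˡ (trans (*-congʳ ([ ρ 0 F.≟ F.0# ]₁-false (t≢0 ∘ ≡.trans (≡.sym ρ0≡t)))) (zeroˡ _))) (zeroʳ y)))) ⟩
      y * ((1# - y) * ψ t + 0#)
        ≈⟨ solve 2 (λ y k → y :* (k :+ :0) := y :+ y :* :1 :* (k :- :1)) ≈-refl y ((1# - y) * ψ t) ⟩
      y + y * 1# * kernel t
        -- Here `h` has degree n. Inserting y^n x^n = 1 creates the factor x^n of `monomial x`, and
        -- t is the only scalar μ for which μ⁻¹ h is monic, so the single term becomes the sum over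
        -- all units.
        ≈⟨ +-congˡ (*-congʳ (*-congˡ (power n))) ⟨
      y + y * (y ^ n * x ^ n) * kernel t
        ≈⟨ +-congˡ (solve 4 (λ y e f k → y :* (e :* f) :* k := (y :* e) :* (k :* f)) ≈-refl y (y ^ n) (x ^ n) (kernel t)) ⟩
      y + y ^ suc n * (kernel t * x ^ n)
        ≈⟨ +-congˡ (*-congˡ (∑-δ (λ μ → (μ F.⁻¹ F.* t) F.≟ F.1#) units-unique (∈-units t≢0)
             (≡.trans (FR.*-comm _ t) (F.⁻¹-inverse t≢0)) inverse-unique (λ μ → kernel μ * x ^ n))) ⟨
      y + y ^ suc n * ∑ F.units (λ μ → [ (μ F.⁻¹ F.* t) F.≟ F.1# ]₁ * (kernel μ * x ^ n))
        ≈⟨ +-congˡ (*-congˡ (∑-cong-∈ F.units (λ {μ} μ∈ → trans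
             (solve 3 (λ d k e → d :* (k :* e) := k :* (d :* e)) ≈-refl _ (kernel μ) (x ^ n))
             (*-congˡ (sym (trans (reflexive (cong (monomial x) (Vec.map-∷ʳ (μ F.⁻¹ F.*_) t h)))
               (monomial-snoc x (Vec.map (μ F.⁻¹ F.*_) h) (μ⁻¹t≢0 (∈-units⁻ μ∈))))))))) ⟩
      y + y ^ suc n * monomialDual (h Vec.∷ʳ t) ∎
      where
      ρ : ℕ → F.Carrier
      ρ i = dot (↑ (h Vec.∷ʳ t)) (λ j → C (i ℕ.+ j))
      ρ0≡t : ρ 0 ≡ t
      ρ0≡t = ≡.trans (dot-snoc h t C) (≡.trans (cong₂ F._+_ (dot-low h C (λ i<n → low (s≤s i<n)))
        (≡.trans (cong (t F.*_) (top refl)) (FR.*-identityʳ t))) (FR.+-identityˡ t))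
      power : ∀ k → y ^ k * x ^ k ≈ 1#
      power zero    = *-identityˡ 1#
      power (suc k) = trans (solve 4 (λ y a x b → (y :* a) :* (x :* b) := (y :* x) :* (a :* b)) ≈-refl y (y ^ k) x (x ^ k))
        (trans (*-cong Qu*x≈1 (power k)) (*-identityˡ 1#))
      inverse-unique : ∀ {μ} → μ ∈ F.units → μ F.⁻¹ F.* t ≡ F.1# → μ ≡ t
      inverse-unique {μ} μ∈ e = ≡.trans (≡.sym (FR.*-identityʳ μ)) (≡.trans (cong (μ F.*_) (≡.sym e))
        (≡.trans (≡.sym (FR.*-assoc μ _ t)) (≡.trans (cong (F._* t) (F.⁻¹-inverse (∈-units⁻ μ∈))) (FR.*-identityˡ t))))
      μ⁻¹t≢0 : ∀ {μ} → μ ≢ F.0# → μ F.⁻¹ F.* t ≢ F.0#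
      μ⁻¹t≢0 {μ} μ≢0 e = t≢0 (0∤ (λ μ⁻¹≡0 → F.1≢0 (≡.trans (≡.sym (F.⁻¹-inverse μ≢0)) (≡.trans (cong (μ F.*_) μ⁻¹≡0) (FR.zeroʳ μ)))) e)

    ∑-kernel : ∑ F.units kernel ≈ y - Q
    ∑-kernel = begin
      ∑ F.units (λ μ → (1# - y) * ψ μ - 1#)
        ≈⟨ trans (∑-+ F.units _ _) (+-cong (∑-*ˡ F.units (1# - y) ψ)
             (trans (∑-cong F.units (λ _ → solve 0 (:- :1 := (:- :1) :* :1) ≈-refl)) (∑-*ˡ F.units (- 1#) (λ _ → 1#)))) ⟩
      (1# - y) * ∑ F.units ψ + - 1# * ∑ F.units (λ _ → 1#)
        ≈⟨ +-cong (*-congˡ ∑-units-ψ) (*-congˡ ∑-units-1) ⟩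
      (1# - y) * - 1# + - 1# * (Q - 1#)
        ≈⟨ solve 2 (λ y q → (:1 :- y) :* (:- :1) :+ (:- :1) :* (q :- :1) := y :- q) ≈-refl y Q ⟩
      y - Q ∎

    -- Multiplication by 1 - Q x turns `monomial x` into `zeta x` up to x^(n+1) times the total mass
    -- y - Q of the kernel. As x y = 1, this correction multiplied by y^n is 1 - Q x, which is
    -- exactly what the constant term in `zetaHat-monomial` becomes.
    zetaHat-dual : ∀ n (h : Vec F.Carrier (suc n)) (C : ℕ → F.Carrier) →
      (∀ {i} → i ℕ.< n → C i ≡ F.0#) → C n ≡ F.1# →
      (1# - Q * x) * zetaHat (suc n) u (λ i → dot (↑ h) (λ j → C (i ℕ.+ j))) ≈
      y ^ n * ∑ F.units (λ μ → kernel μ * zeta x (Vec.map (μ F.⁻¹ F.*_) h))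
    zetaHat-dual n h C low top = begin
      D * Z
        ≈⟨ trans (sym (*-identityˡ _)) (*-congʳ (trans (sym Qu*x≈1) (*-comm y x))) ⟩
      (x * y) * (D * Z)
        ≈⟨ solve 4 (λ x y d z → (x :* y) :* (d :* z) := (x :* d) :* (y :* z)) ≈-refl x y D Z ⟩
      (x * D) * (y * Z)
        ≈⟨ *-congˡ (zetaHat-monomial (suc n) h C (λ { (s≤s i<n) → low i<n }) (λ { refl → top })) ⟩
      (x * D) * (y + (y * y ^ n) * M)
        ≈⟨ solve 5 (λ x d y e m → (x :* d) :* (y :+ (y :* e) :* m) := (y :* x) :* (d :+ e :* (d :* m))) ≈-refl x D y (y ^ n) M ⟩
      (y * x) * (D + y ^ n * (D * M))
        ≈⟨ trans (*-congʳ Qu*x≈1) (*-identityˡ _) ⟩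
      D + y ^ n * (D * M)
        ≈⟨ +-congʳ D≈ ⟩
      y ^ n * (x ^ suc n * (y - Q)) + y ^ n * (D * M)
        ≈⟨ solve 3 (λ e a b → e :* a :+ e :* b := e :* (b :+ a)) ≈-refl (y ^ n) _ _ ⟩
      y ^ n * (D * M + x ^ suc n * (y - Q))
        ≈⟨ *-congˡ (+-cong (∑-*ˡ F.units D _) (trans (∑-*ˡ F.units (x ^ suc n) kernel) (*-congˡ ∑-kernel))) ⟨
      y ^ n * (∑ F.units (λ μ → D * (kernel μ * monomial x (scaled μ))) + ∑ F.units (λ μ → x ^ suc n * kernel μ))
        ≈⟨ *-congˡ (∑-+ F.units _ _) ⟨
      y ^ n * ∑ F.units (λ μ → D * (kernel μ * monomial x (scaled μ)) + x ^ suc n * kernel μ)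
        ≈⟨ *-congˡ (∑-cong F.units (λ μ → solve 4 (λ d k m e → d :* (k :* m) :+ e :* k := k :* (d :* m :+ e)) ≈-refl
             D (kernel μ) (monomial x (scaled μ)) (x ^ suc n))) ⟩
      y ^ n * ∑ F.units (λ μ → kernel μ * zeta x (scaled μ)) ∎
      where
      D = 1# - Q * x
      Z = zetaHat (suc n) u (λ i → dot (↑ h) (λ j → C (i ℕ.+ j)))
      M = monomialDual h
      scaled = λ μ → Vec.map (μ F.⁻¹ F.*_) h
      power : ∀ k → y ^ k * x ^ k ≈ 1#
      power zero    = *-identityˡ 1#
      power (suc k) = trans (solve 4 (λ y a x b → (y :* a) :* (x :* b) := (y :* x) :* (a :* b)) ≈-refl y (y ^ k) x (x ^ k))
        (trans (*-cong Qu*x≈1 (power k)) (*-identityˡ 1#))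
      D≈ : D ≈ y ^ n * (x ^ suc n * (y - Q))
      D≈ = sym (begin
        y ^ n * ((x * x ^ n) * (y - Q))
          ≈⟨ solve 5 (λ e x f y q → e :* ((x :* f) :* (y :- q)) := (e :* f) :* (y :* x :- q :* x)) ≈-refl (y ^ n) x (x ^ n) y Q ⟩
        (y ^ n * x ^ n) * (y * x - Q * x)
          ≈⟨ trans (*-cong (power n) (+-congʳ Qu*x≈1)) (*-identityˡ _) ⟩
        D ∎)

-- The functional equation over a general ring

record TwistData {c ℓ} (A : CommutativeRing c ℓ) : Set (c ⊔ ℓ ⊔ lsuc lzero) where
  private module A = CommutativeRing A
  field
    additive : AdditiveCharacter A
  open AdditiveCharacter additive public
  private module P = Polynomials 𝔽
  field
    {m′}   : ℕ
    g      : P.Monic (suc m′)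
    χ      : P.Poly → A.Carrier
    χ-cong : ∀ f h → f P.≡ h [mod P.⟦ g ⟧ ] → χ f A.≈ χ h
    χ-1    : χ P.1# A.≈ A.1#
    χ-*    : ∀ f h → χ (f P.* h) A.≈ χ f A.* χ h

module FunctionalEquation {c ℓ} (A : CommutativeRing c ℓ) (T : TwistData A) where
  open TwistData T
  private
    module F = FiniteField 𝔽
    module P = Polynomials 𝔽
    m = suc m′
    module FR = RingLaws (PolynomialRing.fieldRing 𝔽)
    module PR = RingLaws (PolynomialRing.polynomialRing 𝔽)
    module PS = IntegerSolver (PolynomialRing.polynomialRing 𝔽)
    module FS = IntegerSolver (PolynomialRing.fieldRing 𝔽)
  open RingLaws A
  open IntegerSolver A
  open ListSum A
  open Enumeration 𝔽
  open PolynomialRing 𝔽 using (0∤; ·ₚ≈*)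
  open FunctionalDot 𝔽
  open MonicModulus 𝔽 g hiding (↑; zeros)
  open Fourier A additive
  open ExpProperties commutativeSemiring using (_^_)
  open RingReasoning A

  residues : List (Vec F.Carrier m)
  residues = P.monics m

  twisted : P.Poly → Carrier → Carrier
  twisted c z = ∑ residues (λ a → ∑ residues (λ b →
    (χ (↑ a) * ψ (resid (c P.* (↑ a P.* ↑ b)))) * (zeta z a * zeta z b)))

  χ-≈ : ∀ f h → f P.≈ h → χ f ≈ χ h
  χ-≈ f h e = χ-cong f h (≈⇒≅ f h e)

  times : P.Poly → Vec F.Carrier m → Vec F.Carrier m
  times s a = remainder (s P.* ↑ a)

  ↑times : ∀ s a → s P.* ↑ a ≅ ↑ (times s a)
  ↑times s a = remainder-≅ (s P.* ↑ a)

  times-* : ∀ s t a → times s (times t a) ≡ times (s P.* t) a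
  times-* s t a = remainder-cong (s P.* ↑ (times t a)) ((s P.* t) P.* ↑ a)
    (≅-trans (s P.* ↑ (times t a)) (s P.* (t P.* ↑ a)) ((s P.* t) P.* ↑ a)
      (≅-*ˡ s (↑ (times t a)) (t P.* ↑ a) (≅-sym (t P.* ↑ a) (↑ (times t a)) (↑times t a)))
      (≈⇒≅ (s P.* (t P.* ↑ a)) ((s P.* t) P.* ↑ a) (PS.solve 3 (λ s t a → s PS.:* (t PS.:* a) PS.:= (s PS.:* t) PS.:* a) (λ _ → refl) s t (↑ a))))

  times-1 : ∀ s a → s ≅ P.1# → times s a ≡ a
  times-1 s a e = ≡.trans (remainder-cong (s P.* ↑ a) (↑ a)
    (≅-trans (s P.* ↑ a) (P.1# P.* ↑ a) (↑ a) (≅-* s P.1# (↑ a) (↑ a) e (≅-refl (↑ a)))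
      (≈⇒≅ (P.1# P.* ↑ a) (↑ a) (PR.*-identityˡ (↑ a))))) (remainder-↑ a)

  times-scalar : ∀ k a → Vec.map (k F.*_) a ≡ times [ k ] a
  times-scalar k a = residue-unique (Vec.map (k F.*_) a) (times [ k ] a)
    (≅-trans (↑ (Vec.map (k F.*_) a)) ([ k ] P.* ↑ a) (↑ (times [ k ] a))
      (≈⇒≅ (↑ (Vec.map (k F.*_) a)) ([ k ] P.* ↑ a)
        (λ n → ≡.trans (cong (λ l → P.coeff l n) (Vec.toList-map (k F.*_) a)) (·ₚ≈* k (↑ a) n)))
      (↑times [ k ] a))

  ∑-times : ∀ s t → s P.* t ≅ P.1# → (f : Vec F.Carrier m → Carrier) → ∑ residues (f ∘ times s) ≈ ∑ residues f
  ∑-times s t st≅1 = ∑-reindex (monics-unique m) (monics-unique m) _≟ᵥ_ (times s) (times t)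
    (λ _ → ∈-monics _) (λ _ → ∈-monics _)
    (λ {a} _ → ≡.trans (times-* t s a) (times-1 (t P.* s) a
      (≅-trans (t P.* s) (s P.* t) P.1# (≈⇒≅ (t P.* s) (s P.* t) (PR.*-comm t s)) st≅1)))
    (λ {a} _ → ≡.trans (times-* s t a) (times-1 (s P.* t) a st≅1))

  scalar-* : ∀ k l → ([ k ] P.* [ l ]) P.≈ [ k F.* l ]
  scalar-* k l zero    = FR.+-identityʳ _
  scalar-* k l (suc n) = refl

  scalar-inverse : ∀ {k} → k ≢ F.0# → ([ k ] P.* [ k F.⁻¹ ]) P.≈ P.1#
  scalar-inverse {k} k≢0 n = ≡.trans (scalar-* k (k F.⁻¹) n) (cong (λ t → P.coeff [ t ] n) (F.⁻¹-inverse k≢0))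

  -- The functional attached to `h`: its value at i is the coefficient of 1/T in T^i h / g.
  residueDual : P.Poly → ℕ → F.Carrier
  residueDual h i = dot h (λ j → B (i ℕ.+ j))

  pairing-resid : ∀ h (a : Vec F.Carrier m) → dot (↑ a) (residueDual h) ≡ resid (↑ a P.* h)
  pairing-resid h a = ≡.sym (≡.trans (resid-dot (↑ a P.* h)) (dot-* (↑ a) h B))

  -- Orthogonality of characters on the residues modulo `g`. The pairing by the coefficient of 1/T
  -- is nondegenerate because `B` is 0 below m - 1 and 1 at m - 1, so a nonzero difference of `a`
  -- and `k` gives a nontrivial character.
  ∑-additive : ∀ (a k : Vec F.Carrier m) →
    ∑ residues (λ b → ψ (resid (↑ b P.* (↑ a P.+ (P.- ↑ k))))) ≈ [ a ≟ᵥ k ]₁ * Q ^ m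
  ∑-additive a k = trans (∑-cong residues (λ b → reflexive (cong ψ (≡.trans
      (resid-≈ (↑ b P.* (↑ a P.+ (P.- ↑ k))) (↑ b P.* ↑ d) (PR.*-congˡ {↑ b} {↑ a P.+ (P.- ↑ k)} {↑ d} a-k≈d))
      (≡.sym (pairing-resid (↑ d) b)))))) (by-cases (a ≟ᵥ k))
    where
    d : Vec F.Carrier m
    d = Vec.zipWith (λ x y → x F.+ F.- y) a k
    difference : ∀ {n} (a k : Vec F.Carrier n) → (↑ a P.+ (P.- ↑ k)) P.≈ ↑ (Vec.zipWith (λ x y → x F.+ F.- y) a k)
    difference []      []      n       = refl
    difference (x ∷ a) (y ∷ k) zero    = refl
    difference (x ∷ a) (y ∷ k) (suc n) = difference a k n
    a-k≈d : (↑ a P.+ (P.- ↑ k)) P.≈ ↑ d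
    a-k≈d = difference a k
    zero-difference : ∀ {n} (a k : Vec F.Carrier n) → Vec.zipWith (λ x y → x F.+ F.- y) a k ≡ zeros n → a ≡ k
    zero-difference []      []      e = refl
    zero-difference (x ∷ a) (y ∷ k) e = cong₂ _∷_
      (≡.trans (FS.solve 2 (λ x y → x FS.:= (x FS.:- y) FS.:+ y) refl x y)
        (≡.trans (cong (F._+ y) (Vec.∷-injectiveˡ e)) (FR.+-identityˡ y)))
      (zero-difference a k (Vec.∷-injectiveʳ e))
    by-cases : (dec : Dec (a ≡ k)) → ∑ residues (pairing (residueDual (↑ d))) ≈ [ dec ]₁ * Q ^ m
    by-cases (yes refl) = trans (∑-pairing-trivial m (residueDual (↑ d)) (λ i _ →
      dot-zeroˡ (↑ d) (λ j → B (i ℕ.+ j)) (λ n → ≡.trans (≡.sym (a-k≈d n)) (PR.-‿inverseʳ (↑ a) n)))) (sym (*-identityˡ _))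
    by-cases (no a≢k) with nondegenerate m d B (λ { (s≤s i<m′) → B-< i<m′ }) (λ { refl → B-top }) (a≢k ∘ zero-difference a k)
    ... | i , i<m , ρ≢0 = trans (∑-pairing-nontrivial m (residueDual (↑ d)) i i<m ρ≢0) (sym (zeroˡ _))

  resid-neg : ∀ f → F.- resid f ≡ resid (P.- f)
  resid-neg f = ≡.trans (FS.solve 2 (λ a b → FS.:- a FS.:= b FS.:- (a FS.:+ b)) refl (resid f) (resid (P.- f)))
    (≡.trans (cong (λ t → resid (P.- f) F.+ F.- t) (≡.trans (≡.sym (resid-+ f (P.- f))) (≡.trans
      (resid-≈ (f P.+ (P.- f)) [] (PR.-‿inverseʳ f)) (resid-dot []))))
      (FS.solve 1 (λ a → a FS.:- FS.:0 FS.:= a) refl (resid (P.- f))))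

  module _ (u x : Carrier) (Qu*x≈1 : Q * u * x ≈ 1#) where
    open Duality u x Qu*x≈1
    private
      y D : Carrier
      y = Q * u
      D = 1# - Q * x

    transform : Vec F.Carrier m → Carrier
    transform h = ∑ residues (λ b → ψ (resid (↑ b P.* ↑ h)) * zeta u b)

    transform-dual : ∀ h → D * transform h ≈ y ^ m′ * ∑ F.units (λ μ → kernel μ * zeta x (times [ μ F.⁻¹ ] h))
    transform-dual h = begin
      D * transform h
        ≈⟨ *-congˡ (∑-cong residues (λ b → *-congʳ (reflexive (cong ψ (pairing-resid (↑ h) b))))) ⟨
      D * zetaHat m u (residueDual (↑ h))
        ≈⟨ zetaHat-dual m′ h B B-< B-top ⟩
      y ^ m′ * ∑ F.units (λ μ → kernel μ * zeta x (Vec.map (μ F.⁻¹ F.*_) h))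
        ≈⟨ *-congˡ (∑-cong F.units (λ μ → *-congˡ {kernel μ} (reflexive (cong (zeta x) (times-scalar (μ F.⁻¹) h))))) ⟩
      _ ∎

    inversion : ∀ k → ∑ residues (λ b → ψ (F.- resid (↑ b P.* ↑ k)) * transform b) ≈ Q ^ m * zeta u k
    inversion k = begin
      ∑ residues (λ b → ψ (F.- resid (↑ b P.* ↑ k)) * transform b)
        ≈⟨ ∑-cong residues (λ b → trans (sym (∑-*ˡ residues _ _)) (∑-cong residues (λ a → trans (sym (*-assoc _ _ _))
             (*-congʳ (trans (sym (ψ-+ _ _)) (reflexive (cong ψ (combine a b)))))))) ⟩
      ∑ residues (λ b → ∑ residues (λ a → ψ (resid (↑ b P.* (↑ a P.+ (P.- ↑ k)))) * zeta u a))
        ≈⟨ ∑-swap residues residues _ ⟩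
      ∑ residues (λ a → ∑ residues (λ b → ψ (resid (↑ b P.* (↑ a P.+ (P.- ↑ k)))) * zeta u a))
        ≈⟨ ∑-cong residues (λ a → trans (∑-*ʳ residues (zeta u a) _) (trans (*-congʳ (∑-additive a k)) (*-assoc _ _ _))) ⟩
      ∑ residues (λ a → [ a ≟ᵥ k ]₁ * (Q ^ m * zeta u a))
        ≈⟨ ∑-δ (_≟ᵥ k) (monics-unique m) (∈-monics k) refl (λ _ e → e) _ ⟩
      Q ^ m * zeta u k ∎
      where
      combine : ∀ a b → F.- resid (↑ b P.* ↑ k) F.+ resid (↑ a P.* ↑ b) ≡ resid (↑ b P.* (↑ a P.+ (P.- ↑ k)))
      combine a b = ≡.trans (cong (F._+ _) (resid-neg (↑ b P.* ↑ k)))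
        (≡.trans (≡.sym (resid-+ (P.- (↑ b P.* ↑ k)) (↑ a P.* ↑ b)))
          (resid-≈ ((P.- (↑ b P.* ↑ k)) P.+ ↑ a P.* ↑ b) (↑ b P.* (↑ a P.+ (P.- ↑ k)))
            (PS.solve 3 (λ a b k → (PS.:- (b PS.:* k)) PS.:+ a PS.:* b PS.:= b PS.:* (a PS.:- k)) (λ _ → refl) (↑ a) (↑ b) (↑ k))))

    -- Fourier inversion writes `zeta u k` through its transforms, each of which can be dualized;
    -- replacing b by μ b then moves the scalar from `zeta x` into the phase.
    zeta-dual : ∀ k → D * (Q ^ m * zeta u k) ≈
      y ^ m′ * ∑ F.units (λ μ → kernel μ * ∑ residues (λ b → ψ (F.- resid (([ μ ] P.* ↑ b) P.* ↑ k)) * zeta x b))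
    zeta-dual k = begin
      D * (Q ^ m * zeta u k)
        ≈⟨ *-congˡ (inversion k) ⟨
      D * ∑ residues (λ b → ψ (F.- resid (↑ b P.* ↑ k)) * transform b)
        ≈⟨ trans (sym (∑-*ˡ residues D _)) (∑-cong residues (λ b → trans
             (solve 3 (λ d s t → d :* (s :* t) := s :* (d :* t)) ≈-refl D _ (transform b))
             (trans (*-congˡ (transform-dual b)) (trans (solve 3 (λ s e t → s :* (e :* t) := e :* (s :* t)) ≈-refl _ (y ^ m′) _)
               (*-congˡ (sym (∑-*ˡ F.units (ψ (F.- resid (↑ b P.* ↑ k))) _))))))) ⟩
      ∑ residues (λ b → y ^ m′ * ∑ F.units (λ μ → ψ (F.- resid (↑ b P.* ↑ k)) * (kernel μ * zeta x (times [ μ F.⁻¹ ] b))))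
        ≈⟨ trans (∑-*ˡ residues (y ^ m′) _) (*-congˡ (∑-swap residues F.units _)) ⟩
      y ^ m′ * ∑ F.units (λ μ → ∑ residues (λ b → ψ (F.- resid (↑ b P.* ↑ k)) * (kernel μ * zeta x (times [ μ F.⁻¹ ] b))))
        ≈⟨ *-congˡ (∑-cong-∈ F.units (λ {μ} μ∈ → trans (∑-cong residues (λ b →
             solve 3 (λ s k z → s :* (k :* z) := k :* (s :* z)) ≈-refl _ (kernel μ) _))
             (trans (∑-*ˡ residues (kernel μ) _) (*-congˡ (substitute (∈-units⁻ μ∈)))))) ⟩
      _ ∎
      where
      substitute : ∀ {μ} → μ ≢ F.0# →
        ∑ residues (λ b → ψ (F.- resid (↑ b P.* ↑ k)) * zeta x (times [ μ F.⁻¹ ] b)) ≈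
        ∑ residues (λ b → ψ (F.- resid (([ μ ] P.* ↑ b) P.* ↑ k)) * zeta x b)
      substitute {μ} μ≢0 = trans (sym (∑-times [ μ ] [ μ F.⁻¹ ] (≈⇒≅ ([ μ ] P.* [ μ F.⁻¹ ]) P.1# (scalar-inverse μ≢0)) _))
        (∑-cong residues (λ b → *-cong
          (reflexive (cong (λ t → ψ (F.- t)) (resid-cong (↑ (times [ μ ] b) P.* ↑ k) (([ μ ] P.* ↑ b) P.* ↑ k)
            (≅-* (↑ (times [ μ ] b)) ([ μ ] P.* ↑ b) (↑ k) (↑ k) (≅-sym ([ μ ] P.* ↑ b) (↑ (times [ μ ] b)) (↑times [ μ ] b)) (≅-refl (↑ k))))))
          (reflexive (cong (zeta x) (≡.trans (times-* [ μ F.⁻¹ ] [ μ ] b) (times-1 ([ μ F.⁻¹ ] P.* [ μ ]) b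
            (≈⇒≅ ([ μ F.⁻¹ ] P.* [ μ ]) P.1# (λ n → ≡.trans (PR.*-comm [ μ F.⁻¹ ] [ μ ] n) (scalar-inverse μ≢0 n)))))))))

    module _ (c c̄ : P.Poly) (cc̄≅1 : c P.* c̄ ≅ P.1#) where

      -- The sum over b is the transform at c a. Once it is dualized, a is replaced by μ c̄ h: this
      -- makes h the argument of `zeta x` and sends μ c̄ into χ and into the remaining factor at u.
      half-dual : D * twisted c u ≈ y ^ m′ * ∑ F.units (λ μ → kernel μ *
        ∑ residues (λ h → χ ([ μ ] P.* c̄ P.* ↑ h) * (zeta u (times ([ μ ] P.* c̄) h) * zeta x h)))
      half-dual = begin
        D * twisted c u
          ≈⟨ *-congˡ (∑-cong residues (λ a → trans (∑-cong residues (λ b → trans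
               (solve 4 (λ s t z w → (s :* t) :* (z :* w) := (s :* z) :* (t :* w)) ≈-refl (χ (↑ a)) _ (zeta u a) (zeta u b))
               (*-congˡ (*-congʳ (reflexive (cong ψ (rearrange a b))))))) (∑-*ˡ residues (χ (↑ a) * zeta u a) _))) ⟩
        D * ∑ residues (λ a → (χ (↑ a) * zeta u a) * transform (times c a))
          ≈⟨ trans (sym (∑-*ˡ residues D _)) (∑-cong residues (λ a → trans
               (solve 3 (λ d s t → d :* (s :* t) := s :* (d :* t)) ≈-refl D _ (transform (times c a)))
               (trans (*-congˡ (transform-dual (times c a))) (trans (solve 3 (λ s e t → s :* (e :* t) := e :* (s :* t)) ≈-refl _ (y ^ m′) _)
                 (*-congˡ (sym (∑-*ˡ F.units (χ (↑ a) * zeta u a) _))))))) ⟩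
        ∑ residues (λ a → y ^ m′ * ∑ F.units (λ μ → (χ (↑ a) * zeta u a) * (kernel μ * zeta x (times [ μ F.⁻¹ ] (times c a)))))
          ≈⟨ trans (∑-*ˡ residues (y ^ m′) _) (*-congˡ (∑-swap residues F.units _)) ⟩
        y ^ m′ * ∑ F.units (λ μ → ∑ residues (λ a → (χ (↑ a) * zeta u a) * (kernel μ * zeta x (times [ μ F.⁻¹ ] (times c a)))))
          ≈⟨ *-congˡ (∑-cong-∈ F.units (λ {μ} μ∈ → trans (∑-cong residues (λ a →
               solve 4 (λ s z k w → (s :* z) :* (k :* w) := k :* (s :* (z :* w))) ≈-refl (χ (↑ a)) (zeta u a) (kernel μ) _))
               (trans (∑-*ˡ residues (kernel μ) _) (*-congˡ (substitute (∈-units⁻ μ∈)))))) ⟩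
        _ ∎
        where
        rearrange : ∀ a b → resid (c P.* (↑ a P.* ↑ b)) ≡ resid (↑ b P.* ↑ (times c a))
        rearrange a b = resid-cong (c P.* (↑ a P.* ↑ b)) (↑ b P.* ↑ (times c a))
          (≅-trans (c P.* (↑ a P.* ↑ b)) (↑ b P.* (c P.* ↑ a)) (↑ b P.* ↑ (times c a))
            (≈⇒≅ (c P.* (↑ a P.* ↑ b)) (↑ b P.* (c P.* ↑ a))
              (PS.solve 3 (λ c a b → c PS.:* (a PS.:* b) PS.:= b PS.:* (c PS.:* a)) (λ _ → refl) c (↑ a) (↑ b)))
            (≅-*ˡ (↑ b) (c P.* ↑ a) (↑ (times c a)) (↑times c a)))
        inverse : ∀ {μ} → μ ≢ F.0# → (([ μ F.⁻¹ ] P.* c) P.* ([ μ ] P.* c̄)) ≅ P.1#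
        inverse {μ} μ≢0 = ≅-trans (([ μ F.⁻¹ ] P.* c) P.* ([ μ ] P.* c̄)) (([ μ ] P.* [ μ F.⁻¹ ]) P.* (c P.* c̄)) P.1#
          (≈⇒≅ (([ μ F.⁻¹ ] P.* c) P.* ([ μ ] P.* c̄)) (([ μ ] P.* [ μ F.⁻¹ ]) P.* (c P.* c̄))
            (PS.solve 4 (λ k c l d → (k PS.:* c) PS.:* (l PS.:* d) PS.:= (l PS.:* k) PS.:* (c PS.:* d)) (λ _ → refl) [ μ F.⁻¹ ] c [ μ ] c̄))
          (≅-trans (([ μ ] P.* [ μ F.⁻¹ ]) P.* (c P.* c̄)) (P.1# P.* P.1#) P.1#
            (≅-* ([ μ ] P.* [ μ F.⁻¹ ]) P.1# (c P.* c̄) P.1# (≈⇒≅ ([ μ ] P.* [ μ F.⁻¹ ]) P.1# (scalar-inverse μ≢0)) cc̄≅1)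
            (≈⇒≅ (P.1# P.* P.1#) P.1# (PR.*-identityˡ P.1#)))
        substitute : ∀ {μ} → μ ≢ F.0# →
          ∑ residues (λ a → χ (↑ a) * (zeta u a * zeta x (times [ μ F.⁻¹ ] (times c a)))) ≈
          ∑ residues (λ h → χ ([ μ ] P.* c̄ P.* ↑ h) * (zeta u (times ([ μ ] P.* c̄) h) * zeta x h))
        substitute {μ} μ≢0 = trans (sym (∑-times ([ μ ] P.* c̄) ([ μ F.⁻¹ ] P.* c)
            (≅-trans (([ μ ] P.* c̄) P.* ([ μ F.⁻¹ ] P.* c)) (([ μ F.⁻¹ ] P.* c) P.* ([ μ ] P.* c̄)) P.1#
              (≈⇒≅ (([ μ ] P.* c̄) P.* ([ μ F.⁻¹ ] P.* c)) (([ μ F.⁻¹ ] P.* c) P.* ([ μ ] P.* c̄)) (PR.*-comm ([ μ ] P.* c̄) ([ μ F.⁻¹ ] P.* c)))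
              (inverse μ≢0)) _))
          (∑-cong residues (λ h → *-cong
            (χ-cong (↑ (times ([ μ ] P.* c̄) h)) ([ μ ] P.* c̄ P.* ↑ h) (≅-sym ([ μ ] P.* c̄ P.* ↑ h) (↑ (times ([ μ ] P.* c̄) h)) (↑times ([ μ ] P.* c̄) h)))
            (*-congˡ (reflexive (cong (zeta x) (≡.trans (times-* [ μ F.⁻¹ ] c _) (≡.trans (times-* ([ μ F.⁻¹ ] P.* c) ([ μ ] P.* c̄) h)
              (times-1 (([ μ F.⁻¹ ] P.* c) P.* ([ μ ] P.* c̄)) h (inverse μ≢0)))))))))

      term : F.Carrier → F.Carrier → Carrier
      term μ ν = kernel μ * (kernel ν * (χ [ μ ] * twisted ((F.- (ν F.* μ)) P.·ₚ c̄) x))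

      -- The only zeta factor still taken at u is the one at μ c̄ h. Dualizing it introduces a new b
      -- with phase -(ν μ) c̄ h b, and the sums over h and b assemble to `twisted` at -(ν μ) c̄.
      double-dual : D * (D * (Q ^ m * twisted c u)) ≈
        (y ^ m′ * y ^ m′) * (χ c̄ * ∑ F.units (λ μ → ∑ F.units (term μ)))
      double-dual = begin
        D * (D * (Q ^ m * twisted c u))
          ≈⟨ solve 3 (λ d q t → d :* (d :* (q :* t)) := (d :* q) :* (d :* t)) ≈-refl D (Q ^ m) (twisted c u) ⟩
        (D * Q ^ m) * (D * twisted c u)
          ≈⟨ *-congˡ half-dual ⟩
        (D * Q ^ m) * (y ^ m′ * ∑ F.units (λ μ → kernel μ *
          ∑ residues (λ h → χ ([ μ ] P.* c̄ P.* ↑ h) * (zeta u (t μ h) * zeta x h))))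
          ≈⟨ trans (solve 3 (λ a b c → a :* (b :* c) := b :* (a :* c)) ≈-refl (D * Q ^ m) (y ^ m′) _)
               (*-congˡ (trans (sym (∑-*ˡ F.units _ _)) (∑-cong F.units (λ μ → trans
                 (solve 3 (λ a b c → a :* (b :* c) := b :* (a :* c)) ≈-refl (D * Q ^ m) (kernel μ) _)
                 (*-congˡ (trans (sym (∑-*ˡ residues _ _)) (∑-cong residues (inner μ)))))))) ⟩
        y ^ m′ * ∑ F.units (λ μ → kernel μ * ∑ residues (λ h →
          (y ^ m′ * χ c̄) * (χ [ μ ] * ∑ F.units (λ ν → kernel ν * ∑ residues (λ b → summand μ ν h b)))))
          ≈⟨ *-congˡ (trans (∑-cong F.units (λ μ → trans (*-congˡ (outer μ)) (solve 3 (λ k a b → k :* (a :* b) := a :* (k :* b)) ≈-refl (kernel μ) (y ^ m′ * χ c̄) _)))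
               (∑-*ˡ F.units _ _)) ⟩
        y ^ m′ * ((y ^ m′ * χ c̄) * ∑ F.units (λ μ → kernel μ * ∑ F.units (λ ν → kernel ν * (χ [ μ ] * twisted ((F.- (ν F.* μ)) P.·ₚ c̄) x))))
          ≈⟨ trans (solve 3 (λ a b c → a :* ((a :* b) :* c) := (a :* a) :* (b :* c)) ≈-refl (y ^ m′) (χ c̄) _)
               (*-congˡ (*-congˡ (∑-cong F.units (λ μ → sym (∑-*ˡ F.units (kernel μ) _))))) ⟩
        (y ^ m′ * y ^ m′) * (χ c̄ * ∑ F.units (λ μ → ∑ F.units (term μ))) ∎
        where
        t : F.Carrier → Vec F.Carrier m → Vec F.Carrier m
        t μ h = times ([ μ ] P.* c̄) h
        summand : F.Carrier → F.Carrier → Vec F.Carrier m → Vec F.Carrier m → Carrier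
        summand μ ν h b = (χ (↑ h) * ψ (resid (((F.- (ν F.* μ)) P.·ₚ c̄) P.* (↑ h P.* ↑ b)))) * (zeta x h * zeta x b)
        [νμ] : ∀ μ ν → ((F.- (ν F.* μ)) P.·ₚ c̄) P.≈ ((P.- ([ ν ] P.* [ μ ])) P.* c̄)
        [νμ] μ ν n = ≡.trans (·ₚ≈* (F.- (ν F.* μ)) c̄ n) (PR.*-congʳ {c̄} {[ F.- (ν F.* μ) ]} {P.- ([ ν ] P.* [ μ ])} constant n)
          where
          constant : [ F.- (ν F.* μ) ] P.≈ (P.- ([ ν ] P.* [ μ ]))
          constant n = ≡.trans (negated n) (PR.-‿cong {[ ν F.* μ ]} {[ ν ] P.* [ μ ]} (λ n → ≡.sym (scalar-* ν μ n)) n)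
            where
            negated : [ F.- (ν F.* μ) ] P.≈ (P.- [ ν F.* μ ])
            negated zero    = refl
            negated (suc n) = refl
        phase : ∀ μ ν h b → F.- resid (([ ν ] P.* ↑ b) P.* ↑ (t μ h)) ≡ resid (((F.- (ν F.* μ)) P.·ₚ c̄) P.* (↑ h P.* ↑ b))
        phase μ ν h b = ≡.trans (cong F.-_ (resid-cong (([ ν ] P.* ↑ b) P.* ↑ (t μ h)) (([ ν ] P.* ↑ b) P.* (([ μ ] P.* c̄) P.* ↑ h))
            (≅-*ˡ ([ ν ] P.* ↑ b) (↑ (t μ h)) (([ μ ] P.* c̄) P.* ↑ h) (≅-sym (([ μ ] P.* c̄) P.* ↑ h) (↑ (t μ h)) (↑times ([ μ ] P.* c̄) h)))))
          (≡.trans (resid-neg (([ ν ] P.* ↑ b) P.* (([ μ ] P.* c̄) P.* ↑ h)))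
            (resid-≈ (P.- (([ ν ] P.* ↑ b) P.* (([ μ ] P.* c̄) P.* ↑ h))) (((F.- (ν F.* μ)) P.·ₚ c̄) P.* (↑ h P.* ↑ b)) (λ n → ≡.trans
              (PS.solve 5 (λ ν b μ c h → PS.:- ((ν PS.:* b) PS.:* ((μ PS.:* c) PS.:* h)) PS.:= ((PS.:- (ν PS.:* μ)) PS.:* c) PS.:* (h PS.:* b))
                (λ _ → refl) [ ν ] (↑ b) [ μ ] c̄ (↑ h) n)
              (PR.*-congʳ {↑ h P.* ↑ b} {(P.- ([ ν ] P.* [ μ ])) P.* c̄} {(F.- (ν F.* μ)) P.·ₚ c̄} (λ n → ≡.sym ([νμ] μ ν n)) n))))
        inner : ∀ μ h → (D * Q ^ m) * (χ ([ μ ] P.* c̄ P.* ↑ h) * (zeta u (t μ h) * zeta x h)) ≈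
          (y ^ m′ * χ c̄) * (χ [ μ ] * ∑ F.units (λ ν → kernel ν * ∑ residues (λ b → summand μ ν h b)))
        inner μ h = begin
          (D * Q ^ m) * (χ ([ μ ] P.* c̄ P.* ↑ h) * (zeta u (t μ h) * zeta x h))
            ≈⟨ *-congˡ (*-congʳ (trans (χ-* ([ μ ] P.* c̄) (↑ h)) (*-congʳ (χ-* [ μ ] c̄)))) ⟩
          (D * Q ^ m) * (((χ [ μ ] * χ c̄) * χ (↑ h)) * (zeta u (t μ h) * zeta x h))
            ≈⟨ solve 7 (λ d q s c h z w → (d :* q) :* (((s :* c) :* h) :* (z :* w)) := (c :* s) :* ((h :* w) :* (d :* (q :* z))))
                 ≈-refl D (Q ^ m) (χ [ μ ]) (χ c̄) (χ (↑ h)) (zeta u (t μ h)) (zeta x h) ⟩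
          (χ c̄ * χ [ μ ]) * ((χ (↑ h) * zeta x h) * (D * (Q ^ m * zeta u (t μ h))))
            ≈⟨ *-congˡ (*-congˡ (zeta-dual (t μ h))) ⟩
          (χ c̄ * χ [ μ ]) * ((χ (↑ h) * zeta x h) * (y ^ m′ * ∑ F.units (λ ν → kernel ν * ∑ residues (λ b → ψ (F.- resid (([ ν ] P.* ↑ b) P.* ↑ (t μ h))) * zeta x b))))
            ≈⟨ solve 5 (λ c s h e w → (c :* s) :* (h :* (e :* w)) := (e :* c) :* (s :* (h :* w))) ≈-refl (χ c̄) (χ [ μ ]) _ (y ^ m′) _ ⟩
          (y ^ m′ * χ c̄) * (χ [ μ ] * ((χ (↑ h) * zeta x h) * ∑ F.units (λ ν → kernel ν * ∑ residues (λ b → ψ (F.- resid (([ ν ] P.* ↑ b) P.* ↑ (t μ h))) * zeta x b))))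
            ≈⟨ *-congˡ (*-congˡ (trans (sym (∑-*ˡ F.units _ _)) (∑-cong F.units (λ ν → trans
                 (solve 3 (λ a k s → a :* (k :* s) := k :* (a :* s)) ≈-refl _ (kernel ν) _)
                 (*-congˡ (trans (sym (∑-*ˡ residues _ _)) (∑-cong residues (λ b → trans
                   (solve 4 (λ h z p w → (h :* z) :* (p :* w) := (h :* p) :* (z :* w)) ≈-refl (χ (↑ h)) (zeta x h) _ (zeta x b))
                   (*-congʳ (*-congˡ (reflexive (cong ψ (phase μ ν h b))))))))))))) ⟩
          _ ∎
        outer : ∀ μ → ∑ residues (λ h → (y ^ m′ * χ c̄) * (χ [ μ ] * ∑ F.units (λ ν → kernel ν * ∑ residues (λ b → summand μ ν h b)))) ≈
          (y ^ m′ * χ c̄) * ∑ F.units (λ ν → kernel ν * (χ [ μ ] * twisted ((F.- (ν F.* μ)) P.·ₚ c̄) x))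
        outer μ = trans (∑-*ˡ residues _ _) (*-congˡ (trans (∑-*ˡ residues (χ [ μ ]) _) (trans (*-congˡ (trans (∑-swap residues F.units _)
            (∑-cong F.units (λ ν → ∑-*ˡ residues (kernel ν) _))))
          (trans (sym (∑-*ˡ F.units (χ [ μ ]) _)) (∑-cong F.units (λ ν →
            solve 3 (λ s k t → s :* (k :* t) := k :* (s :* t)) ≈-refl (χ [ μ ]) (kernel ν) _))))))

      kloosterman : F.Carrier → Carrier
      kloosterman ν = ∑ F.units (λ γ → χ [ γ ] * (kernel (F.- γ) * kernel (ν F.* γ F.⁻¹)))

      -- Put μ = -γ and replace the second parameter by ν γ⁻¹. The multiplier -(ν γ⁻¹)(-γ) of c̄ is
      -- then ν whatever γ is, so the sum over γ can be carried out separately; the sign of μ leaves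
      -- χ(-1).
      functional-equation : D * (D * (Q ^ m * twisted c u)) ≈
        (y ^ m′ * y ^ m′) * ((χ c̄ * χ [ F.- F.1# ]) * ∑ F.units (λ ν → kloosterman ν * twisted (ν P.·ₚ c̄) x))
      functional-equation = trans double-dual (*-congˡ (trans (*-congˡ (begin
        ∑ F.units (λ μ → ∑ F.units (term μ))
          ≈⟨ ∑-reindex units-unique units-unique F._≟_ F.-_ F.-_ (λ γ∈ → ∈-units (negative≢0 (∈-units⁻ γ∈))) (λ γ∈ → ∈-units (negative≢0 (∈-units⁻ γ∈)))
               (λ {γ} _ → FS.solve 1 (λ a → FS.:- (FS.:- a) FS.:= a) refl γ) (λ {γ} _ → FS.solve 1 (λ a → FS.:- (FS.:- a) FS.:= a) refl γ)
               (λ μ → ∑ F.units (term μ)) ⟨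
        ∑ F.units (λ γ → ∑ F.units (term (F.- γ)))
          ≈⟨ ∑-cong-∈ F.units (λ {γ} γ∈ → sym (∑-reindex units-unique units-unique F._≟_ (F._* γ F.⁻¹) (F._* γ)
               (λ ν∈ → ∈-units (product≢0 (∈-units⁻ ν∈) (inverse≢0 (∈-units⁻ γ∈)))) (λ ν∈ → ∈-units (product≢0 (∈-units⁻ ν∈) (∈-units⁻ γ∈)))
               (λ {ν} _ → cancel⁻ ν (∈-units⁻ γ∈)) (λ {ν} _ → ≡.trans (FR.*-assoc ν γ _) (≡.trans (cong (ν F.*_) (F.⁻¹-inverse (∈-units⁻ γ∈))) (FR.*-identityʳ ν)))
               (term (F.- γ)))) ⟩
        ∑ F.units (λ γ → ∑ F.units (λ ν → term (F.- γ) (ν F.* γ F.⁻¹)))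
          ≈⟨ ∑-cong-∈ F.units (λ {γ} γ∈ → ∑-cong F.units (λ ν → trans
               (*-congˡ (*-congˡ (*-cong (trans (χ-≈ [ F.- γ ] ([ F.- F.1# ] P.* [ γ ]) (λ n → ≡.trans (cong (λ k → P.coeff [ k ] n)
                     (FS.solve 1 (λ g → FS.:- g FS.:= (FS.:- FS.:1) FS.:* g) refl γ)) (≡.sym (scalar-* (F.- F.1#) γ n)))) (χ-* [ F.- F.1# ] [ γ ]))
                 (reflexive (cong (λ k → twisted (k P.·ₚ c̄) x) (unwind ν (∈-units⁻ γ∈)))))))
               (solve 5 (λ k l s t w → k :* (l :* ((s :* t) :* w)) := s :* ((t :* (k :* l)) :* w)) ≈-refl
                 (kernel (F.- γ)) (kernel (ν F.* γ F.⁻¹)) (χ [ F.- F.1# ]) (χ [ γ ]) _))) ⟩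
        ∑ F.units (λ γ → ∑ F.units (λ ν → χ [ F.- F.1# ] * ((χ [ γ ] * (kernel (F.- γ) * kernel (ν F.* γ F.⁻¹))) * twisted (ν P.·ₚ c̄) x)))
          ≈⟨ trans (∑-swap F.units F.units _) (trans (∑-cong F.units (λ ν → trans (∑-*ˡ F.units (χ [ F.- F.1# ]) _)
               (*-congˡ (∑-*ʳ F.units (twisted (ν P.·ₚ c̄) x) _)))) (∑-*ˡ F.units (χ [ F.- F.1# ]) _)) ⟩
        χ [ F.- F.1# ] * ∑ F.units (λ ν → kloosterman ν * twisted (ν P.·ₚ c̄) x) ∎))
        (sym (*-assoc _ _ _))))
        where
        negative≢0 : ∀ {γ} → γ ≢ F.0# → F.- γ ≢ F.0#
        negative≢0 {γ} γ≢0 e = γ≢0 (≡.trans (FS.solve 1 (λ a → a FS.:= FS.:- (FS.:- a)) refl γ)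
          (≡.trans (cong F.-_ e) (FS.solve 0 (FS.:- FS.:0 FS.:= FS.:0) refl)))
        product≢0 : ∀ {a b} → a ≢ F.0# → b ≢ F.0# → a F.* b ≢ F.0#
        product≢0 a≢0 b≢0 e = b≢0 (0∤ a≢0 e)
        inverse≢0 : ∀ {γ} → γ ≢ F.0# → γ F.⁻¹ ≢ F.0#
        inverse≢0 {γ} γ≢0 e = F.1≢0 (≡.trans (≡.sym (F.⁻¹-inverse γ≢0)) (≡.trans (cong (γ F.*_) e) (FR.zeroʳ γ)))
        cancel⁻ : ∀ ν {γ} → γ ≢ F.0# → (ν F.* γ F.⁻¹) F.* γ ≡ ν
        cancel⁻ ν {γ} γ≢0 = ≡.trans (FS.solve 3 (λ a b c → (a FS.:* b) FS.:* c FS.:= a FS.:* (c FS.:* b)) refl ν (γ F.⁻¹) γ)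
          (≡.trans (cong (ν F.*_) (F.⁻¹-inverse γ≢0)) (FR.*-identityʳ ν))
        unwind : ∀ ν {γ} → γ ≢ F.0# → F.- ((ν F.* γ F.⁻¹) F.* (F.- γ)) ≡ ν
        unwind ν {γ} γ≢0 = ≡.trans (FS.solve 3 (λ a b c → FS.:- ((a FS.:* b) FS.:* (FS.:- c)) FS.:= (a FS.:* b) FS.:* c) refl ν (γ F.⁻¹) γ)
          (cancel⁻ ν γ≢0)

-- Ring homomorphisms and evaluation of finitely supported series

record Homomorphism {c ℓ c′ ℓ′} (K : CommutativeRing c ℓ) (A : CommutativeRing c′ ℓ′) : Set (c ⊔ ℓ ⊔ c′ ⊔ ℓ′) where
  private
    module K = RingLaws K
    module A = RingLaws A
  field
    ⟦_⟧    : K.Carrier → A.Carrier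
    ⟦⟧-cong : ∀ {x y} → x K.≈ y → ⟦ x ⟧ A.≈ ⟦ y ⟧
    +-homo : ∀ x y → ⟦ x K.+ y ⟧ A.≈ ⟦ x ⟧ A.+ ⟦ y ⟧
    *-homo : ∀ x y → ⟦ x K.* y ⟧ A.≈ ⟦ x ⟧ A.* ⟦ y ⟧
    0-homo : ⟦ K.0# ⟧ A.≈ A.0#
    1-homo : ⟦ K.1# ⟧ A.≈ A.1#

  neg-homo : ∀ x → ⟦ K.- x ⟧ A.≈ A.- ⟦ x ⟧
  neg-homo x = A.trans (solve 2 (λ a b → b := (a :+ b) :- a) A.≈-refl ⟦ x ⟧ ⟦ K.- x ⟧)
    (A.trans (A.+-congʳ (A.trans (A.sym (+-homo x (K.- x))) (A.trans (⟦⟧-cong (K.-‿inverseʳ x)) 0-homo))) (A.+-identityˡ _))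
    where open IntegerSolver A

  ∑-homo : ∀ {a} {X : Set a} (xs : List X) f → ⟦ ListSum.∑ K xs f ⟧ A.≈ ListSum.∑ A xs (λ x → ⟦ f x ⟧)
  ∑-homo []       f = 0-homo
  ∑-homo (x ∷ xs) f = A.trans (+-homo _ _) (A.+-congˡ (∑-homo xs f))

  indicator-homo : ∀ {p} {P : Set p} (P? : Dec P) → ⟦ ListSum.[_]₁ K P? ⟧ A.≈ ListSum.[_]₁ A P?
  indicator-homo (yes _) = 1-homo
  indicator-homo (no _)  = 0-homo

identityHom : ∀ {c ℓ} (K : CommutativeRing c ℓ) → Homomorphism K K
identityHom K = record
  { ⟦_⟧ = id ; ⟦⟧-cong = id ; +-homo = λ _ _ → refl′ ; *-homo = λ _ _ → refl′ ; 0-homo = refl′ ; 1-homo = refl′ }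
  where open RingLaws K using () renaming (≈-refl to refl′)

module RangeSum {c ℓ} (A : CommutativeRing c ℓ) where
  open RingLaws A
  open IntegerSolver A
  open ListSum A
  open Series A
  open RingReasoning A
  open SumProperties semiring using (sum)

  ∑< : ℕ → (ℕ → Carrier) → Carrier
  ∑< N f = sum {N} (λ i → f (toℕ i))

  ∑<-cong : ∀ N f g → (∀ i → f i ≈ g i) → ∑< N f ≈ ∑< N g
  ∑<-cong zero    f g e = ≈-refl
  ∑<-cong (suc N) f g e = +-cong (e 0) (∑<-cong N (f ∘ suc) (g ∘ suc) (e ∘ suc))

  ∑<-cong-< : ∀ N f g → (∀ i → i ℕ.< N → f i ≈ g i) → ∑< N f ≈ ∑< N g
  ∑<-cong-< zero    f g e = ≈-refl
  ∑<-cong-< (suc N) f g e = +-cong (e 0 (s≤s z≤n)) (∑<-cong-< N (f ∘ suc) (g ∘ suc) (λ i i<N → e (suc i) (s≤s i<N)))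

  ∑<-+ : ∀ N f g → ∑< N (λ i → f i + g i) ≈ ∑< N f + ∑< N g
  ∑<-+ zero    f g = sym (+-identityˡ 0#)
  ∑<-+ (suc N) f g = trans (+-congˡ (∑<-+ N (f ∘ suc) (g ∘ suc)))
    (solve 4 (λ a b x y → (a :+ b) :+ (x :+ y) := (a :+ x) :+ (b :+ y)) ≈-refl (f 0) (g 0) (∑< N (f ∘ suc)) (∑< N (g ∘ suc)))

  ∑<-*ˡ : ∀ N k f → ∑< N (λ i → k * f i) ≈ k * ∑< N f
  ∑<-*ˡ zero    k f = sym (zeroʳ k)
  ∑<-*ˡ (suc N) k f = trans (+-congˡ (∑<-*ˡ N k (f ∘ suc))) (sym (distribˡ k _ _))

  ∑<-last : ∀ N f → ∑< (suc N) f ≈ ∑< N f + f N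
  ∑<-last zero    f = trans (+-identityʳ _) (sym (+-identityˡ _))
  ∑<-last (suc N) f = trans (+-congˡ (∑<-last N (f ∘ suc))) (sym (+-assoc _ _ _))

  ∑<-zero : ∀ N f → (∀ i → f i ≈ 0#) → ∑< N f ≈ 0#
  ∑<-zero zero    f e = ≈-refl
  ∑<-zero (suc N) f e = trans (+-cong (e 0) (∑<-zero N (f ∘ suc) (e ∘ suc))) (+-identityˡ 0#)

  ∑<-extend : ∀ D f → (∀ i → f (D ℕ.+ i) ≈ 0#) → ∀ j → ∑< (D ℕ.+ j) f ≈ ∑< D f
  ∑<-extend zero    f e j = ∑<-zero j f e
  ∑<-extend (suc D) f e j = +-congˡ (∑<-extend D (f ∘ suc) e j)

  ∑<-∑ : ∀ {a} {X : Set a} N (xs : List X) (f : ℕ → X → Carrier) → ∑< N (λ i → ∑ xs (f i)) ≈ ∑ xs (λ x → ∑< N (λ i → f i x))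
  ∑<-∑ zero    xs f = sym (∑-0 xs)
  ∑<-∑ (suc N) xs f = trans (+-congˡ (∑<-∑ N xs (f ∘ suc))) (sym (∑-+ xs _ _))

  ∑-upTo : ∀ N f → ∑ (List.upTo N) f ≈ ∑< N f
  ∑-upTo N f = applied N id
    where
    applied : ∀ N h → ∑ (List.applyUpTo h N) f ≈ ∑< N (f ∘ h)
    applied zero    h = ≈-refl
    applied (suc N) h = +-congˡ (applied N (h ∘ suc))

  ⊛-∑ʳ : ∀ {a} {X : Set a} (xs : List X) f (h : X → ℕ → Carrier) → f ⊛ (λ n → ∑ xs (λ x → h x n)) ≋ λ n → ∑ xs (λ x → (f ⊛ h x) n)
  ⊛-∑ʳ xs f h zero    = trans (⊛-0 f (λ n → ∑ xs (λ x → h x n))) (trans (sym (∑-*ˡ xs (f 0) (λ x → h x 0))) (∑-cong xs (λ x → sym (⊛-0 f (h x)))))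
  ⊛-∑ʳ xs f h (suc n) = trans (+-cong (sym (∑-*ˡ xs (f 0) (λ x → h x (suc n)))) (⊛-∑ʳ xs (f ∘ suc) h n)) (sym (∑-+ xs _ _))

  ⊛-scaleʳ : ∀ k f g → f ⊛ (λ n → k * g n) ≋ λ n → k * (f ⊛ g) n
  ⊛-scaleʳ k f g n = trans (⊛-comm f (λ n → k * g n) n) (trans (⊛-scale k g f n) (*-congˡ (⊛-comm g f n)))

  ⊛-supported : ∀ D D′ f g → (∀ i → f (D ℕ.+ i) ≈ 0#) → (∀ i → g (D′ ℕ.+ i) ≈ 0#) → ∀ i → (f ⊛ g) (D ℕ.+ D′ ℕ.+ i) ≈ 0#
  ⊛-supported zero    D′ f g e e′ i = trans (⊛-cong {f} {λ _ → 0#} {g} e (λ _ → ≈-refl) (D′ ℕ.+ i)) (0⊛ g (D′ ℕ.+ i))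
  ⊛-supported (suc D) D′ f g e e′ i = trans (+-cong (trans (*-congˡ (trans (reflexive (cong g index)) (e′ (suc D ℕ.+ i)))) (zeroʳ _))
      (⊛-supported D D′ (f ∘ suc) g e e′ i)) (+-identityˡ 0#)
    where
    index : suc D ℕ.+ D′ ℕ.+ i ≡ D′ ℕ.+ (suc D ℕ.+ i)
    index = ≡.trans (cong (ℕ._+ i) (ℕ.+-comm (suc D) D′)) (ℕ.+-assoc D′ (suc D) i)

module Evaluation {c ℓ c′ ℓ′} (K : CommutativeRing c ℓ) (A : CommutativeRing c′ ℓ′) (ι : Homomorphism K A) where
  private module K = RingLaws K
  open RingLaws A
  open IntegerSolver A
  open RangeSum A
  open Series K
  open Homomorphism ι
  open ExpProperties commutativeSemiring using (_^_)
  open RingReasoning A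

  term : (ℕ → K.Carrier) → Carrier → ℕ → Carrier
  term a z n = ⟦ a n ⟧ * z ^ n

  -- Evaluation of a polynomial: any `D` beyond its degree gives the same result, by `eval-extend`.
  -- Coefficients and points lie in different rings, so that a polynomial over K can be evaluated in
  -- K[[ε]].
  eval : ℕ → (ℕ → K.Carrier) → Carrier → Carrier
  eval D a z = ∑< D (term a z)

  eval-suc : ∀ D a z → eval (suc D) a z ≈ ⟦ a 0 ⟧ + z * eval D (a ∘ suc) z
  eval-suc D a z = +-cong (*-identityʳ _) (trans (∑<-cong D (term a z ∘ suc) (λ n → z * term (a ∘ suc) z n)
      (λ n → solve 3 (λ s z e → s :* (z :* e) := z :* (s :* e)) ≈-refl ⟦ a (suc n) ⟧ z (z ^ n)))
    (∑<-*ˡ D z (term (a ∘ suc) z)))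

  eval-cong : ∀ D {a b} z → (∀ n → a n K.≈ b n) → eval D a z ≈ eval D b z
  eval-cong D {a} {b} z e = ∑<-cong D (term a z) (term b z) (λ n → *-congʳ (⟦⟧-cong (e n)))

  eval-+ : ∀ D a b z → eval D (λ n → a n K.+ b n) z ≈ eval D a z + eval D b z
  eval-+ D a b z = trans (∑<-cong D (term (λ n → a n K.+ b n) z) (λ n → term a z n + term b z n)
    (λ n → trans (*-congʳ (+-homo _ _)) (distribʳ _ _ _))) (∑<-+ D (term a z) (term b z))

  eval-scale : ∀ D k a z → eval D (λ n → k K.* a n) z ≈ ⟦ k ⟧ * eval D a z
  eval-scale D k a z = trans (∑<-cong D (term (λ n → k K.* a n) z) (λ n → ⟦ k ⟧ * term a z n)
    (λ n → trans (*-congʳ (*-homo _ _)) (*-assoc _ _ _))) (∑<-*ˡ D ⟦ k ⟧ (term a z))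

  term-0 : ∀ a z n → a n K.≈ K.0# → term a z n ≈ 0#
  term-0 a z n e = trans (*-congʳ (trans (⟦⟧-cong e) 0-homo)) (zeroˡ _)

  eval-extend : ∀ D a z → (∀ i → a (D ℕ.+ i) K.≈ K.0#) → ∀ j → eval (D ℕ.+ j) a z ≈ eval D a z
  eval-extend D a z e j = ∑<-extend D (term a z) (λ i → term-0 a z (D ℕ.+ i) (e i)) j

  eval-last : ∀ D a z → eval (suc D) a z ≈ eval D a z + ⟦ a D ⟧ * z ^ D
  eval-last D a z = ∑<-last D (term a z)

  eval-0 : ∀ D a z → (∀ n → a n K.≈ K.0#) → eval D a z ≈ 0#
  eval-0 D a z e = ∑<-zero D (term a z) (λ n → term-0 a z n (e n))

  eval-∑ : ∀ {x} {X : Set x} D (xs : List X) (a : X → ℕ → K.Carrier) z →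
    eval D (λ n → ListSum.∑ K xs (λ x → a x n)) z ≈ ListSum.∑ A xs (λ x → eval D (a x) z)
  eval-∑ D xs a z = trans (∑<-cong D (term (λ n → ListSum.∑ K xs (λ x → a x n)) z) (λ n → ListSum.∑ A xs (λ x → term (a x) z n))
    (λ n → trans (*-congʳ (∑-homo xs _)) (sym (ListSum.∑-*ʳ A xs _ _)))) (∑<-∑ D xs (λ n x → term (a x) z n))

  eval-⊛ : ∀ D D′ a b z → (∀ i → a (D ℕ.+ i) K.≈ K.0#) → (∀ i → b (D′ ℕ.+ i) K.≈ K.0#) →
    eval (D ℕ.+ D′) (a ⊛ b) z ≈ eval D a z * eval D′ b z
  eval-⊛ zero    D′ a b z e e′ = trans (eval-0 D′ (a ⊛ b) z (λ n → K.trans (⊛-cong {a} {λ _ → K.0#} {b} e (λ _ → K.≈-refl) n) (0⊛ b n))) (sym (zeroˡ _))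
  eval-⊛ (suc D) D′ a b z e e′ = begin
    eval (suc D ℕ.+ D′) (a ⊛ b) z
      ≈⟨ eval-cong (suc (D ℕ.+ D′)) {a ⊛ b} {λ n → a 0 K.* b n K.+ shift ((a ∘ suc) ⊛ b) n} z split ⟩
    eval (suc (D ℕ.+ D′)) (λ n → a 0 K.* b n K.+ shift ((a ∘ suc) ⊛ b) n) z
      ≈⟨ eval-+ (suc (D ℕ.+ D′)) (λ n → a 0 K.* b n) (shift ((a ∘ suc) ⊛ b)) z ⟩
    eval (suc (D ℕ.+ D′)) (λ n → a 0 K.* b n) z + eval (suc (D ℕ.+ D′)) (shift ((a ∘ suc) ⊛ b)) z
      ≈⟨ +-cong (trans (eval-scale (suc (D ℕ.+ D′)) (a 0) b z) (*-congˡ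
           (trans (reflexive (cong (λ k → eval k b z) (ℕ.+-comm (suc D) D′))) (eval-extend D′ b z e′ (suc D)))))
           (trans (eval-suc (D ℕ.+ D′) (shift ((a ∘ suc) ⊛ b)) z) (trans (+-congʳ 0-homo) (trans (+-identityˡ _)
             (*-congˡ (eval-⊛ D D′ (a ∘ suc) b z e e′))))) ⟩
    ⟦ a 0 ⟧ * eval D′ b z + z * (eval D (a ∘ suc) z * eval D′ b z)
      ≈⟨ solve 4 (λ s y z w → s :* y :+ z :* (w :* y) := (s :+ z :* w) :* y) ≈-refl ⟦ a 0 ⟧ (eval D′ b z) z (eval D (a ∘ suc) z) ⟩
    (⟦ a 0 ⟧ + z * eval D (a ∘ suc) z) * eval D′ b z
      ≈⟨ *-congʳ (eval-suc D a z) ⟨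
    eval (suc D) a z * eval D′ b z ∎
    where
    split : a ⊛ b ≋ λ n → a 0 K.* b n K.+ shift ((a ∘ suc) ⊛ b) n
    split zero    = K.≈-refl
    split (suc n) = K.≈-refl

-- Every axiom of `TwistData` is an equation between values, so it can be transported; this carries
-- the data from K to K[[ε]].
pushforward : ∀ {c ℓ c′ ℓ′} {K : CommutativeRing c ℓ} {A : CommutativeRing c′ ℓ′} → Homomorphism K A → TwistData K → TwistData A
pushforward {A = A} ι T = record
  { additive = record
    { 𝔽    = 𝔽
    ; ψ    = λ y → ⟦ ψ y ⟧
    ; ψ-0  = trans (⟦⟧-cong ψ-0) 1-homo
    ; ψ-+  = λ x y → trans (⟦⟧-cong (ψ-+ x y)) (*-homo _ _)
    ; ∑ψ≈0 = trans (sym (∑-homo (FiniteField.elements 𝔽) ψ)) (trans (⟦⟧-cong ∑ψ≈0) 0-homo)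
    }
  ; g      = g
  ; χ      = λ f → ⟦ χ f ⟧
  ; χ-cong = λ f h e → ⟦⟧-cong (χ-cong f h e)
  ; χ-1    = trans (⟦⟧-cong χ-1) 1-homo
  ; χ-*    = λ f h → trans (⟦⟧-cong (χ-* f h)) (*-homo _ _)
  }
  where
  open Homomorphism ι
  open TwistData T
  open RingLaws A

-- Products and cofactors of monic polynomials

module MonicFactorization {p η} (𝔽 : FiniteField p η) where
  private
    module F = FiniteField 𝔽
    module P = Polynomials 𝔽
    module FR = RingLaws (PolynomialRing.fieldRing 𝔽)
    module PR = RingLaws (PolynomialRing.polynomialRing 𝔽)
  open PolynomialRing 𝔽

  truncate : ∀ n → P.Poly → Vec F.Carrier n
  truncate zero    f       = []
  truncate (suc n) []      = F.0# ∷ truncate n []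
  truncate (suc n) (x ∷ f) = x ∷ truncate n f

  truncate-≈ : ∀ n f → (∀ i → P.coeff f (n ℕ.+ i) ≡ F.0#) → Vec.toList (truncate n f) P.≈ f
  truncate-≈ zero    f       e i       = ≡.sym (e i)
  truncate-≈ (suc n) []      e zero    = refl
  truncate-≈ (suc n) []      e (suc i) = truncate-≈ n [] (λ _ → refl) i
  truncate-≈ (suc n) (x ∷ f) e zero    = refl
  truncate-≈ (suc n) (x ∷ f) e (suc i) = truncate-≈ n f e i

  truncate-monic : ∀ n f → P.coeff f n ≡ F.1# → (∀ i → P.coeff f (suc n ℕ.+ i) ≡ F.0#) → P.⟦ truncate n f ⟧ P.≈ f
  truncate-monic zero    []      t e i       = contradiction (≡.sym t) F.1≢0
  truncate-monic zero    (x ∷ f) t e zero    = ≡.sym t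
  truncate-monic zero    (x ∷ f) t e (suc i) = ≡.sym (e i)
  truncate-monic (suc n) []      t e i       = contradiction (≡.sym t) F.1≢0
  truncate-monic (suc n) (x ∷ f) t e zero    = refl
  truncate-monic (suc n) (x ∷ f) t e (suc i) = truncate-monic n f t e i

  monic-injective : ∀ {n} (f h : P.Monic n) → P.⟦ f ⟧ P.≈ P.⟦ h ⟧ → f ≡ h
  monic-injective []      []      e = refl
  monic-injective (x ∷ f) (y ∷ h) e = cong₂ _∷_ (e 0) (monic-injective f h (e ∘ suc))

  coeff-∷* : ∀ x f h n → P.coeff ((x ∷ f) P.* h) (suc n) ≡ x F.* P.coeff h (suc n) F.+ P.coeff (f P.* h) n
  coeff-∷* x f h n = ≡.trans (coeff-+ (x P.·ₚ h) _ (suc n)) (cong (F._+ P.coeff (f P.* h) n) (coeff-· x h (suc n)))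

  product-high : ∀ {k l} (f : P.Monic k) (h : P.Monic l) i → P.coeff (P.⟦ f ⟧ P.* P.⟦ h ⟧) (suc (k ℕ.+ l) ℕ.+ i) ≡ F.0#
  product-high []      h i = ≡.trans (PR.*-identityˡ P.⟦ h ⟧ _) (monic-high h i)
  product-high {suc k} {l} (x ∷ f) h i = ≡.trans (coeff-∷* x P.⟦ f ⟧ P.⟦ h ⟧ (suc (k ℕ.+ l) ℕ.+ i))
    (≡.trans (cong₂ F._+_ (≡.trans (cong (x F.*_) (≡.trans (cong (P.coeff P.⟦ h ⟧) index) (monic-high h (suc k ℕ.+ i)))) (FR.zeroʳ x))
      (product-high f h i)) (FR.+-identityʳ F.0#))
    where
    index : suc (suc (k ℕ.+ l) ℕ.+ i) ≡ suc (l ℕ.+ (suc k ℕ.+ i))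
    index = cong suc (≡.trans (cong (ℕ._+ i) (ℕ.+-comm (suc k) l)) (ℕ.+-assoc l (suc k) i))

  product-top : ∀ {k l} (f : P.Monic k) (h : P.Monic l) → P.coeff (P.⟦ f ⟧ P.* P.⟦ h ⟧) (k ℕ.+ l) ≡ F.1#
  product-top []      h = ≡.trans (PR.*-identityˡ P.⟦ h ⟧ _) (monic-top h)
  product-top {suc k} {l} (x ∷ f) h = ≡.trans (coeff-∷* x P.⟦ f ⟧ P.⟦ h ⟧ (k ℕ.+ l))
    (≡.trans (cong₂ F._+_ (≡.trans (cong (x F.*_) (≡.trans (cong (P.coeff P.⟦ h ⟧) (cong suc (ℕ.+-comm k l))) (monic-high h k))) (FR.zeroʳ x))
      (product-top f h)) (FR.+-identityˡ F.1#))

  -- The product of coefficient lists may end in zeros, so the vector of lower coefficients is cut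
  -- out of it. The degree enters through an equation, which lets k + (n ∸ k) be n without
  -- transport.
  product : ∀ {k l n} → k ℕ.+ l ≡ n → P.Monic k → P.Monic l → P.Monic n
  product {n = n} e f h = truncate n (P.⟦ f ⟧ P.* P.⟦ h ⟧)

  product-≈ : ∀ {k l n} (e : k ℕ.+ l ≡ n) (f : P.Monic k) (h : P.Monic l) → P.⟦ product e f h ⟧ P.≈ (P.⟦ f ⟧ P.* P.⟦ h ⟧)
  product-≈ {k} {l} refl f h = truncate-monic (k ℕ.+ l) (P.⟦ f ⟧ P.* P.⟦ h ⟧) (product-top f h) (product-high f h)

module MonicCancel {p η} (𝔽 : FiniteField p η) {m′} (g : Polynomials.Monic 𝔽 (suc m′)) where
  private
    module F = FiniteField 𝔽
    module P = Polynomials 𝔽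
    module FR = RingLaws (PolynomialRing.fieldRing 𝔽)
    module PS = IntegerSolver (PolynomialRing.polynomialRing 𝔽)
  open PolynomialRing 𝔽
  open MonicFactorization 𝔽
  open MonicModulus 𝔽 g using (small-multiple)

  -- The difference of the cofactors multiplies the monic `f` to 0, which is a multiple of degree
  -- below that of `f`.
  product-cancel : ∀ {k l} (f : P.Monic k) (h h′ : P.Monic l) →
    (P.⟦ f ⟧ P.* P.⟦ h ⟧) P.≈ (P.⟦ f ⟧ P.* P.⟦ h′ ⟧) → h ≡ h′
  product-cancel f h h′ e = monic-injective h h′ (λ n → ≡.trans
      (PS.solve 2 (λ h k → h PS.:= (h PS.:- k) PS.:+ k) (λ _ → refl) P.⟦ h ⟧ P.⟦ h′ ⟧ n)
      (≡.trans (coeff-+ (P.⟦ h ⟧ P.+ (P.- P.⟦ h′ ⟧)) P.⟦ h′ ⟧ n) (≡.trans (cong (F._+ P.coeff P.⟦ h′ ⟧ n) (difference≈0 n)) (FR.+-identityˡ _))))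
    where
    difference≈0 : (P.⟦ h ⟧ P.+ (P.- P.⟦ h′ ⟧)) P.≈ []
    difference≈0 = small-multiple (P.⟦ h ⟧ P.+ (P.- P.⟦ h′ ⟧)) f (λ i → product≈0 _)
      where
      product≈0 : ((P.⟦ h ⟧ P.+ (P.- P.⟦ h′ ⟧)) P.* P.⟦ f ⟧) P.≈ []
      product≈0 n = ≡.trans (PS.solve 3 (λ h k f → (h PS.:- k) PS.:* f PS.:= f PS.:* h PS.:- f PS.:* k) (λ _ → refl) P.⟦ h ⟧ P.⟦ h′ ⟧ P.⟦ f ⟧ n)
        (≡.trans (coeff-+ (P.⟦ f ⟧ P.* P.⟦ h ⟧) _ n) (≡.trans (cong₂ F._+_ (e n) (coeff-neg (P.⟦ f ⟧ P.* P.⟦ h′ ⟧) n)) (FR.-‿inverseʳ _)))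

-- The coefficients of 𝓡₂ by residue classes

module TwistedSeries {c ℓ} (K : CommutativeRing c ℓ) (T : TwistData K) where
  open TwistData T
  private
    module F = FiniteField 𝔽
    module P = Polynomials 𝔽
    m = suc m′
    module PR = RingLaws (PolynomialRing.polynomialRing 𝔽)
    module PS = IntegerSolver (PolynomialRing.polynomialRing 𝔽)
  open RingLaws K
  open IntegerSolver K
  open ListSum K
  open RangeSum K
  open Series K
  open Enumeration 𝔽
  open PolynomialRing 𝔽 using (monic-high)
  open MonicModulus 𝔽 g
  open MonicFactorization 𝔽 using (truncate; truncate-≈; product; product-≈; monic-injective)
  open MonicCancel 𝔽 g
  open RingReasoning K

  -- Written with the same nesting of sums as `𝓡₂`, so that over ℂ with ψ = e_q the two agree by
  -- computation.
  series : P.Poly → ℕ → Carrier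
  series c n = ∑ (P.monics n) (λ f →
    ∑ (List.upTo (suc n)) (λ k → ∑ (P.divisors f k) (λ d → χ P.⟦ d ⟧)) * ψ (resid (c P.* P.⟦ f ⟧)))

  -- When there is at most one witness, existence is the same as the number of witnesses, which
  -- commutes with other sums.
  any-indicator : ∀ {x} {X : Set x} {p} {R : X → Set p} (R? : ∀ y → Dec (R y)) {xs} → Unique xs →
    (∀ {y z} → R y → R z → y ≡ z) → [ any? R? xs ]₁ ≈ ∑ xs (λ y → [ R? y ]₁)
  any-indicator R? {xs} u unique with any? R? xs
  ... | yes a = let (y , y∈ , r) = find a in sym (trans (∑-cong xs (λ _ → sym (*-identityʳ _)))
                  (∑-δ R? u y∈ r (λ _ r′ → unique r′ r) (λ _ → 1#)))
  ... | no ¬a = sym (trans (∑-cong-∈ xs (λ {y} y∈ → [ R? y ]₁-false (λ r → ¬a (lose y∈ r)))) (∑-0 xs))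

  weight : P.Poly → P.Poly → P.Poly → Carrier
  weight c f h = χ f * ψ (resid (c P.* (f P.* h)))

  -- The monic cofactor h of a divisor d is unique, so being a divisor can be replaced by a sum over
  -- h; conversely the pair (d, h) determines f as its product, and the sum over f collapses.
  ∑-divisors : ∀ c n k → k ℕ.≤ n →
    ∑ (P.monics n) (λ f → ∑ (P.divisors f k) (λ d → χ P.⟦ d ⟧) * ψ (resid (c P.* P.⟦ f ⟧))) ≈
    ∑ (P.monics k) (λ d → ∑ (P.monics (n ∸ k)) (λ h → weight c P.⟦ d ⟧ P.⟦ h ⟧))
  ∑-divisors c n k k≤n = begin
    ∑ (P.monics n) (λ f → ∑ (P.divisors f k) (λ d → χ P.⟦ d ⟧) * W f)
      ≈⟨ ∑-cong (P.monics n) (λ f → trans (*-congʳ (∑-filter (divides? f) (P.monics k) _)) (sym (∑-*ʳ (P.monics k) (W f) _))) ⟩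
    ∑ (P.monics n) (λ f → ∑ (P.monics k) (λ d → ([ divides? f d ]₁ * χ P.⟦ d ⟧) * W f))
      ≈⟨ ∑-swap (P.monics n) (P.monics k) _ ⟩
    ∑ (P.monics k) (λ d → ∑ (P.monics n) (λ f → ([ divides? f d ]₁ * χ P.⟦ d ⟧) * W f))
      ≈⟨ ∑-cong (P.monics k) (λ d → trans (∑-cong (P.monics n) (λ f → trans
           (*-congʳ (*-congʳ (any-indicator (equal? f d) (monics-unique (n ∸ k)) (λ {h} {h′} e e′ →
             product-cancel d h h′ (λ i → ≡.trans (e i) (≡.sym (e′ i)))))))
           (trans (solve 3 (λ s c w → (s :* c) :* w := c :* (s :* w)) ≈-refl _ (χ P.⟦ d ⟧) (W f))
             (*-congˡ (sym (∑-*ʳ (P.monics (n ∸ k)) (W f) _)))))) (∑-*ˡ (P.monics n) (χ P.⟦ d ⟧) _)) ⟩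
    ∑ (P.monics k) (λ d → χ P.⟦ d ⟧ * ∑ (P.monics n) (λ f → ∑ (P.monics (n ∸ k)) (λ h → [ equal? f d h ]₁ * W f)))
      ≈⟨ ∑-cong (P.monics k) (λ d → trans (*-congˡ (trans (∑-swap (P.monics n) (P.monics (n ∸ k)) _) (∑-cong (P.monics (n ∸ k)) (collapse d))))
           (sym (∑-*ˡ (P.monics (n ∸ k)) (χ P.⟦ d ⟧) _))) ⟩
    ∑ (P.monics k) (λ d → ∑ (P.monics (n ∸ k)) (λ h → weight c P.⟦ d ⟧ P.⟦ h ⟧)) ∎
    where
    W : P.Monic n → Carrier
    W f = ψ (resid (c P.* P.⟦ f ⟧))
    equal? : ∀ (f : P.Monic n) (d : P.Monic k) (h : P.Monic (n ∸ k)) → Dec ((P.⟦ d ⟧ P.* P.⟦ h ⟧) P.≈ P.⟦ f ⟧)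
    equal? f d h = (P.⟦ d ⟧ P.* P.⟦ h ⟧) P.≈? P.⟦ f ⟧
    divides? : ∀ (f : P.Monic n) (d : P.Monic k) → Dec (Any (λ h → (P.⟦ d ⟧ P.* P.⟦ h ⟧) P.≈ P.⟦ f ⟧) (P.monics (n ∸ k)))
    divides? f d = any? (equal? f d) (P.monics (n ∸ k))
    collapse : ∀ d h → ∑ (P.monics n) (λ f → [ equal? f d h ]₁ * W f) ≈ ψ (resid (c P.* (P.⟦ d ⟧ P.* P.⟦ h ⟧)))
    collapse d h = trans (∑-δ (λ f → equal? f d h) (monics-unique n) (∈-monics dh) (λ i → ≡.sym (dh≈ i))
        (λ {f} _ e → monic-injective f dh (λ i → ≡.trans (≡.sym (e i)) (≡.sym (dh≈ i)))) W)
      (reflexive (cong ψ (resid-≈ (c P.* P.⟦ dh ⟧) (c P.* (P.⟦ d ⟧ P.* P.⟦ h ⟧)) (PR.*-congˡ {c} {P.⟦ dh ⟧} {P.⟦ d ⟧ P.* P.⟦ h ⟧} dh≈))))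
      where
      dh : P.Monic n
      dh = product (ℕ.m+[n∸m]≡n k≤n) d h
      dh≈ : P.⟦ dh ⟧ P.≈ (P.⟦ d ⟧ P.* P.⟦ h ⟧)
      dh≈ = product-≈ (ℕ.m+[n∸m]≡n k≤n) d h

  count : Vec F.Carrier m → ℕ → Carrier
  count a n = ∑ (P.monics n) (λ f → [ remainder P.⟦ f ⟧ ≟ᵥ a ]₁)

  ∑-residues : ∀ n (φ : P.Poly → Carrier) → (∀ f h → f ≅ h → φ f ≈ φ h) →
    ∑ (P.monics n) (λ f → φ P.⟦ f ⟧) ≈ ∑ (P.monics m) (λ a → φ (↑ a) * count a n)
  ∑-residues n φ φ-cong = begin
    ∑ (P.monics n) (λ f → φ P.⟦ f ⟧)
      ≈⟨ ∑-cong (P.monics n) (λ f → trans (φ-cong P.⟦ f ⟧ (↑ (remainder P.⟦ f ⟧)) (remainder-≅ P.⟦ f ⟧))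
           (sym (∑-δ (remainder P.⟦ f ⟧ ≟ᵥ_) (monics-unique m) (∈-monics _) refl (λ _ → ≡.sym) (λ a → φ (↑ a))))) ⟩
    ∑ (P.monics n) (λ f → ∑ (P.monics m) (λ a → [ remainder P.⟦ f ⟧ ≟ᵥ a ]₁ * φ (↑ a)))
      ≈⟨ ∑-swap (P.monics n) (P.monics m) _ ⟩
    ∑ (P.monics m) (λ a → ∑ (P.monics n) (λ f → [ remainder P.⟦ f ⟧ ≟ᵥ a ]₁ * φ (↑ a)))
      ≈⟨ ∑-cong (P.monics m) (λ a → trans (∑-*ʳ (P.monics n) (φ (↑ a)) _) (*-comm _ _)) ⟩
    ∑ (P.monics m) (λ a → φ (↑ a) * count a n) ∎

  weight-cong : ∀ c f f′ h h′ → f ≅ f′ → h ≅ h′ → weight c f h ≈ weight c f′ h′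
  weight-cong c f f′ h h′ e e′ = *-cong (χ-cong f f′ e) (reflexive (cong ψ (resid-cong (c P.* (f P.* h)) (c P.* (f′ P.* h′))
    (≅-*ˡ c (f P.* h) (f′ P.* h′) (≅-* f f′ h h′ e e′)))))

  ∑-weight : ∀ c k l → ∑ (P.monics k) (λ d → ∑ (P.monics l) (λ h → weight c P.⟦ d ⟧ P.⟦ h ⟧)) ≈
    ∑ (P.monics m) (λ a → ∑ (P.monics m) (λ b → weight c (↑ a) (↑ b) * (count a k * count b l)))
  ∑-weight c k l = begin
    ∑ (P.monics k) (λ d → ∑ (P.monics l) (λ h → weight c P.⟦ d ⟧ P.⟦ h ⟧))
      ≈⟨ ∑-cong (P.monics k) (λ d → ∑-residues l (weight c P.⟦ d ⟧) (λ h h′ → weight-cong c P.⟦ d ⟧ P.⟦ d ⟧ h h′ (≅-refl P.⟦ d ⟧))) ⟩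
    ∑ (P.monics k) (λ d → ∑ (P.monics m) (λ b → weight c P.⟦ d ⟧ (↑ b) * count b l))
      ≈⟨ ∑-residues k (λ f → ∑ (P.monics m) (λ b → weight c f (↑ b) * count b l))
           (λ f f′ e → ∑-cong (P.monics m) (λ b → *-congʳ (weight-cong c f f′ (↑ b) (↑ b) e (≅-refl (↑ b))))) ⟩
    ∑ (P.monics m) (λ a → ∑ (P.monics m) (λ b → weight c (↑ a) (↑ b) * count b l) * count a k)
      ≈⟨ ∑-cong (P.monics m) (λ a → trans (sym (∑-*ʳ (P.monics m) (count a k) _)) (∑-cong (P.monics m) (λ b →
           solve 3 (λ w y x → (w :* y) :* x := w :* (x :* y)) ≈-refl (weight c (↑ a) (↑ b)) (count b l) (count a k)))) ⟩
    _ ∎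

  series-count : ∀ c n → series c n ≈
    ∑ (P.monics m) (λ a → ∑ (P.monics m) (λ b → weight c (↑ a) (↑ b) * (count a ⊛ count b) n))
  series-count c n = begin
    series c n
      ≈⟨ ∑-cong (P.monics n) (λ f → trans (sym (∑-*ʳ (List.upTo (suc n)) _ _)) (∑-upTo (suc n) _)) ⟩
    ∑ (P.monics n) (λ f → ∑< (suc n) (λ k → ∑ (P.divisors f k) (λ d → χ P.⟦ d ⟧) * ψ (resid (c P.* P.⟦ f ⟧))))
      ≈⟨ ∑<-∑ (suc n) (P.monics n) (λ k f → ∑ (P.divisors f k) (λ d → χ P.⟦ d ⟧) * ψ (resid (c P.* P.⟦ f ⟧))) ⟨
    ∑< (suc n) (λ k → ∑ (P.monics n) (λ f → ∑ (P.divisors f k) (λ d → χ P.⟦ d ⟧) * ψ (resid (c P.* P.⟦ f ⟧))))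
      ≈⟨ ∑<-cong-< (suc n) _ (λ k → ∑ (P.monics m) (λ a → ∑ (P.monics m) (λ b → weight c (↑ a) (↑ b) * (count a k * count b (n ∸ k)))))
           (λ { k (s≤s k≤n) → trans (∑-divisors c n k k≤n) (∑-weight c k (n ∸ k)) }) ⟩
    ∑< (suc n) (λ k → ∑ (P.monics m) (λ a → ∑ (P.monics m) (λ b → weight c (↑ a) (↑ b) * (count a k * count b (n ∸ k)))))
      ≈⟨ trans (∑<-∑ (suc n) (P.monics m) (λ k a → ∑ (P.monics m) (λ b → weight c (↑ a) (↑ b) * (count a k * count b (n ∸ k)))))
           (∑-cong (P.monics m) (λ a → trans (∑<-∑ (suc n) (P.monics m) (λ k b → weight c (↑ a) (↑ b) * (count a k * count b (n ∸ k))))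
             (∑-cong (P.monics m) (λ b → ∑<-*ˡ (suc n) (weight c (↑ a) (↑ b)) (λ k → count a k * count b (n ∸ k)))))) ⟩
    _ ∎

  Q : Carrier
  Q = ∑ F.elements (λ _ → 1#)

  -- 1 - q T
  linear : ℕ → Carrier
  linear zero          = 1#
  linear (suc zero)    = - Q
  linear (suc (suc n)) = 0#

  linear⊛-suc : ∀ f n → (linear ⊛ f) (suc n) ≈ f (suc n) - Q * f n
  linear⊛-suc f n = +-cong (*-identityˡ _) (trans (⊛-cong {linear ∘ suc} {constant (- Q)} {f} (λ { zero → ≈-refl ; (suc _) → ≈-refl }) (λ _ → ≈-refl) n)
    (trans (constant⊛ (- Q) f n) (solve 2 (λ q f → (:- q) :* f := :- (q :* f)) ≈-refl Q (f n))))

  linear⊛-0 : ∀ f → (linear ⊛ f) 0 ≈ f 0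
  linear⊛-0 f = trans (⊛-0 linear f) (*-identityˡ _)

  -- From degree `m` on each residue class contains q times as many monic polynomials with every
  -- step of the degree, so the factor 1 - q T leaves a polynomial; its value at z is `zeta z a`.
  eulerFactor : Vec F.Carrier m → ℕ → Carrier
  eulerFactor a = linear ⊛ count a

  numerator : P.Poly → ℕ → Carrier
  numerator c = (linear ⊛ linear) ⊛ series c

  numerator-euler : ∀ c n → numerator c n ≈
    ∑ (P.monics m) (λ a → ∑ (P.monics m) (λ b → weight c (↑ a) (↑ b) * (eulerFactor a ⊛ eulerFactor b) n))
  numerator-euler c n = begin
    ((linear ⊛ linear) ⊛ series c) n
      ≈⟨ ⊛-cong {L²} {L²} {series c} (λ _ → ≈-refl) (series-count c) n ⟩
    (L² ⊛ (λ n → ∑ (P.monics m) (λ a → ∑ (P.monics m) (λ b → weight c (↑ a) (↑ b) * (count a ⊛ count b) n)))) n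
      ≈⟨ trans (⊛-∑ʳ (P.monics m) L² (λ a n → ∑ (P.monics m) (λ b → weight c (↑ a) (↑ b) * (count a ⊛ count b) n)) n)
           (∑-cong (P.monics m) (λ a → trans (⊛-∑ʳ (P.monics m) L² (λ b n → weight c (↑ a) (↑ b) * (count a ⊛ count b) n) n)
             (∑-cong (P.monics m) (λ b → trans (⊛-scaleʳ (weight c (↑ a) (↑ b)) L² (count a ⊛ count b) n)
               (*-congˡ (S.solve 3 (λ l x y → (l S.:* l) S.:* (x S.:* y) S.:= (l S.:* x) S.:* (l S.:* y)) (λ _ → ≈-refl)
                 linear (count a) (count b) n)))))) ⟩
    _ ∎
    where
    L² : ℕ → Carrier
    L² = linear ⊛ linear
    module S = IntegerSolver seriesRing

  ∑-monics-suc : ∀ {x} {X : Set x} n (φ : Vec F.Carrier (suc n) → X) (f : X → Carrier) →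
    ∑ (P.monics (suc n)) (f ∘ φ) ≈ ∑ F.elements (λ x → ∑ (P.monics n) (λ v → f (φ (x ∷ v))))
  ∑-monics-suc n φ f = ∑-cartesianProductWith _∷_ F.elements (P.monics n) (f ∘ φ)

  ∑-monics-+ : ∀ i j (φ : P.Poly → Carrier) →
    ∑ (P.monics (i ℕ.+ j)) (λ v → φ P.⟦ v ⟧) ≈ ∑ (P.monics i) (λ a → ∑ (P.monics j) (λ b → φ (↑ a ++ P.⟦ b ⟧)))
  ∑-monics-+ zero    j φ = sym (+-identityʳ _)
  ∑-monics-+ (suc i) j φ = begin
    ∑ (P.monics (suc i ℕ.+ j)) (λ v → φ P.⟦ v ⟧)
      ≈⟨ ∑-cartesianProductWith _∷_ F.elements (P.monics (i ℕ.+ j)) (λ v → φ P.⟦ v ⟧) ⟩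
    ∑ F.elements (λ x → ∑ (P.monics (i ℕ.+ j)) (λ v → φ (x ∷ P.⟦ v ⟧)))
      ≈⟨ ∑-cong F.elements (λ x → ∑-monics-+ i j (λ f → φ (x ∷ f))) ⟩
    ∑ F.elements (λ x → ∑ (P.monics i) (λ a → ∑ (P.monics j) (λ b → φ (x ∷ (↑ a ++ P.⟦ b ⟧)))))
      ≈⟨ ∑-cartesianProductWith _∷_ F.elements (P.monics i) (λ a → ∑ (P.monics j) (λ b → φ (↑ a ++ P.⟦ b ⟧))) ⟨
    ∑ (P.monics (suc i)) (λ a → ∑ (P.monics j) (λ b → φ (↑ a ++ P.⟦ b ⟧))) ∎

  ≅-+ : ∀ f f′ h → f ≅ f′ → (f P.+ h) ≅ (f′ P.+ h)
  ≅-+ f f′ h (k , e) = k , λ n → ≡.trans (e n)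
    (PS.solve 3 (λ f f′ h → f PS.:- f′ PS.:= (f PS.:+ h) PS.:- (f′ PS.:+ h)) (λ _ → refl) f f′ h n)

  append-≈ : ∀ {n} (v : Vec F.Carrier n) h → (↑ v ++ h) P.≈ (↑ v P.+ (↑ (zeros n) ++ h))
  append-≈ []      h n       = refl
  append-≈ (x ∷ v) h zero    = ≡.sym (RingLaws.+-identityʳ (PolynomialRing.fieldRing 𝔽) x)
  append-≈ (x ∷ v) h (suc n) = append-≈ v h n

  -- With the coefficients from degree m on fixed, the m lowest ones translate the residue by an
  -- arbitrary vector, so each class is met exactly once. The solution is the residue of a minus the
  -- fixed part `w`.
  ∑-tail : ∀ h a → ∑ (P.monics m) (λ v → [ remainder (↑ v ++ h) ≟ᵥ a ]₁) ≈ 1#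
  ∑-tail h a = trans (∑-cong (P.monics m) (λ _ → sym (*-identityʳ _)))
    (∑-δ (λ v → remainder (↑ v ++ h) ≟ᵥ a) (monics-unique m) (∈-monics v₀) solution unique (λ _ → 1#))
    where
    w : P.Poly
    w = ↑ (zeros m) ++ h
    v₀ : Vec F.Carrier m
    v₀ = remainder (↑ a P.+ (P.- w))
    solution : remainder (↑ v₀ ++ h) ≡ a
    solution = ≡.trans (remainder-cong (↑ v₀ ++ h) (↑ a)
      (≅-trans (↑ v₀ ++ h) (↑ v₀ P.+ w) (↑ a) (≈⇒≅ (↑ v₀ ++ h) (↑ v₀ P.+ w) (append-≈ v₀ h))
        (≅-trans (↑ v₀ P.+ w) ((↑ a P.+ (P.- w)) P.+ w) (↑ a)
          (≅-+ (↑ v₀) (↑ a P.+ (P.- w)) w (≅-sym (↑ a P.+ (P.- w)) (↑ v₀) (remainder-≅ (↑ a P.+ (P.- w)))))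
          (≈⇒≅ ((↑ a P.+ (P.- w)) P.+ w) (↑ a) (PS.solve 2 (λ a w → (a PS.:- w) PS.:+ w PS.:= a) (λ _ → refl) (↑ a) w)))))
      (remainder-↑ a)
    unique : ∀ {v} → v ∈ P.monics m → remainder (↑ v ++ h) ≡ a → v ≡ v₀
    unique {v} _ e = ≡.trans (≡.sym (remainder-↑ v)) (remainder-cong (↑ v) (↑ a P.+ (P.- w))
      (≅-trans (↑ v) ((↑ v P.+ w) P.+ (P.- w)) (↑ a P.+ (P.- w))
        (≈⇒≅ (↑ v) ((↑ v P.+ w) P.+ (P.- w)) (PS.solve 2 (λ v w → v PS.:= (v PS.:+ w) PS.:- w) (λ _ → refl) (↑ v) w))
        (≅-+ (↑ v P.+ w) (↑ a) (P.- w) (≅-trans (↑ v P.+ w) (↑ v ++ h) (↑ a)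
          (≈⇒≅ (↑ v P.+ w) (↑ v ++ h) (λ n → ≡.sym (append-≈ v h n)))
          (subst (λ z → (↑ v ++ h) ≅ ↑ z) e (remainder-≅ (↑ v ++ h)))))))

  count-large : ∀ a j → count a (m ℕ.+ j) ≈ ∑ (P.monics j) (λ _ → 1#)
  count-large a j = trans (∑-monics-+ m j (λ f → [ remainder f ≟ᵥ a ]₁))
    (trans (∑-swap (P.monics m) (P.monics j) _) (∑-cong (P.monics j) (λ b → ∑-tail P.⟦ b ⟧ a)))

  count-m : ∀ a → count a m ≈ 1#
  count-m a = trans (reflexive (cong (count a) (≡.sym (ℕ.+-identityʳ m)))) (trans (count-large a 0) (+-identityʳ 1#))

  count-suc : ∀ a j → count a (suc (m ℕ.+ j)) ≈ Q * count a (m ℕ.+ j)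
  count-suc a j = begin
    count a (suc (m ℕ.+ j))                               ≡⟨ cong (count a) (ℕ.+-suc m j) ⟨
    count a (m ℕ.+ suc j)                                 ≈⟨ count-large a (suc j) ⟩
    ∑ (P.monics (suc j)) (λ _ → 1#)                       ≈⟨ ∑-cartesianProductWith _∷_ F.elements (P.monics j) (λ _ → 1#) ⟩
    ∑ F.elements (λ _ → ∑ (P.monics j) (λ _ → 1#))        ≈⟨ ∑-cong F.elements (λ _ → sym (*-identityˡ _)) ⟩
    ∑ F.elements (λ _ → 1# * ∑ (P.monics j) (λ _ → 1#))   ≈⟨ ∑-*ʳ F.elements _ _ ⟩
    Q * ∑ (P.monics j) (λ _ → 1#)                         ≈⟨ *-congˡ (count-large a j) ⟨
    Q * count a (m ℕ.+ j)                                 ∎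

  euler-support : ∀ a i → eulerFactor a (suc m ℕ.+ i) ≈ 0#
  euler-support a i = trans (linear⊛-suc (count a) (m ℕ.+ i)) (trans (+-congʳ (count-suc a i)) (-‿inverseʳ _))

  -- A bound beyond the degree: each `eulerFactor` vanishes from `suc m` on, and `⊛-supported` adds
  -- the bounds of the two factors.
  degree : ℕ
  degree = suc m ℕ.+ suc m

  numerator-support : ∀ c i → numerator c (degree ℕ.+ i) ≈ 0#
  numerator-support c i = trans (numerator-euler c (degree ℕ.+ i)) (∑-zero (P.monics m) (λ a → ∑-zero (P.monics m) (λ b →
    trans (*-congˡ (⊛-supported (suc m) (suc m) (eulerFactor a) (eulerFactor b) (euler-support a) (euler-support b) i)) (zeroʳ _))))

  -- Below degree m a polynomial is its own remainder, after padding with zeros to length m.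
  count-small : ∀ a n → n ℕ.< m → count a n ≈ ∑ (P.monics n) (λ f → [ P.⟦ f ⟧ P.≈? ↑ a ]₁)
  count-small a n n<m = ∑-cong (P.monics n) (λ f → indicator-cong (remainder P.⟦ f ⟧ ≟ᵥ a) (P.⟦ f ⟧ P.≈? ↑ a)
    (λ e i → ≡.trans (≡.sym (padded≈ f i)) (cong (λ v → P.coeff (↑ v) i) (≡.trans (≡.sym (remainder-↑ (padded f)))
      (≡.trans (remainder-cong (↑ (padded f)) P.⟦ f ⟧ (≈⇒≅ (↑ (padded f)) P.⟦ f ⟧ (padded≈ f))) e))))
    (λ e → ≡.trans (remainder-cong P.⟦ f ⟧ (↑ a) (≈⇒≅ P.⟦ f ⟧ (↑ a) e)) (remainder-↑ a)))
    where
    padded : P.Monic n → Vec F.Carrier m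
    padded f = truncate m P.⟦ f ⟧
    padded≈ : ∀ f → ↑ (padded f) P.≈ P.⟦ f ⟧
    padded≈ f = truncate-≈ m P.⟦ f ⟧ (λ i → ≡.trans (cong (λ k → P.coeff P.⟦ f ⟧ (k ℕ.+ i)) (≡.sym (ℕ.m+[n∸m]≡n n<m)))
      (≡.trans (cong (λ k → P.coeff P.⟦ f ⟧ (suc k)) (ℕ.+-assoc n (m ∸ suc n) i)) (monic-high f _)))

-- Evaluation of the numerator

module Numerator {c ℓ c′ ℓ′} (K : CommutativeRing c ℓ) (A : CommutativeRing c′ ℓ′) (ι : Homomorphism K A) (T : TwistData K) where
  open TwistData T using (𝔽; m′; g)
  private
    module F = FiniteField 𝔽
    module P = Polynomials 𝔽
    m = suc m′
    module K = RingLaws K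
    module LK = ListSum K
  open RingLaws A
  open IntegerSolver A
  open ListSum A
  open RangeSum A
  open Homomorphism ι
  open Evaluation K A ι
  open Enumeration 𝔽
  open ExpProperties commutativeSemiring using (_^_)
  open MonicModulus 𝔽 g using (↑; zeros)
  open TwistedSeries K T public
    using (series; linear; linear⊛-suc; linear⊛-0; numerator; numerator-support; degree)
  private
    module TS = TwistedSeries K T
    module SK = Series K

  open FunctionalEquation A (pushforward ι T) public using (twisted; functional-equation; kloosterman)
  open Fourier A (TwistData.additive (pushforward ι T)) public using (Q; monomial; zeta; module Duality)
  open RingReasoning A

  Q-homo : ⟦ TS.Q ⟧ ≈ Q
  Q-homo = trans (∑-homo F.elements _) (∑-cong F.elements (λ _ → 1-homo))

  ∑-monomial : ∀ N z (a : Vec F.Carrier N) →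
    ∑< N (λ n → ∑ (P.monics n) (λ f → [ P.⟦ f ⟧ P.≈? ↑ a ]₁) * z ^ n) ≈ monomial z a
  ∑-monomial zero    z []      = ≈-refl
  ∑-monomial (suc N) z (x ∷ a) = +-cong lowest (trans (∑<-cong N (term′ ∘ suc) (λ n → z * rest n) higher) (trans (∑<-*ˡ N z rest) (*-congˡ (∑-monomial N z a))))
    where
    term′ rest : ℕ → Carrier
    term′ n = ∑ (P.monics n) (λ f → [ P.⟦ f ⟧ P.≈? ↑ (x ∷ a) ]₁) * z ^ n
    rest n = ∑ (P.monics n) (λ f → [ P.⟦ f ⟧ P.≈? ↑ a ]₁) * z ^ n
    indicator-* : ∀ {p q r} {X : Set p} {Y : Set q} {Z : Set r} (X? : Dec X) (Y? : Dec Y) (Z? : Dec Z) →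
      (X → Y) → (X → Z) → (Y → Z → X) → [ X? ]₁ ≈ [ Y? ]₁ * [ Z? ]₁
    indicator-* X? (yes y) Z? f h k = trans (indicator-cong X? Z? h (k y)) (sym (*-identityˡ _))
    indicator-* X? (no ¬y) Z? f h k = trans ([ X? ]₁-false (¬y ∘ f)) (sym (zeroˡ _))
    lowest : term′ 0 ≈ [ a ≟ᵥ zeros N ]₁ * [ x F.≟ F.1# ]₁
    lowest = trans (*-identityʳ _) (trans (+-identityʳ _) (indicator-* ([ F.1# ] P.≈? ↑ (x ∷ a)) (a ≟ᵥ zeros N) (x F.≟ F.1#)
      (λ e → MonicModulus.↑-injective 𝔽 g a (zeros N) (λ i → ≡.trans (≡.sym (e (suc i))) (≡.sym (MonicModulus.↑zeros 𝔽 g N i))))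
      (λ e → ≡.sym (e 0))
      (λ { refl refl zero → refl ; refl refl (suc i) → ≡.sym (MonicModulus.↑zeros 𝔽 g N i) })))
    higher : ∀ n → term′ (suc n) ≈ z * rest n
    higher n = begin
      ∑ (P.monics (suc n)) (λ f → [ P.⟦ f ⟧ P.≈? ↑ (x ∷ a) ]₁) * (z * z ^ n)
        ≈⟨ *-congʳ (∑-cartesianProductWith _∷_ F.elements (P.monics n) _) ⟩
      ∑ F.elements (λ y → ∑ (P.monics n) (λ f → [ (y ∷ P.⟦ f ⟧) P.≈? ↑ (x ∷ a) ]₁)) * (z * z ^ n)
        ≈⟨ *-congʳ (∑-cong F.elements (λ y → trans (∑-cong (P.monics n) (λ f → indicator-* ((y ∷ P.⟦ f ⟧) P.≈? ↑ (x ∷ a)) (y F.≟ x) (P.⟦ f ⟧ P.≈? ↑ a)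
             (λ e → e 0) (λ e → e ∘ suc) (λ { e es zero → e ; e es (suc i) → es i }))) (∑-*ˡ (P.monics n) _ _))) ⟩
      ∑ F.elements (λ y → [ y F.≟ x ]₁ * ∑ (P.monics n) (λ f → [ P.⟦ f ⟧ P.≈? ↑ a ]₁)) * (z * z ^ n)
        ≈⟨ *-congʳ (∑-δ (F._≟ x) elements-unique (∈-elements x) refl (λ _ e → e) _) ⟩
      ∑ (P.monics n) (λ f → [ P.⟦ f ⟧ P.≈? ↑ a ]₁) * (z * z ^ n)
        ≈⟨ solve 3 (λ s z e → s :* (z :* e) := z :* (s :* e)) ≈-refl _ z (z ^ n) ⟩
      z * rest n ∎

  eval-count : ∀ a z → eval m (TS.count a) z ≈ monomial z a
  eval-count a z = trans (∑<-cong-< m (term (TS.count a) z) (λ n → ∑ (P.monics n) (λ f → [ P.⟦ f ⟧ P.≈? ↑ a ]₁) * z ^ n)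
    (λ n n<m → *-congʳ (trans (⟦⟧-cong (TS.count-small a n n<m)) (trans (∑-homo (P.monics n) _)
      (∑-cong (P.monics n) (λ f → indicator-homo (P.⟦ f ⟧ P.≈? ↑ a))))))) (∑-monomial m z a)

  -- Multiplication by T raises degrees, so the subtracted part is truncated one step earlier. This
  -- mismatch at the top is what remains of f in `eval-euler` and in `finite-quotient`.
  eval-linear : ∀ N f z → eval (suc N) (linear SK.⊛ f) z ≈ eval (suc N) f z - Q * z * eval N f z
  eval-linear N f z = begin
    eval (suc N) (linear SK.⊛ f) z
      ≈⟨ eval-suc N (linear SK.⊛ f) z ⟩
    ⟦ (linear SK.⊛ f) 0 ⟧ + z * eval N (λ n → (linear SK.⊛ f) (suc n)) z
      ≈⟨ +-cong (⟦⟧-cong (linear⊛-0 f)) (*-congˡ (trans (eval-cong N {λ n → (linear SK.⊛ f) (suc n)} {λ n → f (suc n) K.+ K.- TS.Q K.* f n} z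
           (λ n → K.trans (linear⊛-suc f n) (K.+-congˡ (-‿distribˡ-* TS.Q (f n)))))
           (trans (eval-+ N (f ∘ suc) (λ n → K.- TS.Q K.* f n) z) (+-congˡ (trans (eval-scale N (K.- TS.Q) f z)
             (*-congʳ (trans (neg-homo TS.Q) (-‿cong Q-homo)))))))) ⟩
    ⟦ f 0 ⟧ + z * (eval N (f ∘ suc) z + - Q * eval N f z)
      ≈⟨ solve 5 (λ s z x q y → s :+ z :* (x :+ (:- q) :* y) := (s :+ z :* x) :- q :* z :* y) ≈-refl ⟦ f 0 ⟧ z _ Q _ ⟩
    (⟦ f 0 ⟧ + z * eval N (f ∘ suc) z) - Q * z * eval N f z
      ≈⟨ +-congʳ (eval-suc N f z) ⟨
    eval (suc N) f z - Q * z * eval N f z ∎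
    where open RingProperties (CommutativeRing.ring K) using (-‿distribˡ-*)

  -- The two truncations differ by the term of degree m; there is exactly one monic polynomial of
  -- degree m in each class, whence the summand z^m of `zeta`.
  eval-euler : ∀ a z → eval (suc m) (TS.eulerFactor a) z ≈ zeta z a
  eval-euler a z = begin
    eval (suc m) (linear SK.⊛ TS.count a) z
      ≈⟨ eval-linear m (TS.count a) z ⟩
    eval (suc m) (TS.count a) z - Q * z * eval m (TS.count a) z
      ≈⟨ +-congʳ (trans (eval-last m (TS.count a) z) (+-congˡ (trans (*-congʳ (trans (⟦⟧-cong (TS.count-m a)) 1-homo)) (*-identityˡ _)))) ⟩
    (eval m (TS.count a) z + z ^ m) - Q * z * eval m (TS.count a) z
      ≈⟨ solve 3 (λ x e k → (x :+ e) :- k :* x := (:1 :- k) :* x :+ e) ≈-refl (eval m (TS.count a) z) (z ^ m) (Q * z) ⟩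
    (1# - Q * z) * eval m (TS.count a) z + z ^ m
      ≈⟨ +-congʳ (*-congˡ (eval-count a z)) ⟩
    zeta z a ∎

  eval-numerator : ∀ c z → eval degree (numerator c) z ≈ twisted c z
  eval-numerator c z = begin
    eval degree (numerator c) z
      ≈⟨ eval-cong degree {numerator c} z (TS.numerator-euler c) ⟩
    eval degree (λ n → LK.∑ (P.monics m) (λ a → LK.∑ (P.monics m) (λ b → TS.weight c (↑ a) (↑ b) K.* (TS.eulerFactor a SK.⊛ TS.eulerFactor b) n))) z
      ≈⟨ trans (eval-∑ degree (P.monics m) (λ a n → LK.∑ (P.monics m) (λ b → TS.weight c (↑ a) (↑ b) K.* (TS.eulerFactor a SK.⊛ TS.eulerFactor b) n)) z)
           (∑-cong (P.monics m) (λ a → trans (eval-∑ degree (P.monics m) (λ b n → TS.weight c (↑ a) (↑ b) K.* (TS.eulerFactor a SK.⊛ TS.eulerFactor b) n) z)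
             (∑-cong (P.monics m) (λ b → trans (eval-scale degree (TS.weight c (↑ a) (↑ b)) (TS.eulerFactor a SK.⊛ TS.eulerFactor b) z)
               (*-cong (*-homo _ _) (trans (eval-⊛ (suc m) (suc m) (TS.eulerFactor a) (TS.eulerFactor b) z (TS.euler-support a) (TS.euler-support b))
                 (*-cong (eval-euler a z) (eval-euler b z)))))))) ⟩
    twisted c z ∎

-- Arithmetic of the finite field: Frobenius, Fermat and the trace

module FieldArithmetic {p η} (𝔽 : FiniteField p η) where
  private
    module F = FiniteField 𝔽
    module P = Polynomials 𝔽
  open PolynomialRing 𝔽 using (fieldRing; 0∤; coeff-+)
  open FunctionalDot 𝔽
  open Enumeration 𝔽
  open RingLaws fieldRing using (+-identityˡ; +-identityʳ; zeroˡ; zeroʳ; *-identityˡ; *-identityʳ; *-assoc; -‿inverseʳ; commutativeSemiring; semiring)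
  open IntegerSolver fieldRing
  open ListSum fieldRing
  open RangeSum fieldRing
  open ExpProperties commutativeSemiring using (^-assocʳ)
  open MultProperties semiring using (×-homo-+; ×1-homo-*; ×-assoc-*)
  open ≡.≡-Reasoning

  difference≢0 : ∀ {x y} → x ≢ y → x F.+ F.- y ≢ F.0#
  difference≢0 {x} {y} x≢y e = x≢y (≡.trans (solve 2 (λ x y → x := (x :- y) :+ y) refl x y) (≡.trans (cong (F._+ y) e) (+-identityˡ y)))

  powers : F.Carrier → ℕ → F.Carrier
  powers x n = x F.^ n

  value : P.Poly → F.Carrier → F.Carrier
  value f x = dot f (powers x)

  value-∷ : ∀ a f x → value (a ∷ f) x ≡ a F.+ x F.* value f x
  value-∷ a f x = cong₂ F._+_ (*-identityʳ a) (scaled f (powers x))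
    where
    scaled : ∀ f B → dot f (λ n → x F.* B n) ≡ x F.* dot f B
    scaled []      B = ≡.sym (zeroʳ x)
    scaled (a ∷ f) B = ≡.trans (cong (a F.* (x F.* B 0) F.+_) (scaled f (B ∘ suc)))
      (solve 4 (λ a x b d → a :* (x :* b) :+ x :* d := x :* (a :* b :+ d)) refl a x (B 0) (dot f (B ∘ suc)))

  -- Synthetic division: this is (f - f(x)) / (T - x), whose coefficients are the intermediate
  -- Horner values of f at x.
  quotient : F.Carrier → P.Poly → P.Poly
  quotient x []          = []
  quotient x (a ∷ [])    = []
  quotient x (a ∷ b ∷ f) = value (b ∷ f) x ∷ quotient x (b ∷ f)

  length-quotient : ∀ x a f → length (quotient x (a ∷ f)) ≡ length f
  length-quotient x a []      = refl
  length-quotient x a (b ∷ f) = cong suc (length-quotient x b f)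

  quotient-spec : ∀ x y f → value f y F.+ F.- value f x ≡ (y F.+ F.- x) F.* value (quotient x f) y
  quotient-spec x y []          = solve 1 (λ d → :0 :- :0 := d :* :0) refl (y F.+ F.- x)
  quotient-spec x y (a ∷ [])    = solve 2 (λ a d → (a :* :1 :+ :0) :- (a :* :1 :+ :0) := d :* :0) refl a (y F.+ F.- x)
  quotient-spec x y (a ∷ b ∷ f) = begin
    value (a ∷ b ∷ f) y F.+ F.- value (a ∷ b ∷ f) x
      ≡⟨ cong₂ (λ s t → s F.+ F.- t) (value-∷ a (b ∷ f) y) (value-∷ a (b ∷ f) x) ⟩
    (a F.+ y F.* Y) F.+ F.- (a F.+ x F.* X)
      ≡⟨ solve 5 (λ a x y s t → (a :+ y :* s) :- (a :+ x :* t) := (y :- x) :* t :+ y :* (s :- t)) refl a x y Y X ⟩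
    (y F.+ F.- x) F.* X F.+ y F.* (Y F.+ F.- X)
      ≡⟨ cong (λ t → (y F.+ F.- x) F.* X F.+ y F.* t) (quotient-spec x y (b ∷ f)) ⟩
    (y F.+ F.- x) F.* X F.+ y F.* ((y F.+ F.- x) F.* value (quotient x (b ∷ f)) y)
      ≡⟨ solve 4 (λ d s y t → d :* s :+ y :* (d :* t) := d :* (s :+ y :* t)) refl (y F.+ F.- x) X y _ ⟩
    (y F.+ F.- x) F.* (X F.+ y F.* value (quotient x (b ∷ f)) y)
      ≡⟨ cong ((y F.+ F.- x) F.*_) (value-∷ X (quotient x (b ∷ f)) y) ⟨
    (y F.+ F.- x) F.* value (quotient x (a ∷ b ∷ f)) y ∎
    where
    X = value (b ∷ f) x
    Y = value (b ∷ f) y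

  quotient-0 : ∀ x f → value f x ≡ F.0# → quotient x f P.≈ [] → f P.≈ []
  quotient-0 x []          e q≈0 i       = refl
  quotient-0 x (a ∷ [])    e q≈0 zero    = ≡.trans (solve 1 (λ a → a := a :* :1 :+ :0) refl a) e
  quotient-0 x (a ∷ [])    e q≈0 (suc i) = refl
  quotient-0 x (a ∷ b ∷ f) e q≈0 zero    = begin
    a                           ≡⟨ solve 2 (λ a x → a := a :+ x :* :0) refl a x ⟩
    a F.+ x F.* F.0#            ≡⟨ cong (λ t → a F.+ x F.* t) (q≈0 0) ⟨
    a F.+ x F.* value (b ∷ f) x ≡⟨ value-∷ a (b ∷ f) x ⟨
    value (a ∷ b ∷ f) x         ≡⟨ e ⟩
    F.0#                        ∎
  quotient-0 x (a ∷ b ∷ f) e q≈0 (suc i) = quotient-0 x (b ∷ f) (q≈0 0) (q≈0 ∘ suc) i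

  -- The length of the list exceeds the degree, so there are more roots than the degree allows.
  -- Splitting off T - x for the first root keeps the other roots, because y - x can be cancelled
  -- when y differs from x.
  too-many-roots : ∀ f xs → Unique xs → length f ≤ length xs → (∀ {x} → x ∈ xs → value f x ≡ F.0#) → f P.≈ []
  too-many-roots []      xs       u l≤ roots = λ _ → refl
  too-many-roots (a ∷ f) (x ∷ xs) (x∉xs ∷ u) (s≤s l≤) roots = quotient-0 x (a ∷ f) (roots (here refl))
    (too-many-roots (quotient x (a ∷ f)) xs u (subst (_≤ length xs) (≡.sym (length-quotient x a f)) l≤) (λ {y} y∈xs →
      0∤ (difference≢0 (λ y≡x → All.lookup x∉xs y∈xs (≡.sym y≡x))) (≡.trans (≡.sym (quotient-spec x y (a ∷ f)))
        (≡.trans (cong₂ (λ s t → s F.+ F.- t) (roots (there y∈xs)) (roots (here refl))) (-‿inverseʳ F.0#)))))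

  monomialₚ : ℕ → P.Poly
  monomialₚ zero    = [ F.1# ]
  monomialₚ (suc n) = F.0# ∷ monomialₚ n

  value-monomialₚ : ∀ n x → value (monomialₚ n) x ≡ x F.^ n
  value-monomialₚ zero    x = solve 0 (:1 :* :1 :+ :0 := :1) refl
  value-monomialₚ (suc n) x = ≡.trans (value-∷ F.0# (monomialₚ n) x) (≡.trans (+-identityˡ _) (cong (x F.*_) (value-monomialₚ n x)))

  length-monomialₚ : ∀ n → length (monomialₚ n) ≡ suc n
  length-monomialₚ zero    = refl
  length-monomialₚ (suc n) = cong suc (length-monomialₚ n)

  coeff-monomialₚ : ∀ n → P.coeff (monomialₚ n) n ≡ F.1#
  coeff-monomialₚ zero    = refl
  coeff-monomialₚ (suc n) = coeff-monomialₚ n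

  power-0 : ∀ {x} n → x F.^ n ≡ F.0# → x ≡ F.0#
  power-0 zero    e = contradiction e F.1≢0
  power-0 {x} (suc n) e with x F.≟ F.0#
  ... | yes x≡0 = x≡0
  ... | no  x≢0 = power-0 n (0∤ x≢0 e)

  length-elements : length F.elements ≡ F.q
  length-elements = ≡.trans (List.length-map (Inverse.to F.enumeration) (List.allFin F.q)) (List.length-tabulate {n = F.q} id)

  ∑-1 : ∀ {a} {X : Set a} (xs : List X) → ∑ xs (λ _ → F.1#) ≡ length xs F.· F.1#
  ∑-1 []       = refl
  ∑-1 (x ∷ xs) = cong (F.1# F.+_) (∑-1 xs)

  -- Translation by 1 permutes the field, so the sum of all elements is equal to itself plus q · 1.
  q·1≡0 : F.q F.· F.1# ≡ F.0#
  q·1≡0 = begin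
    F.q F.· F.1#                           ≡⟨ cong (F._· F.1#) length-elements ⟨
    length F.elements F.· F.1#             ≡⟨ ∑-1 F.elements ⟨
    ∑ F.elements (λ _ → F.1#)              ≡⟨ solve 2 (λ s t → s := (t :+ s) :- t) refl (∑ F.elements (λ _ → F.1#)) (∑ F.elements id) ⟩
    (∑ F.elements id F.+ ∑ F.elements (λ _ → F.1#)) F.+ F.- ∑ F.elements id
      ≡⟨ cong (F._+ F.- ∑ F.elements id) (≡.trans (≡.sym (∑-+ F.elements id (λ _ → F.1#)))
           (∑-reindex elements-unique elements-unique F._≟_ (F._+ F.1#) (F._+ F.- F.1#) (λ _ → ∈-elements _) (λ _ → ∈-elements _)
             (λ {x} _ → solve 1 (λ x → (x :+ :1) :- :1 := x) refl x) (λ {x} _ → solve 1 (λ x → (x :- :1) :+ :1 := x) refl x) id)) ⟩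
    ∑ F.elements id F.+ F.- ∑ F.elements id ≡⟨ -‿inverseʳ _ ⟩
    F.0#                                   ∎

  -- q · 1 is the η-th power of p · 1, and a field has no nilpotent elements other than 0.
  p·1≡0 : p F.· F.1# ≡ F.0#
  p·1≡0 = power-0 η (≡.trans (≡.sym (power-homo η)) q·1≡0)
    where
    power-homo : ∀ n → (p ℕ.^ n) F.· F.1# ≡ (p F.· F.1#) F.^ n
    power-homo zero    = +-identityʳ F.1#
    power-homo (suc n) = ≡.trans (×1-homo-* p (p ℕ.^ n)) (cong (p F.· F.1# F.*_) (power-homo n))

  multiple·≡0 : ∀ n x → (n ℕ.* p) F.· x ≡ F.0#
  multiple·≡0 n x = begin
    (n ℕ.* p) F.· x                 ≡⟨ cong ((n ℕ.* p) F.·_) (*-identityˡ x) ⟨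
    (n ℕ.* p) F.· (F.1# F.* x)      ≡⟨ ×-assoc-* (n ℕ.* p) F.1# x ⟨
    (n ℕ.* p) F.· F.1# F.* x        ≡⟨ cong (F._* x) (×1-homo-* n p) ⟩
    (n F.· F.1# F.* p F.· F.1#) F.* x ≡⟨ cong (λ t → (n F.· F.1# F.* t) F.* x) p·1≡0 ⟩
    (n F.· F.1# F.* F.0#) F.* x     ≡⟨ solve 2 (λ n x → (n :* :0) :* x := :0) refl (n F.· F.1#) x ⟩
    F.0#                            ∎

  1<p : 1 ℕ.< p
  1<p = ℕ.nonTrivial⇒n>1 p {{prime⇒nonTrivial F.p-prime}}

  p∤k! : ∀ {k} → k ℕ.< p → ¬ p ℕ.∣ (k ℕ.!)
  p∤k! {zero}  k<p p∣1 = ℕ.<⇒≢ 1<p (≡.sym (ℕ.∣1⇒≡1 p∣1))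
  p∤k! {suc k} k<p p∣k! with euclidsLemma (suc k) (k ℕ.!) F.p-prime p∣k!
  ... | inj₁ p∣suck = ℕ.>⇒∤ k<p p∣suck
  ... | inj₂ p∣k!′  = p∤k! (ℕ.<-trans (ℕ.n<1+n k) k<p) p∣k!′

  -- The binomial coefficient times two factorials is p!, which p divides; both factorials belong to
  -- numbers below p, so p divides neither.
  p∣pCk : ∀ {k} → suc k ℕ.< p → p ℕ.∣ (p ℕ.C suc k)
  p∣pCk {k} k<p = split (euclidsLemma (p ℕ.C suc k) ((suc k ℕ.!) ℕ.* ((p ∸ suc k) ℕ.!)) F.p-prime
      (subst (p ℕ.∣_) (≡.sym choose) p∣p!))
    where
    instance
      denominator : NonZero ((suc k ℕ.!) ℕ.* ((p ∸ suc k) ℕ.!))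
      denominator = ℕ.m*n≢0 (suc k ℕ.!) ((p ∸ suc k) ℕ.!) {{ℕ._!≢0 (suc k)}} {{ℕ._!≢0 (p ∸ suc k)}}
    choose : (p ℕ.C suc k) ℕ.* ((suc k ℕ.!) ℕ.* ((p ∸ suc k) ℕ.!)) ≡ p ℕ.!
    choose = ≡.trans (cong (ℕ._* ((suc k ℕ.!) ℕ.* ((p ∸ suc k) ℕ.!))) (ℕ.nCk≡n!/k![n-k]! (ℕ.<⇒≤ k<p)))
      (ℕ.m/n*n≡m (ℕ.k![n∸k]!∣n! (ℕ.<⇒≤ k<p)))
    p∣p! : p ℕ.∣ (p ℕ.!)
    p∣p! = subst (λ n → n ℕ.∣ (n ℕ.!)) (ℕ.suc-pred p) (ℕ.m∣m*n (ℕ.pred p ℕ.!))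
    split : p ℕ.∣ (p ℕ.C suc k) ⊎ p ℕ.∣ ((suc k ℕ.!) ℕ.* ((p ∸ suc k) ℕ.!)) → p ℕ.∣ (p ℕ.C suc k)
    split (inj₁ p∣C) = p∣C
    split (inj₂ p∣d) with euclidsLemma (suc k ℕ.!) ((p ∸ suc k) ℕ.!) F.p-prime p∣d
    ... | inj₁ p∣k! = contradiction p∣k! (p∤k! k<p)
    ... | inj₂ p∣l! = contradiction p∣l! (p∤k! (ℕ.∸-monoʳ-< (s≤s z≤n) (ℕ.<⇒≤ k<p)))

  frobenius-+ : ∀ x y → (x F.+ y) F.^ p ≡ x F.^ p F.+ y F.^ p
  frobenius-+ x y = ≡.trans (BinomialTheorem.theorem commutativeSemiring p x y) (expansion p refl)
    where
    term : ℕ → ℕ → F.Carrier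
    term n k = (n ℕ.C k) F.· (x F.^ k F.* y F.^ (n ∸ k))
    -- A variable copy of the exponent p: matching on it exposes the first and the last binomial
    -- term, and the ones between vanish by `p∣pCk`.
    expansion : ∀ n → n ≡ p → ∑< (suc n) (term n) ≡ x F.^ n F.+ y F.^ n
    expansion zero    e = contradiction (≡.sym e) (ℕ.≢-nonZero⁻¹ p)
    expansion (suc n) e = begin
      ∑< (suc (suc n)) (term (suc n))
        ≡⟨ ∑<-last (suc n) (term (suc n)) ⟩
      (term (suc n) 0 F.+ ∑< n (term (suc n) ∘ suc)) F.+ term (suc n) (suc n)
        ≡⟨ cong (λ t → (term (suc n) 0 F.+ t) F.+ term (suc n) (suc n)) (≡.trans
             (∑<-cong-< n (term (suc n) ∘ suc) (λ _ → F.0#) middle) (∑<-zero n (λ _ → F.0#) (λ _ → refl))) ⟩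
      (term (suc n) 0 F.+ F.0#) F.+ term (suc n) (suc n)
        ≡⟨ cong₂ (λ s t → (s F.+ F.0#) F.+ t) (refl {x = term (suc n) 0})
             (≡.trans (cong₂ (λ c d → c F.· (x F.^ suc n F.* y F.^ d)) (ℕ.nCn≡1 (suc n)) (ℕ.n∸n≡0 n)) (+-identityʳ _)) ⟩
      (term (suc n) 0 F.+ F.0#) F.+ x F.^ suc n F.* F.1#
        ≡⟨ solve 2 (λ y x → ((:1 :* y :+ :0) :+ :0) :+ x :* :1 := x :+ y) refl (y F.^ suc n) (x F.^ suc n) ⟩
      x F.^ suc n F.+ y F.^ suc n ∎
      where
      middle : ∀ k → k ℕ.< n → term (suc n) (suc k) ≡ F.0#
      middle k k<n with subst (λ n → n ℕ.∣ (n ℕ.C suc k)) (≡.sym e) (p∣pCk (subst (suc k ℕ.<_) e (s≤s k<n)))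
      ... | ℕ.divides c eq = ≡.trans (cong (F._· (x F.^ suc k F.* y F.^ (n ∸ k))) (≡.trans eq (cong (c ℕ.*_) e))) (multiple·≡0 c _)

  frobenius-0 : F.0# F.^ p ≡ F.0#
  frobenius-0 = subst (λ n → F.0# F.^ n ≡ F.0#) (ℕ.suc-pred p) (zeroˡ _)

  frobenius-∑ : ∀ N f → (∑< N f) F.^ p ≡ ∑< N (λ i → f i F.^ p)
  frobenius-∑ zero    f = frobenius-0
  frobenius-∑ (suc N) f = ≡.trans (frobenius-+ (f 0) _) (cong (f 0 F.^ p F.+_) (frobenius-∑ N (f ∘ suc)))

  frobenius-iterate : ∀ x j → (x F.^ (p ℕ.^ j)) F.^ p ≡ x F.^ (p ℕ.^ suc j)
  frobenius-iterate x j = ≡.trans (^-assocʳ x (p ℕ.^ j) p) (cong (x F.^_) (ℕ.*-comm (p ℕ.^ j) p))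

  frobenius-^-+ : ∀ j x y → (x F.+ y) F.^ (p ℕ.^ j) ≡ x F.^ (p ℕ.^ j) F.+ y F.^ (p ℕ.^ j)
  frobenius-^-+ zero    x y = solve 2 (λ x y → (x :+ y) :* :1 := x :* :1 :+ y :* :1) refl x y
  frobenius-^-+ (suc j) x y = begin
    (x F.+ y) F.^ (p ℕ.^ suc j)                              ≡⟨ frobenius-iterate (x F.+ y) j ⟨
    ((x F.+ y) F.^ (p ℕ.^ j)) F.^ p                          ≡⟨ cong (F._^ p) (frobenius-^-+ j x y) ⟩
    (x F.^ (p ℕ.^ j) F.+ y F.^ (p ℕ.^ j)) F.^ p              ≡⟨ frobenius-+ _ _ ⟩
    (x F.^ (p ℕ.^ j)) F.^ p F.+ (y F.^ (p ℕ.^ j)) F.^ p      ≡⟨ cong₂ F._+_ (frobenius-iterate x j) (frobenius-iterate y j) ⟩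
    x F.^ (p ℕ.^ suc j) F.+ y F.^ (p ℕ.^ suc j)              ∎

  ∏ : List F.Carrier → F.Carrier
  ∏ = foldr F._*_ F.1#

  ∏-↭ : ∀ {xs ys} → xs Perm.↭ ys → ∏ xs ≡ ∏ ys
  ∏-↭ Perm.refl         = refl
  ∏-↭ (Perm.prep x r)   = cong (x F.*_) (∏-↭ r)
  ∏-↭ (Perm.swap x y r) = ≡.trans (cong (λ t → x F.* (y F.* t)) (∏-↭ r)) (solve 3 (λ x y t → x :* (y :* t) := y :* (x :* t)) refl x y _)
  ∏-↭ (Perm.trans r s)  = ≡.trans (∏-↭ r) (∏-↭ s)

  ∏-scale : ∀ x xs → ∏ (map (x F.*_) xs) ≡ x F.^ length xs F.* ∏ xs
  ∏-scale x []       = ≡.sym (*-identityˡ F.1#)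
  ∏-scale x (y ∷ xs) = ≡.trans (cong (x F.* y F.*_) (∏-scale x xs))
    (solve 4 (λ x y e t → (x :* y) :* (e :* t) := (x :* e) :* (y :* t)) refl x y (x F.^ length xs) (∏ xs))

  ∏≢0 : ∀ xs → (∀ {x} → x ∈ xs → x ≢ F.0#) → ∏ xs ≢ F.0#
  ∏≢0 []       ≢0 e = F.1≢0 e
  ∏≢0 (x ∷ xs) ≢0 e = ∏≢0 xs (≢0 ∘ there) (0∤ (≢0 (here refl)) e)

  q≡1+units : F.q ≡ suc (length F.units)
  q≡1+units = ≡.trans (≡.sym length-elements) (↭-length (∼bag⇒↭ (unique∧set⇒bag elements-unique
    (All.tabulate (λ x∈ e → ∈-units⁻ x∈ (≡.sym e)) ∷ units-unique) (mk⇔ split (λ _ → ∈-elements _)))))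
    where
    split : ∀ {x} → x ∈ F.elements → x ∈ F.0# ∷ F.units
    split {x} _ with x F.≟ F.0#
    ... | yes e  = here e
    ... | no x≢0 = there (∈-units x≢0)

  -- Multiplication by x permutes the units, so their product Π is also x^n Π, and Π is invertible.
  unit-power : ∀ {x} → x ≢ F.0# → x F.^ length F.units ≡ F.1#
  unit-power {x} x≢0 = begin
    x F.^ n                         ≡⟨ *-identityʳ _ ⟨
    x F.^ n F.* F.1#                ≡⟨ cong (x F.^ n F.*_) (F.⁻¹-inverse Π≢0) ⟨
    x F.^ n F.* (Π F.* Π F.⁻¹)      ≡⟨ *-assoc _ _ _ ⟨
    x F.^ n F.* Π F.* Π F.⁻¹        ≡⟨ cong (F._* Π F.⁻¹) (∏-scale x F.units) ⟨
    ∏ (map (x F.*_) F.units) F.* Π F.⁻¹ ≡⟨ cong (F._* Π F.⁻¹) (∏-↭ (∼bag⇒↭ (unique∧set⇒bag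
      (Unique.map⁺ (λ {y} {z} e → ≡.trans (≡.sym (cancel y)) (≡.trans (cong (x F.⁻¹ F.*_) e) (cancel z))) units-unique)
      units-unique (mk⇔ forth back)))) ⟩
    Π F.* Π F.⁻¹                    ≡⟨ F.⁻¹-inverse Π≢0 ⟩
    F.1#                            ∎
    where
    n = length F.units
    Π = ∏ F.units
    Π≢0 : Π ≢ F.0#
    Π≢0 = ∏≢0 F.units ∈-units⁻
    cancel : ∀ y → x F.⁻¹ F.* (x F.* y) ≡ y
    cancel y = ≡.trans (solve 3 (λ a b y → a :* (b :* y) := (b :* a) :* y) refl (x F.⁻¹) x y) (≡.trans (cong (F._* y) (F.⁻¹-inverse x≢0)) (*-identityˡ y))
    forth : ∀ {y} → y ∈ map (x F.*_) F.units → y ∈ F.units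
    forth y∈ with ∈-map⁻ (x F.*_) y∈
    ... | z , z∈ , refl = ∈-units (λ e → ∈-units⁻ z∈ (0∤ x≢0 e))
    back : ∀ {y} → y ∈ F.units → y ∈ map (x F.*_) F.units
    back {y} y∈ = subst (_∈ map (x F.*_) F.units) (≡.trans (solve 3 (λ a b y → b :* (a :* y) := (b :* a) :* y) refl (x F.⁻¹) x y)
        (≡.trans (cong (F._* y) (F.⁻¹-inverse x≢0)) (*-identityˡ y)))
      (∈-map⁺ (x F.*_) (∈-units (λ e → ∈-units⁻ y∈ (0∤ x⁻¹≢0 e))))
      where
      x⁻¹≢0 : x F.⁻¹ ≢ F.0#
      x⁻¹≢0 e = F.1≢0 (≡.trans (≡.sym (F.⁻¹-inverse x≢0)) (≡.trans (cong (x F.*_) e) (zeroʳ x)))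

  fermat : ∀ x → x F.^ F.q ≡ x
  fermat x = ≡.trans (cong (x F.^_) q≡1+units) (by-cases (x F.≟ F.0#))
    where
    by-cases : Dec (x ≡ F.0#) → x F.* x F.^ length F.units ≡ x
    by-cases (yes refl) = zeroˡ _
    by-cases (no x≢0)   = ≡.trans (cong (x F.*_) (unit-power x≢0)) (*-identityʳ x)

  Tr-+ : ∀ x y → F.Tr (x F.+ y) ≡ F.Tr x F.+ F.Tr y
  Tr-+ x y = ≡.trans (∑<-cong η (λ j → (x F.+ y) F.^ (p ℕ.^ j)) (λ j → x F.^ (p ℕ.^ j) F.+ y F.^ (p ℕ.^ j)) (λ j → frobenius-^-+ j x y))
    (∑<-+ η (λ j → x F.^ (p ℕ.^ j)) (λ j → y F.^ (p ℕ.^ j)))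

  -- The p-th power moves each conjugate to the next one, and y^q = y closes the cycle.
  Tr-frobenius : ∀ y → F.Tr y F.^ p ≡ F.Tr y
  Tr-frobenius y = begin
    F.Tr y F.^ p
      ≡⟨ frobenius-∑ η (λ j → y F.^ (p ℕ.^ j)) ⟩
    ∑< η (λ j → (y F.^ (p ℕ.^ j)) F.^ p)
      ≡⟨ ∑<-cong η _ (λ j → y F.^ (p ℕ.^ suc j)) (frobenius-iterate y) ⟩
    ∑< η (λ j → y F.^ (p ℕ.^ suc j))
      ≡⟨ solve 2 (λ y s → s := (y :+ s) :- y) refl (y F.^ 1) _ ⟩
    ∑< (suc η) (λ j → y F.^ (p ℕ.^ j)) F.+ F.- (y F.^ 1)
      ≡⟨ cong (F._+ F.- (y F.^ 1)) (∑<-last η (λ j → y F.^ (p ℕ.^ j))) ⟩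
    (F.Tr y F.+ y F.^ F.q) F.+ F.- (y F.^ 1)
      ≡⟨ cong₂ (λ s t → (F.Tr y F.+ s) F.+ F.- t) (fermat y) (*-identityʳ y) ⟩
    (F.Tr y F.+ y) F.+ F.- y
      ≡⟨ solve 2 (λ t y → (t :+ y) :- y := t) refl (F.Tr y) y ⟩
    F.Tr y ∎

  -- A Bézout relation between n and p would express 1 through n · 1 and p · 1, both of which are 0.
  ·1≢0 : ∀ {n} → .{{NonZero n}} → n ℕ.< p → n F.· F.1# ≢ F.0#
  ·1≢0 {n} n<p e with ℕ.coprime-Bézout (ℕ.prime⇒coprime F.p-prime n<p)
  ... | ℕ.Bézout.Identity.+- x y eq = F.1≢0 (≡.trans (≡.sym (+-identityʳ F.1#)) (≡.trans (cong (F.1# F.+_) (≡.sym (≡.trans (×1-homo-* y n)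
          (≡.trans (cong (y F.· F.1# F.*_) e) (zeroʳ _))))) (≡.trans (cong (F._· F.1#) eq) (multiple·≡0 x F.1#))))
  ... | ℕ.Bézout.Identity.-+ x y eq = F.1≢0 (≡.trans (≡.sym (+-identityʳ F.1#)) (≡.trans (cong (F.1# F.+_) (≡.sym (multiple·≡0 x F.1#)))
          (≡.trans (cong (F._· F.1#) eq) (≡.trans (×1-homo-* y n) (≡.trans (cong (y F.· F.1# F.*_) e) (zeroʳ _))))))

  ·1-injective-≤ : ∀ {a b} → a ≤ b → b ℕ.< p → a F.· F.1# ≡ b F.· F.1# → a ≡ b
  ·1-injective-≤ {a} {b} a≤b b<p e with b ∸ a in eq
  ... | zero  = ℕ.≤-antisym a≤b (ℕ.m∸n≡0⇒m≤n eq)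
  ... | suc d = contradiction vanishes (·1≢0 {suc d} (ℕ.≤-<-trans (subst (_≤ b) eq (ℕ.m∸n≤m b a)) b<p))
    where
    vanishes : suc d F.· F.1# ≡ F.0#
    vanishes = begin
      suc d F.· F.1#                                        ≡⟨ solve 2 (λ s t → s := (t :+ s) :- t) refl (suc d F.· F.1#) (a F.· F.1#) ⟩
      (a F.· F.1# F.+ suc d F.· F.1#) F.+ F.- (a F.· F.1#)  ≡⟨ cong (F._+ F.- (a F.· F.1#)) (×-homo-+ F.1# a (suc d)) ⟨
      (a ℕ.+ suc d) F.· F.1# F.+ F.- (a F.· F.1#)           ≡⟨ cong (λ n → n F.· F.1# F.+ F.- (a F.· F.1#)) (≡.trans (cong (a ℕ.+_) (≡.sym eq)) (ℕ.m+[n∸m]≡n a≤b)) ⟩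
      b F.· F.1# F.+ F.- (a F.· F.1#)                       ≡⟨ cong (λ t → b F.· F.1# F.+ F.- t) e ⟩
      b F.· F.1# F.+ F.- (b F.· F.1#)                       ≡⟨ -‿inverseʳ _ ⟩
      F.0#                                                  ∎

  ·1-injective : ∀ {a b} → a ℕ.< p → b ℕ.< p → a F.· F.1# ≡ b F.· F.1# → a ≡ b
  ·1-injective {a} {b} a<p b<p e with ℕ.≤-total a b
  ... | inj₁ a≤b = ·1-injective-≤ a≤b b<p e
  ... | inj₂ b≤a = ≡.sym (·1-injective-≤ b≤a a<p (≡.sym e))

  ·1-frobenius : ∀ a → (a F.· F.1#) F.^ p ≡ a F.· F.1#
  ·1-frobenius zero    = frobenius-0
  ·1-frobenius (suc a) = ≡.trans (frobenius-+ F.1# (a F.· F.1#)) (cong₂ F._+_ (one-power p) (·1-frobenius a))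
    where
    one-power : ∀ n → F.1# F.^ n ≡ F.1#
    one-power zero    = refl
    one-power (suc n) = ≡.trans (*-identityˡ _) (one-power n)

  primeField : List F.Carrier
  primeField = map (F._· F.1#) (List.upTo p)

  -- T^p - T already has the p elements of the prime field as roots; a further root would be one too
  -- many for its degree.
  fixed-in-primeField : ∀ z → z F.^ p ≡ z → z ∈ primeField
  fixed-in-primeField z fixed with any? (z F.≟_) primeField
  ... | yes z∈ = z∈
  ... | no  z∉ = contradiction (too-many-roots f (z ∷ primeField)
          (All.tabulate (λ {y} y∈ z≡y → z∉ (subst (_∈ primeField) (≡.sym z≡y) y∈)) ∷ distinct)
          (ℕ.≤-reflexive (≡.trans length-f (cong suc (≡.sym (≡.trans (List.length-map (F._· F.1#) (List.upTo p)) (List.length-upTo p))))))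
          roots) f≉0
    where
    f : P.Poly
    -- T^p - T by its coefficients; the shift by two is legitimate because p is at least 2, and it
    -- keeps the coefficient of T apart from the leading one.
    f = F.0# ∷ F.- F.1# ∷ monomialₚ (p ∸ 2)
    2+[p-2] : 2 ℕ.+ (p ∸ 2) ≡ p
    2+[p-2] = ℕ.m+[n∸m]≡n (ℕ.nonTrivial⇒n>1 p {{prime⇒nonTrivial F.p-prime}})
    length-f : length f ≡ suc p
    length-f = ≡.trans (cong (suc ∘ suc) (length-monomialₚ (p ∸ 2))) (cong suc 2+[p-2])
    f≉0 : ¬ (f P.≈ [])
    f≉0 f≈0 = F.1≢0 (≡.trans (≡.sym (coeff-monomialₚ (p ∸ 2))) (f≈0 (2 ℕ.+ (p ∸ 2))))
    value-f : ∀ x → value f x ≡ x F.^ p F.+ F.- x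
    value-f x = begin
      value f x
        ≡⟨ ≡.trans (value-∷ F.0# (F.- F.1# ∷ monomialₚ (p ∸ 2)) x) (cong (λ t → F.0# F.+ x F.* t) (≡.trans (value-∷ (F.- F.1#) (monomialₚ (p ∸ 2)) x)
             (cong (λ t → F.- F.1# F.+ x F.* t) (value-monomialₚ (p ∸ 2) x)))) ⟩
      F.0# F.+ x F.* (F.- F.1# F.+ x F.* x F.^ (p ∸ 2))
        ≡⟨ solve 2 (λ x e → :0 :+ x :* (:- :1 :+ x :* e) := x :* (x :* e) :- x) refl x _ ⟩
      x F.^ (2 ℕ.+ (p ∸ 2)) F.+ F.- x
        ≡⟨ cong (λ n → x F.^ n F.+ F.- x) 2+[p-2] ⟩
      x F.^ p F.+ F.- x ∎
    root : ∀ {x} → x F.^ p ≡ x → value f x ≡ F.0#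
    root {x} e = ≡.trans (value-f x) (≡.trans (cong (F._+ F.- x) e) (-‿inverseʳ x))
    roots : ∀ {x} → x ∈ z ∷ primeField → value f x ≡ F.0#
    roots (here refl) = root fixed
    roots (there x∈) with ∈-map⁻ (F._· F.1#) x∈
    ... | a , _ , refl = root (·1-frobenius a)
    distinct : Unique primeField
    distinct = distinct-map (List.upTo p) (Unique.upTo⁺ p) ∈-upTo⁻
      where
      distinct-map : ∀ as → Unique as → (∀ {a} → a ∈ as → a ℕ.< p) → Unique (map (F._· F.1#) as)
      distinct-map []       _          _  = []
      distinct-map (a ∷ as) (a∉ ∷ u) <p = All.map⁺ (All.tabulate (λ b∈ e → All.lookup a∉ b∈ (·1-injective (<p (here refl)) (<p (there b∈)) e)))
        ∷ distinct-map as u (<p ∘ there)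

  -- The trace is fixed by Frobenius and hence lies in the prime field, so the list of candidates in
  -- `trace` is nonempty and its head, not the default 0, is taken.
  trace-spec : ∀ y → F.trace y ℕ.< p × (F.trace y) F.· F.1# ≡ F.Tr y
  trace-spec y = from-member (∈-map⁻ (F._· F.1#) (fixed-in-primeField (F.Tr y) (Tr-frobenius y)))
    where
    candidates : List ℕ
    candidates = List.filter (λ a → (a F.· F.1#) F.≟ F.Tr y) (List.upTo p)
    found : ∀ {a} → a ∈ candidates → ∀ as → as ≡ candidates →
      fromMaybe 0 (List.head as) ℕ.< p × (fromMaybe 0 (List.head as)) F.· F.1# ≡ F.Tr y
    found a∈ []       eq   = contradiction (subst (_ ∈_) (≡.sym eq) a∈) (λ ())
    found a∈ (b ∷ as) eq   = in-candidates (∈-filter⁻ (λ a → (a F.· F.1#) F.≟ F.Tr y) {xs = List.upTo p} (subst (b ∈_) eq (here refl)))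
      where
      in-candidates : b ∈ List.upTo p × b F.· F.1# ≡ F.Tr y → b ℕ.< p × b F.· F.1# ≡ F.Tr y
      in-candidates (b∈ , e) = ∈-upTo⁻ b∈ , e
    from-member : (∃[ a ] a ∈ List.upTo p × F.Tr y ≡ a F.· F.1#) → F.trace y ℕ.< p × (F.trace y) F.· F.1# ≡ F.Tr y
    from-member (a , a∈ , e) = found (∈-filter⁺ (λ a → (a F.· F.1#) F.≟ F.Tr y) a∈ (≡.sym e)) candidates refl

  -- Two representatives below p add up to less than 2 p, so the carry k is 0 or 1.
  trace-+ : ∀ x y → ∃[ k ] F.trace x ℕ.+ F.trace y ≡ F.trace (x F.+ y) ℕ.+ k ℕ.* p
  trace-+ x y = wrap (ℕ.<-≤-connex s p)
    where
    s = F.trace x ℕ.+ F.trace y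
    s·1 : s F.· F.1# ≡ F.trace (x F.+ y) F.· F.1#
    s·1 = ≡.trans (×-homo-+ F.1# (F.trace x) (F.trace y)) (≡.trans (cong₂ F._+_ (proj₂ (trace-spec x)) (proj₂ (trace-spec y)))
      (≡.trans (≡.sym (Tr-+ x y)) (≡.sym (proj₂ (trace-spec (x F.+ y))))))
    wrap : s ℕ.< p ⊎ p ≤ s → ∃[ k ] s ≡ F.trace (x F.+ y) ℕ.+ k ℕ.* p
    wrap (inj₁ s<p) = 0 , ≡.trans (·1-injective s<p (proj₁ (trace-spec (x F.+ y))) s·1) (≡.sym (ℕ.+-identityʳ _))
    wrap (inj₂ p≤s) = 1 , ≡.trans (≡.sym (ℕ.m∸n+n≡m p≤s)) (cong₂ ℕ._+_
      (·1-injective (ℕ.m<n+o⇒m∸n<o s p (ℕ.+-mono-< (proj₁ (trace-spec x)) (proj₁ (trace-spec y)))) (proj₁ (trace-spec (x F.+ y)))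
        (≡.trans reduce s·1)) (≡.sym (ℕ.*-identityˡ p)))
      where
      reduce : (s ∸ p) F.· F.1# ≡ s F.· F.1#
      reduce = begin
        (s ∸ p) F.· F.1#                       ≡⟨ +-identityʳ _ ⟨
        (s ∸ p) F.· F.1# F.+ F.0#              ≡⟨ cong ((s ∸ p) F.· F.1# F.+_) p·1≡0 ⟨
        (s ∸ p) F.· F.1# F.+ p F.· F.1#        ≡⟨ ×-homo-+ F.1# (s ∸ p) p ⟨
        (s ∸ p ℕ.+ p) F.· F.1#                 ≡⟨ cong (F._· F.1#) (ℕ.m∸n+n≡m p≤s) ⟩
        s F.· F.1#                             ∎

  -- The sum of T^(p^j) over e ≤ j < e + n. The offset e makes the recursion structural; the trace
  -- is the case n = η, e = 0.
  tracePolynomial : ℕ → ℕ → P.Poly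
  tracePolynomial zero    e = []
  tracePolynomial (suc n) e = monomialₚ (p ℕ.^ e) P.+ tracePolynomial n (suc e)

  value-tracePolynomial : ∀ n e x → value (tracePolynomial n e) x ≡ ∑< n (λ j → x F.^ (p ℕ.^ (e ℕ.+ j)))
  value-tracePolynomial zero    e x = refl
  value-tracePolynomial (suc n) e x = ≡.trans (dot-+ (monomialₚ (p ℕ.^ e)) _ (powers x)) (cong₂ F._+_
    (≡.trans (value-monomialₚ (p ℕ.^ e) x) (cong (λ k → x F.^ (p ℕ.^ k)) (≡.sym (ℕ.+-identityʳ e))))
    (≡.trans (value-tracePolynomial n (suc e) x) (∑<-cong n _ (λ j → x F.^ (p ℕ.^ (e ℕ.+ suc j))) (λ j → cong (λ k → x F.^ (p ℕ.^ k)) (≡.sym (ℕ.+-suc e j))))))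

  length-+ : ∀ f g {n} → length f ≤ n → length g ≤ n → length (f P.+ g) ≤ n
  length-+ []      g       l  l′ = l′
  length-+ (a ∷ f) []      l  l′ = l
  length-+ (a ∷ f) (b ∷ g) (s≤s l) (s≤s l′) = s≤s (length-+ f g l l′)

  length-tracePolynomial : ∀ n e → length (tracePolynomial n e) ≤ p ℕ.^ (n ℕ.+ e)
  length-tracePolynomial zero    e = z≤n
  length-tracePolynomial (suc n) e = length-+ (monomialₚ (p ℕ.^ e)) _
    (subst (_≤ p ℕ.^ (suc n ℕ.+ e)) (≡.sym (length-monomialₚ (p ℕ.^ e))) (ℕ.^-monoʳ-< p 1<p (s≤s (ℕ.m≤n+m e n))))
    (subst (λ k → length (tracePolynomial n (suc e)) ≤ p ℕ.^ k) (ℕ.+-suc n e) (length-tracePolynomial n (suc e)))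

  coeff-monomialₚ-1 : ∀ n → 1 ℕ.< n → P.coeff (monomialₚ n) 1 ≡ F.0#
  coeff-monomialₚ-1 (suc zero)    (s≤s ())
  coeff-monomialₚ-1 (suc (suc n)) _ = refl

  coeff-tracePolynomial : ∀ n e → P.coeff (tracePolynomial n (suc e)) 1 ≡ F.0#
  coeff-tracePolynomial zero    e = refl
  coeff-tracePolynomial (suc n) e = ≡.trans (coeff-+ (monomialₚ (p ℕ.^ suc e)) _ 1) (≡.trans (cong₂ F._+_
    (coeff-monomialₚ-1 (p ℕ.^ suc e) (ℕ.≤-trans (s≤s (ℕ.m^n>0 p e)) (ℕ.^-monoʳ-< p 1<p (ℕ.n<1+n e)))) (coeff-tracePolynomial n (suc e))) (+-identityʳ F.0#))

  η≢0 : η ≢ 0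
  η≢0 e = F.1≢0 (≡.trans (≡.sym (+-identityʳ F.1#)) (≡.trans (cong (λ n → (p ℕ.^ n) F.· F.1#) (≡.sym e)) q·1≡0))

  tracePolynomial≉0 : ∀ n → n ≢ 0 → ¬ (tracePolynomial n 0 P.≈ [])
  tracePolynomial≉0 zero    n≢0 _ = n≢0 refl
  tracePolynomial≉0 (suc n) n≢0 ≈0 = F.1≢0 (≡.trans (≡.sym (≡.trans (coeff-+ (monomialₚ 1) (tracePolynomial n 1) 1)
    (≡.trans (cong (F.1# F.+_) (coeff-tracePolynomial n 0)) (+-identityʳ F.1#)))) (≈0 1))

  -- Otherwise all q elements would be roots of the trace polynomial, which has degree p^(η-1) < q
  -- and is not zero: its coefficient of T is 1, as all summands but the first have degree at least
  -- p.
  trace-nonzero : ∃[ y ] F.trace y ≢ 0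
  trace-nonzero with any? (λ y → ¬? (F.Tr y F.≟ F.0#)) F.elements
  ... | yes a = let (y , _ , Try≢0) = find a in y , λ e → Try≢0 (≡.trans (≡.sym (proj₂ (trace-spec y))) (cong (F._· F.1#) e))
  ... | no ¬a = contradiction (too-many-roots (tracePolynomial η 0) F.elements elements-unique
          (subst (length (tracePolynomial η 0) ≤_) (≡.trans (cong (p ℕ.^_) (ℕ.+-identityʳ η)) (≡.sym length-elements)) (length-tracePolynomial η 0))
          (λ {y} y∈ → ≡.trans (value-tracePolynomial η 0 y) (vanishing y y∈)))
        (tracePolynomial≉0 η η≢0)
    where
    vanishing : ∀ y → y ∈ F.elements → F.Tr y ≡ F.0#
    vanishing y y∈ with F.Tr y F.≟ F.0#
    ... | yes e = e
    ... | no ≢0 = contradiction (lose y∈ ≢0) ¬a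

-- Real numbers: order and limits

module RealAnalysis {r ℓ₁ ℓ₂} (ℝ : RealNumbers r ℓ₁ ℓ₂) where
  open RealNumbers ℝ using (Carrier; _≈_; _+_; _*_; -_; _-_; 0#; 1#; _#_; _<_; _·_; _⟶_; 1/_; isCommutativeRing; isStrictPartialOrder;
    tight; #-cotrans; #-sym; #⇒<⊎>; <⇒#; 0<1; 0<1+n; +-monoˡ-<; *-positive; archimedean; #⇒invertible; invertible⇒#)
  private module < = IsStrictPartialOrder isStrictPartialOrder

  realRing : CommutativeRing r ℓ₁
  realRing = record { isCommutativeRing = isCommutativeRing }

  open IntegerSolver realRing
  open RingLaws realRing public using (semiring; ≈-refl; sym; trans; reflexive; +-cong; +-congˡ; +-congʳ; *-cong; *-congˡ; *-congʳ; -‿cong; +-assoc; +-comm; +-identityˡ; +-identityʳ; -‿inverseˡ; -‿inverseʳ; *-assoc; *-comm; *-identityˡ; *-identityʳ; zeroˡ; zeroʳ; distribˡ; distribʳ)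
  open MultProperties semiring using (×-homo-+)
  open RingReasoning realRing

  -- Apartness is not decidable, so trichotomy holds only under a double negation. That suffices for
  -- proving `≈` and `≤ᵣ`, which are stable.
  tri : ∀ x y → ¬ ¬ (x < y ⊎ x ≈ y ⊎ y < x)
  tri x y k = k (inj₂ (inj₁ (proj₁ (tight x y) (λ x#y → k (split (#⇒<⊎> x#y))))))
    where
    split : x < y ⊎ y < x → x < y ⊎ x ≈ y ⊎ y < x
    split (inj₁ x<y) = inj₁ x<y
    split (inj₂ y<x) = inj₂ (inj₂ y<x)

  ≈-stable : ∀ {x y} → ¬ ¬ (x ≈ y) → x ≈ y
  ≈-stable {x} {y} ¬¬e = proj₁ (tight x y) (λ x#y → ¬¬e (λ e → proj₂ (tight x y) e x#y))

  <-irrefl : ∀ {x} → ¬ (x < x)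
  <-irrefl = <.irrefl ≈-refl

  <-resp : ∀ {x x′ y y′} → x ≈ x′ → y ≈ y′ → x < y → x′ < y′
  <-resp e e′ = <.<-respˡ-≈ e ∘ <.<-respʳ-≈ e′

  infix 4 _≤ᵣ_
  -- A negation, so that it can be established by the case distinction in `tri`.
  _≤ᵣ_ : Carrier → Carrier → Set ℓ₂
  x ≤ᵣ y = ¬ (y < x)

  ≤ᵣ-reflexive : ∀ {x y} → x ≈ y → x ≤ᵣ y
  ≤ᵣ-reflexive e y<x = <-irrefl (<-resp ≈-refl e y<x)

  <⇒≤ᵣ : ∀ {x y} → x < y → x ≤ᵣ y
  <⇒≤ᵣ x<y y<x = <-irrefl (<.trans x<y y<x)

  -- The strict conclusion carries positive information, which `tri` cannot supply; it is obtained
  -- by cotransitivity, comparing z with both ends of x < y.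
  <-≤-trans : ∀ {x y z} → x < y → y ≤ᵣ z → x < z
  <-≤-trans {x} {y} {z} x<y y≤z with #-cotrans (<⇒# x<y) z
  ... | inj₁ x#z = from (#⇒<⊎> x#z)
    where
    from : x < z ⊎ z < x → x < z
    from (inj₁ x<z) = x<z
    from (inj₂ z<x) = contradiction (<.trans z<x x<y) y≤z
  ... | inj₂ z#y = from (#⇒<⊎> z#y)
    where
    from : z < y ⊎ y < z → x < z
    from (inj₁ z<y) = contradiction z<y y≤z
    from (inj₂ y<z) = <.trans x<y y<z

  +-mono-< : ∀ {x y z w} → x < y → z < w → x + z < y + w
  +-mono-< {x} {y} {z} {w} x<y z<w = <.trans (+-monoˡ-< z x<y) (<-resp (+-comm z y) (+-comm w y) (+-monoˡ-< y z<w))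

  shift-< : ∀ {x y x′ y′} z → x + z ≈ x′ → y + z ≈ y′ → x < y → x′ < y′
  shift-< z e e′ x<y = <-resp e e′ (+-monoˡ-< z x<y)

  neg-< : ∀ {x y} → x < y → - y < - x
  neg-< {x} {y} = shift-< (- x - y) (solve 2 (λ x y → x :+ (:- x :- y) := :- y) ≈-refl x y)
    (solve 2 (λ x y → y :+ (:- x :- y) := :- x) ≈-refl x y)

  ≤ᵣ-trans : ∀ {x y z} → x ≤ᵣ y → y ≤ᵣ z → x ≤ᵣ z
  ≤ᵣ-trans {x} {y} {z} x≤y y≤z z<x = tri x y λ
    { (inj₁ x<y)        → y≤z (<.trans z<x x<y)
    ; (inj₂ (inj₁ x≈y)) → y≤z (<-resp ≈-refl x≈y z<x)
    ; (inj₂ (inj₂ y<x)) → x≤y y<x }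

  +-mono-≤ : ∀ {x y z w} → x ≤ᵣ y → z ≤ᵣ w → x + z ≤ᵣ y + w
  +-mono-≤ {x} {y} {z} {w} x≤y z≤w = ≤ᵣ-trans {y = y + z}
    (λ l → x≤y (shift-< (- z) (cancel y z) (cancel x z) l))
    (λ l → z≤w (shift-< (- y) (cancel′ w y) (cancel′ z y) l))
    where
    cancel : ∀ a b → (a + b) + - b ≈ a
    cancel = solve 2 (λ a b → (a :+ b) :- b := a) ≈-refl
    cancel′ : ∀ a b → (b + a) + - b ≈ a
    cancel′ = solve 2 (λ a b → (b :+ a) :- b := a) ≈-refl

  ≤ᵣ-resp : ∀ {x x′ y y′} → x ≈ x′ → y ≈ y′ → x ≤ᵣ y → x′ ≤ᵣ y′
  ≤ᵣ-resp e e′ x≤y l = x≤y (<-resp (sym e′) (sym e) l)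

  neg-≤ : ∀ {x y} → x ≤ᵣ y → - y ≤ᵣ - x
  neg-≤ {x} {y} x≤y l = x≤y (<-resp (involutive y) (involutive x) (neg-< l))
    where
    involutive : ∀ a → - - a ≈ a
    involutive = solve 1 (λ a → :- :- a := a) ≈-refl

  0≤-* : ∀ {x y} → 0# ≤ᵣ x → 0# ≤ᵣ y → 0# ≤ᵣ x * y
  0≤-* {x} {y} 0≤x 0≤y xy<0 = tri 0# x λ
    { (inj₂ (inj₂ x<0)) → 0≤x x<0
    ; (inj₂ (inj₁ 0≈x)) → <-irrefl (<-resp (trans (*-congʳ (sym 0≈x)) (zeroˡ y)) ≈-refl xy<0)
    ; (inj₁ 0<x) → tri 0# y λ
      { (inj₂ (inj₂ y<0)) → 0≤y y<0
      ; (inj₂ (inj₁ 0≈y)) → <-irrefl (<-resp (trans (*-congˡ (sym 0≈y)) (zeroʳ x)) ≈-refl xy<0)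
      ; (inj₁ 0<y) → <-irrefl (<.trans xy<0 (*-positive 0<x 0<y)) } }

  *-monoˡ-≤ : ∀ {k x y} → 0# ≤ᵣ k → x ≤ᵣ y → k * x ≤ᵣ k * y
  *-monoˡ-≤ {k} {x} {y} 0≤k x≤y = ≤ᵣ-resp (solve 2 (λ k x → :0 :+ k :* x := k :* x) ≈-refl k x)
    (solve 3 (λ k x y → k :* (y :- x) :+ k :* x := k :* y) ≈-refl k x y)
    (+-mono-≤ (0≤-* 0≤k (≤ᵣ-resp (-‿inverseʳ x) ≈-refl (+-mono-≤ x≤y (≤ᵣ-reflexive (≈-refl { - x }))))) (≤ᵣ-reflexive (≈-refl {k * x})))

  positive-square : ∀ {x} → x # 0# → 0# < x * x
  positive-square {x} x#0 with #⇒<⊎> x#0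
  ... | inj₁ x<0 = <-resp ≈-refl (solve 1 (λ x → (:- x) :* (:- x) := x :* x) ≈-refl x) (*-positive 0<-x 0<-x)
    where
    0<-x : 0# < - x
    0<-x = <-resp (solve 0 (:- :0 := :0) ≈-refl) ≈-refl (neg-< x<0)
  ... | inj₂ 0<x = *-positive 0<x 0<x

  0≤-square : ∀ x → 0# ≤ᵣ x * x
  0≤-square x x²<0 = tri x 0# λ
    { (inj₁ x<0)        → <-irrefl (<.trans x²<0 (positive-square (<⇒# x<0)))
    ; (inj₂ (inj₁ x≈0)) → <-irrefl (<-resp (trans (*-congʳ x≈0) (zeroˡ x)) ≈-refl x²<0)
    ; (inj₂ (inj₂ 0<x)) → <-irrefl (<.trans x²<0 (positive-square (#-sym (<⇒# 0<x)))) }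

  -- The axiom of the Heyting field inverts the difference `x - 0#`; only this subtraction has to be
  -- removed.
  invertible : ∀ {x} → x # 0# → ∃[ y ] x * y ≈ 1#
  invertible {x} x#0 with #⇒invertible x#0
  ... | y , _ , e = y , trans (*-congʳ (solve 1 (λ x → x := x :- :0) ≈-refl x)) e

  cancelˡ : ∀ {d x y} → d # 0# → d * x ≈ d * y → x ≈ y
  cancelˡ {d} {x} {y} d#0 e with invertible d#0
  ... | d⁻¹ , inv = begin
    x              ≈⟨ trans (sym (*-identityˡ x)) (*-congʳ (sym inv)) ⟩
    d * d⁻¹ * x    ≈⟨ solve 3 (λ d i x → d :* i :* x := i :* (d :* x)) ≈-refl d d⁻¹ x ⟩
    d⁻¹ * (d * x)  ≈⟨ *-congˡ e ⟩
    d⁻¹ * (d * y)  ≈⟨ solve 3 (λ d i x → i :* (d :* x) := d :* i :* x) ≈-refl d d⁻¹ y ⟩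
    d * d⁻¹ * y    ≈⟨ trans (*-congʳ inv) (*-identityˡ y) ⟩
    y              ∎

  1/-inverse : ∀ n .{{_ : NonZero n}} → n · 1# * (1/ n) ≈ 1#
  1/-inverse (suc n) with #⇒invertible (#-sym (<⇒# (0<1+n n)))
  ... | y , _ , e = trans (*-congʳ (solve 1 (λ x → x := x :- :0) ≈-refl (suc n · 1#))) e

  1/-positive : ∀ n .{{_ : NonZero n}} → 0# < 1/ n
  1/-positive n@(suc n-1) = from (#⇒<⊎> 1/n#0)
    where
    1/n#0 : 1/ n # 0#
    1/n#0 = invertible⇒# (n · 1# , trans (*-congˡ (solve 1 (λ x → x :- :0 := x) ≈-refl _)) (1/-inverse n)
      , trans (*-congʳ (solve 1 (λ x → x :- :0 := x) ≈-refl _)) (trans (*-comm _ _) (1/-inverse n)))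
    from : 1/ n < 0# ⊎ 0# < 1/ n → 0# < 1/ n
    from (inj₂ 0<) = 0<
    from (inj₁ <0) = contradiction (<.trans (<-resp ≈-refl (trans (solve 2 (λ a b → a :* (:- b) := :- (a :* b)) ≈-refl (n · 1#) (1/ n)) (-‿cong (1/-inverse n)))
        (*-positive (0<1+n n-1) (<-resp (solve 0 (:- :0 := :0) ≈-refl) ≈-refl (neg-< <0)))) -1<0) <-irrefl
      where
      -1<0 : - 1# < 0#
      -1<0 = <-resp ≈-refl (solve 0 (:- :0 := :0) ≈-refl) (neg-< 0<1)

  half : Carrier → Carrier
  half x = 1/ 2 * x

  half+half : ∀ x → half x + half x ≈ x
  half+half x = trans (solve 2 (λ h x → h :* x :+ h :* x := ((:1 :+ (:1 :+ :0)) :* h) :* x) ≈-refl (1/ 2) x)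
    (trans (*-congʳ (1/-inverse 2)) (*-identityˡ x))

  half-positive : ∀ {x} → 0# < x → 0# < half x
  half-positive = *-positive (1/-positive 2)

  double-positive : ∀ {x} → 0# < x + x → 0# < x
  double-positive {x} 0<2x = <-resp ≈-refl (trans (solve 2 (λ h x → h :* (x :+ x) := h :* x :+ h :* x) ≈-refl (1/ 2) x) (half+half x)) (half-positive 0<2x)

  Small : Carrier → Carrier → Set ℓ₂
  Small ε x = (- ε < x) × (x < ε)

  Small-resp : ∀ {ε x y} → x ≈ y → Small ε x → Small ε y
  Small-resp e (l , u) = <-resp ≈-refl e l , <-resp e ≈-refl u

  Small-+ : ∀ {ε δ x y} → Small ε x → Small δ y → Small (ε + δ) (x + y)
  Small-+ {ε} {δ} (l , u) (l′ , u′) = <-resp (solve 2 (λ a b → :- a :+ :- b := :- (a :+ b)) ≈-refl ε δ) ≈-refl (+-mono-< l l′) , +-mono-< u u′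

  positive-difference : ∀ {x y} → x < y → 0# < y - x
  positive-difference {x} {y} = shift-< (- x) (-‿inverseʳ x) ≈-refl

  Small-neg : ∀ {ε x} → Small ε x → Small ε (- x)
  Small-neg {ε} {x} (l , u) = neg-< u , <-resp ≈-refl (solve 1 (λ e → :- :- e := e) ≈-refl ε) (neg-< l)

  -- (a - x)(b + y) + (a + x)(b - y) = 2 (ab - xy).
  product-< : ∀ {a b x y} → Small a x → Small b y → x * y < a * b
  product-< {a} {b} {x} {y} (lx , ux) (ly , uy) = shift-< (x * y) (+-identityˡ _) (solve 2 (λ a x → (a :- x) :+ x := a) ≈-refl (a * b) (x * y))
    (double-positive (<-resp (+-identityˡ 0#) (solve 4 (λ a b x y → (a :- x) :* (b :+ y) :+ (a :+ x) :* (b :- y) := (a :* b :- x :* y) :+ (a :* b :- x :* y)) ≈-refl a b x y)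
      (+-mono-< (*-positive (positive-difference ux) (0<+ ly)) (*-positive (0<+ lx) (positive-difference uy)))))
    where
    0<+ : ∀ {c z} → - c < z → 0# < c + z
    0<+ {c} {z} l = <-resp ≈-refl (solve 2 (λ c z → z :- :- c := c :+ z) ≈-refl c z) (positive-difference l)

  Small-* : ∀ {a b x y} → Small a x → Small b y → Small (a * b) (x * y)
  Small-* {a} {b} {x} {y} sx sy = <-resp ≈-refl (solve 2 (λ x y → :- ((:- x) :* y) := x :* y) ≈-refl x y) (neg-< (product-< (Small-neg sx) sy)) , product-< sx sy

  bounded : ∀ x → ∃[ n ] Small (suc n · 1#) x
  bounded x with archimedean x | archimedean (- x)
  ... | a , x<a | b , -x<b = a ℕ.+ b ,
    (<-resp ≈-refl (solve 1 (λ x → :- :- x := x) ≈-refl x) (neg-< (<.trans -x<b (enlarge b a (ℕ.+-comm b a)))) , <.trans x<a (enlarge a b refl))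
    where
    0≤· : ∀ n → 0# ≤ᵣ n · 1#
    0≤· zero    = ≤ᵣ-reflexive ≈-refl
    0≤· (suc n) = <⇒≤ᵣ (0<1+n n)
    enlarge : ∀ a b {c} → a ℕ.+ b ≡ c → a · 1# < suc c · 1#
    enlarge a b refl = <-≤-trans (<-resp (+-identityˡ _) ≈-refl (+-monoˡ-< (a · 1#) 0<1))
      (≤ᵣ-resp (+-identityʳ _) (trans (+-assoc 1# _ _) (+-congˡ (sym (×-homo-+ 1# a b)))) (+-mono-≤ (≤ᵣ-reflexive (≈-refl {1# + a · 1#})) (0≤· b)))

  -- `s ⟶ x` unfolds to `null (λ n → s n - x)`, so the limit laws reduce to closure properties of
  -- null sequences.
  null : (ℕ → Carrier) → Set (r ⊔ ℓ₂)
  null s = ∀ {ε} → 0# < ε → ∃[ N ] (∀ n → N ℕ.≤ n → Small ε (s n))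

  null-cong : ∀ {s t} → (∀ n → s n ≈ t n) → null s → null t
  null-cong e s⟶0 0<ε with s⟶0 0<ε
  ... | N , f = N , λ n N≤n → Small-resp (e n) (f n N≤n)

  null-+ : ∀ {s t} → null s → null t → null (λ n → s n + t n)
  null-+ {s} {t} s⟶0 t⟶0 {ε} 0<ε with s⟶0 (half-positive 0<ε) | t⟶0 (half-positive 0<ε)
  ... | N , f | M , g = N ℕ.+ M , λ n le →
    let (l , u) = Small-+ (f n (ℕ.≤-trans (ℕ.m≤m+n N M) le)) (g n (ℕ.≤-trans (ℕ.m≤n+m M N) le))
    in <-resp (-‿cong (half+half ε)) ≈-refl l , <-resp ≈-refl (half+half ε) u

  -- A natural bound n + 1 for the size of k makes ε / (n + 1) a sufficient tolerance, without
  -- dividing by k.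
  null-scale : ∀ {s} k → null s → null (λ n → k * s n)
  null-scale {s} k s⟶0 {ε} 0<ε = scaled (bounded k)
    where
    scaled : ∃[ n ] Small (suc n · 1#) k → ∃[ N ] (∀ i → N ℕ.≤ i → Small ε (k * s i))
    scaled (n , k<n) = let (N , f) = s⟶0 (*-positive (1/-positive (suc n)) 0<ε) in N , λ i le →
      let (l , u) = Small-* k<n (f i le) in <-resp (-‿cong e) ≈-refl l , <-resp ≈-refl e u
      where
      e : suc n · 1# * ((1/ suc n) * ε) ≈ ε
      e = trans (sym (*-assoc _ _ ε)) (trans (*-congʳ (1/-inverse (suc n))) (*-identityˡ ε))

  null-* : ∀ {s t} → null s → null t → null (λ n → s n * t n)
  null-* s⟶0 t⟶0 {ε} 0<ε with s⟶0 0<ε | t⟶0 0<1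
  ... | N , f | M , g = N ℕ.+ M , λ n le →
    let (l , u) = Small-* (f n (ℕ.≤-trans (ℕ.m≤m+n N M) le)) (g n (ℕ.≤-trans (ℕ.m≤n+m M N) le))
    in <-resp (-‿cong (*-identityʳ ε)) ≈-refl l , <-resp ≈-refl (*-identityʳ ε) u

  null-sandwich : ∀ {s b} → (∀ n → s n ≤ᵣ b n) → (∀ n → - s n ≤ᵣ b n) → null b → null s
  null-sandwich {s} {b} s≤b -s≤b b⟶0 {ε} 0<ε with b⟶0 0<ε
  ... | N , f = N , λ n le → <-resp ≈-refl (solve 1 (λ x → :- :- x := x) ≈-refl (s n)) (neg-< (≤-<-trans (-s≤b n) (proj₂ (f n le)))) , ≤-<-trans (s≤b n) (proj₂ (f n le))
    where
    ≤-<-trans : ∀ {x y z} → x ≤ᵣ y → y < z → x < z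
    ≤-<-trans {x} {y} {z} x≤y y<z = <-resp (solve 1 (λ x → :- :- x := x) ≈-refl x) (solve 1 (λ x → :- :- x := x) ≈-refl z) (neg-< (<-≤-trans (neg-< y<z) (neg-≤ x≤y)))

  null-subsequence : ∀ {s} (φ : ℕ → ℕ) → (∀ n → n ℕ.≤ φ n) → null s → null (s ∘ φ)
  null-subsequence φ n≤φ s⟶0 0<ε with s⟶0 0<ε
  ... | N , f = N , λ n le → f (φ n) (ℕ.≤-trans le (n≤φ n))

  null-constant : ∀ {x} → null (λ _ → x) → x ≈ 0#
  null-constant {x} x⟶0 = ≈-stable λ x≉0 → tri x 0# λ
    { (inj₂ (inj₁ e))   → x≉0 e
    ; (inj₁ x<0)        → let (N , f) = x⟶0 (<-resp (solve 0 (:- :0 := :0) ≈-refl) ≈-refl (neg-< x<0))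
                          in <-irrefl (<-resp (solve 1 (λ x → :- :- x := x) ≈-refl x) ≈-refl (proj₁ (f N ℕ.≤-refl)))
    ; (inj₂ (inj₂ 0<x)) → let (N , f) = x⟶0 0<x in <-irrefl (proj₂ (f N ℕ.≤-refl)) }

  ⟶-cong : ∀ {s t x y} → (∀ n → s n ≈ t n) → x ≈ y → s ⟶ x → t ⟶ y
  ⟶-cong e e′ = null-cong (λ n → +-cong (e n) (-‿cong e′))

  ⟶-unique : ∀ {s x y} → s ⟶ x → s ⟶ y → x ≈ y
  ⟶-unique {s} {x} {y} s⟶x s⟶y = begin
    x            ≈⟨ solve 2 (λ x y → x := (x :- y) :+ y) ≈-refl x y ⟩
    (x - y) + y  ≈⟨ +-congʳ (null-constant (null-cong (λ n → solve 3 (λ s x y → (s :- y) :+ (:- :1) :* (s :- x) := x :- y) ≈-refl (s n) x y)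
                      (null-+ s⟶y (null-scale (- 1#) s⟶x)))) ⟩
    0# + y       ≈⟨ +-identityˡ y ⟩
    y            ∎

  ⟶-+ : ∀ {s t x y} → s ⟶ x → t ⟶ y → (λ n → s n + t n) ⟶ (x + y)
  ⟶-+ {s} {t} {x} {y} s⟶x t⟶y = null-cong (λ n → solve 4 (λ s t x y → (s :- x) :+ (t :- y) := (s :+ t) :- (x :+ y)) ≈-refl (s n) (t n) x y) (null-+ s⟶x t⟶y)

  ⟶-* : ∀ {s t x y} → s ⟶ x → t ⟶ y → (λ n → s n * t n) ⟶ (x * y)
  ⟶-* {s} {t} {x} {y} s⟶x t⟶y = null-cong
    (λ n → solve 4 (λ s t x y → (s :- x) :* (t :- y) :+ (x :* (t :- y) :+ y :* (s :- x)) := s :* t :- x :* y) ≈-refl (s n) (t n) x y)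
    (null-+ (null-* s⟶x t⟶y) (null-+ (null-scale x t⟶y) (null-scale y s⟶x)))

  ⟶-constant : ∀ x → (λ _ → x) ⟶ x
  ⟶-constant x 0<ε = 0 , λ _ _ → <-resp ≈-refl (sym (-‿inverseʳ x)) (<-resp ≈-refl (solve 0 (:- :0 := :0) ≈-refl) (neg-< 0<ε)) , <-resp (sym (-‿inverseʳ x)) ≈-refl 0<ε

  ⟶-neg : ∀ {s x} → s ⟶ x → (λ n → - s n) ⟶ (- x)
  ⟶-neg {s} {x} s⟶x = ⟶-cong (λ n → solve 1 (λ a → (:- :1) :* a := :- a) ≈-refl (s n)) (solve 1 (λ a → (:- :1) :* a := :- a) ≈-refl x) (⟶-* (⟶-constant (- 1#)) s⟶x)

  ⟶-suc : ∀ {s x} → (s ∘ suc) ⟶ x → s ⟶ x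
  ⟶-suc s⟶x 0<ε with s⟶x 0<ε
  ... | N , f = suc N , λ { (suc n) (s≤s le) → f n le }

  ⟶-eventually : ∀ {s x} N → (∀ n → s (N ℕ.+ n) ≈ x) → s ⟶ x
  ⟶-eventually zero    e = ⟶-cong (λ n → sym (e n)) ≈-refl (⟶-constant _)
  ⟶-eventually (suc N) e = ⟶-suc (⟶-eventually N e)

-- Complex numbers and values of power series

module ComplexAnalysis {r ℓ₁ ℓ₂} (ℝ : RealNumbers r ℓ₁ ℓ₂) where
  private
    module ℝ = RealNumbers ℝ
    module RA = RealAnalysis ℝ
    module RS = IntegerSolver RA.realRing
  open RS using (:0; :1; _:=_; _:+_; _:*_; _:-_; :-_)
  open ComplexNumbers ℝ
  open Meromorphic ℝ

  complexRing : CommutativeRing r ℓ₁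
  complexRing = record
    { Carrier = ℂ
    ; _≈_ = _≈_
    ; _+_ = _+_
    ; _*_ = _*_
    ; -_  = -_
    ; 0#  = 0#
    ; 1#  = 1#
    ; isCommutativeRing = record
      { isRing = record
        { +-isAbelianGroup = record
          { isGroup = record
            { isMonoid = record
              { isSemigroup = record
                { isMagma = record
                  { isEquivalence = record
                    { refl = RA.≈-refl , RA.≈-refl
                    ; sym = λ (e , f) → RA.sym e , RA.sym f
                    ; trans = λ (e , f) (e′ , f′) → RA.trans e e′ , RA.trans f f′ }
                  ; ∙-cong = λ (e , f) (e′ , f′) → RA.+-cong e e′ , RA.+-cong f f′
                  }
                ; assoc = λ x y z → RA.+-assoc _ _ _ , RA.+-assoc _ _ _
                }
              ; identity = (λ x → RA.+-identityˡ _ , RA.+-identityˡ _) , (λ x → RA.+-identityʳ _ , RA.+-identityʳ _)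
              }
            ; inverse = (λ x → RA.-‿inverseˡ _ , RA.-‿inverseˡ _) , (λ x → RA.-‿inverseʳ _ , RA.-‿inverseʳ _)
            ; ⁻¹-cong = λ (e , f) → RA.-‿cong e , RA.-‿cong f
            }
          ; comm = λ x y → RA.+-comm _ _ , RA.+-comm _ _
          }
        ; *-cong = λ (e , f) (e′ , f′) → RA.+-cong (RA.*-cong e e′) (RA.-‿cong (RA.*-cong f f′)) , RA.+-cong (RA.*-cong e f′) (RA.*-cong f e′)
        ; *-assoc = λ x y z →
            RS.solve 6 (λ a b c d e f → (a :* c :- b :* d) :* e :- (a :* d :+ b :* c) :* f := a :* (c :* e :- d :* f) :- b :* (c :* f :+ d :* e))
              RA.≈-refl (re x) (im x) (re y) (im y) (re z) (im z)
          , RS.solve 6 (λ a b c d e f → (a :* c :- b :* d) :* f :+ (a :* d :+ b :* c) :* e := a :* (c :* f :+ d :* e) :+ b :* (c :* e :- d :* f))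
              RA.≈-refl (re x) (im x) (re y) (im y) (re z) (im z)
        ; *-identity =
            (λ x → RS.solve 2 (λ a b → :1 :* a :- :0 :* b := a) RA.≈-refl (re x) (im x) , RS.solve 2 (λ a b → :1 :* b :+ :0 :* a := b) RA.≈-refl (re x) (im x))
          , (λ x → RS.solve 2 (λ a b → a :* :1 :- b :* :0 := a) RA.≈-refl (re x) (im x) , RS.solve 2 (λ a b → a :* :0 :+ b :* :1 := b) RA.≈-refl (re x) (im x))
        ; distrib =
            (λ x y z →
              RS.solve 6 (λ a b c d e f → a :* (c :+ e) :- b :* (d :+ f) := (a :* c :- b :* d) :+ (a :* e :- b :* f)) RA.≈-refl (re x) (im x) (re y) (im y) (re z) (im z)
            , RS.solve 6 (λ a b c d e f → a :* (d :+ f) :+ b :* (c :+ e) := (a :* d :+ b :* c) :+ (a :* f :+ b :* e)) RA.≈-refl (re x) (im x) (re y) (im y) (re z) (im z))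
          , (λ x y z →
              RS.solve 6 (λ a b c d e f → (c :+ e) :* a :- (d :+ f) :* b := (c :* a :- d :* b) :+ (e :* a :- f :* b)) RA.≈-refl (re x) (im x) (re y) (im y) (re z) (im z)
            , RS.solve 6 (λ a b c d e f → (c :+ e) :* b :+ (d :+ f) :* a := (c :* b :+ d :* a) :+ (e :* b :+ f :* a)) RA.≈-refl (re x) (im x) (re y) (im y) (re z) (im z))
        }
      ; *-comm = λ x y →
          RS.solve 4 (λ a b c d → a :* c :- b :* d := c :* a :- d :* b) RA.≈-refl (re x) (im x) (re y) (im y)
        , RS.solve 4 (λ a b c d → a :* d :+ b :* c := c :* b :+ d :* a) RA.≈-refl (re x) (im x) (re y) (im y)
      }
    }

  private module CR = RingLaws complexRing
  open RingReasoning complexRing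
  open Series complexRing
  open RangeSum complexRing

  open Evaluation complexRing complexRing (identityHom complexRing) using (eval; term; eval-suc)

  ≈-stable : ∀ {z w} → ¬ ¬ (z ≈ w) → z ≈ w
  ≈-stable ¬¬e = RA.≈-stable (λ k → ¬¬e (k ∘ proj₁)) , RA.≈-stable (λ k → ¬¬e (k ∘ proj₂))

  zero-or-apart : ∀ z → ¬ ¬ (z ≈ 0# ⊎ z # 0#)
  zero-or-apart z k = k (inj₁
    ( proj₁ (ℝ.tight (re z) ℝ.0#) (λ a → k (inj₂ (inj₁ a)))
    , proj₁ (ℝ.tight (im z) ℝ.0#) (λ a → k (inj₂ (inj₂ a)))))

  normSquared : ℂ → ℝ.Carrier
  normSquared z = re z ℝ.* re z ℝ.+ im z ℝ.* im z

  normSquared-positive : ∀ {z} → z # 0# → ℝ.0# ℝ.< normSquared z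
  normSquared-positive {z} (inj₁ a) = RA.<-≤-trans (RA.positive-square a)
    (RA.≤ᵣ-resp (RA.+-identityʳ _) RA.≈-refl (RA.+-mono-≤ (RA.≤ᵣ-reflexive (RA.≈-refl {re z ℝ.* re z})) (RA.0≤-square (im z))))
  normSquared-positive {z} (inj₂ b) = RA.<-≤-trans (RA.positive-square b)
    (RA.≤ᵣ-resp (RA.+-identityˡ _) RA.≈-refl (RA.+-mono-≤ (RA.0≤-square (re z)) (RA.≤ᵣ-reflexive (RA.≈-refl {im z ℝ.* im z}))))

  conj-* : ∀ d z → conj d * (d * z) ≈ (normSquared d ℝ.* re z) +i (normSquared d ℝ.* im z)
  conj-* d z =
      RS.solve 4 (λ a b c e → a :* (a :* c :- b :* e) :- (:- b) :* (a :* e :+ b :* c) := (a :* a :+ b :* b) :* c) RA.≈-refl (re d) (im d) (re z) (im z)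
    , RS.solve 4 (λ a b c e → a :* (a :* e :+ b :* c) :+ (:- b) :* (a :* c :- b :* e) := (a :* a :+ b :* b) :* e) RA.≈-refl (re d) (im d) (re z) (im z)

  -- Multiplying by `conj d` replaces d by the positive real |d|², which is cancelled in the real
  -- and the imaginary part separately.
  cancelˡ : ∀ {d z w} → d # 0# → d * z ≈ d * w → z ≈ w
  cancelˡ {d} {z} {w} d#0 e = RA.cancelˡ n#0 (proj₁ e′) , RA.cancelˡ n#0 (proj₂ e′)
    where
    n#0 : normSquared d ℝ.# ℝ.0#
    n#0 = ℝ.#-sym (ℝ.<⇒# (normSquared-positive d#0))
    e′ : (normSquared d ℝ.* re z) +i (normSquared d ℝ.* im z) ≈ (normSquared d ℝ.* re w) +i (normSquared d ℝ.* im w)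
    e′ = CR.trans (CR.sym (conj-* d z)) (CR.trans (CR.*-congˡ {conj d} e) (conj-* d w))

  1#0 : 1# # 0#
  1#0 = inj₁ (ℝ.#-sym (ℝ.<⇒# ℝ.0<1))

  #-resp : ∀ {z w} → z ≈ w → z # 0# → w # 0#
  #-resp {z} {w} (e , f) (inj₁ a) = inj₁ (real e a)
    where
    real : ∀ {x y} → x ℝ.≈ y → x ℝ.# ℝ.0# → y ℝ.# ℝ.0#
    real {x} {y} e a with ℝ.#-cotrans a y
    ... | inj₁ x#y = contradiction x#y (proj₂ (ℝ.tight x y) e)
    ... | inj₂ y#0 = y#0
  #-resp {z} {w} (e , f) (inj₂ b) = inj₂ (real f b)
    where
    real : ∀ {x y} → x ℝ.≈ y → x ℝ.# ℝ.0# → y ℝ.# ℝ.0#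
    real {x} {y} e a with ℝ.#-cotrans a y
    ... | inj₁ x#y = contradiction x#y (proj₂ (ℝ.tight x y) e)
    ... | inj₂ y#0 = y#0

  ⟶-cong : ∀ {s t x y} → (∀ n → s n ≈ t n) → x ≈ y → s ⟶ x → t ⟶ y
  ⟶-cong e (f , g) (a , b) = RA.⟶-cong (proj₁ ∘ e) f a , RA.⟶-cong (proj₂ ∘ e) g b

  ⟶-unique : ∀ {s x y} → s ⟶ x → s ⟶ y → x ≈ y
  ⟶-unique (a , b) (a′ , b′) = RA.⟶-unique a a′ , RA.⟶-unique b b′

  ⟶-+ : ∀ {s t x y} → s ⟶ x → t ⟶ y → (λ n → s n + t n) ⟶ (x + y)
  ⟶-+ (a , b) (a′ , b′) = RA.⟶-+ a a′ , RA.⟶-+ b b′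

  ⟶-* : ∀ {s t x y} → s ⟶ x → t ⟶ y → (λ n → s n * t n) ⟶ (x * y)
  ⟶-* (a , b) (a′ , b′) = RA.⟶-+ (RA.⟶-* a a′) (RA.⟶-neg (RA.⟶-* b b′)) , RA.⟶-+ (RA.⟶-* a b′) (RA.⟶-* b a′)

  ⟶-constant : ∀ x → (λ _ → x) ⟶ x
  ⟶-constant x = RA.⟶-constant (re x) , RA.⟶-constant (im x)

  ⟶-suc : ∀ {s x} → (s ∘ suc) ⟶ x → s ⟶ x
  ⟶-suc (a , b) = RA.⟶-suc a , RA.⟶-suc b

  ⟶-eventually : ∀ {s x} N → (∀ n → s (N ℕ.+ n) ≈ x) → s ⟶ x
  ⟶-eventually N e = RA.⟶-eventually N (proj₁ ∘ e) , RA.⟶-eventually N (proj₂ ∘ e)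

  partial-cong : ∀ a b z → a ≋ b → ∀ N → ∑< N (λ n → a n * z ^ n) ≈ ∑< N (λ n → b n * z ^ n)
  partial-cong a b z e N = ∑<-cong N (λ n → a n * z ^ n) (λ n → b n * z ^ n) (λ n → CR.*-congʳ {z ^ n} (e n))

  HasValue-cong : ∀ a b z {w w′} → a ≋ b → w ≈ w′ → HasValue a z w → HasValue b z w′
  HasValue-cong a b z e = ⟶-cong (partial-cong a b z e)

  HasValue-point : ∀ a {z z′ w} → z ≈ z′ → HasValue a z w → HasValue a z′ w
  HasValue-point a {z} {z′} e = ⟶-cong (λ N → ∑<-cong N (λ n → a n * z ^ n) (λ n → a n * z′ ^ n) (λ n → CR.*-congˡ {a n} (^-congˡ n e))) CR.≈-refl
    where open ExpProperties CR.commutativeSemiring using (^-congˡ)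

  HasValue-+ : ∀ a b z {w w′} → HasValue a z w → HasValue b z w′ → HasValue (λ n → a n + b n) z (w + w′)
  HasValue-+ a b z v v′ = ⟶-cong (λ N → CR.sym (CR.trans
      (∑<-cong N (λ n → (a n + b n) * z ^ n) (λ n → a n * z ^ n + b n * z ^ n) (λ n → CR.distribʳ (z ^ n) (a n) (b n)))
      (∑<-+ N (λ n → a n * z ^ n) (λ n → b n * z ^ n)))) CR.≈-refl (⟶-+ v v′)

  HasValue-scale : ∀ a k z {w} → HasValue a z w → HasValue (λ n → k * a n) z (k * w)
  HasValue-scale a k z v = ⟶-cong (λ N → CR.sym (CR.trans
      (∑<-cong N (λ n → (k * a n) * z ^ n) (λ n → k * (a n * z ^ n)) (λ n → CR.*-assoc k (a n) (z ^ n)))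
      (∑<-*ˡ N k (λ n → a n * z ^ n)))) CR.≈-refl (⟶-* (⟶-constant k) v)

  HasValue-shift : ∀ a z {w} → HasValue a z w → HasValue (shift a) z (z * w)
  HasValue-shift a z v = ⟶-suc (⟶-cong (λ N → CR.sym (begin
    0# * 1# + ∑< N (λ n → a n * (z * z ^ n))
      ≈⟨ CR.trans (CR.+-congʳ (CR.zeroˡ 1#)) (CR.+-identityˡ (∑< N (λ n → a n * (z * z ^ n)))) ⟩
    ∑< N (λ n → a n * (z * z ^ n))
      ≈⟨ ∑<-cong N (λ n → a n * (z * z ^ n)) (λ n → z * (a n * z ^ n)) (λ n → CS.solve 3 (λ a z e → a CS.:* (z CS.:* e) CS.:= z CS.:* (a CS.:* e)) CR.≈-refl (a n) z (z ^ n)) ⟩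
    ∑< N (λ n → z * (a n * z ^ n))
      ≈⟨ ∑<-*ˡ N z (λ n → a n * z ^ n) ⟩
    z * ∑< N (λ n → a n * z ^ n) ∎)) CR.≈-refl (⟶-* (⟶-constant z) v))
    where module CS = IntegerSolver complexRing

  -- Since p is a polynomial, the product is a finite combination of shifts of the series, and no
  -- rearrangement of infinite sums occurs.
  HasValue-⊛ : ∀ D p a z {w} → (∀ i → p (D ℕ.+ i) ≈ 0#) → HasValue a z w → HasValue (p ⊛ a) z (eval D p z * w)
  HasValue-⊛ zero    p a z {w} e v = HasValue-cong (λ n → 0# * a n) (p ⊛ a) z
    (λ n → CR.trans (CR.zeroˡ (a n)) (CR.sym (CR.trans (⊛-cong {p} {λ _ → 0#} {a} e (λ _ → CR.≈-refl) n) (0⊛ a n)))) CR.≈-refl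
    (HasValue-scale a 0# z v)
  HasValue-⊛ (suc D) p a z {w} e v = HasValue-cong (λ n → p 0 * a n + shift ((p ∘ suc) ⊛ a) n) (p ⊛ a) z {w = p 0 * w + z * (eval D (p ∘ suc) z * w)}
    (λ { zero → CR.≈-refl ; (suc n) → CR.≈-refl })
    (CR.trans (CS.solve 4 (λ s w z y → s CS.:* w CS.:+ z CS.:* (y CS.:* w) CS.:= (s CS.:+ z CS.:* y) CS.:* w) CR.≈-refl (p 0) w z (eval D (p ∘ suc) z))
      (CR.*-congʳ {w} (CR.sym (eval-suc D p z))))
    (HasValue-+ (λ n → p 0 * a n) (shift ((p ∘ suc) ⊛ a)) z (HasValue-scale a (p 0) z v) (HasValue-shift ((p ∘ suc) ⊛ a) z (HasValue-⊛ D (p ∘ suc) a z e v)))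
    where module CS = IntegerSolver complexRing

  HasValue-finite : ∀ D p z → (∀ i → p (D ℕ.+ i) ≈ 0#) → HasValue p z (eval D p z)
  HasValue-finite D p z e = ⟶-eventually D (λ n → ∑<-extend D (term p z) (λ i → CR.trans (CR.*-congʳ {z ^ (D ℕ.+ i)} (e i)) (CR.zeroˡ (z ^ (D ℕ.+ i)))) n)

-- The addition law of the exponential function

module ExponentialSeries {c ℓ} (R : CommutativeRing c ℓ) where
  open RingLaws R
  open IntegerSolver R
  open Series R
  open RangeSum R
  open MultProperties semiring using () renaming (_×_ to _·_)
  open ExpProperties commutativeSemiring using (_^_)
  open RingReasoning R

  -- T d/dT
  θ : (ℕ → Carrier) → ℕ → Carrier
  θ f n = n · 1# * f n

  θ-⊛ : ∀ f g n → θ (f ⊛ g) n ≈ (θ f ⊛ g) n + (f ⊛ θ g) n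
  θ-⊛ f g zero    = solve 2 (λ x y → :0 :* (x :* y :+ :0) := (:0 :* x :* y :+ :0) :+ (x :* (:0 :* y) :+ :0)) ≈-refl (f 0) (g 0)
  θ-⊛ f g (suc n) = begin
    (1# + n · 1#) * (f 0 * g (suc n) + ((f ∘ suc) ⊛ g) n)
      ≈⟨ solve 4 (λ k x y w → (:1 :+ k) :* (x :* y :+ w) := x :* ((:1 :+ k) :* y) :+ (k :* w :+ w)) ≈-refl (n · 1#) (f 0) (g (suc n)) (((f ∘ suc) ⊛ g) n) ⟩
    f 0 * θ g (suc n) + (n · 1# * ((f ∘ suc) ⊛ g) n + ((f ∘ suc) ⊛ g) n)
      ≈⟨ +-congˡ (+-congʳ (θ-⊛ (f ∘ suc) g n)) ⟩
    f 0 * θ g (suc n) + (((θ (f ∘ suc) ⊛ g) n + ((f ∘ suc) ⊛ θ g) n) + ((f ∘ suc) ⊛ g) n)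
      ≈⟨ solve 4 (λ a b c d → a :+ ((b :+ c) :+ d) := (b :+ d) :+ (a :+ c)) ≈-refl _ ((θ (f ∘ suc) ⊛ g) n) (((f ∘ suc) ⊛ θ g) n) (((f ∘ suc) ⊛ g) n) ⟩
    ((θ (f ∘ suc) ⊛ g) n + ((f ∘ suc) ⊛ g) n) + (f 0 * θ g (suc n) + ((f ∘ suc) ⊛ θ g) n)
      ≈⟨ +-congʳ (begin
        (θ (f ∘ suc) ⊛ g) n + ((f ∘ suc) ⊛ g) n
          ≈⟨ ⊛-distribʳ g (θ (f ∘ suc)) (f ∘ suc) n ⟨
        ((λ i → θ (f ∘ suc) i + f (suc i)) ⊛ g) n
          ≈⟨ ⊛-cong {λ i → θ (f ∘ suc) i + f (suc i)} {θ f ∘ suc} {g} (λ i → solve 2 (λ k x → k :* x :+ x := (:1 :+ k) :* x) ≈-refl (i · 1#) (f (suc i))) (λ _ → ≈-refl) n ⟩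
        ((θ f ∘ suc) ⊛ g) n
          ≈⟨ solve 3 (λ x y w → w := :0 :* x :* y :+ w) ≈-refl (f 0) (g (suc n)) _ ⟩
        (θ f ⊛ g) (suc n) ∎) ⟩
    (θ f ⊛ g) (suc n) + (f ⊛ θ g) (suc n) ∎

  -- `inv n` stands for 1/(n+1) and `inv! n` for 1/n!; they are abstract so that the real and the
  -- complex series can share the argument.
  module Factorial (inv inv! : ℕ → Carrier) (inv-spec : ∀ n → suc n · 1# * inv n ≈ 1#)
    (inv!-0 : inv! 0 ≈ 1#) (inv!-suc : ∀ n → inv! (suc n) ≈ inv n * inv! n) where

    terms : Carrier → ℕ → Carrier
    terms z n = inv! n * z ^ n

    terms-suc : ∀ z n → θ (terms z) (suc n) ≈ z * terms z n
    terms-suc z n = begin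
      suc n · 1# * (inv! (suc n) * (z * z ^ n))
        ≈⟨ *-congˡ (*-congʳ (inv!-suc n)) ⟩
      suc n · 1# * ((inv n * inv! n) * (z * z ^ n))
        ≈⟨ solve 5 (λ k i f z e → k :* ((i :* f) :* (z :* e)) := (k :* i) :* (z :* (f :* e))) ≈-refl (suc n · 1#) (inv n) (inv! n) z (z ^ n) ⟩
      (suc n · 1# * inv n) * (z * (inv! n * z ^ n))
        ≈⟨ trans (*-congʳ (inv-spec n)) (*-identityˡ _) ⟩
      z * terms z n ∎

    terms-unique : ∀ z f → f 0 ≈ 1# → (∀ n → θ f (suc n) ≈ z * f n) → f ≋ terms z
    terms-unique z f f0 rec zero    = trans f0 (sym (trans (*-identityʳ _) inv!-0))
    terms-unique z f f0 rec (suc n) = begin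
      f (suc n)                             ≈⟨ trans (sym (*-identityˡ _)) (*-congʳ (sym (inv-spec n))) ⟩
      (suc n · 1# * inv n) * f (suc n)      ≈⟨ solve 3 (λ k i x → (k :* i) :* x := i :* (k :* x)) ≈-refl (suc n · 1#) (inv n) (f (suc n)) ⟩
      inv n * θ f (suc n)                   ≈⟨ *-congˡ (trans (rec n) (trans (*-congˡ (terms-unique z f f0 rec n)) (sym (terms-suc z n)))) ⟩
      inv n * θ (terms z) (suc n)           ≈⟨ solve 3 (λ k i x → i :* (k :* x) := (k :* i) :* x) ≈-refl (suc n · 1#) (inv n) (terms z (suc n)) ⟩
      (suc n · 1# * inv n) * terms z (suc n) ≈⟨ trans (*-congʳ (inv-spec n)) (*-identityˡ _) ⟩
      terms z (suc n)                       ∎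

    θ-terms : ∀ z → θ (terms z) ≋ shift (λ n → z * terms z n)
    θ-terms z zero    = zeroˡ _
    θ-terms z (suc n) = terms-suc z n

    -- With T as variable, `terms a` is the series of e^(aT). Both sides solve f' = (a + b) f with
    -- f(0) = 1, and the recursion on coefficients has only one solution.
    terms-+ : ∀ a b → terms a ⊛ terms b ≋ terms (a + b)
    terms-+ a b = terms-unique (a + b) (terms a ⊛ terms b)
      (trans (⊛-0 (terms a) (terms b)) (trans (*-cong (trans (*-identityʳ _) inv!-0) (trans (*-identityʳ _) inv!-0)) (*-identityˡ 1#)))
      (λ n → begin
        θ (terms a ⊛ terms b) (suc n)
          ≈⟨ θ-⊛ (terms a) (terms b) (suc n) ⟩
        (θ (terms a) ⊛ terms b) (suc n) + (terms a ⊛ θ (terms b)) (suc n)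
          ≈⟨ +-cong (derivative a (terms b) n) (trans (⊛-comm (terms a) (θ (terms b)) (suc n)) (trans (derivative b (terms a) n) (*-congˡ (⊛-comm (terms b) (terms a) n)))) ⟩
        a * (terms a ⊛ terms b) n + b * (terms a ⊛ terms b) n
          ≈⟨ distribʳ _ a b ⟨
        (a + b) * (terms a ⊛ terms b) n ∎)
      where
      derivative : ∀ a g n → (θ (terms a) ⊛ g) (suc n) ≈ a * (terms a ⊛ g) n
      derivative a g n = trans (⊛-cong {θ (terms a)} {shift (λ n → a * terms a n)} {g} (θ-terms a) (λ _ → ≈-refl) (suc n))
        (trans (shift⊛ (λ n → a * terms a n) g (suc n)) (⊛-scale a (terms a) g n))

  triangle-suc : ∀ N f g → ∑< (suc N) (f ⊛ g) ≈ f 0 * ∑< (suc N) g + ∑< N ((f ∘ suc) ⊛ g)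
  triangle-suc N f g = begin
    (f 0 * g 0 + 0#) + ∑< N (λ n → f 0 * g (suc n) + ((f ∘ suc) ⊛ g) n)
      ≈⟨ +-congˡ (trans (∑<-+ N (λ n → f 0 * g (suc n)) ((f ∘ suc) ⊛ g)) (+-congʳ (∑<-*ˡ N (f 0) (g ∘ suc)))) ⟩
    (f 0 * g 0 + 0#) + (f 0 * ∑< N (g ∘ suc) + ∑< N ((f ∘ suc) ⊛ g))
      ≈⟨ solve 4 (λ x y s t → (x :* y :+ :0) :+ (x :* s :+ t) := x :* (y :+ s) :+ t) ≈-refl (f 0) (g 0) _ _ ⟩
    f 0 * ∑< (suc N) g + ∑< N ((f ∘ suc) ⊛ g) ∎

  ∑<-split : ∀ N k f → ∑< (N ℕ.+ k) f ≈ ∑< N f + ∑< k (λ i → f (N ℕ.+ i))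
  ∑<-split zero    k f = sym (+-identityˡ _)
  ∑<-split (suc N) k f = trans (+-congˡ (∑<-split N k (f ∘ suc))) (sym (+-assoc _ _ _))

  -- The part of the square [0, N) × [0, M) above the triangle i + j < N.
  corner : ℕ → ℕ → (ℕ → Carrier) → (ℕ → Carrier) → Carrier
  corner N M f g = ∑< N f * ∑< M g - ∑< N (f ⊛ g)

  -- Row 0 of the rectangle leaves the triangle at column N + 1. The other rows form the corner of
  -- the shifted f, whose triangle is smaller by one.
  corner-suc : ∀ N k f g → corner (suc N) (suc N ℕ.+ k) f g ≈ f 0 * ∑< k (λ i → g (suc N ℕ.+ i)) + corner N (suc N ℕ.+ k) (f ∘ suc) g
  corner-suc N k f g = begin
    (f 0 + ∑< N (f ∘ suc)) * ∑< (suc N ℕ.+ k) g - ∑< (suc N) (f ⊛ g)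
      ≈⟨ +-congˡ (-‿cong (triangle-suc N f g)) ⟩
    (f 0 + ∑< N (f ∘ suc)) * ∑< (suc N ℕ.+ k) g - (f 0 * ∑< (suc N) g + ∑< N ((f ∘ suc) ⊛ g))
      ≈⟨ solve 5 (λ x s m n t → (x :+ s) :* m :- (x :* n :+ t) := x :* (m :- n) :+ (s :* m :- t)) ≈-refl (f 0) (∑< N (f ∘ suc)) (∑< (suc N ℕ.+ k) g) (∑< (suc N) g) _ ⟩
    f 0 * (∑< (suc N ℕ.+ k) g - ∑< (suc N) g) + corner N (suc N ℕ.+ k) (f ∘ suc) g
      ≈⟨ +-congʳ (*-congˡ (trans (+-congʳ (∑<-split (suc N) k g)) (solve 2 (λ a b → (a :+ b) :- a := b) ≈-refl (∑< (suc N) g) _))) ⟩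
    f 0 * ∑< k (λ i → g (suc N ℕ.+ i)) + corner N (suc N ℕ.+ k) (f ∘ suc) g ∎

module ExponentialLaw {r ℓ₁ ℓ₂} {ℝ : RealNumbers r ℓ₁ ℓ₂} (E : Exponential ℝ) where
  private
    module ℝ = RealNumbers ℝ
    module RA = RealAnalysis ℝ
    module RS = IntegerSolver RA.realRing
    module RR = RingLaws RA.realRing
    module RΣ = RangeSum RA.realRing
    module R⊛ = Series RA.realRing
    module RE = ExponentialSeries RA.realRing
    module CA = ComplexAnalysis ℝ
    module CR = RingLaws CA.complexRing
    module CΣ = RangeSum CA.complexRing
    module C⊛ = Series CA.complexRing
    module CE = ExponentialSeries CA.complexRing
    module R^ = ExpProperties RR.commutativeSemiring
  open RA using (_≤ᵣ_)
  open ComplexNumbers ℝ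
  open Meromorphic ℝ
  open Exponential E
  open RS using (:0; :1; _:=_; _:+_; _:*_; _:-_; :-_)

  fromℝ-* : ∀ x y → fromℝ x * fromℝ y ≈ fromℝ (x ℝ.* y)
  fromℝ-* x y = RS.solve 2 (λ x y → x :* y :- :0 :* :0 := x :* y) RA.≈-refl x y , RS.solve 2 (λ x y → x :* :0 :+ :0 :* y := :0) RA.≈-refl x y

  fromℝ-^ : ∀ x n → fromℝ x ^ n ≈ fromℝ (x R^.^ n)
  fromℝ-^ x zero    = CR.≈-refl
  fromℝ-^ x (suc n) = CR.trans (CR.*-congˡ {fromℝ x} (fromℝ-^ x n)) (fromℝ-* x _)

  fromℝ-· : ∀ n → n · 1# ≈ fromℝ (n ℝ.· ℝ.1#)
  fromℝ-· zero    = CR.≈-refl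
  fromℝ-· (suc n) = CR.trans (CR.+-congˡ {1#} (fromℝ-· n)) (RA.≈-refl , RA.+-identityˡ ℝ.0#)

  module RF = RE.Factorial (λ n → ℝ.1/ suc n) (λ n → ℝ.1/ n !) (λ n → RA.1/-inverse (suc n)) RA.≈-refl (λ n → RA.≈-refl)
  module CF = CE.Factorial (λ n → fromℝ (ℝ.1/ suc n)) (λ n → fromℝ (ℝ.1/ n !))
    (λ n → CR.trans (CR.*-congʳ {fromℝ (ℝ.1/ suc n)} (fromℝ-· (suc n))) (CR.trans (fromℝ-* _ _) (RA.1/-inverse (suc n) , RA.≈-refl)))
    CR.≈-refl (λ n → CR.sym (fromℝ-* _ _))

  infix 4 _≼_
  -- Bounds on both coordinates take the place of the modulus, which would require square roots. The
  -- price is the factor 2 in `≼-*`, the source of the doubled bounds below.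
  record _≼_ (z : ℂ) (A : ℝ.Carrier) : Set ℓ₂ where
    constructor dominated
    field
      re≤ : re z ≤ᵣ A
      -re≤ : ℝ.- re z ≤ᵣ A
      im≤ : im z ≤ᵣ A
      -im≤ : ℝ.- im z ≤ᵣ A

  ≼-resp : ∀ {z w A B} → z ≈ w → A ℝ.≈ B → z ≼ A → w ≼ B
  ≼-resp (e , f) g (dominated a b c d) = dominated (RA.≤ᵣ-resp e g a) (RA.≤ᵣ-resp (RA.-‿cong e) g b) (RA.≤ᵣ-resp f g c) (RA.≤ᵣ-resp (RA.-‿cong f) g d)

  ≼-≤ : ∀ {z A B} → z ≼ A → A ≤ᵣ B → z ≼ B
  ≼-≤ (dominated p q s t) A≤B = dominated (RA.≤ᵣ-trans p A≤B) (RA.≤ᵣ-trans q A≤B) (RA.≤ᵣ-trans s A≤B) (RA.≤ᵣ-trans t A≤B)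

  ≼-+ : ∀ {z w A B} → z ≼ A → w ≼ B → z + w ≼ A ℝ.+ B
  ≼-+ {z} {w} (dominated a b c d) (dominated a′ b′ c′ d′) = dominated (RA.+-mono-≤ a a′)
    (RA.≤ᵣ-resp (neg-+ (re z) (re w)) RA.≈-refl (RA.+-mono-≤ b b′)) (RA.+-mono-≤ c c′) (RA.≤ᵣ-resp (neg-+ (im z) (im w)) RA.≈-refl (RA.+-mono-≤ d d′))
    where
    neg-+ : ∀ x y → ℝ.- x ℝ.+ ℝ.- y ℝ.≈ ℝ.- (x ℝ.+ y)
    neg-+ = RS.solve 2 (λ x y → :- x :+ :- y := :- (x :+ y)) RA.≈-refl

  0≤-difference : ∀ {x y} → x ≤ᵣ y → ℝ.0# ≤ᵣ y ℝ.- x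
  0≤-difference {x} x≤y = RA.≤ᵣ-resp (RA.-‿inverseʳ x) RA.≈-refl (RA.+-mono-≤ x≤y (RA.≤ᵣ-reflexive (RA.≈-refl {ℝ.- x})))

  product-≤ : ∀ {x y A B} → x ≤ᵣ A → ℝ.- x ≤ᵣ A → y ≤ᵣ B → ℝ.- y ≤ᵣ B → x ℝ.* y ≤ᵣ A ℝ.* B
  product-≤ {x} {y} {A} {B} x≤ -x≤ y≤ -y≤ AB<xy = RA.+-mono-≤ (RA.0≤-* (0≤-difference x≤) (0≤-difference -y≤)) (RA.0≤-* (0≤-difference -x≤) (0≤-difference y≤))
    (RA.<-resp (RS.solve 4 (λ a b x y → (a :* b :- x :* y) :+ (a :* b :- x :* y) := (a :- x) :* (b :- :- y) :+ (a :- :- x) :* (b :- y)) RA.≈-refl A B x y) RA.≈-refl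
      (RA.+-mono-< negative negative))
    where
    negative : A ℝ.* B ℝ.- x ℝ.* y ℝ.< ℝ.0#
    negative = RA.shift-< (ℝ.- (x ℝ.* y)) RA.≈-refl (RA.-‿inverseʳ _) AB<xy

  ≼-* : ∀ {z w A B} → z ≼ A → w ≼ B → z * w ≼ (A ℝ.+ A) ℝ.* B
  ≼-* {z} {w} {A} {B} (dominated a b c d) (dominated a′ b′ c′ d′) = dominated
    (bound (product-≤ a b a′ b′) (RA.≤ᵣ-resp (neg-*ˡ (im z) (im w)) RA.≈-refl (product-≤ d (involutive c) c′ d′)))
    (RA.≤ᵣ-resp (RS.solve 4 (λ x y u v → (:- x) :* u :+ y :* v := :- (x :* u :- y :* v)) RA.≈-refl (re z) (im z) (re w) (im w)) RA.≈-refl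
      (bound (product-≤ b (involutive a) a′ b′) (product-≤ c d c′ d′)))
    (bound (product-≤ a b c′ d′) (product-≤ c d a′ b′))
    (RA.≤ᵣ-resp (RS.solve 4 (λ x y u v → (:- x) :* v :+ (:- y) :* u := :- (x :* v :+ y :* u)) RA.≈-refl (re z) (im z) (re w) (im w)) RA.≈-refl
      (bound (product-≤ b (involutive a) c′ d′) (product-≤ d (involutive c) a′ b′)))
    where
    bound : ∀ {x y} → x ≤ᵣ A ℝ.* B → y ≤ᵣ A ℝ.* B → x ℝ.+ y ≤ᵣ (A ℝ.+ A) ℝ.* B
    bound x≤ y≤ = RA.≤ᵣ-resp RA.≈-refl (RS.solve 2 (λ a b → a :* b :+ a :* b := (a :+ a) :* b) RA.≈-refl A B) (RA.+-mono-≤ x≤ y≤)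
    involutive : ∀ {x} → x ≤ᵣ A → ℝ.- (ℝ.- x) ≤ᵣ A
    involutive {x} = RA.≤ᵣ-resp (RS.solve 1 (λ x → x := :- :- x) RA.≈-refl x) RA.≈-refl
    neg-*ˡ : ∀ x y → (ℝ.- x) ℝ.* y ℝ.≈ ℝ.- (x ℝ.* y)
    neg-*ˡ = RS.solve 2 (λ x y → (:- x) :* y := :- (x :* y)) RA.≈-refl

  ≼-∑< : ∀ N (f : ℕ → ℂ) (F : ℕ → ℝ.Carrier) → (∀ n → f n ≼ F n) → CΣ.∑< N f ≼ RΣ.∑< N F
  ≼-∑< zero    f F d = dominated (RA.≤ᵣ-reflexive RA.≈-refl) (RA.≤ᵣ-reflexive -0≈0) (RA.≤ᵣ-reflexive RA.≈-refl) (RA.≤ᵣ-reflexive -0≈0)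
    where
    -0≈0 : ℝ.- ℝ.0# ℝ.≈ ℝ.0#
    -0≈0 = RS.solve 0 (:- :0 := :0) RA.≈-refl
  ≼-∑< (suc N) f F d = ≼-+ (d 0) (≼-∑< N (f ∘ suc) (F ∘ suc) (d ∘ suc))

  -- Row by row, by `corner-suc`; each product costs the factor 2 of `≼-*`, which is absorbed by
  -- doubling F.
  ≼-corner : ∀ N k (f g : ℕ → ℂ) (F G : ℕ → ℝ.Carrier) → (∀ n → f n ≼ F n) → (∀ n → g n ≼ G n) →
    CE.corner N (N ℕ.+ k) f g ≼ RE.corner N (N ℕ.+ k) (λ n → F n ℝ.+ F n) G
  ≼-corner zero    k f g F G d d′ = ≼-resp
    (CR.sym (CR.trans (CR.+-congʳ { - 0#} (CR.zeroˡ (CΣ.∑< k g))) (CR.-‿inverseʳ 0#)))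
    (RS.solve 1 (λ s → :0 := :0 :* s :- :0) RA.≈-refl (RΣ.∑< k G))
    (≼-∑< 0 f F d)
  ≼-corner (suc N) k f g F G d d′ = ≼-resp (CR.sym (CE.corner-suc N k f g)) (RA.sym (RE.corner-suc N k (λ n → F n ℝ.+ F n) G))
    (≼-+ (≼-* (d 0) (≼-∑< k (λ i → g (suc N ℕ.+ i)) (λ i → G (suc N ℕ.+ i)) (λ i → d′ (suc N ℕ.+ i))))
      (subst (λ M → CE.corner N M (f ∘ suc) g ≼ RE.corner N M (λ n → F (suc n) ℝ.+ F (suc n)) G) (ℕ.+-suc N k)
        (≼-corner N (suc k) (f ∘ suc) g (F ∘ suc) G (d ∘ suc) d′)))

  0≤-∑< : ∀ N (F : ℕ → ℝ.Carrier) → (∀ n → ℝ.0# ≤ᵣ F n) → ℝ.0# ≤ᵣ RΣ.∑< N F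
  0≤-∑< zero    F 0≤F = RA.≤ᵣ-reflexive RA.≈-refl
  0≤-∑< (suc N) F 0≤F = RA.≤ᵣ-resp (RA.+-identityˡ ℝ.0#) RA.≈-refl (RA.+-mono-≤ (0≤F 0) (0≤-∑< N (F ∘ suc) (0≤F ∘ suc)))

  -- The rectangle of indices i < N, j < M lies inside the triangle i + j < N + M, and the terms are
  -- nonnegative.
  square-≤ : ∀ N M (F G : ℕ → ℝ.Carrier) → (∀ n → ℝ.0# ≤ᵣ F n) → (∀ n → ℝ.0# ≤ᵣ G n) → RΣ.∑< N F ℝ.* RΣ.∑< M G ≤ᵣ RΣ.∑< (N ℕ.+ M) (F R⊛.⊛ G)
  square-≤ zero    M F G 0≤F 0≤G = RA.≤ᵣ-resp (RA.sym (RA.zeroˡ _)) RA.≈-refl (0≤-∑< M (F R⊛.⊛ G) (0≤-⊛ F 0≤F))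
    where
    0≤-⊛ : ∀ (F : ℕ → ℝ.Carrier) → (∀ n → ℝ.0# ≤ᵣ F n) → ∀ n → ℝ.0# ≤ᵣ (F R⊛.⊛ G) n
    0≤-⊛ F 0≤F zero    = RA.≤ᵣ-resp RA.≈-refl (RA.sym (RA.+-identityʳ _)) (RA.0≤-* (0≤F 0) (0≤G 0))
    0≤-⊛ F 0≤F (suc n) = RA.≤ᵣ-resp (RA.+-identityˡ ℝ.0#) RA.≈-refl (RA.+-mono-≤ (RA.0≤-* (0≤F 0) (0≤G (suc n))) (0≤-⊛ (F ∘ suc) (0≤F ∘ suc) n))
  square-≤ (suc N) M F G 0≤F 0≤G = RA.≤ᵣ-resp (RA.sym (RA.distribʳ _ _ _)) (RA.sym (RE.triangle-suc (N ℕ.+ M) F G))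
    (RA.+-mono-≤ (RA.*-monoˡ-≤ (0≤F 0) (RA.≤ᵣ-resp (RA.+-identityʳ _) (RA.trans (RA.sym (RE.∑<-split M (suc N) G)) (RA.reflexive (cong (λ n → RΣ.∑< n G) (ℕ.+-comm M (suc N)))))
        (RA.+-mono-≤ (RA.≤ᵣ-reflexive (RA.≈-refl {RΣ.∑< M G})) (0≤-∑< (suc N) (λ i → G (M ℕ.+ i)) (λ i → 0≤G (M ℕ.+ i))))))
      (square-≤ N M (F ∘ suc) G (0≤F ∘ suc) 0≤G))

  0≤-^ : ∀ {x} n → ℝ.0# ≤ᵣ x → ℝ.0# ≤ᵣ x R^.^ n
  0≤-^ zero    0≤x = RA.<⇒≤ᵣ ℝ.0<1
  0≤-^ (suc n) 0≤x = RA.0≤-* 0≤x (0≤-^ n 0≤x)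

  0≤-1/! : ∀ n → ℝ.0# ≤ᵣ ℝ.1/ n !
  0≤-1/! zero    = RA.<⇒≤ᵣ ℝ.0<1
  0≤-1/! (suc n) = RA.0≤-* (RA.<⇒≤ᵣ (RA.1/-positive (suc n))) (0≤-1/! n)

  ≼-scale : ∀ {z A k} → ℝ.0# ≤ᵣ k → z ≼ A → fromℝ k * z ≼ k ℝ.* A
  ≼-scale {z} {A} {k} 0≤k (dominated a b c d) = dominated
    (RA.≤ᵣ-resp (RS.solve 3 (λ k x y → k :* x := k :* x :- :0 :* y) RA.≈-refl k (re z) (im z)) RA.≈-refl (RA.*-monoˡ-≤ 0≤k a))
    (RA.≤ᵣ-resp (RS.solve 3 (λ k x y → k :* (:- x) := :- (k :* x :- :0 :* y)) RA.≈-refl k (re z) (im z)) RA.≈-refl (RA.*-monoˡ-≤ 0≤k b))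
    (RA.≤ᵣ-resp (RS.solve 3 (λ k x y → k :* y := k :* y :+ :0 :* x) RA.≈-refl k (re z) (im z)) RA.≈-refl (RA.*-monoˡ-≤ 0≤k c))
    (RA.≤ᵣ-resp (RS.solve 3 (λ k x y → k :* (:- y) := :- (k :* y :+ :0 :* x)) RA.≈-refl k (re z) (im z)) RA.≈-refl (RA.*-monoˡ-≤ 0≤k d))

  ≼-^ : ∀ {z M} n → z ≼ M → z ^ n ≼ (M ℝ.+ M) R^.^ n
  ≼-^ zero    d = dominated (RA.≤ᵣ-reflexive RA.≈-refl) (RA.≤ᵣ-trans -1≤0 (RA.<⇒≤ᵣ ℝ.0<1)) (RA.<⇒≤ᵣ ℝ.0<1)
    (RA.≤ᵣ-trans (RA.≤ᵣ-reflexive (RS.solve 0 (:- :0 := :0) RA.≈-refl)) (RA.<⇒≤ᵣ ℝ.0<1))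
    where
    -1≤0 : ℝ.- ℝ.1# ≤ᵣ ℝ.0#
    -1≤0 = RA.≤ᵣ-resp RA.≈-refl (RS.solve 0 (:- :0 := :0) RA.≈-refl) (RA.neg-≤ (RA.<⇒≤ᵣ ℝ.0<1))
  ≼-^ (suc n) d = ≼-* d (≼-^ n d)

  ≼-terms : ∀ {z M} → z ≼ M → ∀ n → CF.terms z n ≼ RF.terms (M ℝ.+ M) n
  ≼-terms d n = ≼-scale (0≤-1/! n) (≼-^ n d)

  bound : ∀ z → ∃[ M ] ℝ.0# ≤ᵣ M × z ≼ M
  bound z = bounds (RA.bounded (re z)) (RA.bounded (im z))
    where
    bounds : ∃[ n ] RA.Small (suc n ℝ.· ℝ.1#) (re z) → ∃[ n ] RA.Small (suc n ℝ.· ℝ.1#) (im z) → ∃[ M ] ℝ.0# ≤ᵣ M × z ≼ M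
    bounds (a , sa) (b , sb) = A ℝ.+ B , RA.≤ᵣ-resp (RA.+-identityˡ ℝ.0#) RA.≈-refl (RA.+-mono-≤ 0≤A 0≤B)
      , dominated (left (proj₂ sa)) (left (proj₂ (RA.Small-neg sa))) (right (proj₂ sb)) (right (proj₂ (RA.Small-neg sb)))
      where
      A B : ℝ.Carrier
      A = suc a ℝ.· ℝ.1#
      B = suc b ℝ.· ℝ.1#
      0≤A : ℝ.0# ≤ᵣ A
      0≤A = RA.<⇒≤ᵣ (ℝ.0<1+n a)
      0≤B : ℝ.0# ≤ᵣ B
      0≤B = RA.<⇒≤ᵣ (ℝ.0<1+n b)
      left : ∀ {x} → x ℝ.< A → x ≤ᵣ A ℝ.+ B
      left l = RA.≤ᵣ-resp (RA.+-identityʳ _) RA.≈-refl (RA.+-mono-≤ (RA.<⇒≤ᵣ l) 0≤B)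
      right : ∀ {x} → x ℝ.< B → x ≤ᵣ A ℝ.+ B
      right l = RA.≤ᵣ-resp (RA.+-identityˡ _) RA.≈-refl (RA.+-mono-≤ 0≤A (RA.<⇒≤ᵣ l))

  real-exp-converges : ∀ K → ∃[ x ] (λ N → RΣ.∑< N (RF.terms K)) ℝ.⟶ x
  real-exp-converges K = re (exp (fromℝ K)) , RA.⟶-cong (real-part (λ n → fromℝ (ℝ.1/ n !) * fromℝ K ^ n) (RF.terms K)
      (λ n → RA.trans (proj₁ (CR.*-congˡ {fromℝ (ℝ.1/ n !)} (fromℝ-^ K n))) (proj₁ (fromℝ-* (ℝ.1/ n !) (K R^.^ n))))) RA.≈-refl (proj₁ (exp-series (fromℝ K)))
    where
    real-part : ∀ (f : ℕ → ℂ) (F : ℕ → ℝ.Carrier) → (∀ n → re (f n) ℝ.≈ F n) → ∀ N → re (CΣ.∑< N f) ℝ.≈ RΣ.∑< N F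
    real-part f F e zero    = RA.≈-refl
    real-part f F e (suc N) = RA.+-cong (e 0) (real-part (f ∘ suc) (F ∘ suc) (e ∘ suc) N)

  null-doubled-tail : ∀ {s x} → s ℝ.⟶ x → RA.null (λ N → s (N ℕ.+ N) ℝ.- s N)
  null-doubled-tail {s} {x} s⟶x = RA.null-cong (λ N → RS.solve 3 (λ a b x → (a :- x) :+ (:- :1) :* (b :- x) := a :- b) RA.≈-refl (s (N ℕ.+ N)) (s N) x)
    (RA.null-+ (RA.null-subsequence (λ N → N ℕ.+ N) (λ N → ℕ.m≤m+n N N) s⟶x) (RA.null-scale (ℝ.- ℝ.1#) s⟶x))

  -- Σ_{i,j<N} − Σ_{i+j<N} of the products of terms is dominated by a tail of
  -- a real exponential series, whose convergence is part of the hypotheses.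
  corner-null : ∀ a b → (λ N → CE.corner N N (CF.terms a) (CF.terms b)) ⟶ 0#
  corner-null a b = corners (bound a) (bound b)
    where
    corners : ∃[ M ] ℝ.0# ≤ᵣ M × a ≼ M → ∃[ M ] ℝ.0# ≤ᵣ M × b ≼ M → (λ N → CE.corner N N (CF.terms a) (CF.terms b)) ⟶ 0#
    corners (A , 0≤A , a≼A) (B , 0≤B , b≼B) =
        RA.null-cong (λ N → RS.solve 1 (λ x → x := x :- :0) RA.≈-refl _) (RA.null-sandwich (λ N → _≼_.re≤ (majorant N)) (λ N → _≼_.-re≤ (majorant N)) tail-null)
      , RA.null-cong (λ N → RS.solve 1 (λ x → x := x :- :0) RA.≈-refl _) (RA.null-sandwich (λ N → _≼_.im≤ (majorant N)) (λ N → _≼_.-im≤ (majorant N)) tail-null)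
      where
      F G H : ℕ → ℝ.Carrier
      F = RF.terms (A ℝ.+ A)
      G = RF.terms (B ℝ.+ B)
      H = RF.terms ((A ℝ.+ A) ℝ.+ (B ℝ.+ B))
      -- The square lies in the triangle of size 2 N, so the corner is at most the difference of the
      -- triangles of sizes 2 N and N, which are partial sums of a single exponential series. The
      -- factor 2 comes from the doubling in `≼-corner`.
      tail : ℕ → ℝ.Carrier
      tail N = (ℝ.1# ℝ.+ ℝ.1#) ℝ.* (RΣ.∑< (N ℕ.+ N) H ℝ.- RΣ.∑< N H)
      tail-null : RA.null tail
      tail-null = RA.null-scale (ℝ.1# ℝ.+ ℝ.1#) (null-doubled-tail (proj₂ (real-exp-converges ((A ℝ.+ A) ℝ.+ (B ℝ.+ B)))))
      0≤double : ∀ {x} → ℝ.0# ≤ᵣ x → ℝ.0# ≤ᵣ x ℝ.+ x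
      0≤double 0≤x = RA.≤ᵣ-resp (RA.+-identityˡ ℝ.0#) RA.≈-refl (RA.+-mono-≤ 0≤x 0≤x)
      0≤terms : ∀ {K} → ℝ.0# ≤ᵣ K → ∀ n → ℝ.0# ≤ᵣ RF.terms K n
      0≤terms 0≤K n = RA.0≤-* (0≤-1/! n) (0≤-^ n 0≤K)
      F⊛G : ∀ N → RΣ.∑< N (F R⊛.⊛ G) ℝ.≈ RΣ.∑< N H
      F⊛G N = RΣ.∑<-cong N (F R⊛.⊛ G) H (RF.terms-+ (A ℝ.+ A) (B ℝ.+ B))
      double-corner : ∀ N → RE.corner N N (λ n → F n ℝ.+ F n) G ℝ.≈ (ℝ.1# ℝ.+ ℝ.1#) ℝ.* RE.corner N N F G
      double-corner N = RA.trans (RA.+-cong (RA.*-congʳ (RΣ.∑<-+ N F F))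
          (RA.-‿cong (RA.trans (RΣ.∑<-cong N ((λ n → F n ℝ.+ F n) R⊛.⊛ G) (λ n → (F R⊛.⊛ G) n ℝ.+ (F R⊛.⊛ G) n) (R⊛.⊛-distribʳ G F F))
            (RΣ.∑<-+ N (F R⊛.⊛ G) (F R⊛.⊛ G)))))
        (RS.solve 3 (λ f g t → (f :+ f) :* g :- (t :+ t) := (:1 :+ :1) :* (f :* g :- t)) RA.≈-refl (RΣ.∑< N F) (RΣ.∑< N G) (RΣ.∑< N (F R⊛.⊛ G)))
      corner≤tail : ∀ N → RE.corner N N (λ n → F n ℝ.+ F n) G ≤ᵣ tail N
      corner≤tail N = RA.≤ᵣ-resp (RA.sym (double-corner N)) RA.≈-refl (RA.*-monoˡ-≤ (0≤double (RA.<⇒≤ᵣ ℝ.0<1))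
        (RA.+-mono-≤ (RA.≤ᵣ-resp RA.≈-refl (F⊛G (N ℕ.+ N)) (square-≤ N N F G (0≤terms (0≤double 0≤A)) (0≤terms (0≤double 0≤B))))
          (RA.≤ᵣ-reflexive (RA.-‿cong (F⊛G N)))))
      majorant : ∀ N → CE.corner N N (CF.terms a) (CF.terms b) ≼ tail N
      majorant N = ≼-≤ (subst (λ M → CE.corner N M (CF.terms a) (CF.terms b) ≼ RE.corner N M (λ n → F n ℝ.+ F n) G) (ℕ.+-identityʳ N)
                        (≼-corner N 0 (CF.terms a) (CF.terms b) F G (≼-terms a≼A) (≼-terms b≼B))) (corner≤tail N)

  exp-cong : ∀ {z w} → z ≈ w → exp z ≈ exp w
  exp-cong {z} {w} e = CA.⟶-unique (CA.HasValue-point (λ n → fromℝ (ℝ.1/ n !)) e (exp-series z)) (exp-series w)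

  -- The product of the N-th partial sums at a and b, minus the corner, is the N-th partial sum at a
  -- + b; the corner tends to 0.
  exp-+ : ∀ a b → exp (a + b) ≈ exp a * exp b
  exp-+ a b = CA.⟶-unique (exp-series (a + b)) (CA.⟶-cong
    (λ N → CR.trans (CS.solve 2 (λ s t → s CS.:- (s CS.:- t) CS.:= t) CR.≈-refl (CΣ.∑< N (CF.terms a) * CΣ.∑< N (CF.terms b)) (CΣ.∑< N (CF.terms a C⊛.⊛ CF.terms b)))
      (CΣ.∑<-cong N (CF.terms a C⊛.⊛ CF.terms b) (CF.terms (a + b)) (CF.terms-+ a b)))
    (CS.solve 1 (λ x → x CS.:+ CS.:- CS.:0 CS.:= x) CR.≈-refl (exp a * exp b))
    (CA.⟶-+ (CA.⟶-* (exp-series a) (exp-series b)) (neg-⟶ (corner-null a b))))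
    where
    module CS = IntegerSolver CA.complexRing
    neg-⟶ : ∀ {s x} → s ⟶ x → (λ n → - s n) ⟶ (- x)
    neg-⟶ (u , v) = RA.⟶-neg u , RA.⟶-neg v

-- The additive character e_q

module TraceCharacter {r ℓ₁ ℓ₂} {ℝ : RealNumbers r ℓ₁ ℓ₂} (E : Exponential ℝ) {p η} (𝔽 : FiniteField p η) where
  private
    module ℝ = RealNumbers ℝ
    module RA = RealAnalysis ℝ
    module RS = IntegerSolver RA.realRing
    module RM = MultProperties (CommutativeRing.semiring RA.realRing)
    module CA = ComplexAnalysis ℝ
    module CR = RingLaws CA.complexRing
    module CS = IntegerSolver CA.complexRing
    module F = FiniteField 𝔽
    module FA = FieldArithmetic 𝔽
    module FR = RingLaws (PolynomialRing.fieldRing 𝔽)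
    module LS = ListSum CA.complexRing
  open ComplexNumbers ℝ
  open Exponential E
  open ExponentialLaw E
  open Characters E 𝔽 using (e_q)
  open Enumeration 𝔽
  open RS using (_:=_; _:*_)
  open RingReasoning CA.complexRing

  angle : ℕ → ℝ.Carrier
  angle n = (2 ℕ.* n) ℝ.· π ℝ.* (ℝ.1/ p)

  point : ℕ → ℂ
  point n = exp (ℝ.0# +i angle n)

  angle-+ : ∀ a b → angle (a ℕ.+ b) ℝ.≈ angle a ℝ.+ angle b
  angle-+ a b = RA.trans (RA.*-congʳ (RA.trans (RM.×-congˡ (ℕ.*-distribˡ-+ 2 a b)) (RM.×-homo-+ π (2 ℕ.* a) (2 ℕ.* b)))) (RA.distribʳ _ _ _)

  ·-scale : ∀ n x → n ℝ.· x ℝ.≈ n ℝ.· ℝ.1# ℝ.* x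
  ·-scale n x = RA.trans (RM.×-congʳ n (RA.sym (RA.*-identityˡ x))) (RA.sym (RM.×-assoc-* n ℝ.1# x))

  angle-p : angle p ℝ.≈ 2 ℝ.· π
  angle-p = RA.trans (RA.*-congʳ (RA.trans (RM.×-congˡ (ℕ.*-comm 2 p)) (RA.trans (RA.sym (RM.×-assocˡ π p 2)) (·-scale p (2 ℝ.· π)))))
    (RA.trans (RS.solve 3 (λ p x i → p :* x :* i := (p :* i) :* x) RA.≈-refl (p ℝ.· ℝ.1#) (2 ℝ.· π) (ℝ.1/ p))
      (RA.trans (RA.*-congʳ (RA.1/-inverse p)) (RA.*-identityˡ _)))

  point-+ : ∀ a b → point (a ℕ.+ b) ≈ point a * point b
  point-+ a b = CR.trans (exp-cong (RA.sym (RA.+-identityˡ ℝ.0#) , angle-+ a b)) (exp-+ (ℝ.0# +i angle a) (ℝ.0# +i angle b))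

  point-p : point p ≈ 1#
  point-p = CR.trans (exp-cong (RA.≈-refl , angle-p)) 2π-period

  -- Follows from the period alone: point 0 times point p is point p, and point p is 1.
  point-0 : point 0 ≈ 1#
  point-0 = begin
    point 0             ≈⟨ CR.*-identityʳ _ ⟨
    point 0 * 1#        ≈⟨ CR.*-congˡ {point 0} point-p ⟨
    point 0 * point p   ≈⟨ point-+ 0 p ⟨
    point p             ≈⟨ point-p ⟩
    1#                  ∎

  point-multiple : ∀ k → point (k ℕ.* p) ≈ 1#
  point-multiple zero    = point-0
  point-multiple (suc k) = CR.trans (point-+ p (k ℕ.* p)) (CR.trans (CR.*-cong {point p} {1#} {point (k ℕ.* p)} {1#} point-p (point-multiple k)) (CR.*-identityˡ 1#))

  -- Reducing the sum of two representatives modulo p removes full turns of the circle, which `exp`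
  -- does not see.
  e_q-+ : ∀ x y → e_q (x F.+ y) ≈ e_q x * e_q y
  e_q-+ x y = step (FA.trace-+ x y)
    where
    t = F.trace (x F.+ y)
    step : ∃[ k ] F.trace x ℕ.+ F.trace y ≡ t ℕ.+ k ℕ.* p → point t ≈ point (F.trace x) * point (F.trace y)
    step (k , e) = begin
      point t                                ≈⟨ CR.*-identityʳ _ ⟨
      point t * 1#                           ≈⟨ CR.*-congˡ {point t} (point-multiple k) ⟨
      point t * point (k ℕ.* p)              ≈⟨ point-+ t (k ℕ.* p) ⟨
      point (t ℕ.+ k ℕ.* p)                  ≡⟨ cong point e ⟨
      point (F.trace x ℕ.+ F.trace y)        ≈⟨ point-+ (F.trace x) (F.trace y) ⟩
      point (F.trace x) * point (F.trace y)  ∎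

  -- The angles of n and p - n are both positive and add up to 2π, so the angle of n lies strictly
  -- between 0 and the least period.
  point-nontrivial : ∀ {n} → n ≢ 0 → n ℕ.< p → ¬ (point n ≈ 1#)
  point-nontrivial {zero}  n≢0 _   = contradiction refl n≢0
  point-nontrivial {suc n} _   n<p = 2π-least (angle (suc n)) (0<angle (suc n) (s≤s z≤n))
      (RA.<-resp (RA.+-identityˡ _) (RA.trans (RA.trans (RA.+-comm _ _) (RA.sym (angle-+ (suc n) (p ∸ suc n)))) (RA.trans (RA.reflexive (cong angle (ℕ.m+[n∸m]≡n (ℕ.<⇒≤ n<p)))) angle-p))
        (ℝ.+-monoˡ-< (angle (suc n)) (0<angle (p ∸ suc n) (ℕ.m<n⇒0<n∸m n<p))))
    where
    0<angle : ∀ k → 0 ℕ.< k → ℝ.0# ℝ.< angle k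
    0<angle (suc k) _ = ℝ.*-positive (RA.<-resp RA.≈-refl (RA.sym (·-scale (2 ℕ.* suc k) π)) (ℝ.*-positive (ℝ.0<1+n (k ℕ.+ 1 ℕ.* suc k)) π-positive)) (RA.1/-positive p)

  trace-0 : F.trace F.0# ≡ 0
  trace-0 = FA.·1-injective (proj₁ (FA.trace-spec F.0#)) (ℕ.<-trans (s≤s z≤n) FA.1<p) (≡.trans (proj₂ (FA.trace-spec F.0#)) Tr-0)
    where
    Tr-0 : F.Tr F.0# ≡ F.0#
    Tr-0 = ≡.trans (FS.solve 2 (λ a b → a FS.:= (a FS.:+ b) FS.:- b) refl (F.Tr F.0#) (F.Tr F.0#))
      (≡.trans (cong (λ z → z F.+ F.- F.Tr F.0#) (≡.trans (≡.sym (FA.Tr-+ F.0# F.0#)) (cong F.Tr (FR.+-identityˡ F.0#)))) (FR.-‿inverseʳ _))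
      where module FS = IntegerSolver (PolynomialRing.fieldRing 𝔽)

  e_q-0 : e_q F.0# ≈ 1#
  e_q-0 = CR.trans (CR.reflexive (cong point trace-0)) point-0

  -- Translating the sum by y multiplies it by e_q y, which is not 1.
  ∑-e_q : LS.∑ F.elements e_q ≈ 0#
  ∑-e_q = sum-zero FA.trace-nonzero
    where
    S : ℂ
    S = LS.∑ F.elements e_q
    sum-zero : ∃[ y ] F.trace y ≢ 0 → S ≈ 0#
    sum-zero (y , t≢0) = CA.≈-stable λ S≉0 → CA.zero-or-apart (e_q y + - 1#) λ
      { (inj₁ e) → point-nontrivial t≢0 (proj₁ (FA.trace-spec y)) (CR.trans (CS.solve 1 (λ x → x CS.:= (x CS.:- CS.:1) CS.:+ CS.:1) CR.≈-refl (e_q y))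
          (CR.trans (CR.+-congʳ {1#} e) (CR.+-identityˡ 1#)))
      ; (inj₂ a) → S≉0 (CA.cancelˡ a (begin
          (e_q y + - 1#) * S         ≈⟨ CS.solve 2 (λ x s → (x CS.:- CS.:1) CS.:* s CS.:= x CS.:* s CS.:- s) CR.≈-refl (e_q y) S ⟩
          e_q y * S + - S            ≈⟨ CR.+-congʳ { - S} (translate y) ⟩
          S + - S                    ≈⟨ CR.-‿inverseʳ S ⟩
          0#                         ≈⟨ CR.zeroʳ (e_q y + - 1#) ⟨
          (e_q y + - 1#) * 0#        ∎)) }
      where
      translate : ∀ y → e_q y * S ≈ S
      translate y = CR.trans (CR.sym (LS.∑-*ˡ F.elements (e_q y) e_q)) (CR.trans (LS.∑-cong F.elements (λ x → CR.sym (e_q-+ y x)))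
        (LS.∑-reindex elements-unique elements-unique F._≟_ (y F.+_) (F._+_ (F.- y)) (λ _ → ∈-elements _) (λ _ → ∈-elements _)
          (λ {x} _ → FS.solve 2 (λ y x → (FS.:- y) FS.:+ (y FS.:+ x) FS.:= x) refl y x)
          (λ {x} _ → FS.solve 2 (λ y x → y FS.:+ ((FS.:- y) FS.:+ x) FS.:= x) refl y x) e_q))
        where module FS = IntegerSolver (PolynomialRing.fieldRing 𝔽)

-- Roots of unity and the finite order of χ

module UnitModulus {r ℓ₁ ℓ₂} (ℝ : RealNumbers r ℓ₁ ℓ₂) where
  private
    module ℝ = RealNumbers ℝ
    module RA = RealAnalysis ℝ
    module RS = IntegerSolver RA.realRing
    module RR = RingLaws RA.realRing
    module R^ = ExpProperties RR.commutativeSemiring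
    module CA = ComplexAnalysis ℝ
  open RA using (_≤ᵣ_)
  open CA using (normSquared)
  open ComplexNumbers ℝ
  open RS using (:0; :1; _:=_; _:+_; _:*_; _:-_; :-_)

  0≤normSquared : ∀ z → ℝ.0# ≤ᵣ normSquared z
  0≤normSquared z = RA.≤ᵣ-resp (RA.+-identityˡ ℝ.0#) RA.≈-refl (RA.+-mono-≤ (RA.0≤-square (re z)) (RA.0≤-square (im z)))

  normSquared-^ : ∀ z n → normSquared (z ^ n) ℝ.≈ normSquared z R^.^ n
  normSquared-^ z zero    = RS.solve 0 (:1 :* :1 :+ :0 :* :0 := :1) RA.≈-refl
  normSquared-^ z (suc n) = RA.trans
    (RS.solve 4 (λ a b c d → (a :* c :- b :* d) :* (a :* c :- b :* d) :+ (a :* d :+ b :* c) :* (a :* d :+ b :* c) := (a :* a :+ b :* b) :* (c :* c :+ d :* d))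
      RA.≈-refl (re z) (im z) (re (z ^ n)) (im (z ^ n)))
    (RA.*-congˡ (normSquared-^ z n))

  power-≤1 : ∀ {x} n → ℝ.0# ≤ᵣ x → x ≤ᵣ ℝ.1# → x R^.^ n ≤ᵣ ℝ.1#
  power-≤1 zero    0≤x x≤1 = RA.≤ᵣ-reflexive RA.≈-refl
  power-≤1 {x} (suc n) 0≤x x≤1 = RA.≤ᵣ-trans (RA.≤ᵣ-resp RA.≈-refl (RA.*-identityʳ x) (RA.*-monoˡ-≤ 0≤x (power-≤1 n 0≤x x≤1))) x≤1

  power-≥1 : ∀ {x} n → ℝ.0# ≤ᵣ x → ℝ.1# ≤ᵣ x → ℝ.1# ≤ᵣ x R^.^ n
  power-≥1 zero    0≤x 1≤x = RA.≤ᵣ-reflexive RA.≈-refl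
  power-≥1 {x} (suc n) 0≤x 1≤x = RA.≤ᵣ-trans 1≤x (RA.≤ᵣ-resp (RA.*-identityʳ x) RA.≈-refl (RA.*-monoˡ-≤ 0≤x (power-≥1 n 0≤x 1≤x)))

  -- From x < 1 would follow x^(n+1) ≤ x < 1, and from 1 < x that x^(n+1) ≥ x > 1.
  real-root-of-unity : ∀ {x} n → ℝ.0# ≤ᵣ x → x R^.^ suc n ℝ.≈ ℝ.1# → x ℝ.≈ ℝ.1#
  real-root-of-unity {x} n 0≤x e = RA.≈-stable λ x≉1 → RA.tri x ℝ.1# λ
    { (inj₂ (inj₁ x≈1)) → x≉1 x≈1
    ; (inj₁ x<1)        → RA.≤ᵣ-resp e (RA.*-identityʳ x) (RA.*-monoˡ-≤ 0≤x (power-≤1 n 0≤x (RA.<⇒≤ᵣ x<1))) x<1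
    ; (inj₂ (inj₂ 1<x)) → RA.≤ᵣ-resp (RA.*-identityʳ x) e (RA.*-monoˡ-≤ 0≤x (power-≥1 n 0≤x (RA.<⇒≤ᵣ 1<x))) 1<x }

  conj-root-of-unity : ∀ {z} n → z ^ suc n ≈ 1# → conj z * z ≈ 1#
  conj-root-of-unity {z} n e = RA.trans (RS.solve 2 (λ a b → a :* a :- (:- b) :* b := a :* a :+ b :* b) RA.≈-refl (re z) (im z)) modulus≈1
      , RS.solve 2 (λ a b → a :* b :+ (:- b) :* a := :0) RA.≈-refl (re z) (im z)
    where
    modulus≈1 : normSquared z ℝ.≈ ℝ.1#
    modulus≈1 = real-root-of-unity n (0≤normSquared z) (RA.trans (RA.sym (normSquared-^ z (suc n)))
      (RA.trans (RA.+-cong (RA.*-cong (proj₁ e) (proj₁ e)) (RA.*-cong (proj₂ e) (proj₂ e))) (RS.solve 0 (:1 :* :1 :+ :0 :* :0 := :1) RA.≈-refl)))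

module FiniteOrder {c ℓ} (K : CommutativeRing c ℓ) (T : TwistData K) where
  open TwistData T using (𝔽; m′; g; χ; χ-cong; χ-1; χ-*)
  private
    module F = FiniteField 𝔽
    module P = Polynomials 𝔽
    m = suc m′
    module PR = RingLaws (PolynomialRing.polynomialRing 𝔽)
  open RingLaws K
  open MonicModulus 𝔽 g
  open Enumeration 𝔽
  open ExpProperties commutativeSemiring using (_^_; ^-homo-*)
  open ExpProperties PR.commutativeSemiring using () renaming (_^_ to _^ₚ_)
  open IntegerSolver K
  open RingReasoning K

  χ-^ : ∀ f n → χ (f ^ₚ n) ≈ χ f ^ n
  χ-^ f zero    = χ-1
  χ-^ f (suc n) = trans (χ-* f (f ^ₚ n)) (*-congˡ (χ-^ f n))

  -- By the pigeonhole principle two powers f^i and f^j with i < j have the same residue. Cancelling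
  -- χ(f)^i with the inverse χ(h)^i leaves χ(f)^(j-i) = 1, the exponent being written as a
  -- successor.
  finite-order : ∀ f h → f P.* h ≅ P.1# → ∃[ n ] χ f ^ suc n ≈ 1#
  finite-order f h fh≅1 = order (Fin.pigeonhole (ℕ.n<1+n (length (P.monics m))) index)
    where
    residue : ℕ → Vec F.Carrier m
    residue i = remainder (f ^ₚ i)
    index : Fin (suc (length (P.monics m))) → Fin (length (P.monics m))
    index i = Any.index (∈-monics (residue (toℕ i)))
    index-injective : ∀ a b → Any.index (∈-monics a) ≡ Any.index (∈-monics b) → a ≡ b
    index-injective a b e = ≡.trans (lookup-index (∈-monics a)) (≡.trans (cong (List.lookup (P.monics m)) e) (≡.sym (lookup-index (∈-monics b))))
    inverse-power : ∀ n → χ f ^ n * χ h ^ n ≈ 1#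
    inverse-power zero    = *-identityˡ 1#
    inverse-power (suc n) = trans (solve 4 (λ a b c d → (a :* b) :* (c :* d) := (a :* c) :* (b :* d)) ≈-refl (χ f) (χ f ^ n) (χ h) (χ h ^ n))
      (trans (*-cong (trans (sym (χ-* f h)) (trans (χ-cong (f P.* h) P.1# fh≅1) χ-1)) (inverse-power n)) (*-identityˡ 1#))
    order : (∃[ i ] ∃[ j ] i Fin.< j × index i ≡ index j) → ∃[ n ] χ f ^ suc n ≈ 1#
    order (i , j , i<j , e) = toℕ j ∸ suc (toℕ i) , (begin
      χ f ^ d                                      ≈⟨ trans (sym (*-identityʳ _)) (*-congˡ (sym (inverse-power (toℕ i)))) ⟩
      χ f ^ d * (χ f ^ toℕ i * χ h ^ toℕ i)        ≈⟨ solve 3 (λ a b c → a :* (b :* c) := (b :* a) :* c) ≈-refl _ (χ f ^ toℕ i) _ ⟩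
      (χ f ^ toℕ i * χ f ^ d) * χ h ^ toℕ i        ≈⟨ *-congʳ (^-homo-* (χ f) (toℕ i) d) ⟨
      χ f ^ (toℕ i ℕ.+ d) * χ h ^ toℕ i            ≡⟨ cong (λ k → χ f ^ k * χ h ^ toℕ i) (≡.trans (ℕ.+-suc (toℕ i) _) (ℕ.m+[n∸m]≡n i<j)) ⟩
      χ f ^ toℕ j * χ h ^ toℕ i                    ≈⟨ *-congʳ (trans (sym (χ-^ f (toℕ j))) (trans (χ-cong (f ^ₚ toℕ j) (f ^ₚ toℕ i) congruent) (χ-^ f (toℕ i)))) ⟩
      χ f ^ toℕ i * χ h ^ toℕ i                    ≈⟨ inverse-power (toℕ i) ⟩
      1#                                           ∎)
      where
      d : ℕ
      d = suc (toℕ j ∸ suc (toℕ i))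
      congruent : f ^ₚ toℕ j ≅ f ^ₚ toℕ i
      congruent = ≅-trans (f ^ₚ toℕ j) (↑ (residue (toℕ j))) (f ^ₚ toℕ i) (remainder-≅ (f ^ₚ toℕ j))
        (subst (λ v → ↑ v ≅ f ^ₚ toℕ i) (index-injective (residue (toℕ i)) (residue (toℕ j)) e)
          (≅-sym (f ^ₚ toℕ i) (↑ (residue (toℕ i))) (remainder-≅ (f ^ₚ toℕ i))))

-- Deformation over K[[ε]] and the pole 1/q

module ConstantTerm {c ℓ} (K : CommutativeRing c ℓ) where
  private module K = RingLaws K
  open Series K
  open RingLaws seriesRing
  open IntegerSolver seriesRing
  private
    module KS = IntegerSolver K

  constantHom : Homomorphism K seriesRing
  constantHom = record
    { ⟦_⟧ = constant
    ; ⟦⟧-cong = λ { e zero → e ; e (suc n) → K.≈-refl }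
    ; +-homo = λ { x y zero → K.≈-refl ; x y (suc n) → K.sym (K.+-identityˡ K.0#) }
    ; *-homo = λ { x y zero → K.sym (K.+-identityʳ _) ; x y (suc n) → K.sym (K.trans (constant⊛ x (constant y) (suc n)) (K.zeroʳ x)) }
    ; 0-homo = λ { zero → K.≈-refl ; (suc n) → K.≈-refl }
    ; 1-homo = λ n → K.≈-refl
    }

  constantTerm : Homomorphism seriesRing K
  constantTerm = record
    { ⟦_⟧ = λ f → f 0
    ; ⟦⟧-cong = λ e → e 0
    ; +-homo = λ f g → K.≈-refl
    ; *-homo = ⊛-0
    ; 0-homo = K.≈-refl
    ; 1-homo = K.≈-refl
    }

  private
    module ER = ExpProperties K.commutativeSemiring
    module ES = ExpProperties commutativeSemiring
    module EK = Evaluation K K (identityHom K)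
    module EA = Evaluation K seriesRing constantHom
    module ΣK = RangeSum K
    module ΣA = RangeSum seriesRing

  ^-constantTerm : ∀ f n → (f ES.^ n) 0 K.≈ f 0 ER.^ n
  ^-constantTerm f zero    = K.≈-refl
  ^-constantTerm f (suc n) = K.trans (⊛-0 f (f ES.^ n)) (K.*-congˡ (^-constantTerm f n))

  eval-constantTerm : ∀ D a z → EA.eval D a z 0 K.≈ EK.eval D a (z 0)
  eval-constantTerm D a z = K.trans (pointwise D (EA.term a z))
    (ΣK.∑<-cong D (λ n → EA.term a z n 0) (EK.term a (z 0)) (λ n → K.trans (⊛-0 (constant (a n)) (z ES.^ n)) (K.*-congˡ (^-constantTerm z n))))
    where
    pointwise : ∀ D (f : ℕ → ℕ → K.Carrier) → ΣA.∑< D f 0 K.≈ ΣK.∑< D (λ n → f n 0)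
    pointwise zero    f = K.≈-refl
    pointwise (suc D) f = K.+-congˡ (pointwise D (f ∘ suc))

  1+ε : ℕ → K.Carrier
  1+ε zero          = K.1#
  1+ε (suc zero)    = K.1#
  1+ε (suc (suc n)) = K.0#

  -- The inverse 1 - ε + ε² - ... of 1 + ε.
  alternating : ℕ → K.Carrier
  alternating zero    = K.1#
  alternating (suc n) = K.- alternating n

  1+ε-inverse : 1+ε ⊛ alternating ≋ constant K.1#
  1+ε-inverse zero    = K.trans (K.+-identityʳ _) (K.*-identityˡ _)
  1+ε-inverse (suc n) = K.trans (K.+-cong (K.*-identityˡ _)
    (K.trans (⊛-cong {1+ε ∘ suc} {constant K.1#} {alternating} (λ { zero → K.≈-refl ; (suc _) → K.≈-refl }) (λ _ → K.≈-refl) n)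
      (K.trans (constant⊛ K.1# alternating n) (K.*-identityˡ _)))) (K.-‿inverseˡ _)

  1-alternating : ∀ n → constant K.1# n K.+ K.- alternating n K.≈ shift alternating n
  1-alternating zero    = K.-‿inverseʳ K.1#
  1-alternating (suc n) = KS.solve 1 (λ a → KS.:0 KS.:- (KS.:- a) KS.:= a) K.≈-refl (alternating n)

  -- d = ε/(1 + ε) has leading term ε, so d² X has leading term X 0 ε²; comparing the coefficients
  -- of ε² suffices, and no division in K is involved.
  cancel-ε² : ∀ d X Y → d ≋ shift alternating → d ⊛ (d ⊛ X) ≋ d ⊛ (d ⊛ Y) → X 0 K.≈ Y 0
  cancel-ε² d X Y d≋ e = K.trans (K.sym (leading X)) (K.trans (e 2) (leading Y))
    where
    leading : ∀ X → (d ⊛ (d ⊛ X)) 2 K.≈ X 0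
    leading X = K.trans (solve 2 (λ d x → d :* (d :* x) := (d :* d) :* x) ≈-refl d X 2)
      (K.trans (⊛-cong {d ⊛ d} {shift alternating ⊛ shift alternating} {X} (⊛-cong {d} {shift alternating} d≋ d≋) (λ _ → K.≈-refl) 2)
        (K.trans (⊛-assoc (shift alternating) (shift alternating) X 2)
          (K.trans (shift⊛ alternating (shift alternating ⊛ X) 2)
            (KS.solve 3 (λ x y z → KS.:1 KS.:* (KS.:0 KS.:* y KS.:+ (KS.:1 KS.:* x KS.:+ KS.:0)) KS.:+ ((KS.:- KS.:1) KS.:* (KS.:0 KS.:* x KS.:+ KS.:0) KS.:+ KS.:0) KS.:= x)
              K.≈-refl (X 0) (X 1) (X 2)))))

module SpecialValue {c ℓ} (K : CommutativeRing c ℓ) (T : TwistData K) where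
  open TwistData T
  private
    m = suc m′
    module CR = RingLaws K
    module CS = IntegerSolver K
    module LS = ListSum K
    module C⊛ = Series K
    module CΣ = RangeSum K
    module AR = RingLaws C⊛.seriesRing
    module F = FiniteField 𝔽
    module P = Polynomials 𝔽
    module EC = ExpProperties CR.commutativeSemiring
    module CT = ConstantTerm K
  open CommutativeRing K using (Carrier; _≈_; _+_; _*_; -_; 0#; 1#)
  open EC using (_^_)
  open MonicModulus 𝔽 g using (_≅_)
  open C⊛ using (_⊛_; constant)
  open Enumeration 𝔽 using (∈-units⁻)
  open CS using (solve; _:=_; _:+_; _:*_; _:-_; :-_; :0; :1)
  open RingReasoning K

  module EK = Evaluation K K (identityHom K)
  module NC = Numerator K K (identityHom K) T
  module NA = Numerator K C⊛.seriesRing CT.constantHom T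
  open NC public using (linear; numerator; numerator-support; degree; Q; series)

  linear-support : ∀ i → linear (2 ℕ.+ i) ≈ 0#
  linear-support i = CR.≈-refl

  linear²-support : ∀ i → (linear ⊛ linear) (4 ℕ.+ i) ≈ 0#
  linear²-support = CΣ.⊛-supported 2 2 linear linear linear-support linear-support

  eval-linear : ∀ x → EK.eval 2 linear x ≈ 1# + - (Q * x)
  eval-linear x = solve 2 (λ q x → :1 :* :1 :+ ((:- q) :* (x :* :1) :+ :0) := :1 :- q :* x) CR.≈-refl Q x

  eval-linear² : ∀ x → EK.eval 4 (linear ⊛ linear) x ≈ (1# + - (Q * x)) * (1# + - (Q * x))
  eval-linear² x = CR.trans (EK.eval-⊛ 2 2 linear linear x linear-support linear-support)
    (CR.*-cong {EK.eval 2 linear x} {1# + - (Q * x)} {EK.eval 2 linear x} {1# + - (Q * x)} (eval-linear x) (eval-linear x))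

  -- At Q x = 1 the value of (1 - Q T) G truncated after degree n telescopes to G n x^n. For n ≥ D
  -- the truncation loses nothing, so this is the full value 0, and Q^n cancels x^n.
  finite-quotient : ∀ G D x → Q * x ≈ 1# → (∀ i → (linear ⊛ G) (D ℕ.+ i) ≈ 0#) → EK.eval D (linear ⊛ G) x ≈ 0# → ∀ i → G (D ℕ.+ i) ≈ 0#
  finite-quotient G D x Qx≈1 supp root i = begin
    G n                                  ≈⟨ CR.trans (CR.sym (CR.*-identityʳ (G n))) (CR.*-congˡ {G n} (CR.sym (power n))) ⟩
    G n * (Q ^ n * x ^ n)                ≈⟨ solve 3 (λ g q x → g :* (q :* x) := q :* (g :* x)) CR.≈-refl (G n) (Q ^ n) (x ^ n) ⟩
    Q ^ n * (G n * x ^ n)                ≈⟨ CR.*-congˡ {Q ^ n} top ⟩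
    Q ^ n * 0#                           ≈⟨ CR.zeroʳ (Q ^ n) ⟩
    0#                                   ∎
    where
    n : ℕ
    n = D ℕ.+ i
    power : ∀ n → Q ^ n * x ^ n ≈ 1#
    power zero    = CR.*-identityˡ 1#
    power (suc n) = CR.trans (solve 4 (λ q a x b → (q :* a) :* (x :* b) := (q :* x) :* (a :* b)) CR.≈-refl Q (Q ^ n) x (x ^ n))
      (CR.trans (CR.*-cong {Q * x} {1#} {Q ^ n * x ^ n} {1#} Qx≈1 (power n)) (CR.*-identityˡ 1#))
    top : G n * x ^ n ≈ 0#
    top = begin
      G n * x ^ n
        ≈⟨ solve 2 (λ t e → t := (e :+ t) :- :1 :* e) CR.≈-refl (G n * x ^ n) (EK.eval n G x) ⟩
      (EK.eval n G x + G n * x ^ n) + - (1# * EK.eval n G x)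
        ≈⟨ CR.+-cong {EK.eval n G x + G n * x ^ n} {EK.eval (suc n) G x} (CR.sym (EK.eval-last n G x)) (CR.-‿cong (CR.*-congʳ {EK.eval n G x} (CR.sym Qx≈1))) ⟩
      EK.eval (suc n) G x + - (Q * x * EK.eval n G x)
        ≈⟨ NC.eval-linear n G x ⟨
      EK.eval (suc n) (linear ⊛ G) x
        ≡⟨ cong (λ j → EK.eval j (linear ⊛ G) x) (ℕ.+-suc D i) ⟨
      EK.eval (D ℕ.+ suc i) (linear ⊛ G) x
        ≈⟨ EK.eval-extend D (linear ⊛ G) x supp (suc i) ⟩
      EK.eval D (linear ⊛ G) x
        ≈⟨ root ⟩
      0# ∎

  module Identity (c c̄ : P.Poly) (cc̄≅1 : c P.* c̄ ≅ P.1#) (u x : Carrier) (Qux≈1 : Q * u * x ≈ 1#)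
    (w : F.Carrier → Carrier) where
    private
      y D : Carrier
      y = Q * u
      D = 1# + - (Q * x)

    kl : F.Carrier → Carrier
    kl ν = NC.kloosterman u x Qux≈1 c c̄ cc̄≅1 ν

    side : Carrier
    side = (y ^ m′ * y ^ m′) * ((χ c̄ * χ [ F.- F.1# ]) * LS.∑ F.units (λ ν → kl ν * w ν))

    -- Both factors D stay outermost, ready to be cancelled one after the other when D is apart from
    -- 0.
    regular-case : (∀ ν → ν ≢ F.0# → D * D * w ν ≈ EK.eval degree (numerator (ν P.·ₚ c̄)) x) →
      D * (D * (Q ^ m * NC.twisted c u)) ≈ D * (D * side)
    regular-case values = begin
      D * (D * (Q ^ m * NC.twisted c u))
        ≈⟨ NC.functional-equation u x Qux≈1 c c̄ cc̄≅1 ⟩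
      (y ^ m′ * y ^ m′) * (χχ * LS.∑ F.units (λ ν → kl ν * NC.twisted (ν P.·ₚ c̄) x))
        ≈⟨ CR.*-congˡ {y ^ m′ * y ^ m′} (CR.*-congˡ {χχ} (CR.trans (LS.∑-cong-∈ F.units (λ {ν} ν∈ → CR.trans
             (CR.*-congˡ {kl ν} (CR.trans (CR.sym (NC.eval-numerator (ν P.·ₚ c̄) x)) (CR.sym (values ν (∈-units⁻ ν∈)))))
             (solve 3 (λ k d w → k :* (d :* d :* w) := (d :* d) :* (k :* w)) CR.≈-refl (kl ν) D (w ν))))
             (LS.∑-*ˡ F.units (D * D) (λ ν → kl ν * w ν)))) ⟩
      (y ^ m′ * y ^ m′) * (χχ * ((D * D) * LS.∑ F.units (λ ν → kl ν * w ν)))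
        ≈⟨ solve 4 (λ y c d s → y :* (c :* ((d :* d) :* s)) := d :* (d :* (y :* (c :* s)))) CR.≈-refl (y ^ m′ * y ^ m′) χχ D (LS.∑ F.units (λ ν → kl ν * w ν)) ⟩
      D * (D * side) ∎
      where
      χχ : Carrier
      χχ = χ c̄ * χ [ F.- F.1# ]

    -- At the pole x = 1/q all 𝓡₂(ν c̄) are polynomials.  Compare the constant
    -- terms of the functional equation over K[[ε]] at u (1 + ε) and
    -- x / (1 + ε), after cancelling (1 - q x / (1 + ε))².
    module Degenerate (Qx≈1 : Q * x ≈ 1#)
      (support : ∀ ν → ν ≢ F.0# → ∀ i → series (ν P.·ₚ c̄) (degree ℕ.+ i) ≈ 0#)
      (value : ∀ ν → ν ≢ F.0# → w ν ≈ EK.eval degree (series (ν P.·ₚ c̄)) x) where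
      private
        module AS = IntegerSolver C⊛.seriesRing
        module LA = ListSum C⊛.seriesRing
        module A^ = ExpProperties AR.commutativeSemiring
        module EA = Evaluation K C⊛.seriesRing CT.constantHom
        module ι = Homomorphism CT.constantHom
        module π = Homomorphism CT.constantTerm
        open AR using () renaming (_*_ to _*ᴬ_; _+_ to _+ᴬ_; -_ to -ᴬ_; 1# to 1ᴬ; _≈_ to _≈ᴬ_)

        uᴬ xᴬ yᴬ Dᴬ χχᴬ : ℕ → Carrier
        uᴬ = constant u *ᴬ CT.1+ε
        xᴬ = constant x *ᴬ CT.alternating
        yᴬ = NA.Q *ᴬ uᴬ
        Dᴬ = 1ᴬ +ᴬ (-ᴬ (NA.Q *ᴬ xᴬ))
        χχᴬ = constant (χ c̄) *ᴬ constant (χ [ F.- F.1# ])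

        Qᴬ≈ : NA.Q ≈ᴬ constant Q
        Qᴬ≈ = AR.sym NA.Q-homo

        inverseᴬ : NA.Q *ᴬ uᴬ *ᴬ xᴬ ≈ᴬ 1ᴬ
        inverseᴬ = AR.trans (AR.*-congʳ {xᴬ} (AR.*-congʳ {uᴬ} Qᴬ≈)) (AR.trans
          (AS.solve 5 (λ q u e x a → (q AS.:* (u AS.:* e)) AS.:* (x AS.:* a) AS.:= ((q AS.:* u) AS.:* x) AS.:* (e AS.:* a)) AR.≈-refl
            (constant Q) (constant u) CT.1+ε (constant x) CT.alternating)
          (AR.trans (AR.*-cong {constant Q *ᴬ constant u *ᴬ constant x} {1ᴬ} {CT.1+ε *ᴬ CT.alternating} {1ᴬ}
              (AR.trans (AR.*-congʳ {constant x} (AR.sym (ι.*-homo Q u))) (AR.trans (AR.sym (ι.*-homo (Q * u) x)) (ι.⟦⟧-cong Qux≈1)))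
              CT.1+ε-inverse)
            (AR.*-identityˡ 1ᴬ)))

        -- Because Q x = 1, the factor is 1 - 1/(1 + ε) = ε/(1 + ε).
        Dᴬ≈ : Dᴬ ≈ᴬ C⊛.shift CT.alternating
        Dᴬ≈ = AR.trans (AR.+-congˡ {1ᴬ} (AR.-‿cong {NA.Q *ᴬ xᴬ} {CT.alternating} (AR.trans (AR.*-congʳ {xᴬ} Qᴬ≈)
            (AR.trans (AR.sym (AR.*-assoc (constant Q) (constant x) CT.alternating))
              (AR.trans (AR.*-congʳ {CT.alternating} (AR.trans (AR.sym (ι.*-homo Q x)) (ι.⟦⟧-cong Qx≈1))) (AR.*-identityˡ CT.alternating))))))
          CT.1-alternating

        klᴬ : F.Carrier → ℕ → Carrier
        klᴬ ν = NA.kloosterman uᴬ xᴬ inverseᴬ c c̄ cc̄≅1 ν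

        R : F.Carrier → ℕ → Carrier
        R ν = series (ν P.·ₚ c̄)

        rᴬ : F.Carrier → ℕ → Carrier
        rᴬ ν = EA.eval degree (R ν) xᴬ

        eval-linear²ᴬ : EA.eval 4 (linear ⊛ linear) xᴬ ≈ᴬ Dᴬ *ᴬ Dᴬ
        eval-linear²ᴬ = AR.trans (EA.eval-⊛ 2 2 linear linear xᴬ linear-support linear-support) (AR.*-cong {L} {Dᴬ} {L} {Dᴬ} L≈ L≈)
          where
          L : ℕ → Carrier
          L = EA.eval 2 linear xᴬ
          L≈ : L ≈ᴬ Dᴬ
          L≈ = AR.trans (AR.+-cong {constant 1# *ᴬ 1ᴬ} {1ᴬ} (AR.*-identityˡ 1ᴬ) (AR.+-congʳ {λ _ → 0#} (AR.*-cong {constant (- Q)} {AR.- NA.Q} {xᴬ *ᴬ 1ᴬ} {xᴬ}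
              (AR.trans (ι.neg-homo Q) (AR.-‿cong {constant Q} {NA.Q} NA.Q-homo)) (AR.*-identityʳ xᴬ))))
            (AS.solve 2 (λ q x → AS.:1 AS.:+ ((AS.:- q) AS.:* x AS.:+ AS.:0) AS.:= AS.:1 AS.:- q AS.:* x) AR.≈-refl NA.Q xᴬ)

        -- `R ν` is a polynomial, so it has a value at the deformed point too, and (1 - Q T)² splits
        -- off there. The truncation bound is first raised by 4 because `eval-⊛` works with the sum
        -- of both bounds.
        twistedᴬ : ∀ ν → ν ≢ F.0# → NA.twisted (ν P.·ₚ c̄) xᴬ ≈ᴬ (Dᴬ *ᴬ Dᴬ) *ᴬ rᴬ ν
        twistedᴬ ν ν≢0 = AR.trans (AR.sym (NA.eval-numerator (ν P.·ₚ c̄) xᴬ)) (AR.trans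
          (AR.sym (EA.eval-extend degree (numerator (ν P.·ₚ c̄)) xᴬ (numerator-support (ν P.·ₚ c̄)) 4))
          (AR.trans (AR.reflexive (cong (λ n → EA.eval n (numerator (ν P.·ₚ c̄)) xᴬ) (ℕ.+-comm degree 4)))
            (AR.trans (EA.eval-⊛ 4 degree (linear ⊛ linear) (R ν) xᴬ linear²-support (support ν ν≢0))
              (AR.*-congʳ {rᴬ ν} eval-linear²ᴬ))))

        leftᴬ rightᴬ sumᴬ : ℕ → Carrier
        leftᴬ = (NA.Q A^.^ m) *ᴬ NA.twisted c uᴬ
        sumᴬ = LA.∑ F.units (λ ν → klᴬ ν *ᴬ rᴬ ν)
        rightᴬ = ((yᴬ A^.^ m′) *ᴬ (yᴬ A^.^ m′)) *ᴬ (χχᴬ *ᴬ sumᴬ)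

        identityᴬ : Dᴬ *ᴬ (Dᴬ *ᴬ leftᴬ) ≈ᴬ Dᴬ *ᴬ (Dᴬ *ᴬ rightᴬ)
        identityᴬ = AR.trans (NA.functional-equation uᴬ xᴬ inverseᴬ c c̄ cc̄≅1) (AR.trans
          (AR.*-congˡ {(yᴬ A^.^ m′) *ᴬ (yᴬ A^.^ m′)} (AR.*-congˡ {χχᴬ} (AR.trans
            (LA.∑-cong-∈ F.units {λ ν → klᴬ ν *ᴬ NA.twisted (ν P.·ₚ c̄) xᴬ} {λ ν → (Dᴬ *ᴬ Dᴬ) *ᴬ (klᴬ ν *ᴬ rᴬ ν)} (λ {ν} ν∈ → AR.trans (AR.*-congˡ {klᴬ ν} (twistedᴬ ν (∈-units⁻ ν∈)))
              (AS.solve 3 (λ k d r → k AS.:* (d AS.:* r) AS.:= d AS.:* (k AS.:* r)) AR.≈-refl (klᴬ ν) (Dᴬ *ᴬ Dᴬ) (rᴬ ν))))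
            (LA.∑-*ˡ F.units (Dᴬ *ᴬ Dᴬ) (λ ν → klᴬ ν *ᴬ rᴬ ν)))))
          (AS.solve 4 (λ y c d s → y AS.:* (c AS.:* ((d AS.:* d) AS.:* s)) AS.:= d AS.:* (d AS.:* (y AS.:* (c AS.:* s)))) AR.≈-refl
            ((yᴬ A^.^ m′) *ᴬ (yᴬ A^.^ m′)) χχᴬ Dᴬ sumᴬ))

        π-u : uᴬ 0 ≈ u
        π-u = CR.trans (C⊛.⊛-0 (constant u) CT.1+ε) (CR.*-identityʳ u)

        π-x : xᴬ 0 ≈ x
        π-x = CR.trans (C⊛.⊛-0 (constant x) CT.alternating) (CR.*-identityʳ x)

        π-Q : NA.Q 0 ≈ Q
        π-Q = Qᴬ≈ 0

        π-y : yᴬ 0 ≈ y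
        π-y = CR.trans (C⊛.⊛-0 NA.Q uᴬ) (CR.*-cong {NA.Q 0} {Q} {uᴬ 0} {u} π-Q π-u)

        eval-point : ∀ D a {z z′} → z ≈ z′ → EK.eval D a z ≈ EK.eval D a z′
        eval-point D a {z} {z′} e = CΣ.∑<-cong D (EK.term a z) (EK.term a z′) (λ n → CR.*-congˡ {a n} (EC.^-congˡ n e))

        π-left : leftᴬ 0 ≈ Q ^ m * NC.twisted c u
        π-left = CR.trans (C⊛.⊛-0 (NA.Q A^.^ m) (NA.twisted c uᴬ)) (CR.*-cong {(NA.Q A^.^ m) 0} {Q ^ m} {NA.twisted c uᴬ 0} {NC.twisted c u}
          (CR.trans (CT.^-constantTerm NA.Q m) (EC.^-congˡ m π-Q))
          (CR.trans (CR.sym (NA.eval-numerator c uᴬ 0)) (CR.trans (CT.eval-constantTerm degree (numerator c) uᴬ)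
            (CR.trans (eval-point degree (numerator c) π-u) (NC.eval-numerator c u)))))

        π-kernel : ∀ μ → NA.Duality.kernel uᴬ xᴬ inverseᴬ μ 0 ≈ NC.Duality.kernel u x Qux≈1 μ
        π-kernel μ = CR.+-congʳ { - 1#} (CR.trans (C⊛.⊛-0 (1ᴬ +ᴬ (-ᴬ yᴬ)) (constant (ψ μ))) (CR.*-congʳ {ψ μ} (CR.+-congˡ {1#} (CR.-‿cong π-y))))

        π-kl : ∀ ν → klᴬ ν 0 ≈ kl ν
        π-kl ν = CR.trans (π.∑-homo F.units (λ γ → constant (χ [ γ ]) *ᴬ (κᴬ (F.- γ) *ᴬ κᴬ (ν F.* γ F.⁻¹)))) (LS.∑-cong F.units (λ γ →
          CR.trans (C⊛.⊛-0 (constant (χ [ γ ])) (κᴬ (F.- γ) *ᴬ κᴬ (ν F.* γ F.⁻¹))) (CR.*-congˡ {χ [ γ ]}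
            (CR.trans (C⊛.⊛-0 (κᴬ (F.- γ)) (κᴬ (ν F.* γ F.⁻¹))) (CR.*-cong {κᴬ (F.- γ) 0} {κ (F.- γ)} {κᴬ (ν F.* γ F.⁻¹) 0} {κ (ν F.* γ F.⁻¹)}
              (π-kernel (F.- γ)) (π-kernel (ν F.* γ F.⁻¹)))))))
          where
          κᴬ : F.Carrier → ℕ → Carrier
          κᴬ = NA.Duality.kernel uᴬ xᴬ inverseᴬ
          κ : F.Carrier → Carrier
          κ = NC.Duality.kernel u x Qux≈1

        π-r : ∀ ν → ν ≢ F.0# → rᴬ ν 0 ≈ w ν
        π-r ν ν≢0 = CR.trans (CT.eval-constantTerm degree (R ν) xᴬ) (CR.trans (eval-point degree (R ν) π-x)
          (CR.sym (value ν ν≢0)))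

        π-power : ∀ n → (yᴬ A^.^ n) 0 ≈ y ^ n
        π-power n = CR.trans (CT.^-constantTerm yᴬ n) (EC.^-congˡ n π-y)

        π-right : rightᴬ 0 ≈ side
        π-right = CR.trans (C⊛.⊛-0 ((yᴬ A^.^ m′) *ᴬ (yᴬ A^.^ m′)) (χχᴬ *ᴬ sumᴬ)) (CR.*-cong {((yᴬ A^.^ m′) *ᴬ (yᴬ A^.^ m′)) 0} {y ^ m′ * y ^ m′} {(χχᴬ *ᴬ sumᴬ) 0} {χχ * S}
          (CR.trans (C⊛.⊛-0 (yᴬ A^.^ m′) (yᴬ A^.^ m′)) (CR.*-cong {(yᴬ A^.^ m′) 0} {y ^ m′} {(yᴬ A^.^ m′) 0} {y ^ m′} (π-power m′) (π-power m′)))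
          (CR.trans (C⊛.⊛-0 χχᴬ sumᴬ) (CR.*-cong {χχᴬ 0} {χχ} {sumᴬ 0} {S} (C⊛.⊛-0 (constant (χ c̄)) (constant (χ [ F.- F.1# ])))
            (CR.trans (π.∑-homo F.units (λ ν → klᴬ ν *ᴬ rᴬ ν)) (LS.∑-cong-∈ F.units (λ {ν} ν∈ →
              CR.trans (C⊛.⊛-0 (klᴬ ν) (rᴬ ν)) (CR.*-cong {klᴬ ν 0} {kl ν} {rᴬ ν 0} {w ν} (π-kl ν) (π-r ν (∈-units⁻ ν∈)))))))))
          where
          χχ S : Carrier
          χχ = χ c̄ * χ [ F.- F.1# ]
          S = LS.∑ F.units (λ ν → kl ν * w ν)

      degenerate-case : Q ^ m * NC.twisted c u ≈ side
      degenerate-case = CR.trans (CR.sym π-left) (CR.trans (CT.cancel-ε² Dᴬ leftᴬ rightᴬ Dᴬ≈ identityᴬ) π-right)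

-- From values of meromorphic functions to the identity at a point

module ValueIdentity {c ℓ ℓ′ ℓ″} (K : CommutativeRing c ℓ) (T : TwistData K)
  -- Besides its ring structure, ℂ is represented only by cancellation, stable equality and a
  -- relation `Value`, so the algebra below never unfolds into pairs of reals.
  (_#0 : CommutativeRing.Carrier K → Set ℓ′)
  (cancel : ∀ {d z w} → d #0 → CommutativeRing._≈_ K (CommutativeRing._*_ K d z) (CommutativeRing._*_ K d w) → CommutativeRing._≈_ K z w)
  (zero-or-apart : ∀ z → ¬ ¬ (CommutativeRing._≈_ K z (CommutativeRing.0# K) ⊎ z #0))
  (stable : ∀ {z w} → ¬ ¬ (CommutativeRing._≈_ K z w) → CommutativeRing._≈_ K z w)
  (Value : (ℕ → CommutativeRing.Carrier K) → CommutativeRing.Carrier K → CommutativeRing.Carrier K → Set ℓ″)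
  where
  open TwistData T
  private
    m = suc m′
    module CR = RingLaws K
    module CS = IntegerSolver K
    module LS = ListSum K
    module C⊛ = Series K
    module F = FiniteField 𝔽
    module P = Polynomials 𝔽
    module EC = ExpProperties CR.commutativeSemiring
    module FS = IntegerSolver (PolynomialRing.fieldRing 𝔽)
    module PS = IntegerSolver (PolynomialRing.polynomialRing 𝔽)
    module PR = RingLaws (PolynomialRing.polynomialRing 𝔽)
  open CommutativeRing K using (Carrier; _≈_; _+_; _*_; -_; 0#; 1#)
  open EC using (_^_; ^-distrib-*; ^-congˡ)
  open MonicModulus 𝔽 g using (_≅_; ≈⇒≅; ≅-trans)
  open C⊛ using (_⊛_; _≋_; constant)
  open CS using (solve; _:=_; _:+_; _:*_; _:-_; :-_; :0; :1)
  open SpecialValue K T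
  open RingReasoning K

  -- The only analytic input: if P F is a polynomial, then P(x) F(x) = (P F)(x).
  ValueFinite : Set _
  ValueFinite = ∀ F a D P D′ {x w} → (∀ i → P (D ℕ.+ i) ≈ 0#) → (∀ i → (P ⊛ F) (D′ ℕ.+ i) ≈ 0#) →
    Value F x w → a ≈ EK.eval D P x → a * w ≈ EK.eval D′ (P ⊛ F) x

  module _ (value-finite : ValueFinite) where

    value-numerator : ∀ c {x w} → Value (series c) x w → (1# + - (Q * x)) * (1# + - (Q * x)) * w ≈ EK.eval degree (numerator c) x
    value-numerator c {x} {w} v = value-finite (series c) ((1# + - (Q * x)) * (1# + - (Q * x))) 4 (linear ⊛ linear) degree linear²-support (numerator-support c) v (CR.sym (eval-linear² x))

    -- Having a value w at 1/q makes (1 - q x)² w vanish, so the numerator vanishes there and one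
    -- factor 1 - q T divides out. Then (1 - q T) 𝓡₂ has the value (1 - q x) w = 0, and the second
    -- factor divides out: 𝓡₂ is itself a polynomial.
    module Pole (c : P.Poly) {x w : Carrier} (Qx≈1 : Q * x ≈ 1#) (v : Value (series c) x w) where
      private
        R : ℕ → Carrier
        R = series c
        1-Qx≈0 : 1# + - (Q * x) ≈ 0#
        1-Qx≈0 = CR.trans (CR.+-congˡ {1#} (CR.-‿cong Qx≈1)) (CR.-‿inverseʳ 1#)
        numerator≋ : linear ⊛ (linear ⊛ R) ≋ numerator c
        numerator≋ n = CR.sym (C⊛.⊛-assoc linear linear R n)
        support₂ : ∀ i → (linear ⊛ (linear ⊛ R)) (degree ℕ.+ i) ≈ 0#
        support₂ i = CR.trans (numerator≋ (degree ℕ.+ i)) (numerator-support c i)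
        support₁ : ∀ i → (linear ⊛ R) (degree ℕ.+ i) ≈ 0#
        support₁ = finite-quotient (linear ⊛ R) degree x Qx≈1 support₂ (begin
          EK.eval degree (linear ⊛ (linear ⊛ R)) x  ≈⟨ EK.eval-cong degree {linear ⊛ (linear ⊛ R)} {numerator c} x numerator≋ ⟩
          EK.eval degree (numerator c) x            ≈⟨ value-numerator c v ⟨
          (1# + - (Q * x)) * (1# + - (Q * x)) * w   ≈⟨ CR.*-congʳ {w} (CR.*-congʳ {1# + - (Q * x)} 1-Qx≈0) ⟩
          0# * (1# + - (Q * x)) * w                 ≈⟨ solve 2 (λ d w → :0 :* d :* w := :0) CR.≈-refl (1# + - (Q * x)) w ⟩
          0#                                        ∎)

      support : ∀ i → R (degree ℕ.+ i) ≈ 0#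
      support = finite-quotient R degree x Qx≈1 support₁ (begin
        EK.eval degree (linear ⊛ R) x  ≈⟨ value-finite R (1# + - (Q * x)) 2 linear degree linear-support support₁ v (CR.sym (eval-linear x)) ⟨
        (1# + - (Q * x)) * w           ≈⟨ CR.*-congʳ {w} 1-Qx≈0 ⟩
        0# * w                         ≈⟨ CR.zeroˡ w ⟩
        0#                             ∎)

      value : w ≈ EK.eval degree R x
      value = begin
        w                                    ≈⟨ CR.*-identityˡ w ⟨
        1# * w                               ≈⟨ value-finite R 1# 1 (constant 1#) degree (λ _ → CR.≈-refl) (λ i → CR.trans (1⊛ (degree ℕ.+ i)) (support i)) v
                                                  (solve 0 (:1 := :1 :* :1 :+ :0) CR.≈-refl) ⟩
        EK.eval degree (constant 1# ⊛ R) x   ≈⟨ EK.eval-cong degree {constant 1# ⊛ R} {R} x 1⊛ ⟩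
        EK.eval degree R x                   ∎
        where
        1⊛ : constant 1# ⊛ R ≋ R
        1⊛ n = CR.trans (C⊛.constant⊛ 1# R n) (CR.*-identityˡ (R n))

    module AtPoint (c c̄ : P.Poly) (cc̄≅1 : c P.* c̄ ≅ P.1#) (u x : Carrier) (Qux≈1 : Q * u * x ≈ 1#)
      (w : F.Carrier → Carrier) (w-value : ∀ ν → ν ≢ F.0# → Value (series (ν P.·ₚ c̄)) x (w ν)) where
      module I = Identity c c̄ cc̄≅1 u x Qux≈1 w
      private
        D : Carrier
        D = 1# + - (Q * x)

      identity : Q ^ m * NC.twisted c u ≈ I.side
      identity = stable λ fails → zero-or-apart D λ
        { (inj₁ D≈0) → fails (degenerate (CR.trans (solve 1 (λ q → q := :1 :- (:1 :- q)) CR.≈-refl (Q * x))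
            (CR.trans (CR.+-congˡ {1#} (CR.-‿cong D≈0)) (solve 0 (:1 :- :0 := :1) CR.≈-refl))))
        ; (inj₂ D#0) → fails (cancel D#0 (cancel D#0 (I.regular-case (λ ν ν≢0 → value-numerator (ν P.·ₚ c̄) (w-value ν ν≢0))))) }
        where
        degenerate : Q * x ≈ 1# → Q ^ m * NC.twisted c u ≈ I.side
        degenerate Qx≈1 = I.Degenerate.degenerate-case Qx≈1
          (λ ν ν≢0 → Pole.support (ν P.·ₚ c̄) Qx≈1 (w-value ν ν≢0)) (λ ν ν≢0 → Pole.value (ν P.·ₚ c̄) Qx≈1 (w-value ν ν≢0))

      module Conclusion (s i conjχ v : Carrier) (s-inverse : (1# + - (Q * u)) * s ≈ 1#) (i-inverse : Q * i ≈ 1#)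
        (conjχ-inverse : conjχ * χ (P.- c) ≈ 1#) (v-value : Value (series c) u v) where

        kloostermanSum : F.Carrier → F.Carrier → Carrier
        kloostermanSum α β = LS.∑ F.units λ γ → χ [ γ ] * ψ (α F.* γ F.+ β F.* γ F.⁻¹)

        -- A copy of `𝓑` with i in place of 1/q, shaped so that the two agree by computation over ℂ.
        factor : F.Carrier → Carrier
        factor μ = LS.∑ (0 ∷ 1 ∷ []) λ η₁ → LS.∑ (0 ∷ 1 ∷ []) λ η₂ →
          (- 1#) ^ (η₁ ℕ.+ η₂)
            * kloostermanSum (η₁ F.· F.1# F.+ (F.- F.1#)) ((F.1# F.+ (F.- (η₂ F.· F.1#))) F.* μ)
            * (i * s ^ (η₁ ℕ.+ η₂))

        -- Since s inverts 1 - q u, each kernel is (1 - q u)(ψ μ - s). In `factor`, η₁ = 1 removes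
        -- the exponential in γ and η₂ = 1 the one in γ⁻¹, each at the cost of a factor -s: the four
        -- terms are the expansion of (ψ(-γ) - s)(ψ(ν γ⁻¹) - s).
        factor≈ : ∀ ν → factor ν ≈ i * (s * s) * I.kl ν
        factor≈ ν = begin
          factor ν
            ≈⟨ CR.+-cong (CR.+-cong (CR.*-congʳ (CR.*-congˡ (split _ _ X Y at-0 at-0′))) (CR.+-congʳ (CR.*-congʳ (CR.*-congˡ (split _ _ X 1s at-0 at-1′)))))
                 (CR.+-congʳ (CR.+-cong (CR.*-congʳ (CR.*-congˡ (split _ _ 1s Y at-1 at-0′))) (CR.+-congʳ (CR.*-congʳ (CR.*-congˡ (split _ _ 1s 1s at-1 at-1′)))))) ⟩
          _ ≈⟨ solve 6 (λ i s a b c d →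
                 (:1 :* a :* (i :* :1) :+ ((:- :1) :* :1 :* b :* (i :* (s :* :1)) :+ :0))
                   :+ (((:- :1) :* :1 :* c :* (i :* (s :* :1)) :+ ((:- :1) :* ((:- :1) :* :1) :* d :* (i :* (s :* (s :* :1))) :+ :0)) :+ :0)
                 := i :* (((a :+ (:- s) :* b) :+ (:- s) :* c) :+ (s :* s) :* d))
                 CR.≈-refl i s (LS.∑ F.units (λ γ → χ [ γ ] * (X γ * Y γ))) (LS.∑ F.units (λ γ → χ [ γ ] * (X γ * 1#)))
                   (LS.∑ F.units (λ γ → χ [ γ ] * (1# * Y γ))) (LS.∑ F.units (λ γ → χ [ γ ] * (1# * 1#))) ⟩
          i * (((LS.∑ F.units (λ γ → χ [ γ ] * (X γ * Y γ)) + (- s) * LS.∑ F.units (λ γ → χ [ γ ] * (X γ * 1#)))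
            + (- s) * LS.∑ F.units (λ γ → χ [ γ ] * (1# * Y γ))) + (s * s) * LS.∑ F.units (λ γ → χ [ γ ] * (1# * 1#)))
            ≈⟨ CR.*-congˡ (CR.+-cong (CR.+-cong (CR.+-congˡ (LS.∑-*ˡ F.units _ _)) (LS.∑-*ˡ F.units _ _)) (LS.∑-*ˡ F.units _ _)) ⟨
          i * (((LS.∑ F.units (λ γ → χ [ γ ] * (X γ * Y γ)) + LS.∑ F.units (λ γ → (- s) * (χ [ γ ] * (X γ * 1#))))
            + LS.∑ F.units (λ γ → (- s) * (χ [ γ ] * (1# * Y γ)))) + LS.∑ F.units (λ γ → (s * s) * (χ [ γ ] * (1# * 1#))))
            ≈⟨ CR.*-congˡ (CR.trans (CR.+-congʳ (CR.trans (CR.+-congʳ (CR.sym (LS.∑-+ F.units _ _))) (CR.sym (LS.∑-+ F.units _ _)))) (CR.sym (LS.∑-+ F.units _ _))) ⟩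
          i * LS.∑ F.units (λ γ → ((χ [ γ ] * (X γ * Y γ) + (- s) * (χ [ γ ] * (X γ * 1#))) + (- s) * (χ [ γ ] * (1# * Y γ))) + (s * s) * (χ [ γ ] * (1# * 1#)))
            ≈⟨ CR.*-congˡ (LS.∑-cong F.units (λ γ → CR.trans
                 (solve 4 (λ s c x y → ((c :* (x :* y) :+ (:- s) :* (c :* (x :* :1))) :+ (:- s) :* (c :* (:1 :* y))) :+ (s :* s) :* (c :* (:1 :* :1))
                   := c :* ((:1 :* x :- s) :* (:1 :* y :- s))) CR.≈-refl s (χ [ γ ]) (X γ) (Y γ))
                 (CR.trans (CR.*-congˡ (CR.*-cong (CR.+-congʳ (CR.*-congʳ (CR.sym s-inverse))) (CR.+-congʳ (CR.*-congʳ (CR.sym s-inverse)))))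
                   (solve 5 (λ s k c x y → c :* ((k :* s :* x :- s) :* (k :* s :* y :- s)) := (s :* s) :* (c :* ((k :* x :- :1) :* (k :* y :- :1))))
                     CR.≈-refl s (1# + - (Q * u)) (χ [ γ ]) (X γ) (Y γ))))) ⟩
          i * LS.∑ F.units (λ γ → (s * s) * (χ [ γ ] * (((1# + - (Q * u)) * X γ + - 1#) * ((1# + - (Q * u)) * Y γ + - 1#))))
            ≈⟨ CR.trans (CR.*-congˡ (LS.∑-*ˡ F.units (s * s) _)) (CR.sym (CR.*-assoc i (s * s) _)) ⟩
          i * (s * s) * I.kl ν ∎
          where
          X Y 1s : F.Carrier → Carrier
          X γ = ψ (F.- γ)
          Y γ = ψ (ν F.* γ F.⁻¹)
          1s γ = 1#
          split : ∀ α β (f h : F.Carrier → Carrier) → (∀ γ → ψ (α F.* γ) ≈ f γ) → (∀ γ → ψ (β F.* γ F.⁻¹) ≈ h γ) →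
            kloostermanSum α β ≈ LS.∑ F.units (λ γ → χ [ γ ] * (f γ * h γ))
          split α β f h e e′ = LS.∑-cong F.units (λ γ → CR.*-congˡ (CR.trans (ψ-+ _ _) (CR.*-cong (e γ) (e′ γ))))
          at-0 : ∀ γ → ψ ((F.0# F.+ (F.- F.1#)) F.* γ) ≈ X γ
          at-0 γ = CR.reflexive (cong ψ (FS.solve 1 (λ γ → (FS.:0 FS.:+ (FS.:- FS.:1)) FS.:* γ FS.:= FS.:- γ) refl γ))
          at-1 : ∀ γ → ψ ((F.1# F.+ F.0# F.+ (F.- F.1#)) F.* γ) ≈ 1#
          at-1 γ = CR.trans (CR.reflexive (cong ψ (FS.solve 1 (λ γ → (FS.:1 FS.:+ FS.:0 FS.:+ (FS.:- FS.:1)) FS.:* γ FS.:= FS.:0) refl γ))) ψ-0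
          at-0′ : ∀ γ → ψ (((F.1# F.+ (F.- F.0#)) F.* ν) F.* γ F.⁻¹) ≈ Y γ
          at-0′ γ = CR.reflexive (cong ψ (FS.solve 2 (λ ν γ → ((FS.:1 FS.:+ (FS.:- FS.:0)) FS.:* ν) FS.:* γ FS.:= ν FS.:* γ) refl ν (γ F.⁻¹)))
          at-1′ : ∀ γ → ψ (((F.1# F.+ (F.- (F.1# F.+ F.0#))) F.* ν) F.* γ F.⁻¹) ≈ 1#
          at-1′ γ = CR.trans (CR.reflexive (cong ψ (FS.solve 2 (λ ν γ → ((FS.:1 FS.:+ (FS.:- (FS.:1 FS.:+ FS.:0))) FS.:* ν) FS.:* γ FS.:= FS.:0) refl ν (γ F.⁻¹)))) ψ-0

        χ-inverse : χ (P.- c) * (χ c̄ * χ [ F.- F.1# ]) ≈ 1#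
        χ-inverse = CR.trans (CR.*-congˡ (CR.sym (χ-* c̄ [ F.- F.1# ]))) (CR.trans (CR.sym (χ-* (P.- c) (c̄ P.* [ F.- F.1# ])))
          (CR.trans (χ-cong ((P.- c) P.* (c̄ P.* [ F.- F.1# ])) P.1# (≅-trans ((P.- c) P.* (c̄ P.* [ F.- F.1# ])) (c P.* c̄) P.1#
            (≈⇒≅ ((P.- c) P.* (c̄ P.* [ F.- F.1# ])) (c P.* c̄) rearrange) cc̄≅1)) χ-1))
          where
          rearrange : ((P.- c) P.* (c̄ P.* [ F.- F.1# ])) P.≈ (c P.* c̄)
          rearrange n = ≡.trans (PR.*-congˡ {P.- c} {c̄ P.* [ F.- F.1# ]} {c̄ P.* (P.- P.1#)} (PR.*-congˡ {c̄} {[ F.- F.1# ]} {P.- P.1#} (λ { zero → refl ; (suc n) → refl })) n)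
            (PS.solve 2 (λ c d → (PS.:- c) PS.:* (d PS.:* (PS.:- PS.:1)) PS.:= c PS.:* d) (λ _ → refl) c c̄ n)

        χχ≈conjχ : χ c̄ * χ [ F.- F.1# ] ≈ conjχ
        χχ≈conjχ = CR.trans (CR.sym (CR.*-identityˡ _)) (CR.trans (CR.*-congʳ (CR.sym conjχ-inverse))
          (CR.trans (CR.*-assoc conjχ _ _) (CR.trans (CR.*-congˡ χ-inverse) (CR.*-identityʳ conjχ))))

        power-inverse : ∀ n → i ^ n * Q ^ n ≈ 1#
        power-inverse zero    = CR.*-identityˡ 1#
        power-inverse (suc n) = CR.trans (solve 4 (λ i a q b → (i :* a) :* (q :* b) := (q :* i) :* (a :* b)) CR.≈-refl i (i ^ n) Q (Q ^ n))
          (CR.trans (CR.*-cong i-inverse (power-inverse n)) (CR.*-identityˡ 1#))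

        powers : i ^ m′ * ((Q * u) ^ m′ * (Q * u) ^ m′) ≈ (Q * u ^ 2) ^ m′
        powers = CR.trans (CR.*-congˡ (CR.sym (^-distrib-* (Q * u) (Q * u) m′))) (CR.trans (CR.sym (^-distrib-* i ((Q * u) * (Q * u)) m′))
          (^-congˡ m′ (CR.trans (solve 3 (λ i q u → i :* ((q :* u) :* (q :* u)) := (q :* i) :* (q :* (u :* (u :* :1)))) CR.≈-refl i Q u)
            (CR.trans (CR.*-congʳ i-inverse) (CR.*-identityˡ _)))))

        -- Of the m factors 1/q that undo Fourier inversion, m - 1 turn (q u)^(2(m-1)) into (q
        -- u²)^(m-1), and the last one enters `factor`. The two factors s that solve (1 - q u)² v =
        -- numerator for v enter it as well.
        conclusion : v ≈ conjχ * (Q * u ^ 2) ^ m′ * LS.∑ F.units (λ μ → factor μ * w μ)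
        conclusion = begin
          v
            ≈⟨ CR.trans (CR.sym (CR.*-identityˡ v)) (CR.*-congʳ (CR.trans (CR.sym (CR.*-identityˡ 1#)) (CR.*-cong (CR.sym (power-inverse m))
                 (CR.trans (CR.sym (CR.*-identityˡ 1#)) (CR.*-cong (CR.sym s-inverse) (CR.sym s-inverse)))))) ⟩
          ((i ^ m * Q ^ m) * ((k * s) * (k * s))) * v
            ≈⟨ solve 5 (λ i q k s v → ((i :* q) :* ((k :* s) :* (k :* s))) :* v := (i :* (s :* s)) :* (q :* (k :* k :* v))) CR.≈-refl (i ^ m) (Q ^ m) k s v ⟩
          (i ^ m * (s * s)) * (Q ^ m * (k * k * v))
            ≈⟨ CR.*-congˡ (CR.trans (CR.*-congˡ (CR.trans (value-numerator c v-value) (NC.eval-numerator c u))) identity) ⟩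
          (i ^ m * (s * s)) * (((Q * u) ^ m′ * (Q * u) ^ m′) * ((χ c̄ * χ [ F.- F.1# ]) * S))
            ≈⟨ solve 6 (λ i e s y c t → ((i :* e) :* (s :* s)) :* (y :* (c :* t)) := c :* (e :* y) :* ((i :* (s :* s)) :* t)) CR.≈-refl i (i ^ m′) s _ _ S ⟩
          (χ c̄ * χ [ F.- F.1# ]) * (i ^ m′ * ((Q * u) ^ m′ * (Q * u) ^ m′)) * (i * (s * s) * S)
            ≈⟨ CR.*-cong (CR.*-cong χχ≈conjχ powers) (CR.trans (CR.sym (LS.∑-*ˡ F.units (i * (s * s)) _))
                 (LS.∑-cong F.units (λ μ → CR.trans (CR.sym (CR.*-assoc _ _ _)) (CR.*-congʳ (CR.sym (factor≈ μ)))))) ⟩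
          conjχ * (Q * u ^ 2) ^ m′ * LS.∑ F.units (λ μ → factor μ * w μ) ∎
          where
          k S : Carrier
          k = 1# + - (Q * u)
          S = LS.∑ F.units (λ ν → I.kl ν * w ν)

-- Specialization to ℂ and to the character e_q

module Main {r ℓ₁ ℓ₂} (ℝ : RealNumbers r ℓ₁ ℓ₂) (E : Exponential ℝ) {p η} (𝔽 : FiniteField p η)
  {m′ k} (g : Polynomials.Monic 𝔽 (suc m′)) (ℓ : Polynomials.Monic 𝔽 k)
  (ℓ∣g : Polynomials._∣_ 𝔽 (Polynomials.⟦_⟧ 𝔽 ℓ) (Polynomials.⟦_⟧ 𝔽 g))
  (χ : Characters.DirichletCharacter E 𝔽 (Polynomials.⟦_⟧ 𝔽 ℓ))
  where
  private
    m = suc m′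
    module ℝ = RealNumbers ℝ
    module RA = RealAnalysis ℝ
    module CA = ComplexAnalysis ℝ
    module CR = RingLaws CA.complexRing
    module CS = IntegerSolver CA.complexRing
    module LS = ListSum CA.complexRing
    module C⊛ = Series CA.complexRing
    module F = FiniteField 𝔽
    module P = Polynomials 𝔽
    module PR = RingLaws (PolynomialRing.polynomialRing 𝔽)
    module PS = IntegerSolver (PolynomialRing.polynomialRing 𝔽)
    module EC = ExpProperties CR.commutativeSemiring
    module AC = TraceCharacter E 𝔽
  open ComplexNumbers ℝ
  open Meromorphic ℝ
  open Characters E 𝔽
  open MonicModulus 𝔽 g using (_≅_)
  open C⊛ using (_⊛_; _≋_; ⊛-cong; ⊛-comm)
  open CS using (solve; _:=_; _:*_)
  open RingReasoning CA.complexRing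

  χ-cong : ∀ f h → f ≅ h → χ ⟨ f ⟩ ≈ χ ⟨ h ⟩
  χ-cong f h (a , e) = DirichletCharacter.periodic χ {f} {h} (divisible ℓ∣g)
    where
    divisible : P.⟦ ℓ ⟧ P.∣ P.⟦ g ⟧ → P.⟦ ℓ ⟧ P.∣ (f P.+ (P.- h))
    divisible (b , e′) = a P.* b , λ n → ≡.trans (PR.*-assoc a b P.⟦ ℓ ⟧ n) (≡.trans (PR.*-congˡ {a} {b P.* P.⟦ ℓ ⟧} {P.⟦ g ⟧} e′ n) (e n))

  χ-* : ∀ f h → χ ⟨ f P.* h ⟩ ≈ χ ⟨ f ⟩ * χ ⟨ h ⟩
  χ-* = DirichletCharacter.homo-* χ

  χ-1 : χ ⟨ P.1# ⟩ ≈ 1#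
  χ-1 = DirichletCharacter.homo-1 χ

  twistData : TwistData CA.complexRing
  twistData = record
    { additive = record { 𝔽 = 𝔽 ; ψ = e_q ; ψ-0 = AC.e_q-0 ; ψ-+ = AC.e_q-+ ; ∑ψ≈0 = AC.∑-e_q }
    ; g = g ; χ = χ ⟨_⟩ ; χ-cong = χ-cong ; χ-1 = χ-1 ; χ-* = χ-* }

  module SV = SpecialValue CA.complexRing twistData
  open SV using (linear; numerator; numerator-support; degree; Q; linear²-support; module EK)

  series≡𝓡₂ : ∀ c n → SV.series c n ≡ 𝓡₂ χ c g n
  series≡𝓡₂ c n = refl

  continuation : ∀ c → MeromorphicExtension (𝓡₂ χ c g)
  continuation c = record
    { num = numerator c
    ; den = linear ⊛ linear
    ; num-entire = λ z → EK.eval degree (numerator c) z , CA.HasValue-finite degree (numerator c) z (numerator-support c)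
    ; den-entire = λ z → EK.eval 4 (linear ⊛ linear) z , CA.HasValue-finite 4 (linear ⊛ linear) z linear²-support
    ; den≢0 = 0 , CA.#-resp (CR.sym (CR.trans (C⊛.⊛-0 linear linear) (CR.*-identityˡ 1#))) CA.1#0
    ; extends = ⊛-cong {linear ⊛ linear} {linear ⊛ linear} {𝓡₂ χ c g} {SV.series c} (λ _ → CR.≈-refl) (λ n → CR.reflexive (≡.sym (series≡𝓡₂ c n)))
    }

  -- Whichever quotient num / den witnesses the value, (P F) den = P num holds for series. P and P F
  -- are polynomials, so both sides can be evaluated at x, and den is cancelled because it is apart
  -- from 0 there.
  value-finite : ∀ F a D P D′ {x w} → (∀ i → P (D ℕ.+ i) ≈ 0#) → (∀ i → (P ⊛ F) (D′ ℕ.+ i) ≈ 0#) →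
    F at x ↦ w → a ≈ EK.eval D P x → a * w ≈ EK.eval D′ (P ⊛ F) x
  value-finite F a D P D′ {x} {w} supp supp′ (R , n , d , num↦n , den↦d , d#0 , dw≈n) a≈ = CA.cancelˡ d#0 (begin
    d * (a * w)                       ≈⟨ solve 3 (λ d a w → d :* (a :* w) := a :* (d :* w)) CR.≈-refl d a w ⟩
    a * (d * w)                       ≈⟨ CR.*-cong {a} {EK.eval D P x} a≈ dw≈n ⟩
    EK.eval D P x * n                 ≈⟨ CA.⟶-unique (CA.HasValue-⊛ D P num x supp num↦n)
                                           (CA.HasValue-cong ((P ⊛ F) ⊛ den) (P ⊛ num) x same CR.≈-refl (CA.HasValue-⊛ D′ (P ⊛ F) den x supp′ den↦d)) ⟩
    EK.eval D′ (P ⊛ F) x * d          ≈⟨ CR.*-comm (EK.eval D′ (P ⊛ F) x) d ⟩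
    d * EK.eval D′ (P ⊛ F) x          ∎)
    where
    open MeromorphicExtension R
    same : (P ⊛ F) ⊛ den ≋ P ⊛ num
    same n = CR.trans (C⊛.⊛-assoc P F den n) (⊛-cong {P} {P} {F ⊛ den} {num} (λ _ → CR.≈-refl) (λ n → CR.trans (⊛-comm F den n) (extends n)) n)

  Q≈q : Q ≈ fromℕ F.q
  Q≈q = CR.trans (CR.reflexive (sum-ones F.elements)) (CR.reflexive (cong fromℕ (FieldArithmetic.length-elements 𝔽)))
    where
    sum-ones : ∀ {a} {X : Set a} (xs : List X) → LS.∑ xs (λ _ → 1#) ≡ fromℕ (length xs)
    sum-ones []       = refl
    sum-ones (x ∷ xs) = cong (1# +_) (sum-ones xs)

  1/q : ℂ
  1/q = fromℝ (ℝ.1/ F.q)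

  Q*1/q≈1 : Q * 1/q ≈ 1#
  Q*1/q≈1 = CR.trans (CR.*-congʳ {1/q} (CR.trans Q≈q (ExponentialLaw.fromℝ-· E F.q))) (CR.trans (ExponentialLaw.fromℝ-* E _ _) (RA.1/-inverse F.q , RA.≈-refl))


  conj-χ : ∀ c c̄ → c P.* c̄ ≅ P.1# → conj (χ ⟨ P.- c ⟩) * χ ⟨ P.- c ⟩ ≈ 1#
  conj-χ c c̄ cc̄≅1 = modulus (FiniteOrder.finite-order CA.complexRing twistData (P.- c) (P.- c̄) negated)
    where
    open MonicModulus 𝔽 g using (≅-trans; ≈⇒≅)
    negated : (P.- c) P.* (P.- c̄) ≅ P.1#
    negated = ≅-trans ((P.- c) P.* (P.- c̄)) (c P.* c̄) P.1#
      (≈⇒≅ ((P.- c) P.* (P.- c̄)) (c P.* c̄) (PS.solve 2 (λ c d → (PS.:- c) PS.:* (PS.:- d) PS.:= c PS.:* d) (λ _ → refl) c c̄)) cc̄≅1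
    modulus : ∃[ n ] (χ ⟨ P.- c ⟩) EC.^ suc n ≈ 1# → conj (χ ⟨ P.- c ⟩) * χ ⟨ P.- c ⟩ ≈ 1#
    modulus (n , e) = UnitModulus.conj-root-of-unity ℝ n e

  module VI = ValueIdentity CA.complexRing twistData
    (_# 0#) CA.cancelˡ CA.zero-or-apart CA.≈-stable _at_↦_

  module Conclusion (c c̄ : P.Poly) (cc̄≅1 : c P.* c̄ ≅ P.1#) (u x s v : ℂ) (w : F.Carrier → ℂ)
    (qux≈1 : fromℕ F.q * u * x ≈ 1#) (s-inverse : (1# + (- (fromℕ F.q * u))) * s ≈ 1#)
    (v-value : 𝓡₂ χ c g at u ↦ v) (w-value : ∀ μ → μ ≢ F.0# → 𝓡₂ χ (μ P.·ₚ c̄) g at x ↦ w μ) where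

    module I = VI.AtPoint.Conclusion value-finite c c̄ cc̄≅1 u x
      (CR.trans (CR.*-congʳ {x} (CR.*-congʳ {u} Q≈q)) qux≈1) w w-value s 1/q (conj (χ ⟨ P.- c ⟩)) v
      (CR.trans (CR.*-congʳ {s} (CR.+-congˡ {1#} (CR.-‿cong (CR.*-congʳ {u} Q≈q)))) s-inverse)
      Q*1/q≈1 (conj-χ c c̄ cc̄≅1) v-value

    factor≡𝓑 : ∀ μ → I.factor μ ≡ 𝓑 χ μ s
    factor≡𝓑 μ = refl

    scale : ℂ
    scale = conj (χ ⟨ P.- c ⟩) * (Q * u ^ 2) ^ m′

    in-Q : v ≈ scale * LS.∑ F.units (λ μ → I.factor μ * w μ)
    in-Q = I.conclusion

    conclusion : v ≈ conj (χ ⟨ P.- c ⟩) * (fromℕ F.q * u ^ 2) ^ m′ * LS.∑ F.units (λ μ → 𝓑 χ μ s * w μ)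
    conclusion = CR.trans in-Q (CR.*-cong {scale} {conj (χ ⟨ P.- c ⟩) * (fromℕ F.q * u ^ 2) ^ m′}
      {LS.∑ F.units (λ μ → I.factor μ * w μ)} {LS.∑ F.units (λ μ → 𝓑 χ μ s * w μ)}
      (CR.*-congˡ {conj (χ ⟨ P.- c ⟩)} (EC.^-congˡ m′ (CR.*-congʳ {u ^ 2} Q≈q)))
      (LS.∑-cong F.units (λ μ → CR.*-congʳ {w μ} (CR.reflexive (factor≡𝓑 μ)))))

-- The identity of meromorphic functions is expressed at the points where the functions on both
-- sides have values. The inverses of q u and 1 - q u are given by their defining equations, so u is
-- neither 0 nor 1/q.
proposition3p15 : ∀ {r ℓ₁ ℓ₂} (ℝ : RealNumbers r ℓ₁ ℓ₂) (E : Exponential ℝ)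
    {p η} (𝔽 : FiniteField p η) →
    let module F = FiniteField 𝔽
        module P = Polynomials 𝔽
        open ComplexNumbers ℝ
        open Meromorphic ℝ
        open Characters E 𝔽
    in
    ∀ {m k} (g : P.Monic m) → 1 ≤ m →
    (ℓ : P.Monic k) (c c̄ : P.Poly) →
    P.⟦ ℓ ⟧ P.∣ P.⟦ g ⟧ → P.Coprime c P.⟦ g ⟧ →
    (c P.* c̄) P.≡ P.1# [mod P.⟦ g ⟧ ] →
    (χ : DirichletCharacter P.⟦ ℓ ⟧) → Primitive χ →
    MeromorphicExtension (𝓡₂ χ c g)
    × (∀ u [qu]⁻¹ [1-qu]⁻¹ v (w : F.Carrier → ℂ) →
       fromℕ F.q * u * [qu]⁻¹ ≈ 1# →
       (1# + (- (fromℕ F.q * u))) * [1-qu]⁻¹ ≈ 1# →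
       𝓡₂ χ c g at u ↦ v →
       (∀ μ → μ ≢ F.0# → 𝓡₂ χ (μ P.·ₚ c̄) g at [qu]⁻¹ ↦ w μ) →
       v ≈ conj (χ ⟨ P.- c ⟩) * (fromℕ F.q * u ^ 2) ^ (m ∸ 1)
             * ∑ F.units (λ μ → 𝓑 χ μ [1-qu]⁻¹ * w μ))
proposition3p15 ℝ E 𝔽 {suc m′} g 1≤m ℓ c c̄ ℓ∣g _ cc̄≅1 χ _ =
  continuation c , λ u x s v w qux≈1 s-inverse v-value w-value →
    Conclusion.conclusion c c̄ cc̄≅1 u x s v w qux≈1 s-inverse v-value w-value
  where open Main ℝ E 𝔽 g ℓ ℓ∣g χ
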